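{- A rooted graph $(G,t)$ is perfectly resilient if and only if it does not contain any of the four rooted graphs $K_5\setminus e$, $K_{3,3}\setminus e$, $K_{3,4}\setminus 2e$, or subdivided $K_{2,4}$ as a rooted minor.
   Context: Graphs are finite, simple, undirected; nodes $V$, links $E$. A rooted graph $(G,t)$ is a graph $G$ with a designated node $t$ (the target). For a node $v$, $E_v$ is the set of links incident to $v$. A forwarding function for $v$ is a map $\pi_v\colon (E_v\cup\{\bot\})\times 2^{E_v}\to E_v\cup\{\bot\}$ taking an in-port (an incident link, or $\bot$ meaning the packet starts at $v$) and the set of failed incident links, and returning a non-failed incident link (the out-port), or $\bot$ if all incident links fail. A forwarding pattern is a family $\pi=(\pi_v)_{v\in V\setminus\{t\}}$. Given a start node $s$ and a set $F\subseteq E$ of failed links, the routing is the node sequence with $\rho_1=s$, $\rho_2$ the other endpoint of $\pi_s(\bot,E_s\cap F)$, and for $i\ge 3$, $\rho_i$ the other endpoint of $\pi_{\rho_{i-1}}(\{\rho_{i-2},\rho_{i-1}\},E_{\rho_{i-1}}\cap F)$; it stops when it reaches $t$. $(G,t)$ is perfectly resilient if there is a forwarding pattern such that for every $s\in V$ and every $F\subseteq E$ for which $s$ and $t$ lie in the same connected component of $(V,E\setminus F)$, the routing contains $t$. A rooted graph $(H,t_H)$ is a rooted minor of $(G,t)$ if there are pairwise node-disjoint connected subgraphs $G_x$ of $G$, one for each node $x$ of $H$, such that for each link $\{x,y\}$ of $H$ some link of $G$ joins a node of $G_x$ to a node of $G_y$, and $t\in G_{t_H}$. The four rooted graphs: $K_5\setminus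 e$ is $K_5$ with root $t$ one of its nodes and one link incident to $t$ removed. $K_{3,3}\setminus e$ is $K_{3,3}$ with root $t$ one of its nodes and one link incident to $t$ removed. $K_{3,4}\setminus 2e$ is the complete bipartite graph with sides $\{u,v,w\}$ and $\{p,q,t,x\}$ with the two links $\{w,p\},\{w,q\}$ removed, rooted at $t$. The subdivided $K_{2,4}$ is the complete bipartite graph with sides $\{v,x\}$ and $\{u,p,q,r\}$ in which the link $\{u,v\}$ is subdivided by the root $t$ (i.e. replaced by links $\{u,t\},\{t,v\}$). -}

module Defs where

open import Data.Nat using (ℕ; zero; suc; _≡ᵇ_)
open import Data.Fin using (Fin; toℕ)
open import Data.Fin.Properties using (_≟_)
open import Data.Bool using (Bool; true; false; _∧_; _∨_; not; if_then_else_)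
open import Data.Bool.Properties using (∨-comm)
open import Data.Maybe using (Maybe; just; nothing)
open import Data.List using (List; []; _∷_)
open import Data.Product using (Σ; _×_; _,_; proj₁; proj₂; ∃; ∃₂)
open import Data.Sum using (_⊎_)
open import Relation.Nullary using (¬_; yes; no; does)
open import Relation.Binary.PropositionalEquality using (_≡_; refl; sym; cong₂)
open import Data.Empty using (⊥-elim)

record Graph : Set where
  field
    size   : ℕ
    adj    : Fin size → Fin size → Bool
    adj-sym    : ∀ u v → adj u v ≡ adj v u
    adj-irrefl : ∀ u → adj u u ≡ false

open Graph public

Node : Graph → Set
Node G = Fin (size G)

Edge : (G : Graph) → Node G → Node G → Set
Edge G u v = adj G u v ≡ true

-- Sets of failed links: a symmetric Bool-valued relation F on nodes;
-- link {u,v} fails iff F u v ≡ true (values on non-links are irrelevant).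

FailureSet : Graph → Set
FailureSet G = Node G → Node G → Bool

SymmetricF : (G : Graph) → FailureSet G → Set
SymmetricF G F = ∀ u v → F u v ≡ F v u

data ConnAvoiding (G : Graph) (F : FailureSet G) : Node G → Node G → Set where
  here : ∀ {u} → ConnAvoiding G F u u
  step : ∀ {u v w} → Edge G u v → F u v ≡ false →
         ConnAvoiding G F v w → ConnAvoiding G F u w

-- Forwarding functions.  An incident link {v,u} of v is represented by
-- the neighbour u.  In-port: nothing = ⊥ (packet starts at v), just u = link {u,v}.
-- Failed incident links: a predicate on nodes (subset of E_v).
-- Out-port: just u (link {v,u}) or nothing (= ⊥).

FwdFun : (G : Graph) → Node G → Set
FwdFun G v = Maybe (Node G) → (Node G → Bool) → Maybe (Node G)

InPort : (G : Graph) → Node G → Maybe (Node G) → Set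
InPort G v nothing  = Data.Unit.⊤ where import Data.Unit
InPort G v (just u) = Edge G v u

ValidFwd : (G : Graph) (v : Node G) → FwdFun G v → Set
ValidFwd G v π =
  ∀ (inp : Maybe (Node G)) (fl : Node G → Bool) →
  InPort G v inp →
  (∀ u → fl u ≡ true → Edge G v u) →
  (π inp fl ≡ nothing × (∀ u → Edge G v u → fl u ≡ true))
  ⊎ (Σ (Node G) λ u → π inp fl ≡ just u × Edge G v u × fl u ≡ false)

-- forwarding pattern: one function per node (the one at t is never used
-- before t is reached and is unconstrained)
FwdPattern : Graph → Set
FwdPattern G = (v : Node G) → FwdFun G v

ValidPattern : (G : Graph) → Node G → FwdPattern G → Set
ValidPattern G t π = ∀ v → ¬ (v ≡ t) → ValidFwd G v (π v)

failedAt : (G : Graph) → FailureSet G → Node G → (Node G → Bool)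
failedAt G F v u = adj G v u ∧ F v u

State : Graph → Set
State G = Maybe (Node G) × Node G

routeStep : (G : Graph) → FwdPattern G → FailureSet G → State G → State G
routeStep G π F (prev , cur) with π cur prev (failedAt G F cur)
... | nothing = (prev , cur)
... | just u  = (just cur , u)

-- route i = (ρ_i, ρ_{i+1}) shifted: proj₂ (route G π F s i) is ρ_{i+1}
route : (G : Graph) → FwdPattern G → FailureSet G → Node G → ℕ → State G
route G π F s zero    = (nothing , s)
route G π F s (suc i) = routeStep G π F (route G π F s i)

RoutingContains : (G : Graph) → FwdPattern G → FailureSet G → Node G → Node G → Set
RoutingContains G π F s t = ∃ λ i → proj₂ (route G π F s i) ≡ t

PerfectlyResilient : (G : Graph) → Node G → Set
PerfectlyResilient G t =
  Σ (FwdPattern G) λ π →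
    ValidPattern G t π ×
    (∀ (s : Node G) (F : FailureSet G) → SymmetricF G F →
       ConnAvoiding G F s t → RoutingContains G π F s t)

-- Rooted minors.  Branch sets are given by β : V(G) → Maybe V(H)
-- (so they are automatically pairwise disjoint); each is nonempty and
-- induces a connected subgraph.

data PathWithin (G : Graph) (P : Node G → Set) : Node G → Node G → Set where
  here : ∀ {u} → P u → PathWithin G P u u
  step : ∀ {u v w} → P u → Edge G u v → PathWithin G P v w → PathWithin G P u w

record RootedMinor (H : Graph) (tH : Node H) (G : Graph) (t : Node G) : Set where
  field
    branch    : Node G → Maybe (Node H)
    nonempty  : ∀ x → ∃ λ v → branch v ≡ just x
    connected : ∀ x u v → branch u ≡ just x → branch v ≡ just x →
                PathWithin G (λ w → branch w ≡ just x) u v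
    linked    : ∀ x y → Edge H x y →
                ∃₂ λ u v → branch u ≡ just x × branch v ≡ just y × Edge G u v
    rooted    : branch t ≡ just tH

private
  memE : List (ℕ × ℕ) → ℕ → ℕ → Bool
  memE [] a b = false
  memE ((x , y) ∷ es) a b = ((x ≡ᵇ a) ∧ (y ≡ᵇ b)) ∨ memE es a b

  neq : ∀ {k} → Fin k → Fin k → Bool
  neq u v = not (does (u ≟ v))

  neq-sym : ∀ {k} (u v : Fin k) → neq u v ≡ neq v u
  neq-sym u v with u ≟ v | v ≟ u
  ... | yes _ | yes _ = refl
  ... | no _  | no _  = refl
  ... | yes p | no q  = ⊥-elim (q (sym p))
  ... | no p  | yes q = ⊥-elim (p (sym q))

  neq-refl : ∀ {k} (u : Fin k) → neq u u ≡ false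
  neq-refl u with u ≟ u
  ... | yes _ = refl
  ... | no p  = ⊥-elim (p refl)

mkGraph : (k : ℕ) → List (ℕ × ℕ) → Graph
mkGraph k es = record
  { size = k
  ; adj = λ u v → neq u v ∧ (memE es (toℕ u) (toℕ v) ∨ memE es (toℕ v) (toℕ u))
  ; adj-sym = λ u v → cong₂ _∧_ (neq-sym u v)
                        (∨-comm (memE es (toℕ u) (toℕ v)) (memE es (toℕ v) (toℕ u)))
  ; adj-irrefl = λ u → cong₂ _∧_ (neq-refl u) refl
  }

-- K5 \ e : nodes 0..4, root 0, link {0,1} removed
K5-e : Graph
K5-e = mkGraph 5 ((0 , 2) ∷ (0 , 3) ∷ (0 , 4) ∷ (1 , 2) ∷ (1 , 3) ∷ (1 , 4)
                 ∷ (2 , 3) ∷ (2 , 4) ∷ (3 , 4) ∷ [])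

K5-e-root : Node K5-e
K5-e-root = Data.Fin.zero

-- K33 \ e : sides {0,1,2}, {3,4,5}, root 0, link {0,3} removed
K33-e : Graph
K33-e = mkGraph 6 ((0 , 4) ∷ (0 , 5)
                  ∷ (1 , 3) ∷ (1 , 4) ∷ (1 , 5)
                  ∷ (2 , 3) ∷ (2 , 4) ∷ (2 , 5) ∷ [])

K33-e-root : Node K33-e
K33-e-root = Data.Fin.zero

-- K34 \ 2e : u=0, v=1, w=2 ; p=3, q=4, t=5, x=6 ; links {w,p},{w,q} removed; root t
K34-2e : Graph
K34-2e = mkGraph 7 ((0 , 3) ∷ (0 , 4) ∷ (0 , 5) ∷ (0 , 6)
                   ∷ (1 , 3) ∷ (1 , 4) ∷ (1 , 5) ∷ (1 , 6)
                   ∷ (2 , 5) ∷ (2 , 6) ∷ [])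

K34-2e-root : Node K34-2e
K34-2e-root = Data.Fin.fromℕ< {5} {7} (Data.Nat.s≤s (Data.Nat.s≤s (Data.Nat.s≤s
                (Data.Nat.s≤s (Data.Nat.s≤s (Data.Nat.s≤s Data.Nat.z≤n))))))

-- subdivided K24 : v=0, x=1 ; u=2, p=3, q=4, r=5 ; t=6 subdivides {u,v}; root t
K24-sub : Graph
K24-sub = mkGraph 7 ((0 , 3) ∷ (0 , 4) ∷ (0 , 5)
                    ∷ (1 , 2) ∷ (1 , 3) ∷ (1 , 4) ∷ (1 , 5)
                    ∷ (2 , 6) ∷ (6 , 0) ∷ [])

K24-sub-root : Node K24-sub
K24-sub-root = Data.Fin.fromℕ< {6} {7} (Data.Nat.s≤s (Data.Nat.s≤s (Data.Nat.s≤s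
                (Data.Nat.s≤s (Data.Nat.s≤s (Data.Nat.s≤s (Data.Nat.s≤s Data.Nat.z≤n)))))))

ForbiddenRootedMinor : (G : Graph) → Node G → Set
ForbiddenRootedMinor G t =
    RootedMinor K5-e K5-e-root G t
  ⊎ RootedMinor K33-e K33-e-root G t
  ⊎ RootedMinor K34-2e K34-2e-root G t
  ⊎ RootedMinor K24-sub K24-sub-root G t

{-# OPTIONS --safe #-}
-- A pattern of G routes packets inside the branch sets of a minor H and so answers, for each node of H, which
-- link of H follows a given in-port and set of alive links. For each of the four graphs, an adversary that
-- asks for such answers always finds failures under which the packet loops without meeting the root.
--
-- Conversely, cut nodes and a separating root split the problem; otherwise remove the root and call its
-- neighbours terminals. If the rest can be drawn with all nodes on a circle and no crossing links, then taking
-- the next alive link in the cyclic order visits every terminal that can be reached. If it cannot, then either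
-- the rest decomposes into parts between two nodes, whose patterns are combined, or a longest cycle through the
-- terminals together with a path off it or a pair of crossing chords gives one of the four minors. A part behind
-- a cut node is handled with the cut node as a terminal that is joined to the root by a private path.
module Submission where

open import Data.Nat using (ℕ; zero; suc; _+_; _∸_; _≤_; _<_; z≤n; s≤s; _<?_)
open import Data.Fin using (Fin; toℕ) renaming (zero to fzero; suc to fsuc)
open import Data.Fin.Properties using (_≟_; any?; all?; toℕ-injective; toℕ<n)
open import Data.Bool using (Bool; true; false; _∧_; _∨_; not; if_then_else_)
open import Data.Maybe using (Maybe; just; nothing)
open import Data.List using (List; []; _∷_; _++_; length; allFin; reverse)
open import Data.List.Membership.Propositional using (_∈_; _∉_)
open import Data.List.Membership.Propositional.Properties
  using (∈-++⁺ˡ; ∈-++⁺ʳ; ∈-++⁻; ∈-∃++; ∈-allFin)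
open import Data.List.Relation.Unary.Any using (here; there)
open import Data.List.Relation.Unary.All using (All; []; _∷_)
open import Data.List.Relation.Unary.AllPairs using ([]; _∷_)
open import Data.List.Relation.Unary.Unique.Propositional using (Unique)
open import Data.Vec using (Vec; []; _∷_; lookup)
open import Data.Product using (Σ; _×_; _,_; proj₁; proj₂; ∃; ∃₂)
open import Data.Sum using (_⊎_; inj₁; inj₂; [_,_]′)
open import Data.Empty using (⊥; ⊥-elim)
open import Data.Unit using (⊤; tt)
open import Function using (_∘_; id; case_of_)
open import Function.Bundles using (_⇔_; mk⇔)
open import Relation.Nullary using (¬_; Dec; yes; no; does)
open import Relation.Nullary.Decidable using (_×-dec_; _⊎-dec_; ¬?; map′; decidable-stable)
open import Relation.Binary.PropositionalEquality
  using (_≡_; _≢_; refl; sym; trans; cong; cong₂; subst; subst₂)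
open import Relation.Binary.Construct.Closure.ReflexiveTransitive
  using (Star; ε; _◅_; _◅◅_)
import Relation.Binary.Construct.Closure.ReflexiveTransitive as Star
import Data.List.Relation.Unary.All as All
import Data.List.Relation.Unary.All.Properties as All
import Data.List.Relation.Unary.AllPairs.Properties as AllPairs
import Data.List.Properties as List
import Data.Nat.Properties as ℕ
import Data.Bool.Properties as Bool
import Data.List.Membership.DecPropositional as DecMem
open import Defs
import Data.List as List
import Data.Maybe as Maybe
import Data.Fin.Properties as Fin
open import Relation.Binary.Definitions using (tri<; tri≈; tri>)
import Data.List.Membership.Propositional.Properties as Mem
import Data.Vec as Vec
import Data.Vec.Properties as Vec
import Data.Vec.Relation.Unary.All as VAll
open import Data.Fin.Patterns using (0F; 1F; 2F; 3F; 4F; 5F; 6F)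
import Data.List.Relation.Unary.Any.Properties as Any
import Data.Product.Properties as ×
import Data.Maybe.Properties as Maybe

-- Two guarantees of different strength shape the construction. A `Tour` leaves a piece at its
-- terminals, one after the other, so it can be chained through a cut node: leaving one part there
-- means entering the next. A `Roam` only has to pass every terminal. This suffices at the very end,
-- since a packet standing at a terminal with an alive link to the root is delivered, but gluing at
-- a cut node consumes tours. Tours come from private paths: the extra node of such a path completes
-- two attachment-free parallel connections to K_{3,4} minus two links or to the subdivided K_{2,4},
-- and thereby forces a drawing on a circle. The side beyond a cut node contracts to exactly such a
-- path, so cutting always supplies one. With neither a cut node nor a private path no drawing is
-- forced. The exceptions are two terminals with parallel parts between them (`Duo`) and three or
-- more terminals arranged in a ring (`Wheel`), and for these a `Roam` is built directly.

∧-true : ∀ {a b} → a ∧ b ≡ true → a ≡ true × b ≡ true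
∧-true {true} {true} _ = refl , refl

∧-intro : ∀ {a b} → a ≡ true → b ≡ true → a ∧ b ≡ true
∧-intro refl refl = refl

∨-true : ∀ {a b} → a ∨ b ≡ true → a ≡ true ⊎ b ≡ true
∨-true {true} _ = inj₁ refl
∨-true {false} e = inj₂ e

∨-introˡ : ∀ {a b} → a ≡ true → a ∨ b ≡ true
∨-introˡ refl = refl

∨-introʳ : ∀ {a b} → b ≡ true → a ∨ b ≡ true
∨-introʳ {true} refl = refl
∨-introʳ {false} refl = refl

not-true : ∀ {a} → not a ≡ true → a ≡ false
not-true {false} _ = refl

¬true : ∀ {a} → ¬ (a ≡ true) → a ≡ false
¬true {true} h = ⊥-elim (h refl)
¬true {false} h = refl

true≢false : ∀ {a} → a ≡ true → a ≡ false → ⊥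
true≢false refl ()

does-true : ∀ {P : Set} (d : Dec P) → P → does d ≡ true
does-true (yes _) p = refl
does-true (no ¬p) p = ⊥-elim (¬p p)

does-yes : ∀ {P : Set} (d : Dec P) → does d ≡ true → P
does-yes (yes p) _ = p

does-false : ∀ {P : Set} (d : Dec P) → ¬ P → does d ≡ false
does-false (yes p) ¬p = ⊥-elim (¬p p)
does-false (no _) _ = refl

does-no : ∀ {P : Set} (d : Dec P) → does d ≡ false → ¬ P
does-no (no ¬p) _ = ¬p

true? : (b : Bool) → Dec (b ≡ true)
true? true = yes refl
true? false = no λ ()

dec-stable : ∀ {P : Set} → Dec P → ¬ ¬ P → P
dec-stable = decidable-stable

-- Finite graphs as boolean relations: connectivity, deletion, paths

Rel : ℕ → Set
Rel n = Fin n → Fin n → Bool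

Symm : ∀ {n} → Rel n → Set
Symm D = ∀ u v → D u v ≡ D v u

Irr : ∀ {n} → Rel n → Set
Irr D = ∀ u → D u u ≡ false

Adj : ∀ {n} → Rel n → Fin n → Fin n → Set
Adj D u v = D u v ≡ true

Conn : ∀ {n} → Rel n → Fin n → Fin n → Set
Conn D = Star (Adj D)

flip-adj : ∀ {n} {D : Rel n} → Symm D → ∀ {u v} → Adj D u v → Adj D v u
flip-adj s {u} {v} e = trans (s v u) e

conn-sym : ∀ {n} {D : Rel n} → Symm D → ∀ {u v} → Conn D u v → Conn D v u
conn-sym s = Star.reverse (flip-adj s)

conn-mono : ∀ {n} {D D' : Rel n} → (∀ {u v} → Adj D u v → Adj D' u v) →
            ∀ {u v} → Conn D u v → Conn D' u v
conn-mono f = Star.map f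

module Reach {n} (D : Rel n) where
  -- Warshall's recursion: `through ks` allows the nodes of `ks` as intermediate stops, so with all
  -- nodes allowed it decides connectivity.
  through : List (Fin n) → Fin n → Fin n → Bool
  through [] u v = does (u ≟ v) ∨ D u v
  through (k ∷ ks) u v = through ks u v ∨ (through ks u k ∧ through ks k v)

  through-sound : ∀ ks {u v} → through ks u v ≡ true → Conn D u v
  through-sound [] {u} {v} e with u ≟ v
  ... | yes refl = ε
  ... | no _ = e ◅ ε
  through-sound (k ∷ ks) {u} {v} e with ∨-true {through ks u v} e
  ... | inj₁ e′ = through-sound ks e′
  ... | inj₂ e′ with ∧-true e′
  ... | a , b = through-sound ks a ◅◅ through-sound ks b

  through-self : ∀ ks u → through ks u u ≡ true
  through-self [] u = ∨-introˡ (does-true (u ≟ u) refl)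
  through-self (k ∷ ks) u = ∨-introˡ (through-self ks u)

  through-adj : ∀ ks {u v} → Adj D u v → through ks u v ≡ true
  through-adj [] {u} {v} e = ∨-introʳ {does (u ≟ v)} e
  through-adj (k ∷ ks) e = ∨-introˡ (through-adj ks e)

  -- Induction on the list. If `k` is its head, walks to and from `k` never need `k` as an
  -- intermediate stop. Otherwise the head may occur on either half, and if it occurs on both, the
  -- stretch between its two occurrences is dropped.
  through-trans : ∀ {ks k} → k ∈ ks → ∀ {u v} →
    through ks u k ≡ true → through ks k v ≡ true → through ks u v ≡ true
  through-trans {j ∷ ks} (here refl) {u} {v} a b =
    ∨-introʳ {through ks u v} (∧-intro (to a) (from b))
    where
    to : through (j ∷ ks) u j ≡ true → through ks u j ≡ true
    to e with ∨-true {through ks u j} e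
    ... | inj₁ e′ = e′
    ... | inj₂ e′ = proj₁ (∧-true e′)
    from : through (j ∷ ks) j v ≡ true → through ks j v ≡ true
    from e with ∨-true {through ks j v} e
    ... | inj₁ e′ = e′
    ... | inj₂ e′ = proj₂ (∧-true {through ks j j} e′)
  through-trans {j ∷ ks} {k} (there k∈) {u} {v} a b
    with ∨-true {through ks u k} a | ∨-true {through ks k v} b
  ... | inj₁ p | inj₁ q = ∨-introˡ (through-trans k∈ p q)
  ... | inj₁ p | inj₂ q with ∧-true {through ks k j} q
  ...   | q₁ , q₂ = ∨-introʳ {through ks u v} (∧-intro (through-trans k∈ p q₁) q₂)
  through-trans {j ∷ ks} {k} (there k∈) {u} {v} a b | inj₂ p | inj₁ q with ∧-true {through ks u j} p
  ...   | p₁ , p₂ = ∨-introʳ {through ks u v} (∧-intro p₁ (through-trans k∈ p₂ q))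
  through-trans {j ∷ ks} {k} (there k∈) {u} {v} a b | inj₂ p | inj₂ q with ∧-true {through ks u j} p | ∧-true {through ks k j} q
  ...   | p₁ , p₂ | q₁ , q₂ = ∨-introʳ {through ks u v} (∧-intro {through ks u j} p₁ q₂)

  through-complete : ∀ {u v} → Conn D u v → through (allFin n) u v ≡ true
  through-complete {u} ε = through-self (allFin n) u
  through-complete (e ◅ es) =
    through-trans (∈-allFin _) (through-adj (allFin n) e) (through-complete es)

conn? : ∀ {n} (D : Rel n) u v → Dec (Conn D u v)
conn? {n} D u v with Reach.through D (allFin n) u v in eq
... | true = yes (Reach.through-sound D (allFin n) eq)
... | false = no λ c → true≢false (Reach.through-complete D c) eq

-- Removing a vertex keeps it as an isolated vertex.
infixl 6 _∖_
_∖_ : ∀ {n} → Rel n → Fin n → Rel n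
(D ∖ z) u v = D u v ∧ (not (does (u ≟ z)) ∧ not (does (v ≟ z)))

module _ {n} {D : Rel n} {z : Fin n} where
  ∖-adj : ∀ {u v} → Adj D u v → u ≢ z → v ≢ z → Adj (D ∖ z) u v
  ∖-adj {u} {v} e u≢ v≢ = ∧-intro e (∧-intro (cong not (does-false (u ≟ z) u≢)) (cong not (does-false (v ≟ z) v≢)))

  ∖-inv : ∀ {u v} → Adj (D ∖ z) u v → Adj D u v × u ≢ z × v ≢ z
  ∖-inv {u} {v} e with ∧-true e
  ... | a , b with ∧-true b
  ...   | c , d = a , does-no (u ≟ z) (not-true c) , does-no (v ≟ z) (not-true d)

  ∖-conn : ∀ {u v} → Conn (D ∖ z) u v → Conn D u v
  ∖-conn = Star.map (λ e → proj₁ (∖-inv e))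

∖-symm : ∀ {n} {D : Rel n} → Symm D → ∀ z → Symm (D ∖ z)
∖-symm s z u v = cong₂ _∧_ (s u v) (Bool.∧-comm (not (does (u ≟ z))) (not (does (v ≟ z))))

-- Deleting leaves isolated nodes behind instead of changing the node type, so the nodes that count
-- as present are those with a link.
Active : ∀ {n} → Rel n → Fin n → Set
Active D v = ∃ λ u → Adj D v u

active? : ∀ {n} (D : Rel n) v → Dec (Active D v)
active? D v = any? λ u → true? (D v u)

conn-end : ∀ {n} {D : Rel n} → Symm D → ∀ {u v} → u ≢ v → Conn D u v → Active D v
conn-end s ne ε = ⊥-elim (ne refl)
conn-end {D = D} s {u} {v} ne (_◅_ {j = j} e es) with j ≟ v
... | yes refl = u , flip-adj s e
... | no j≢v = conn-end s j≢v es

data Path {V : Set} (R : V → V → Set) : V → List V → V → Set where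
  ⟨_⟩ : ∀ u → Path R u (u ∷ []) u
  _∺_ : ∀ {u v xs w} → R u v → Path R v xs w → Path R u (u ∷ xs) w
infixr 5 _∺_

module _ {V : Set} {R : V → V → Set} where
  path-++ : ∀ {u xs v v′ ys w} → Path R u xs v → R v v′ → Path R v′ ys w → Path R u (xs ++ ys) w
  path-++ ⟨ u ⟩ r q = r ∺ q
  path-++ (r′ ∺ p) r q = r′ ∺ path-++ p r q

  path-split : ∀ {u w} x xs y ys → Path R u (x ∷ xs ++ y ∷ ys) w →
    ∃ λ v → Path R u (x ∷ xs) v × R v y × Path R y (y ∷ ys) w
  path-split x [] y ys (r ∺ ⟨ _ ⟩) = x , ⟨ x ⟩ , r , ⟨ _ ⟩
  path-split x [] y ys (r ∺ (r′ ∺ p)) = x , ⟨ x ⟩ , r , r′ ∺ p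
  path-split x (x′ ∷ xs) y ys (r ∺ p) with path-head p
    where
    path-head : ∀ {v a as w} → Path R v (a ∷ as) w → v ≡ a
    path-head ⟨ _ ⟩ = refl
    path-head (_ ∺ _) = refl
  ... | refl with path-split x′ xs y ys p
  ...   | v , p₁ , r′ , p₂ = v , r ∺ p₁ , r′ , p₂

  path-head : ∀ {v a as w} → Path R v (a ∷ as) w → v ≡ a
  path-head ⟨ _ ⟩ = refl
  path-head (_ ∺ _) = refl

  path-last∈ : ∀ {u xs w} → Path R u xs w → w ∈ xs
  path-last∈ ⟨ u ⟩ = here refl
  path-last∈ (r ∺ p) = there (path-last∈ p)

  path-head∈ : ∀ {u xs w} → Path R u xs w → u ∈ xs
  path-head∈ ⟨ u ⟩ = here refl
  path-head∈ (r ∺ p) = here refl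

  path-last : ∀ {u w y} xs → Path R u (xs ++ y ∷ []) w → w ≡ y
  path-last [] ⟨ _ ⟩ = refl
  path-last [] (_ ∺ ())
  path-last (x ∷ []) (r ∺ p) = path-last [] p
  path-last (x ∷ x′ ∷ xs) (r ∺ p) = path-last (x′ ∷ xs) p

  path-reverse : (∀ {u v} → R u v → R v u) → ∀ {u xs w} → Path R u xs w → Path R w (reverse xs) u
  path-reverse s ⟨ u ⟩ = ⟨ u ⟩
  path-reverse s {u} (_∺_ {xs = xs} r p) =
    subst (λ l → Path R _ l u) (sym (List.unfold-reverse u xs)) (path-++ (path-reverse s p) (s r) ⟨ u ⟩)

  path-map : ∀ {R′ : V → V → Set} → (∀ {u v} → R u v → R′ u v) → ∀ {u xs w} → Path R u xs w → Path R′ u xs w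
  path-map f ⟨ u ⟩ = ⟨ u ⟩
  path-map f (r ∺ p) = f r ∺ path-map f p

uniq-++ : ∀ {V : Set} {xs ys : List V} → Unique xs → Unique ys → (∀ {v} → v ∈ xs → v ∈ ys → ⊥) → Unique (xs ++ ys)
uniq-++ {xs = []} _ uy _ = uy
uniq-++ {xs = x ∷ xs} (x∉ ∷ ux) uy d =
  All.++⁺ x∉ (All.tabulate λ v∈ e → d (here refl) (subst (_∈ _) (sym e) v∈)) ∷ uniq-++ ux uy (λ a b → d (there a) b)

uniq-left : ∀ {V : Set} (xs : List V) {ys} → Unique (xs ++ ys) → Unique xs
uniq-left [] _ = []
uniq-left (x ∷ xs) (x∉ ∷ u) = All.++⁻ˡ xs x∉ ∷ uniq-left xs u

uniq-right : ∀ {V : Set} (xs : List V) {ys} → Unique (xs ++ ys) → Unique ys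
uniq-right [] u = u
uniq-right (x ∷ xs) (_ ∷ u) = uniq-right xs u

uniq-disj : ∀ {V : Set} (xs : List V) {ys} → Unique (xs ++ ys) → ∀ {v} → v ∈ xs → v ∈ ys → ⊥
uniq-disj (x ∷ xs) (x∉ ∷ u) (here refl) b = All.lookup (All.++⁻ʳ xs x∉) b refl
uniq-disj (x ∷ xs) (x∉ ∷ u) (there a) b = uniq-disj xs u a b

uniq-swap : ∀ {V : Set} (xs : List V) {ys} → Unique (xs ++ ys) → Unique (ys ++ xs)
uniq-swap xs u = uniq-++ (uniq-right xs u) (uniq-left xs u) (λ a b → uniq-disj xs u b a)

∈-swap : ∀ {V : Set} (xs : List V) {ys v} → v ∈ xs ++ ys → v ∈ ys ++ xs
∈-swap xs {ys} m with ∈-++⁻ xs m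
... | inj₁ a = ∈-++⁺ʳ ys a
... | inj₂ b = ∈-++⁺ˡ b

module _ {n : ℕ} where
  open DecMem (_≟_ {n}) public using (_∈?_)

module _ {n} {R : Fin n → Fin n → Set} where
  -- Loop erasure: if the start recurs on the simple path built for the rest, everything before that
  -- occurrence is dropped.
  simple-path : ∀ {u v} → Star R u v → ∃ λ xs → Path R u xs v × Unique xs
  simple-path {u} ε = u ∷ [] , ⟨ u ⟩ , [] ∷ []
  simple-path {u} (r ◅ rs) with simple-path rs
  ... | xs , p , q with u ∈? xs
  ...   | no u∉ = u ∷ xs , r ∺ p , All.tabulate (λ v∈ e → u∉ (subst (_∈ xs) (sym e) v∈)) ∷ q
  ...   | yes u∈ with ∈-∃++ u∈
  ...     | [] , zs , refl with path-head p
  ...       | refl = xs , p , q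
  simple-path {u} (r ◅ rs) | xs , p , q | yes u∈ | y ∷ ys , zs , refl with path-split y ys u zs p
  ... | _ , _ , _ , p′ = u ∷ zs , p′ , uniq-right (y ∷ ys) q

  first-hit : ∀ {P : Fin n → Set} → (∀ v → Dec (P v)) → ∀ {u w} → Star R u w → P w →
    ∃ λ z → P z × Star (λ a b → R a b × ¬ P a) u z
  first-hit P? ε pw = _ , pw , ε
  first-hit P? {u} (r ◅ rs) pw with P? u
  ... | yes pu = u , pu , ε
  ... | no ¬pu with first-hit P? rs pw
  ...   | z , pz , s = z , pz , (r , ¬pu) ◅ s

  path-unhit : ∀ {P : Fin n → Set} {u xs z} → Path (λ a b → R a b × ¬ P a) u xs z →
    ∃ λ ys → xs ≡ ys ++ z ∷ [] × (∀ {v} → v ∈ ys → ¬ P v)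
  path-unhit ⟨ _ ⟩ = [] , refl , λ ()
  path-unhit {u = u} ((r , ¬p) ∺ q) with path-unhit q
  ... | ys , refl , f = u ∷ ys , refl , λ { (here refl) → ¬p ; (there m) → f m }

-- Minors as partial maps with connected fibres

Within : {V X : Set} → (V → V → Set) → (V → Maybe X) → X → V → V → Set
Within R f x a b = R a b × f a ≡ just x × f b ≡ just x

-- Rooted minor models in an arbitrary graph (V , R); nonemptiness of the branch
-- sets is implied by linked when the minor has no isolated node.
record Model (H : Graph) (tH : Node H) {V : Set} (R : V → V → Set) (t : V) : Set where
  field
    branch    : V → Maybe (Node H)
    connected : ∀ {x u v} → branch u ≡ just x → branch v ≡ just x → Star (Within R branch x) u v
    linked    : ∀ x y → Edge H x y → ∃₂ λ u v → branch u ≡ just x × branch v ≡ just y × R u v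
    rooted    : branch t ≡ just tH

-- The partial map presents `(V , R)` as a minor of `(V′ , R′)`: fibres are contracted, nodes
-- without image are deleted. All reductions between graphs below take this form, so the four minors
-- are pulled back in one place.
record Contract {V V′ : Set} (R : V → V → Set) (t : V) (R′ : V′ → V′ → Set) (t′ : V′) : Set where
  field
    to    : V′ → Maybe V
    fibre : ∀ {v a b} → to a ≡ just v → to b ≡ just v → Star (Within R′ to v) a b
    lift  : ∀ {u v} → R u v → ∃₂ λ a b → to a ≡ just u × to b ≡ just v × R′ a b
    root  : to t′ ≡ just t

module _ {H : Graph} {tH : Node H} {V V′ : Set} {R : V → V → Set} {t : V} {R′ : V′ → V′ → Set} {t′ : V′} where
  -- Each step of a walk inside a branch set lifts to a link between two fibres, and connectedness
  -- of the fibres bridges the gap between consecutive lifts.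
  model-contract : Contract R t R′ t′ → Model H tH R t → Model H tH R′ t′
  model-contract C M = record
    { branch = br
    ; connected = con
    ; linked = λ x y e → let (u , v , bu , bv , r) = linked x y e
                             (a , b , ta , tb , r′) = lift r
                         in a , b , br-intro ta bu , br-intro tb bv , r′
    ; rooted = br-intro root rooted
    }
    where
    open Model M
    open Contract C
    br : V′ → Maybe (Node H)
    br a = to a Maybe.>>= branch
    br-intro : ∀ {a u x} → to a ≡ just u → branch u ≡ just x → br a ≡ just x
    br-intro ta bu rewrite ta = bu
    br-elim : ∀ {a x} → br a ≡ just x → ∃ λ u → to a ≡ just u × branch u ≡ just x
    br-elim {a} e with to a
    ... | just u = u , refl , e
    widen : ∀ {x u a b} → branch u ≡ just x → Star (Within R′ to u) a b → Star (Within R′ br x) a b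
    widen bu = Star.map λ (r , p , q) → r , br-intro p bu , br-intro q bu
    walk : ∀ {x u v a b} → branch u ≡ just x → Star (Within R branch x) u v → to a ≡ just u → to b ≡ just v →
           Star (Within R′ br x) a b
    walk bu ε ta tb = widen bu (fibre ta tb)
    walk bu ((r , bu′ , bw) ◅ s) ta tb with lift r
    ... | a₁ , b₁ , ta₁ , tb₁ , r′ =
      widen bu (fibre ta ta₁) ◅◅ ((r′ , br-intro ta₁ bu , br-intro tb₁ bw) ◅ walk bw s tb₁ tb)
    con : ∀ {x a b} → br a ≡ just x → br b ≡ just x → Star (Within R′ br x) a b
    con ea eb with br-elim ea | br-elim eb
    ... | u , ta , bu | v , tb , bv = walk bu (connected bu bv) ta tb

module _ {V : Set} (R : V → V → Set) (t : V) where
  Forb : Set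
  Forb = Model K5-e K5-e-root R t ⊎ Model K33-e K33-e-root R t
       ⊎ Model K34-2e K34-2e-root R t ⊎ Model K24-sub K24-sub-root R t

forb-contract : ∀ {V V′ : Set} {R : V → V → Set} {t} {R′ : V′ → V′ → Set} {t′} → Contract R t R′ t′ → Forb R t → Forb R′ t′
forb-contract C (inj₁ m) = inj₁ (model-contract C m)
forb-contract C (inj₂ (inj₁ m)) = inj₂ (inj₁ (model-contract C m))
forb-contract C (inj₂ (inj₂ (inj₁ m))) = inj₂ (inj₂ (inj₁ (model-contract C m)))
forb-contract C (inj₂ (inj₂ (inj₂ m))) = inj₂ (inj₂ (inj₂ (model-contract C m)))

module _ {H : Graph} {tH : Node H} {G : Graph} {t : Node G} where
  to-rooted : (∀ x → ∃ λ y → Edge H x y) → Model H tH (Edge G) t → RootedMinor H tH G t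
  to-rooted ni M = record
    { branch = branch
    ; nonempty = λ x → let (y , e) = ni x ; (u , _ , bu , _) = linked x y e in u , bu
    ; connected = λ x u v bu bv → conv bv (connected bu bv)
    ; linked = linked
    ; rooted = rooted }
    where
    open Model M
    conv : ∀ {x u v} → branch v ≡ just x → Star (Within (Edge G) branch x) u v →
           PathWithin G (λ w → branch w ≡ just x) u v
    conv bv ε = here bv
    conv bv ((e , bu , _) ◅ s) = step bu e (conv bv s)

no-isolated? : (H : Graph) → Dec (∀ x → ∃ λ y → Edge H x y)
no-isolated? H = all? λ x → any? λ y → true? (adj H x y)

forb-rooted : ∀ {G t} → Forb (Edge G) t → ForbiddenRootedMinor G t
forb-rooted (inj₁ m) = inj₁ (to-rooted (does-yes (no-isolated? K5-e) refl) m)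
forb-rooted (inj₂ (inj₁ m)) = inj₂ (inj₁ (to-rooted (does-yes (no-isolated? K33-e) refl) m))
forb-rooted (inj₂ (inj₂ (inj₁ m))) = inj₂ (inj₂ (inj₁ (to-rooted (does-yes (no-isolated? K34-2e) refl) m)))
forb-rooted (inj₂ (inj₂ (inj₂ m))) = inj₂ (inj₂ (inj₂ (to-rooted (does-yes (no-isolated? K24-sub) refl) m)))

-- Checking minors of small graphs by evaluation

allF : ∀ {n} → (Fin n → Bool) → Bool
allF {zero} f = true
allF {suc n} f = f fzero ∧ allF (f ∘ fsuc)

anyF : ∀ {n} → (Fin n → Bool) → Bool
anyF {zero} f = false
anyF {suc n} f = f fzero ∨ anyF (f ∘ fsuc)

allF-sound : ∀ {n} (f : Fin n → Bool) → allF f ≡ true → ∀ i → f i ≡ true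
allF-sound f e fzero = proj₁ (∧-true e)
allF-sound f e (fsuc i) = allF-sound (f ∘ fsuc) (proj₂ (∧-true {f fzero} e)) i

anyF-sound : ∀ {n} (f : Fin n → Bool) → anyF f ≡ true → ∃ λ i → f i ≡ true
anyF-sound {suc n} f e with ∨-true {f fzero} e
... | inj₁ e′ = fzero , e′
... | inj₂ e′ = let (i , p) = anyF-sound (f ∘ fsuc) e′ in fsuc i , p

_⇒ᵇ_ : Bool → Bool → Bool
a ⇒ᵇ b = not a ∨ b

⇒ᵇ-sound : ∀ {a b} → (a ⇒ᵇ b) ≡ true → a ≡ true → b ≡ true
⇒ᵇ-sound e refl = e

-- A graph whose vertices are r disjoint connected segments of (V , R), with
-- adjacencies listed in es; minors of it are verified by evaluation.
module Small {r : ℕ} (es : List (Fin r × Fin r)) where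
  mem : List (Fin r × Fin r) → Fin r → Fin r → Bool
  mem [] i j = false
  mem ((a , b) ∷ l) i j = (does (a ≟ i) ∧ does (b ≟ j)) ∨ mem l i j

  R : Fin r → Fin r → Bool
  R i j = mem es i j ∨ mem es j i

  module _ (H : Graph) (lab : Vec (Maybe (Node H)) r) where
    is : Node H → Fin r → Bool
    is x i with lookup lab i
    ... | nothing = false
    ... | just y = does (y ≟ x)

    reach : ℕ → Node H → Fin r → Fin r → Bool
    reach zero x i j = does (i ≟ j)
    reach (suc k) x i j = does (i ≟ j) ∨ anyF λ m → R i m ∧ (is x m ∧ reach k x m j)

    check : Node H → Fin r → Bool
    check tH ri = is tH ri
      -- Four links suffice: a connected branch set of at most five segments has diameter at most
      -- four.
      ∧ (allF (λ x → allF λ i → is x i ⇒ᵇ allF λ j → is x j ⇒ᵇ reach 4 x i j)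
      ∧ allF (λ x → allF λ y → adj H x y ⇒ᵇ anyF λ i → is x i ∧ anyF λ j → is y j ∧ R i j))

    is-sound : ∀ {x i} → is x i ≡ true → lookup lab i ≡ just x
    is-sound {x} {i} e with lookup lab i
    ... | just y = cong just (does-yes (y ≟ x) e)

    is-complete : ∀ {x i} → lookup lab i ≡ just x → is x i ≡ true
    is-complete {x} {i} e with lookup lab i
    is-complete {x} {i} refl | just y = does-true (y ≟ x) refl

    reach-sound : ∀ k {x i j} → is x i ≡ true → reach k x i j ≡ true → Star (Within (λ a b → R a b ≡ true) (lookup lab) x) i j
    reach-sound zero {x} {i} {j} b e with i ≟ j
    ... | yes refl = ε
    reach-sound (suc k) {x} {i} {j} b e with i ≟ j
    ... | yes refl = ε
    ... | no _ with anyF-sound (λ m → R i m ∧ (is x m ∧ reach k x m j)) e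
    ...   | m , e′ with ∧-true {R i m} e′
    ...     | r , e″ with ∧-true {is x m} e″
    ...       | bm , s = (r , is-sound b , is-sound bm) ◅ reach-sound k bm s

    model : ∀ tH ri → check tH ri ≡ true → Model H tH (λ a b → R a b ≡ true) ri
    model tH ri e = record
      { branch = lookup lab
      ; connected = λ {x} {u} {v} bu bv → reach-sound 4 (is-complete bu)
          (⇒ᵇ-sound (allF-sound _ (⇒ᵇ-sound (allF-sound _ (allF-sound _ e₂ x) u) (is-complete bu)) v) (is-complete bv))
      ; linked = λ x y xy →
          let (i , p) = anyF-sound _ (⇒ᵇ-sound {adj H x y} (allF-sound _ (allF-sound _ e₃ x) y) xy)
              (ix , p′) = ∧-true {is x i} p
              (j , q) = anyF-sound _ p′
              (jy , rr) = ∧-true {is y j} q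
          in i , j , is-sound ix , is-sound jy , rr
      ; rooted = is-sound e₁ }
      where
      e₁ = proj₁ (∧-true {is tH ri} e)
      e₂ = proj₁ (∧-true (proj₂ (∧-true {is tH ri} e)))
      e₃ = proj₂ (∧-true {allF (λ x → allF λ i → is x i ⇒ᵇ allF λ j → is x j ⇒ᵇ reach 4 x i j)} (proj₂ (∧-true {is tH ri} e)))

SegAdj : {V : Set} → (V → V → Set) → List V → List V → Set
SegAdj R S T = ∃₂ λ a b → a ∈ S × b ∈ T × R a b

-- The last list is not followed by `++ []`, so that the concatenation of concrete segments computes
-- to the list that was cut.
concatV : ∀ {V : Set} {r} → Vec (List V) r → List V
concatV [] = []
concatV (s ∷ []) = s
concatV (s ∷ ss@(_ ∷ _)) = s ++ concatV ss

Disj : ∀ {V : Set} {r} → Vec (List V) r → Set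
Disj ss = ∀ i j {v} → v ∈ lookup ss i → v ∈ lookup ss j → i ≡ j

∈-concatV : ∀ {V : Set} {r} (ss : Vec (List V) r) i {v} → v ∈ lookup ss i → v ∈ concatV ss
∈-concatV (s ∷ []) fzero m = m
∈-concatV (s ∷ ss@(_ ∷ _)) fzero m = ∈-++⁺ˡ m
∈-concatV (s ∷ ss@(_ ∷ _)) (fsuc i) m = ∈-++⁺ʳ s (∈-concatV ss i m)

uniq-disjV : ∀ {V : Set} {r} (ss : Vec (List V) r) → Unique (concatV ss) → Disj ss
uniq-disjV (s ∷ []) u fzero fzero m m′ = refl
uniq-disjV (s ∷ ss@(_ ∷ _)) u fzero fzero m m′ = refl
uniq-disjV (s ∷ ss@(_ ∷ _)) u fzero (fsuc j) m m′ = ⊥-elim (uniq-disj s u m (∈-concatV ss j m′))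
uniq-disjV (s ∷ ss@(_ ∷ _)) u (fsuc i) fzero m m′ = ⊥-elim (uniq-disj s u m′ (∈-concatV ss i m))
uniq-disjV (s ∷ ss@(_ ∷ _)) u (fsuc i) (fsuc j) m m′ = cong fsuc (uniq-disjV ss (uniq-right s u) i j m m′)

IsPath : {V : Set} → (V → V → Set) → List V → Set
IsPath R xs = ∃₂ λ u w → Path R u xs w

Connected : {V : Set} → (V → V → Set) → List V → Set
Connected R s = ∀ {a b} → a ∈ s → b ∈ s → Star (λ x y → R x y × x ∈ s × y ∈ s) a b

path-connected : ∀ {V : Set} {R : V → V → Set} → (∀ {u v} → R u v → R v u) → ∀ {s} → IsPath R s → Connected R s
path-connected {V} {R} R-sym {s} (u , w , p) a b = Star.reverse (λ (r , x , y) → R-sym r , y , x) (from-head p id a) ◅◅ from-head p id b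
  where
  from-head : ∀ {a xs w} → Path R a xs w → (∀ {x} → x ∈ xs → x ∈ s) → ∀ {b} → b ∈ xs → Star (λ x y → R x y × x ∈ s × y ∈ s) a b
  from-head ⟨ _ ⟩ f (here refl) = ε
  from-head (r ∺ p) f (here refl) = ε
  from-head (r ∺ p) f (there m) = (r , f (here refl) , f (there (path-head∈ p))) ◅ from-head p (f ∘ there) m

module Segments {V : Set} (_≟ᵛ_ : (u v : V) → Dec (u ≡ v)) {R : V → V → Set} (R-sym : ∀ {u v} → R u v → R v u) where
  open DecMem _≟ᵛ_ using () renaming (_∈?_ to _∈ᵛ?_)

  index : ∀ {r} → Vec (List V) r → V → Maybe (Fin r)
  index [] v = nothing
  index (s ∷ ss) v with v ∈ᵛ? s
  ... | yes _ = just fzero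
  ... | no _ = Maybe.map fsuc (index ss v)

  index-sound : ∀ {r} (ss : Vec (List V) r) {v i} → index ss v ≡ just i → v ∈ lookup ss i
  index-sound (s ∷ ss) {v} e with v ∈ᵛ? s
  index-sound (s ∷ ss) refl | yes m = m
  index-sound (s ∷ ss) {v} e | no _ with index ss v in eq
  index-sound (s ∷ ss) refl | no _ | just i = index-sound ss eq

  index-complete : ∀ {r} (ss : Vec (List V) r) → Disj ss → ∀ i {v} → v ∈ lookup ss i → index ss v ≡ just i
  index-complete (s ∷ ss) u i {v} m with v ∈ᵛ? s
  index-complete (s ∷ ss) u fzero m | yes _ = refl
  index-complete (s ∷ ss) u (fsuc i) m | yes v∈ = (case u fzero (fsuc i) v∈ m of λ ())
  index-complete (s ∷ ss) u fzero m | no v∉ = ⊥-elim (v∉ m)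
  index-complete (s ∷ ss) u (fsuc i) m | no v∉ rewrite index-complete ss (λ a b p q → Fin.suc-injective (u (fsuc a) (fsuc b) p q)) i m = refl

  module _ {r} (ss : Vec (List V) r) (u : Disj ss) (ps : ∀ i → Connected R (lookup ss i))
           (es : List (Fin r × Fin r)) (ad : All (λ (i , j) → SegAdj R (lookup ss i) (lookup ss j)) es)
           {t : V} (ri : Fin r) (t∈ : t ∈ lookup ss ri) where

    private
      mem-adj : ∀ {l} → All (λ (i , j) → SegAdj R (lookup ss i) (lookup ss j)) l → ∀ {i j} → Small.mem es l i j ≡ true →
                SegAdj R (lookup ss i) (lookup ss j)
      mem-adj {(a , b) ∷ l} (x ∷ xs) {i} {j} e with ∨-true {does (a ≟ i) ∧ does (b ≟ j)} e
      ... | inj₂ e′ = mem-adj xs e′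
      ... | inj₁ e′ with ∧-true {does (a ≟ i)} e′
      ...   | p , q with does-yes (a ≟ i) p | does-yes (b ≟ j) q
      ...     | refl | refl = x
      seg-adj : ∀ {i j} → Small.R es i j ≡ true → SegAdj R (lookup ss i) (lookup ss j)
      seg-adj {i} {j} e with ∨-true {Small.mem es es i j} e
      ... | inj₁ e′ = mem-adj ad e′
      ... | inj₂ e′ with mem-adj ad e′
      ...   | a , b , ma , mb , r = b , a , mb , ma , R-sym r

    seg-contract : Contract (λ a b → Small.R es a b ≡ true) ri R t
    seg-contract = record
      { to = index ss
      ; fibre = λ {i} ta tb → Star.map (λ (r , a , b) → r , index-complete ss u i a , index-complete ss u i b)
          (ps i (index-sound ss ta) (index-sound ss tb))
      ; lift = λ {i} {j} e → let (a , b , ma , mb , r) = seg-adj e in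
          a , b , index-complete ss u i ma , index-complete ss u j mb , r
      ; root = index-complete ss u ri t∈ }

    seg-model : (H : Graph) (tH : Node H) (lab : Vec (Maybe (Node H)) r) → Small.check es H lab tH ri ≡ true → Model H tH R t
    seg-model H tH lab e = model-contract seg-contract (Small.model es H lab tH ri e)

-- The graph D with a root joined directly to the nodes of Dir and through a
-- private degree-two node to the nodes of Ext.
data Vtx (n : ℕ) : Set where
  vtx  : Fin n → Vtx n
  pend : Fin n → Vtx n
  root : Vtx n

vtx-inj : ∀ {n} {u v : Fin n} → vtx u ≡ vtx v → u ≡ v
vtx-inj refl = refl

_≟ᵥ_ : ∀ {n} (u v : Vtx n) → Dec (u ≡ v)
vtx u ≟ᵥ vtx v = map′ (cong vtx) vtx-inj (u ≟ v)
vtx u ≟ᵥ pend v = no λ ()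
vtx u ≟ᵥ root = no λ ()
pend u ≟ᵥ vtx v = no λ ()
pend u ≟ᵥ pend v = map′ (cong pend) (λ { refl → refl }) (u ≟ v)
pend u ≟ᵥ root = no λ ()
root ≟ᵥ vtx v = no λ ()
root ≟ᵥ pend v = no λ ()
root ≟ᵥ root = yes refl

VSet : ℕ → Set
VSet n = Fin n → Bool

data Link {n} (D : Rel n) (Dir Ext : VSet n) : Vtx n → Vtx n → Set where
  dd : ∀ {u v} → Adj D u v → Link D Dir Ext (vtx u) (vtx v)
  dr : ∀ {u} → Dir u ≡ true → Link D Dir Ext (vtx u) root
  rd : ∀ {u} → Dir u ≡ true → Link D Dir Ext root (vtx u)
  dp : ∀ {u} → Ext u ≡ true → Link D Dir Ext (vtx u) (pend u)
  pd : ∀ {u} → Ext u ≡ true → Link D Dir Ext (pend u) (vtx u)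
  pr : ∀ {u} → Ext u ≡ true → Link D Dir Ext (pend u) root
  rp : ∀ {u} → Ext u ≡ true → Link D Dir Ext root (pend u)

link-sym : ∀ {n} {D : Rel n} {Dir Ext} → Symm D → ∀ {a b} → Link D Dir Ext a b → Link D Dir Ext b a
link-sym s (dd e) = dd (flip-adj s e)
link-sym s (dr e) = rd e
link-sym s (rd e) = dr e
link-sym s (dp e) = pd e
link-sym s (pd e) = dp e
link-sym s (pr e) = rp e
link-sym s (rp e) = pr e

Bad : ∀ {n} → Rel n → VSet n → VSet n → Set
Bad D Dir Ext = Forb (Link D Dir Ext) root

-- Patterns on a piece: runs, orbits and tours

Pattern : ℕ → Set
Pattern n = Fin n → Maybe (Fin n) → VSet n → Maybe (Fin n)

infixr 6 _⊔_
infixr 7 _⊓_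
_⊔_ _⊓_ : ∀ {n} → Rel n → Rel n → Rel n
(D ⊔ D′) u v = D u v ∨ D′ u v
(D ⊓ D′) u v = D u v ∧ D′ u v

⊓-symm : ∀ {n} {D L : Rel n} → Symm D → Symm L → Symm (D ⊓ L)
⊓-symm d l u v = cong₂ _∧_ (d u v) (l u v)

⊓-adj : ∀ {n} {D L : Rel n} {u v} → Adj (D ⊓ L) u v → Adj D u v × Adj L u v
⊓-adj {D = D} {L} {u} {v} e = ∧-true {D u v} e

-- A missing output means leaving the piece at the current node.
data Run {n} (σ : Pattern n) (L : Rel n) : Maybe (Fin n) → Fin n → Fin n → Set where
  exit : ∀ {p v} → σ v p (L v) ≡ nothing → Run σ L p v v
  go   : ∀ {p v w a} → σ v p (L v) ≡ just w → Run σ L (just v) w a → Run σ L p v a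

-- Leaving at a terminal and starting afresh there models a packet that finds its link to the root
-- dead.
data Orb {n} (σ : Pattern n) (L : Rel n) : Fin n → Fin n → Set where
  one  : ∀ {a b} → Run σ L nothing a b → Orb σ L a b
  more : ∀ {a b c} → Run σ L nothing a c → Orb σ L c b → Orb σ L a b

Valid : ∀ {n} → Rel n → Pattern n → Set
Valid D σ = ∀ {v p al w} → σ v p al ≡ just w → Adj D v w × al w ≡ true

-- `round` speaks of exits and not merely of nodes passed: at an exit another piece can take over,
-- which is what gluing relies on. The pattern is fixed before `L`, so it has to serve all failure
-- sets at once.
record Tour {n} (D : Rel n) (A : VSet n) : Set where
  field
    σ     : Pattern n
    valid : Valid D σ
    exits : ∀ {L} → Symm L → ∀ {s a} → A a ≡ true → Conn (D ⊓ L) s a → ∃ λ a′ → A a′ ≡ true × Run σ L nothing s a′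
    round : ∀ {L} → Symm L → ∀ {a b} → A a ≡ true → A b ≡ true → Conn (D ⊓ L) a b → Orb σ L a b

module _ {n} {σ : Pattern n} {L : Rel n} where
  orb-trans : ∀ {a b c} → Orb σ L a b → Orb σ L b c → Orb σ L a c
  orb-trans (one r) o = more r o
  orb-trans (more r o′) o = more r (orb-trans o′ o)

  run-port : ∀ {p q v a} → σ v p (L v) ≡ σ v q (L v) → Run σ L p v a → Run σ L q v a
  run-port e (exit x) = exit (trans (sym e) x)
  run-port e (go x r) = go (trans (sym e) x) r

  run-conn : ∀ {D} → Valid D σ → ∀ {p v a} → Run σ L p v a → Conn (D ⊓ L) v a
  run-conn val (exit _) = ε
  run-conn val (go {v = v} {w} e r) = let (d , l) = val {v} e in ∧-intro d l ◅ run-conn val r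

  run-det : ∀ {p v a b} → Run σ L p v a → Run σ L p v b → a ≡ b
  run-det (exit _) (exit _) = refl
  run-det (exit e) (go e′ _) = case trans (sym e) e′ of λ ()
  run-det (go e _) (exit e′) = case trans (sym e) e′ of λ ()
  run-det (go e r) (go e′ r′) with trans (sym e) e′
  ... | refl = run-det r r′

bool-case : ∀ (b : Bool) → b ≡ true ⊎ b ≡ false
bool-case true = inj₁ refl
bool-case false = inj₂ refl

-- An exit outside `A′` becomes an immediate fresh start at the same node, so a run of the new
-- pattern concatenates runs of the old one up to the next exit in `A′`.
module Forget {n} (σ : Pattern n) (A′ : VSet n) where
  σ′ : Pattern n
  σ′ v p al with σ v p al
  ... | just w = just w
  ... | nothing = if A′ v then nothing else σ v nothing al

  σ′-just : ∀ {v p al w} → σ v p al ≡ just w → σ′ v p al ≡ just w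
  σ′-just {v} {p} {al} e with σ v p al
  σ′-just refl | just w = refl

  σ′-exit : ∀ {v p al} → A′ v ≡ true → σ v p al ≡ nothing → σ′ v p al ≡ nothing
  σ′-exit {v} {p} {al} a e with σ v p al
  σ′-exit a refl | nothing rewrite a = refl

  σ′-restart : ∀ {v p al} → A′ v ≡ false → σ v p al ≡ nothing → σ′ v nothing al ≡ σ′ v p al
  σ′-restart {v} {p} {al} a e with σ v p al
  σ′-restart {v} {p} {al} a refl | nothing rewrite a with σ v nothing al in eq
  ... | nothing rewrite a = eq
  ... | just w = refl

  valid′ : ∀ {D} → Valid D σ → Valid D σ′
  valid′ val {v} {p} {al} e with σ v p al in eq
  valid′ val {v} {p} {al} refl | just w = val {v} {p} eq
  valid′ val {v} {p} {al} e | nothing with A′ v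
  valid′ val {v} {p} {al} e | nothing | false = val {v} {nothing} e

  module _ {L : Rel n} where
    keep : ∀ {p s a} → A′ a ≡ true → Run σ L p s a → Run σ′ L p s a
    keep a (exit e) = exit (σ′-exit a e)
    keep a (go e r) = go (σ′-just e) (keep a r)

    skip : ∀ {p s a x} → A′ a ≡ false → Run σ L p s a → Run σ′ L nothing a x → Run σ′ L p s x
    skip a (exit e) r′ = run-port (σ′-restart a e) r′
    skip a (go e r) r′ = go (σ′-just e) (skip a r r′)

    orb-first : ∀ {a b} → A′ b ≡ true → Orb σ L a b → ∃ λ c → A′ c ≡ true × Run σ′ L nothing a c
    orb-first {a} {b} ab (one r) = b , ab , keep ab r
    orb-first {a} ab (more {c = c} r o) with bool-case (A′ c)
    ... | inj₁ ac = c , ac , keep ac r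
    ... | inj₂ ac = let (d , ad , r′) = orb-first ab o in d , ad , skip ac r r′

    orb-keep : ∀ {a b} → A′ b ≡ true → Orb σ L a b → Orb σ′ L a b
    orb-keep ab (one r) = one (keep ab r)
    orb-keep {a} ab (more {c = c} r o) with bool-case (A′ c)
    ... | inj₁ ac = more (keep ac r) (orb-keep ab o)
    ... | inj₂ ac with orb-keep ab o
    ...   | one r′ = one (skip ac r r′)
    ...   | more r′ o′ = more (skip ac r r′) o′

_⊆ᵇ_ : ∀ {n} → VSet n → VSet n → Set
A ⊆ᵇ B = ∀ {v} → A v ≡ true → B v ≡ true

-- The old run may exit at a forgotten terminal. By `round` an orbit leads from there to the wanted
-- terminal, and the first member of `A′` on it is where the new pattern exits.
tour-forget : ∀ {n} {D : Rel n} {A A′ : VSet n} → Symm D → A′ ⊆ᵇ A → Tour D A → Tour D A′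
tour-forget {D = D} {A} {A′} sD sub T = record
  { σ = σ′
  ; valid = valid′ valid
  ; exits = λ {L} sL {s} {a} a′ c → ex sL a′ c (exits sL (sub a′) c)
  ; round = λ sL a b c → orb-keep b (round sL (sub a) (sub b) c) }
  where
  open Tour T
  open Forget σ A′
  ex : ∀ {L} → Symm L → ∀ {s a} → A′ a ≡ true → Conn (D ⊓ L) s a → (∃ λ a′ → A a′ ≡ true × Run σ L nothing s a′) →
       ∃ λ a′ → A′ a′ ≡ true × Run σ′ L nothing s a′
  ex sL a′ c (x , ax , r) with bool-case (A′ x)
  ... | inj₁ a″ = x , a″ , keep a″ r
  ... | inj₂ a″ with orb-first a′ (round sL ax (sub a′) (conn-sym (⊓-symm sD sL) (run-conn valid r) ◅◅ c))
  ...   | d , ad , r′ = d , ad , skip a″ r r′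

-- Joining two tours at a cut node

_∪_ : ∀ {n} → VSet n → VSet n → VSet n
(A ∪ B) v = A v ∨ B v

-- Two pieces sharing only z: whoever leaves the first one at z enters the second
-- one, and leaving the second one at z means leaving the union.
module Glue {n} {D₁ D₂ : Rel n} {A₁ A₂ : VSet n} (s₁ : Symm D₁) (s₂ : Symm D₂) (i₁ : Irr D₁) (i₂ : Irr D₂)
            (T₁ : Tour D₁ A₁) (T₂ : Tour D₂ A₂) (z : Fin n) (z₁ : A₁ z ≡ true) (z₂ : A₂ z ≡ true)
            (side : VSet n)
            (d₁ : ∀ {u v} → u ≢ z → Adj D₁ u v → side u ≡ true)
            (d₂ : ∀ {u v} → u ≢ z → Adj D₂ u v → side u ≡ false)
            (a₁ : ∀ {u} → u ≢ z → A₁ u ≡ true → side u ≡ true)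
            (a₂ : ∀ {u} → u ≢ z → A₂ u ≡ true → side u ≡ false) where
  private
    module T₁ = Tour T₁
    module T₂ = Tour T₂

  -- The in-port is the only memory available: the side of `q` decides which of the two tours is
  -- being followed at `z`.
  atZ : Maybe (Fin n) → VSet n → Maybe (Fin n)
  atZ nothing al = T₁.σ z nothing al Maybe.<∣> T₂.σ z nothing al
  atZ (just q) al = if side q then T₁.σ z (just q) al Maybe.<∣> T₂.σ z nothing al else T₂.σ z (just q) al

  σ : Pattern n
  σ v p al with v ≟ z
  ... | yes _ = atZ p al
  ... | no _ = if side v then T₁.σ v p al else T₂.σ v p al

  ifb : ∀ {X : Set} {b : Bool} {x y : X} → b ≡ true → (if b then x else y) ≡ x
  ifb refl = refl
  ifb′ : ∀ {X : Set} {b : Bool} {x y : X} → b ≡ false → (if b then x else y) ≡ y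
  ifb′ refl = refl

  σ-1 : ∀ {v p al} → v ≢ z → side v ≡ true → σ v p al ≡ T₁.σ v p al
  σ-1 {v} ne sv with v ≟ z
  ... | yes e = ⊥-elim (ne e)
  ... | no _ = ifb sv

  σ-2 : ∀ {v p al} → v ≢ z → side v ≡ false → σ v p al ≡ T₂.σ v p al
  σ-2 {v} ne sv with v ≟ z
  ... | yes e = ⊥-elim (ne e)
  ... | no _ = ifb′ sv

  σ-z : ∀ {p al} → σ z p al ≡ atZ p al
  σ-z with z ≟ z
  ... | yes _ = refl
  ... | no ne = ⊥-elim (ne refl)

  From₁ : Maybe (Fin n) → Set
  From₁ p = p ≡ nothing ⊎ ∃ λ q → p ≡ just q × side q ≡ true

  atZ-1 : ∀ {p al} → From₁ p → atZ p al ≡ (T₁.σ z p al Maybe.<∣> T₂.σ z nothing al)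
  atZ-1 (inj₁ refl) = refl
  atZ-1 (inj₂ (q , refl , sq)) = ifb sq

  Loc₁ Loc₂ : Fin n → Set
  Loc₁ v = v ≡ z ⊎ (v ≢ z × side v ≡ true)
  Loc₂ v = v ≡ z ⊎ (v ≢ z × side v ≡ false)

  State₁ State₂ : Maybe (Fin n) → Fin n → Set
  State₁ p v = (v ≡ z × From₁ p) ⊎ (v ≢ z × side v ≡ true)
  State₂ p v = (v ≡ z × ∃ λ q → p ≡ just q × side q ≡ false) ⊎ (v ≢ z × side v ≡ false)

  loc₁-adj : ∀ {v w} → Adj D₁ v w → Loc₁ w
  loc₁-adj {v} {w} e with w ≟ z
  ... | yes p = inj₁ p
  ... | no p = inj₂ (p , d₁ p (flip-adj s₁ e))

  loc₂-adj : ∀ {v w} → Adj D₂ v w → Loc₂ w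
  loc₂-adj {v} {w} e with w ≟ z
  ... | yes p = inj₁ p
  ... | no p = inj₂ (p , d₂ p (flip-adj s₂ e))

  adj≢ : ∀ {D : Rel n} → Irr D → ∀ {u v} → Adj D u v → u ≢ v
  adj≢ i e refl = true≢false e (i _)

  next₁ : ∀ {v w} → Adj D₁ v w → State₁ (just v) w
  next₁ {v} {w} e with loc₁-adj e
  ... | inj₁ refl = inj₁ (refl , inj₂ (v , refl , d₁ (adj≢ i₁ e) e))
  ... | inj₂ p = inj₂ p

  next₂ : ∀ {v w} → Adj D₂ v w → State₂ (just v) w
  next₂ {v} {w} e with loc₂-adj e
  ... | inj₁ refl = inj₁ (refl , v , refl , d₂ (adj≢ i₂ e) e)
  ... | inj₂ p = inj₂ p

  start₁ : ∀ {v} → Loc₁ v → State₁ nothing v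
  start₁ (inj₁ e) = inj₁ (e , inj₁ refl)
  start₁ (inj₂ p) = inj₂ p

  module _ {L : Rel n} where
    data Enter₂ (x : Fin n) : Set where
      none : T₂.σ z nothing (L z) ≡ nothing → x ≡ z → Enter₂ x
      some : ∀ {w} → T₂.σ z nothing (L z) ≡ just w → Run σ L (just z) w x → Enter₂ x

    lift₂ : ∀ {p v a} → State₂ p v → Run T₂.σ L p v a → Run σ L p v a
    lift₂ (inj₁ (refl , q , refl , sq)) (exit e) = exit (trans σ-z (trans (ifb′ sq) e))
    lift₂ (inj₁ (refl , q , refl , sq)) (go e r) =
      go (trans σ-z (trans (ifb′ sq) e)) (lift₂ (next₂ (proj₁ (T₂.valid {z} e))) r)
    lift₂ (inj₂ (ne , sv)) (exit e) = exit (trans (σ-2 ne sv) e)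
    lift₂ {v = v} (inj₂ (ne , sv)) (go e r) = go (trans (σ-2 ne sv) e) (lift₂ (next₂ (proj₁ (T₂.valid {v} e))) r)

    enter₂ : ∀ {a} → Run T₂.σ L nothing z a → Enter₂ a
    enter₂ (exit e) = none e refl
    enter₂ (go e r) = some e (lift₂ (next₂ (proj₁ (T₂.valid {z} e))) r)

    lift₁ : ∀ {p v a} → State₁ p v → a ≢ z → Run T₁.σ L p v a → Run σ L p v a
    lift₁ (inj₁ (refl , f)) ne (exit e) = ⊥-elim (ne refl)
    lift₁ (inj₁ (refl , f)) ne (go e r) =
      go (trans σ-z (trans (atZ-1 f) (cong (Maybe._<∣> _) e))) (lift₁ (next₁ (proj₁ (T₁.valid {z} e))) ne r)
    lift₁ (inj₂ (ne′ , sv)) ne (exit e) = exit (trans (σ-1 ne′ sv) e)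
    lift₁ {v = v} (inj₂ (ne′ , sv)) ne (go e r) =
      go (trans (σ-1 ne′ sv) e) (lift₁ (next₁ (proj₁ (T₁.valid {v} e))) ne r)

    pass : ∀ {p v x} → State₁ p v → Run T₁.σ L p v z → Enter₂ x → Run σ L p v x
    pass (inj₁ (refl , f)) (exit e) (none e′ refl) = exit (trans σ-z (trans (atZ-1 f) (trans (cong (Maybe._<∣> _) e) e′)))
    pass (inj₁ (refl , f)) (exit e) (some e′ r) = go (trans σ-z (trans (atZ-1 f) (trans (cong (Maybe._<∣> _) e) e′))) r
    pass (inj₁ (refl , f)) (go e r) x =
      go (trans σ-z (trans (atZ-1 f) (cong (Maybe._<∣> _) e))) (pass (next₁ (proj₁ (T₁.valid {z} e))) r x)
    pass (inj₂ (ne , sv)) (exit e) x = ⊥-elim (ne refl)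
    pass {v = v} (inj₂ (ne , sv)) (go e r) x =
      go (trans (σ-1 ne sv) e) (pass (next₁ (proj₁ (T₁.valid {v} e))) r x)

    loc₁-conn : ∀ {a c} → Loc₁ a → Conn (D₁ ⊓ L) a c → Loc₁ c
    loc₁-conn l ε = l
    loc₁-conn {a} l (_◅_ {j = j} e es) = loc₁-conn (loc₁-adj (proj₁ (⊓-adj {D = D₁} {L} {a} {j} e))) es

    loc₂-conn : ∀ {a c} → Loc₂ a → Conn (D₂ ⊓ L) a c → Loc₂ c
    loc₂-conn l ε = l
    loc₂-conn {a} l (_◅_ {j = j} e es) = loc₂-conn (loc₂-adj (proj₁ (⊓-adj {D = D₂} {L} {a} {j} e))) es

    start₂ : ∀ {a} → a ≢ z → Loc₂ a → State₂ nothing a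
    start₂ ne (inj₁ e) = ⊥-elim (ne e)
    start₂ ne (inj₂ p) = inj₂ p

    orb₂-to-z : ∀ {a} → a ≢ z → Loc₂ a → Orb T₂.σ L a z → Orb σ L a z
    orb₂-to-z ne l (one r) = one (lift₂ (start₂ ne l) r)
    orb₂-to-z ne l (more {c = c} r o) with c ≟ z
    ... | yes refl = one (lift₂ (start₂ ne l) r)
    ... | no c≢ = more (lift₂ (start₂ ne l) r) (orb₂-to-z c≢ (loc₂-conn l (run-conn T₂.valid r)) o)

    module _ (sL : Symm L) where
      -- Passing into the second piece delays the exit at `z`. The second tour may first leave at
      -- other terminals, but `round` from `z` to `z` brings it back, and the exit then taken is the
      -- one the first tour wanted.
      return₁ : ∀ {a} → Loc₁ a → Run T₁.σ L nothing a z → Orb σ L a z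
      return₁ l r with T₂.round sL z₂ z₂ ε
      ... | one r′ = one (pass (start₁ l) r (enter₂ r′))
      ... | more {c = c} r′ o with c ≟ z
      ...   | yes refl = one (pass (start₁ l) r (enter₂ r′))
      ...   | no c≢ = more (pass (start₁ l) r (enter₂ r′)) (orb₂-to-z c≢ (loc₂-conn (inj₁ refl) (run-conn T₂.valid r′)) o)

      orb₁ : ∀ {a b} → Loc₁ a → Orb T₁.σ L a b → Orb σ L a b
      orb₁ {b = b} l (one r) with b ≟ z
      ... | yes refl = return₁ l r
      ... | no b≢ = one (lift₁ (start₁ l) b≢ r)
      orb₁ l (more {c = c} r o) with c ≟ z
      ... | yes refl = orb-trans (return₁ l r) (orb₁ (inj₁ refl) o)
      ... | no c≢ = more (lift₁ (start₁ l) c≢ r) (orb₁ (loc₁-conn l (run-conn T₁.valid r)) o)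

      orb₁-enter : ∀ {a x} → Loc₁ a → Orb T₁.σ L a z → Enter₂ x → Orb σ L a x
      orb₁-enter l (one r) x = one (pass (start₁ l) r x)
      orb₁-enter l (more {c = c} r o) x with c ≟ z
      ... | yes refl = one (pass (start₁ l) r x)
      ... | no c≢ = more (lift₁ (start₁ l) c≢ r) (orb₁-enter (loc₁-conn l (run-conn T₁.valid r)) o x)

      -- A fresh start at `z` enters the first piece, so the second one is entered only when the
      -- orbit of the first has returned to `z`.
      step₂ : ∀ {a c} → Loc₂ a → Run T₂.σ L nothing a c → Orb σ L a c
      step₂ (inj₁ refl) r = orb₁-enter (inj₁ refl) (T₁.round sL z₁ z₁ ε) (enter₂ r)
      step₂ (inj₂ p) r = one (lift₂ (inj₂ p) r)

      orb₂ : ∀ {a b} → Loc₂ a → Orb T₂.σ L a b → Orb σ L a b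
      orb₂ l (one r) = step₂ l r
      orb₂ l (more r o) = orb-trans (step₂ l r) (orb₂ (loc₂-conn l (run-conn T₂.valid r)) o)

    C₁ C₂ : Fin n → Fin n → Set
    C₁ = Conn (D₁ ⊓ L)
    C₂ = Conn (D₂ ⊓ L)

    -- A walk in the union changes sides only at `z`. Dropping its excursions that return to `z`
    -- leaves a walk on one side, or one on each side joined at `z`.
    split₁ : ∀ {a b} → a ≢ z × side a ≡ true → Conn ((D₁ ⊔ D₂) ⊓ L) a b → (Loc₁ b × C₁ a b) ⊎ (C₁ a z × Loc₂ b × C₂ z b)
    split₂ : ∀ {a b} → a ≢ z × side a ≡ false → Conn ((D₁ ⊔ D₂) ⊓ L) a b → (Loc₂ b × C₂ a b) ⊎ (C₂ a z × Loc₁ b × C₁ z b)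
    splitz : ∀ {b} → Conn ((D₁ ⊔ D₂) ⊓ L) z b → (Loc₁ b × C₁ z b) ⊎ (Loc₂ b × C₂ z b)
    split₁ l ε = inj₁ (inj₂ l , ε)
    split₁ {a} (ne , sa) (_◅_ {j = j} e es) with ⊓-adj {D = D₁ ⊔ D₂} {L} {a} {j} e
    ... | d , al with ∨-true {D₁ a j} d
    ...   | inj₂ d2 = ⊥-elim (true≢false sa (d₂ ne d2))
    ...   | inj₁ d1 with loc₁-adj d1
    ...     | inj₁ refl with splitz es
    ...       | inj₁ (lb , c) = inj₁ (lb , ∧-intro d1 al ◅ c)
    ...       | inj₂ (lb , c) = inj₂ (∧-intro d1 al ◅ ε , lb , c)
    split₁ {a} (ne , sa) (e ◅ es) | d , al | inj₁ d1 | inj₂ l with split₁ l es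
    ... | inj₁ (lb , c) = inj₁ (lb , ∧-intro d1 al ◅ c)
    ... | inj₂ (c , lb , c′) = inj₂ (∧-intro d1 al ◅ c , lb , c′)
    split₂ l ε = inj₁ (inj₂ l , ε)
    split₂ {a} (ne , sa) (_◅_ {j = j} e es) with ⊓-adj {D = D₁ ⊔ D₂} {L} {a} {j} e
    ... | d , al with ∨-true {D₁ a j} d
    ...   | inj₁ d1 = ⊥-elim (true≢false (d₁ ne d1) sa)
    ...   | inj₂ d2 with loc₂-adj d2
    ...     | inj₁ refl with splitz es
    ...       | inj₂ (lb , c) = inj₁ (lb , ∧-intro d2 al ◅ c)
    ...       | inj₁ (lb , c) = inj₂ (∧-intro d2 al ◅ ε , lb , c)
    split₂ {a} (ne , sa) (e ◅ es) | d , al | inj₂ d2 | inj₂ l with split₂ l es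
    ... | inj₁ (lb , c) = inj₁ (lb , ∧-intro d2 al ◅ c)
    ... | inj₂ (c , lb , c′) = inj₂ (∧-intro d2 al ◅ c , lb , c′)
    splitz ε = inj₁ (inj₁ refl , ε)
    splitz (_◅_ {j = j} e es) with ⊓-adj {D = D₁ ⊔ D₂} {L} {z} {j} e
    ... | d , al with ∨-true {D₁ z j} d
    splitz (e ◅ es) | d , al | inj₁ d1 with loc₁-adj d1
    ...   | inj₁ refl = ⊥-elim (adj≢ {D₁} i₁ d1 refl)
    ...   | inj₂ l with split₁ l es
    ...     | inj₁ (lb , c) = inj₁ (lb , ∧-intro d1 al ◅ c)
    ...     | inj₂ (_ , lb , c) = inj₂ (lb , c)
    splitz (e ◅ es) | d , al | inj₂ d2 with loc₂-adj d2
    ...   | inj₁ refl = ⊥-elim (adj≢ {D₂} i₂ d2 refl)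
    ...   | inj₂ l with split₂ l es
    ...     | inj₁ (lb , c) = inj₂ (lb , ∧-intro d2 al ◅ c)
    ...     | inj₂ (_ , lb , c) = inj₁ (lb , c)

    in₁ : ∀ {b} → Loc₁ b → (A₁ ∪ A₂) b ≡ true → A₁ b ≡ true
    in₁ {b} l ab with ∨-true {A₁ b} ab
    ... | inj₁ x = x
    in₁ (inj₁ refl) ab | inj₂ x = z₁
    in₁ (inj₂ (ne , sb)) ab | inj₂ x = ⊥-elim (true≢false sb (a₂ ne x))

    in₂ : ∀ {b} → Loc₂ b → (A₁ ∪ A₂) b ≡ true → A₂ b ≡ true
    in₂ {b} l ab with ∨-true {A₁ b} ab
    ... | inj₂ x = x
    in₂ (inj₁ refl) ab | inj₁ x = z₂
    in₂ (inj₂ (ne , sb)) ab | inj₁ x = ⊥-elim (true≢false (a₁ ne x) sb)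

    locate : ∀ a → a ≡ z ⊎ (a ≢ z × side a ≡ true) ⊎ (a ≢ z × side a ≡ false)
    locate a with a ≟ z | bool-case (side a)
    ... | yes e | _ = inj₁ e
    ... | no ne | inj₁ s = inj₂ (inj₁ (ne , s))
    ... | no ne | inj₂ s = inj₂ (inj₂ (ne , s))

    exits₁ : Symm L → ∀ {s a} → Loc₁ s → A₁ a ≡ true → C₁ s a → ∃ λ a′ → (A₁ ∪ A₂) a′ ≡ true × Run σ L nothing s a′
    exits₁ sL l aa c with T₁.exits sL aa c
    ... | a′ , ia , r with a′ ≟ z
    ...   | no ne = a′ , ∨-introˡ ia , lift₁ (start₁ l) ne r
    ...   | yes refl with T₂.exits sL z₂ (ε {x = z})
    ...     | x , ix , r′ = x , ∨-introʳ {A₁ x} ix , pass (start₁ l) r (enter₂ r′)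

    exits′ : Symm L → ∀ {s a} → (A₁ ∪ A₂) a ≡ true → Conn ((D₁ ⊔ D₂) ⊓ L) s a → ∃ λ a′ → (A₁ ∪ A₂) a′ ≡ true × Run σ L nothing s a′
    exits₂ : Symm L → ∀ {s a} → s ≢ z × side s ≡ false → A₂ a ≡ true → C₂ s a → ∃ λ a′ → (A₁ ∪ A₂) a′ ≡ true × Run σ L nothing s a′
    exits₂ sL l aa c with T₂.exits sL aa c
    ... | x , ix , r = x , ∨-introʳ {A₁ x} ix , lift₂ (inj₂ l) r
    exits′ sL {s} {a} aa c with locate s
    ... | inj₁ refl = exits₁ sL (inj₁ refl) z₁ ε
    exits′ sL {s} {a} aa c | inj₂ (inj₁ l) with split₁ l c
    ... | inj₁ (lb , c′) = exits₁ sL (inj₂ l) (in₁ lb aa) c′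
    ... | inj₂ (c′ , _) = exits₁ sL (inj₂ l) z₁ c′
    exits′ sL {s} {a} aa c | inj₂ (inj₂ l) with split₂ l c
    ... | inj₁ (lb , c′) = exits₂ sL l (in₂ lb aa) c′
    ... | inj₂ (c′ , _) = exits₂ sL l z₂ c′

    round′ : Symm L → ∀ {a b} → (A₁ ∪ A₂) a ≡ true → (A₁ ∪ A₂) b ≡ true → Conn ((D₁ ⊔ D₂) ⊓ L) a b → Orb σ L a b
    round′ sL {a} {b} ia ib c with locate a
    round′ sL {a} {b} ia ib c | inj₁ refl with splitz c
    ... | inj₁ (lb , c′) = orb₁ sL (inj₁ refl) (T₁.round sL z₁ (in₁ lb ib) c′)
    ... | inj₂ (lb , c′) = orb₂ sL (inj₁ refl) (T₂.round sL z₂ (in₂ lb ib) c′)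
    round′ sL {a} {b} ia ib c | inj₂ (inj₁ l) with split₁ l c
    ... | inj₁ (lb , c′) = orb₁ sL (inj₂ l) (T₁.round sL (in₁ (inj₂ l) ia) (in₁ lb ib) c′)
    ... | inj₂ (c′ , lb , c″) = orb-trans (orb₁ sL (inj₂ l) (T₁.round sL (in₁ (inj₂ l) ia) z₁ c′))
                                          (orb₂ sL (inj₁ refl) (T₂.round sL z₂ (in₂ lb ib) c″))
    round′ sL {a} {b} ia ib c | inj₂ (inj₂ l) with split₂ l c
    ... | inj₁ (lb , c′) = orb₂ sL (inj₂ l) (T₂.round sL (in₂ (inj₂ l) ia) (in₂ lb ib) c′)
    ... | inj₂ (c′ , lb , c″) = orb-trans (orb₂ sL (inj₂ l) (T₂.round sL (in₂ (inj₂ l) ia) z₂ c′))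
                                          (orb₁ sL (inj₁ refl) (T₁.round sL z₁ (in₁ lb ib) c″))

  orElse : ∀ {D : Rel n} {al : VSet n} {v w} (x y : Maybe (Fin n)) → (x ≡ just w → Adj D v w × al w ≡ true) →
           (y ≡ just w → Adj D v w × al w ≡ true) → (x Maybe.<∣> y) ≡ just w → Adj D v w × al w ≡ true
  orElse (just x) y f g e = f e
  orElse nothing y f g e = g e

  val₁ : ∀ {v p al w} → T₁.σ v p al ≡ just w → Adj (D₁ ⊔ D₂) v w × al w ≡ true
  val₁ {v} {p} {al} {w} e = let (d , l) = T₁.valid {v} {p} e in ∨-introˡ d , l
  val₂ : ∀ {v p al w} → T₂.σ v p al ≡ just w → Adj (D₁ ⊔ D₂) v w × al w ≡ true
  val₂ {v} {p} {al} {w} e = let (d , l) = T₂.valid {v} {p} e in ∨-introʳ {D₁ v w} d , l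

  valid′ : Valid (D₁ ⊔ D₂) σ
  valid′ {v} {p} {al} e with v ≟ z
  valid′ {v} {nothing} {al} e | yes refl = orElse {D₁ ⊔ D₂} {al} {z} (T₁.σ z nothing al) _ (val₁ {z}) (val₂ {z}) e
  valid′ {v} {just q} {al} e | yes refl with side q
  ... | true = orElse {D₁ ⊔ D₂} {al} {z} (T₁.σ z (just q) al) _ (val₁ {z}) (val₂ {z}) e
  ... | false = val₂ {z} e
  valid′ {v} {p} {al} e | no _ with side v
  ... | true = val₁ {v} e
  ... | false = val₂ {v} e

  tour : Tour (D₁ ⊔ D₂) (A₁ ∪ A₂)
  tour = record { σ = σ ; valid = λ {v} → valid′ {v} ; exits = exits′ ; round = round′ }

-- Adding a link between the two terminals of a piece

⁅_∣_⁆ : ∀ {n} → Fin n → Fin n → VSet n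
⁅ v ∣ x ⁆ u = does (u ≟ v) ∨ does (u ≟ x)

pair-inv : ∀ {n} {v x u : Fin n} → ⁅ v ∣ x ⁆ u ≡ true → u ≡ v ⊎ u ≡ x
pair-inv {v = v} {x} {u} e with ∨-true {does (u ≟ v)} e
... | inj₁ p = inj₁ (does-yes (u ≟ v) p)
... | inj₂ p = inj₂ (does-yes (u ≟ x) p)

pairˡ : ∀ {n} (v x : Fin n) → ⁅ v ∣ x ⁆ v ≡ true
pairˡ v x = ∨-introˡ (does-true (v ≟ v) refl)

pairʳ : ∀ {n} (v x : Fin n) → ⁅ v ∣ x ⁆ x ≡ true
pairʳ v x = ∨-introʳ {does (x ≟ v)} (does-true (x ≟ x) refl)

edge : ∀ {n} → Fin n → Fin n → Rel n
edge v x a b = (does (a ≟ v) ∧ does (b ≟ x)) ∨ (does (a ≟ x) ∧ does (b ≟ v))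

edge-inv : ∀ {n} {v x a b : Fin n} → Adj (edge v x) a b → (a ≡ v × b ≡ x) ⊎ (a ≡ x × b ≡ v)
edge-inv {v = v} {x} {a} {b} e with ∨-true {does (a ≟ v) ∧ does (b ≟ x)} e
... | inj₁ p = let (p₁ , p₂) = ∧-true {does (a ≟ v)} p in inj₁ (does-yes (a ≟ v) p₁ , does-yes (b ≟ x) p₂)
... | inj₂ p = let (p₁ , p₂) = ∧-true {does (a ≟ x)} p in inj₂ (does-yes (a ≟ x) p₁ , does-yes (b ≟ v) p₂)

edge-adj : ∀ {n} {v x : Fin n} → Adj (edge v x) v x
edge-adj {v = v} {x} = ∨-introˡ (∧-intro (does-true (v ≟ v) refl) (does-true (x ≟ x) refl))

edge-symm : ∀ {n} {v x : Fin n} → Symm (edge v x)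
edge-symm {v = v} {x} a b = trans (Bool.∨-comm (does (a ≟ v) ∧ does (b ≟ x)) _)
  (cong₂ _∨_ (Bool.∧-comm (does (a ≟ x)) _) (Bool.∧-comm (does (a ≟ v)) _))

-- When the link between v and x is alive it is the only one used to cross the piece.
module AddEdge {n} {D : Rel n} (sD : Symm D) (v x : Fin n) (v≢x : v ≢ x) (v≁x : D v x ≡ false)
               (T : Tour D ⁅ v ∣ x ⁆) where
  private module T = Tour T

  -- A start uses the link and an arrival over it is an exit; packets already inside the piece
  -- ignore it. The in-port `y` identifies the link because `v` and `x` are not adjacent in `D`.
  across : Fin n → Maybe (Fin n) → VSet n → Maybe (Fin n) → Maybe (Fin n)
  across y p al d with al y
  ... | false = d
  across y nothing al d | true = just y
  across y (just q) al d | true = if does (q ≟ y) then nothing else d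

  σ : Pattern n
  σ u p al with u ≟ v | u ≟ x
  ... | yes _ | _ = across x p al (T.σ u p al)
  ... | no _ | yes _ = across v p al (T.σ u p al)
  ... | no _ | no _ = T.σ u p al

  Other : Fin n → Fin n → Set
  Other u y = (u ≡ v × y ≡ x) ⊎ (u ≡ x × y ≡ v)

  other-adj : ∀ {u y} → Other u y → Adj (edge v x) u y
  other-adj (inj₁ (refl , refl)) = edge-adj {v = v} {x}
  other-adj (inj₂ (refl , refl)) = flip-adj (edge-symm {v = v} {x}) {v} {x} (edge-adj {v = v} {x})

  σ-end : ∀ u y p al → Other u y → σ u p al ≡ across y p al (T.σ u p al)
  σ-end u y p al (inj₁ (refl , refl)) with u ≟ u
  ... | yes _ = refl
  ... | no ne = ⊥-elim (ne refl)
  σ-end u y p al (inj₂ (refl , refl)) with u ≟ v | u ≟ u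
  ... | yes e | _ = ⊥-elim (v≢x (sym e))
  ... | no _ | yes _ = refl
  ... | no _ | no ne = ⊥-elim (ne refl)

  σ-mid : ∀ {u p al} → u ≢ v → u ≢ x → σ u p al ≡ T.σ u p al
  σ-mid {u} a b with u ≟ v | u ≟ x
  ... | yes e | _ = ⊥-elim (a e)
  ... | no _ | yes e = ⊥-elim (b e)
  ... | no _ | no _ = refl

  which : ∀ u → (∃ λ y → Other u y) ⊎ (u ≢ v × u ≢ x)
  which u with u ≟ v | u ≟ x
  ... | yes e | _ = inj₁ (x , inj₁ (e , refl))
  ... | no _ | yes e = inj₁ (v , inj₂ (e , refl))
  ... | no a | no b = inj₂ (a , b)

  across-valid : ∀ {u y p al d w} → Other u y → (d ≡ just w → Adj D u w × al w ≡ true) → across y p al d ≡ just w →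
                 Adj (D ⊔ edge v x) u w × al w ≡ true
  across-valid {u} {y} {p} {al} o f e with al y in eq
  across-valid {u} {y} {p} {al} {w = w} o f e | false = let (a , b) = f e in ∨-introˡ a , b
  across-valid {u} {y} {nothing} o f refl | true = ∨-introʳ {D u y} (other-adj o) , eq
  across-valid {u} {y} {just q} o f e | true with q ≟ y
  ... | no _ = let (a , b) = f e in ∨-introˡ a , b

  valid′ : Valid (D ⊔ edge v x) σ
  valid′ {u} {p} {al} e with which u
  ... | inj₁ (y , o) = across-valid {u} {y} {p} {al} o (T.valid {u} {p} {al}) (trans (sym (σ-end u y p al o)) e)
  ... | inj₂ (a , b) = let (c , d) = T.valid {u} (trans (sym (σ-mid {p = p} {al} a b)) e) in ∨-introˡ c , d

  not-adj : ∀ {u y} → Other u y → ¬ Adj D y u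
  not-adj (inj₁ (refl , refl)) e = true≢false (flip-adj sD e) v≁x
  not-adj (inj₂ (refl , refl)) e = true≢false e v≁x

  module _ {L : Rel n} (sL : Symm L) where
    across-dead : ∀ y p al d → al y ≡ false → across y p al d ≡ d
    across-dead y p al d e with al y
    across-dead y p al d refl | false = refl

    across-alive : ∀ y q al d → al y ≡ true → q ≢ y → across y (just q) al d ≡ d
    across-alive y q al d e ne with al y
    across-alive y q al d refl ne | true with q ≟ y
    ... | yes e = ⊥-elim (ne e)
    ... | no _ = refl

    across-start : ∀ y al d → al y ≡ true → across y nothing al d ≡ just y
    across-start y al d e with al y
    across-start y al d refl | true = refl

    across-back : ∀ y al d → al y ≡ true → across y (just y) al d ≡ nothing
    across-back y al d e with al y
    across-back y al d refl | true with y ≟ y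
    ... | yes _ = refl
    ... | no ne = ⊥-elim (ne refl)

    other-flip : ∀ {u y} → Other u y → Other y u
    other-flip (inj₁ (a , b)) = inj₂ (b , a)
    other-flip (inj₂ (a , b)) = inj₁ (b , a)

    alive-flip : ∀ {u y} → Other u y → L v x ≡ true → L u y ≡ true
    alive-flip (inj₁ (refl , refl)) e = e
    alive-flip (inj₂ (refl , refl)) e = flip-adj sL e

    dead-flip : ∀ {u y} → Other u y → L v x ≡ false → L u y ≡ false
    dead-flip (inj₁ (refl , refl)) e = e
    dead-flip (inj₂ (refl , refl)) e = trans (sL x v) e

    σ-same : ∀ {u p} → L v x ≡ false ⊎ (∃ λ q → p ≡ just q × Adj D q u) ⊎ (u ≢ v × u ≢ x) → σ u p (L u) ≡ T.σ u p (L u)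
    σ-same {u} {p} h with which u
    ... | inj₂ (a , b) = σ-mid a b
    σ-same {u} {p} (inj₁ e) | inj₁ (y , o) = trans (σ-end u y p (L u) o) (across-dead y p (L u) _ (dead-flip o e))
    σ-same {u} {p} (inj₂ (inj₂ (a , b))) | inj₁ (y , inj₁ (e , _)) = ⊥-elim (a e)
    σ-same {u} {p} (inj₂ (inj₂ (a , b))) | inj₁ (y , inj₂ (e , _)) = ⊥-elim (b e)
    σ-same {u} (inj₂ (inj₁ (q , refl , a))) | inj₁ (y , o) with bool-case (L u y)
    ... | inj₂ e = trans (σ-end u y (just q) (L u) o) (across-dead y (just q) (L u) _ e)
    ... | inj₁ e = trans (σ-end u y (just q) (L u) o) (across-alive y q (L u) _ e λ { refl → not-adj o a })

    lift : ∀ {p u a} → L v x ≡ false ⊎ (∃ λ q → p ≡ just q × Adj D q u) ⊎ (u ≢ v × u ≢ x) → Run T.σ L p u a → Run σ L p u a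
    lift h (exit e) = exit (trans (σ-same h) e)
    lift {u = u} h (go e r) = go (trans (σ-same h) e) (lift (inj₂ (inj₁ (u , refl , proj₁ (T.valid {u} e)))) r)

    cross : ∀ {u y} → Other u y → L v x ≡ true → Run σ L nothing u y
    cross {u} {y} o e = go (trans (σ-end u y nothing (L u) o) (across-start y (L u) _ (alive-flip o e)))
      (exit (trans (σ-end y u (just u) (L y) (other-flip o)) (across-back u (L y) _ (alive-flip (other-flip o) e))))

    in-pair : ∀ {u y} → Other u y → ⁅ v ∣ x ⁆ y ≡ true
    in-pair (inj₁ (refl , refl)) = pairʳ v x
    in-pair (inj₂ (refl , refl)) = pairˡ v x

    conn-dead : L v x ≡ false → ∀ {a b} → Conn ((D ⊔ edge v x) ⊓ L) a b → Conn (D ⊓ L) a b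
    conn-dead e = conn-mono λ {a} {b} ab → let (p , q) = ⊓-adj {D = D ⊔ edge v x} {L} {a} {b} ab in case ∨-true {D a b} p of λ where
      (inj₁ d) → ∧-intro d q
      (inj₂ d) → case edge-inv {v = v} {x} {a} {b} d of λ where
        (inj₁ (refl , refl)) → ⊥-elim (true≢false q e)
        (inj₂ (refl , refl)) → ⊥-elim (true≢false q (trans (sL x v) e))

    -- A walk that uses the added link stands at one of its ends just before, so some end is reached
    -- without it.
    end-hit : ∀ {s a} → ⁅ v ∣ x ⁆ a ≡ true → Conn ((D ⊔ edge v x) ⊓ L) s a → ∃ λ a′ → ⁅ v ∣ x ⁆ a′ ≡ true × Conn (D ⊓ L) s a′
    end-hit ia ε = _ , ia , ε
    end-hit {s} ia (_◅_ {j = j} e es) with ⊓-adj {D = D ⊔ edge v x} {L} {s} {j} e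
    ... | p , q with ∨-true {D s j} p
    ...   | inj₁ d = let (a′ , ia′ , c) = end-hit ia es in a′ , ia′ , ∧-intro d q ◅ c
    ...   | inj₂ d with edge-inv {v = v} {x} {s} {j} d
    ...     | inj₁ (refl , _) = v , pairˡ v x , ε
    ...     | inj₂ (refl , _) = x , pairʳ v x , ε

    exits′ : ∀ {s a} → ⁅ v ∣ x ⁆ a ≡ true → Conn ((D ⊔ edge v x) ⊓ L) s a → ∃ λ a′ → ⁅ v ∣ x ⁆ a′ ≡ true × Run σ L nothing s a′
    exits′ {s} ia c with end-hit ia c
    ... | a′ , ia′ , c′ with T.exits sL ia′ c′ | bool-case (L v x) | which s
    ...   | b , ib , r | inj₂ dead | _ = b , ib , lift (inj₁ dead) r
    ...   | b , ib , r | inj₁ al | inj₁ (y , o) = y , in-pair o , cross o al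
    ...   | b , ib , r | inj₁ al | inj₂ h = b , ib , lift (inj₂ (inj₂ h)) r

    lift-orb : L v x ≡ false → ∀ {a b} → Orb T.σ L a b → Orb σ L a b
    lift-orb d (one r) = one (lift (inj₁ d) r)
    lift-orb d (more r o) = more (lift (inj₁ d) r) (lift-orb d o)

    round′ : ∀ {a b} → ⁅ v ∣ x ⁆ a ≡ true → ⁅ v ∣ x ⁆ b ≡ true → Conn ((D ⊔ edge v x) ⊓ L) a b → Orb σ L a b
    round′ {a} {b} ia ib c with bool-case (L v x)
    ... | inj₂ dead = lift-orb dead (T.round sL ia ib (conn-dead dead c))
    ... | inj₁ al with pair-inv {v = v} {x} {a} ia | pair-inv {v = v} {x} {b} ib
    ...   | inj₁ refl | inj₁ refl = more (cross (inj₁ (refl , refl)) al) (one (cross (inj₂ (refl , refl)) al))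
    ...   | inj₁ refl | inj₂ refl = one (cross (inj₁ (refl , refl)) al)
    ...   | inj₂ refl | inj₁ refl = one (cross (inj₂ (refl , refl)) al)
    ...   | inj₂ refl | inj₂ refl = more (cross (inj₂ (refl , refl)) al) (one (cross (inj₁ (refl , refl)) al))

  tour : Tour (D ⊔ edge v x) ⁅ v ∣ x ⁆
  tour = record { σ = σ ; valid = λ {u} → valid′ {u} ; exits = exits′ ; round = round′ }

tour-resp : ∀ {n} {D D′ : Rel n} {A A′ : VSet n} → (∀ {u v} → Adj D u v → Adj D′ u v) → (∀ {u v} → Adj D′ u v → Adj D u v) →
            A ⊆ᵇ A′ → A′ ⊆ᵇ A → Tour D A → Tour D′ A′
tour-resp {D = D} {D′} f g h k T = record
  { σ = σ
  ; valid = λ {v} {p} e → let (a , b) = valid {v} {p} e in f a , b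
  ; exits = λ sL a c → let (x , ix , r) = exits sL (k a) (back c) in x , h ix , r
  ; round = λ sL a b c → round sL (k a) (k b) (back c) }
  where
  open Tour T
  back : ∀ {L a b} → Conn (D′ ⊓ L) a b → Conn (D ⊓ L) a b
  back {L} = conn-mono λ {a} {b} e → let (p , q) = ⊓-adj {D = D′} {L} {a} {b} e in ∧-intro (g p) q

data Hit {n} (σ : Pattern n) (L : Rel n) (t : Fin n) : Maybe (Fin n) → Fin n → Set where
  at : ∀ {p} → Hit σ L t p t
  go : ∀ {p v w} → σ v p (L v) ≡ just w → Hit σ L t (just v) w → Hit σ L t p v

record Resilient {n} (D : Rel n) (t : Fin n) : Set where
  field
    σ     : Pattern n
    valid : Valid D σ
    hits  : ∀ {L} → Symm L → ∀ {s} → Conn (D ⊓ L) s t → Hit σ L t nothing s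

-- Cyclic order and the walk around a drawing on a circle

Cyc : ℕ → ℕ → ℕ → Set
Cyc a b c = (a < b × b < c) ⊎ (b < c × c < a) ⊎ (c < a × a < b)

pattern C1 p q = inj₁ (p , q)
pattern C2 p q = inj₂ (inj₁ (p , q))
pattern C3 p q = inj₂ (inj₂ (p , q))

cyc-rot : ∀ {a b c} → Cyc a b c → Cyc b c a
cyc-rot (C1 p q) = C3 p q
cyc-rot (C2 p q) = C1 p q
cyc-rot (C3 p q) = C2 p q

cyc-trans : ∀ {a b c d} → Cyc a b c → Cyc a c d → Cyc a b d
cyc-trans (C1 p q) (C1 r s) = C1 p (ℕ.<-trans q s)
cyc-trans (C1 p q) (C2 r s) = ⊥-elim (ℕ.<-asym (ℕ.<-trans r s) (ℕ.<-trans p q))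
cyc-trans (C1 p q) (C3 r s) = C3 r p
cyc-trans (C2 p q) (C1 r s) = ⊥-elim (ℕ.<-asym q r)
cyc-trans (C2 p q) (C2 r s) = C2 (ℕ.<-trans p r) s
cyc-trans (C2 p q) (C3 r s) = ⊥-elim (ℕ.<-asym q s)
cyc-trans (C3 p q) (C1 r s) = ⊥-elim (ℕ.<-asym p r)
cyc-trans (C3 p q) (C2 r s) = C3 s q
cyc-trans (C3 p q) (C3 r s) = ⊥-elim (ℕ.<-asym p s)

cyc-asym : ∀ {a b c} → Cyc a b c → ¬ Cyc a c b
cyc-asym (C1 p q) (C1 r s) = ℕ.<-asym q s
cyc-asym (C1 p q) (C2 r s) = ℕ.<-asym q r
cyc-asym (C1 p q) (C3 r s) = ℕ.<-asym p r
cyc-asym (C2 p q) (C1 r s) = ℕ.<-asym p s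
cyc-asym (C2 p q) (C2 r s) = ℕ.<-asym p r
cyc-asym (C2 p q) (C3 r s) = ℕ.<-asym q s
cyc-asym (C3 p q) (C1 r s) = ℕ.<-asym p r
cyc-asym (C3 p q) (C2 r s) = ℕ.<-asym q s
cyc-asym (C3 p q) (C3 r s) = ℕ.<-asym q r

cyc-irr : ∀ {a b} → ¬ Cyc a b b
cyc-irr c = cyc-asym c c

cyc-irrˡ : ∀ {a b} → ¬ Cyc a a b
cyc-irrˡ c = cyc-irr (cyc-rot (cyc-rot c))

cyc-inner : ∀ {k a b c} → Cyc k a b → Cyc k b c → Cyc a b c
cyc-inner p q = cyc-rot (cyc-rot (cyc-trans (cyc-rot q) (cyc-rot (cyc-rot p))))

cyc-total : ∀ {a b c} → a ≢ b → b ≢ c → a ≢ c → Cyc a b c ⊎ Cyc a c b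
cyc-total {a} {b} {c} p q r with ℕ.<-cmp a b | ℕ.<-cmp b c | ℕ.<-cmp a c
... | tri≈ _ p′ _ | _ | _ = ⊥-elim (p p′)
... | _ | tri≈ _ q′ _ | _ = ⊥-elim (q q′)
... | _ | _ | tri≈ _ r′ _ = ⊥-elim (r r′)
... | tri< x _ _ | tri< y _ _ | _ = inj₁ (C1 x y)
... | tri< x _ _ | tri> _ _ y | tri< z _ _ = inj₂ (C1 z y)
... | tri< x _ _ | tri> _ _ y | tri> _ _ z = inj₁ (C3 z x)
... | tri> _ _ x | tri< y _ _ | tri< z _ _ = inj₂ (C3 x z)
... | tri> _ _ x | tri< y _ _ | tri> _ _ z = inj₁ (C2 y z)
... | tri> _ _ x | tri> _ _ y | _ = inj₂ (C2 y x)

cyc? : ∀ a b c → Dec (Cyc a b c)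
cyc? a b c = (a <? b ×-dec b <? c) ⊎-dec ((b <? c ×-dec c <? a) ⊎-dec (c <? a ×-dec a <? b))

module Minimum {n} (P : Fin n → Bool) (_≺_ : Fin n → Fin n → Set) (≺? : ∀ a b → Dec (a ≺ b))
               (≺-irr : ∀ {a} → ¬ a ≺ a) (≺-trans : ∀ {a b c} → a ≺ b → b ≺ c → a ≺ c) where
  best : List (Fin n) → Maybe (Fin n)
  best [] = nothing
  best (x ∷ xs) with P x | best xs
  ... | false | r = r
  ... | true | nothing = just x
  ... | true | just y with ≺? x y
  ...   | yes _ = just x
  ...   | no _ = just y

  best-none : ∀ xs → best xs ≡ nothing → ∀ {x} → x ∈ xs → P x ≡ false
  best-none (x ∷ xs) e m with P x in px | best xs in bx
  best-none (x ∷ xs) e (here refl) | false | r = px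
  best-none (x ∷ xs) refl (there m) | false | nothing = best-none xs bx m
  best-none (x ∷ xs) () m | true | nothing
  best-none (x ∷ xs) e m | true | just y with ≺? x y
  best-none (x ∷ xs) () m | true | just y | yes _
  best-none (x ∷ xs) () m | true | just y | no _

  best-some : ∀ xs {w} → best xs ≡ just w → P w ≡ true × (∀ {x} → x ∈ xs → P x ≡ true → ¬ x ≺ w)
  best-some (x ∷ xs) e with P x in px | best xs in bx
  best-some (x ∷ xs) refl | false | just w with best-some xs bx
  ... | pw , f = pw , λ { (here refl) p _ → true≢false p px ; (there m) p → f m p }
  best-some (x ∷ xs) refl | true | nothing =
    px , λ { (here refl) p → ≺-irr ; (there m) p _ → true≢false p (best-none xs bx m) }
  best-some (x ∷ xs) e | true | just y with ≺? x y | best-some xs bx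
  best-some (x ∷ xs) refl | true | just y | yes q | py , f =
    px , λ { (here refl) p → ≺-irr ; (there m) p r → f m p (≺-trans r q) }
  best-some (x ∷ xs) refl | true | just y | no q | py , f =
    py , λ { (here refl) p → q ; (there m) p → f m p }

  minimum : Maybe (Fin n)
  minimum = best (allFin n)

-- An outerplanar drawing reduced to the order of the nodes on the circle: straight links with four
-- distinct ends cross exactly when their ends alternate. Isolated nodes also receive a position of
-- their own.
record NonCrossing {n} (D : Rel n) : Set where
  field
    pos   : Fin n → ℕ
    bound : ℕ
    pos<  : ∀ v → pos v < bound
    inj   : ∀ {u v} → pos u ≡ pos v → u ≡ v
    nc    : ∀ {a b c d} → Adj D a c → Adj D b d → Cyc (pos a) (pos b) (pos c) → Cyc (pos a) (pos c) (pos d) → ⊥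

-- The walk takes the next alive neighbour in the cyclic order after the in-port and
-- leaves when it would pass its own position.  Leaving at k and starting again there,
-- it next leaves at a node y such that no alive link leaves the open arc from k to y.
module Circle {n} {D : Rel n} (sD : Symm D) (iD : Irr D) (N : NonCrossing D) where
  open NonCrossing N

  C : Fin n → Fin n → Fin n → Set
  C a b c = Cyc (pos a) (pos b) (pos c)

  c-total : ∀ {a b c} → a ≢ b → b ≢ c → a ≢ c → C a b c ⊎ C a c b
  c-total p q r = cyc-total (p ∘ inj) (q ∘ inj) (r ∘ inj)

  Between : Maybe (Fin n) → Fin n → Fin n → Set
  Between nothing v w = ⊤
  Between (just u) v w = C u w v

  between? : ∀ p v w → Dec (Between p v w)
  between? nothing v w = yes tt
  between? (just u) v w = cyc? (pos u) (pos w) (pos v)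

  origin : Maybe (Fin n) → Fin n → Fin n
  origin nothing v = v
  origin (just u) v = u

  module M (v : Fin n) (p : Maybe (Fin n)) (al : VSet n) =
    Minimum (λ w → D v w ∧ (al w ∧ does (between? p v w))) (λ a b → C (origin p v) a b)
            (λ a b → cyc? (pos (origin p v)) (pos a) (pos b)) cyc-irr cyc-trans

  σ : Pattern n
  σ v p al = M.minimum v p al

  σ-none : ∀ {v p al w} → σ v p al ≡ nothing → Adj D v w → al w ≡ true → ¬ Between p v w
  σ-none {v} {p} {al} {w} e d a b =
    true≢false (∧-intro d (∧-intro a (does-true (between? p v w) b))) (M.best-none v p al (allFin n) e (∈-allFin w))

  σ-some : ∀ {v p al w} → σ v p al ≡ just w → Adj D v w × al w ≡ true × Between p v w ×
    (∀ {w′} → Adj D v w′ → al w′ ≡ true → Between p v w′ → ¬ C (origin p v) w′ w)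
  σ-some {v} {p} {al} {w} e with M.best-some v p al (allFin n) e
  ... | pw , f with ∧-true {D v w} pw
  ...   | d , q with ∧-true {al w} q
  ...     | a , b = d , a , does-yes (between? p v w) b ,
              λ {w′} d′ a′ b′ → f (∈-allFin w′) (∧-intro d′ (∧-intro a′ (does-true (between? p v w′) b′)))

  valid : Valid D σ
  valid {v} {p} {al} e = let (d , a , _) = σ-some {v} {p} {al} e in d , a

  -- Unrolls the circle just after `k`: positions up to that of `k` are raised by `bound`, which
  -- turns cyclic order seen from `k` into order of numbers.
  key : Fin n → Fin n → ℕ
  key k v with pos k <? pos v
  ... | yes _ = pos v
  ... | no _ = pos v + bound

  key< : ∀ k {u v} → C k u v → key k u < key k v
  key< k {u} {v} c with pos k <? pos u | pos k <? pos v
  key< k (C1 p q) | yes _ | yes _ = q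
  key< k (C2 p q) | yes a | _ = ⊥-elim (ℕ.<-asym (ℕ.<-trans p q) a)
  key< k (C3 p q) | yes _ | yes b = ⊥-elim (ℕ.<-asym p b)
  key< k {u} {v} c | yes _ | no _ = ℕ.<-≤-trans (pos< u) (ℕ.m≤n+m bound (pos v))
  key< k (C1 p q) | no a | _ = ⊥-elim (a p)
  key< k (C3 p q) | no a | _ = ⊥-elim (a q)
  key< k (C2 p q) | no _ | yes b = ⊥-elim (ℕ.<-asym q b)
  key< k (C2 p q) | no _ | no _ = ℕ.+-monoˡ-< bound p

  key-bound : ∀ k v → key k v < bound + bound
  key-bound k v with pos k <? pos v
  ... | yes _ = ℕ.<-≤-trans (pos< v) (ℕ.m≤m+n bound bound)
  ... | no _ = ℕ.+-monoˡ-< bound (pos< v)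

  module _ {L : Rel n} (sL : Symm L) where
    E : Fin n → Fin n → Set
    E u v = Adj (D ⊓ L) u v

    E-sym : ∀ {u v} → E u v → E v u
    E-sym = flip-adj (⊓-symm sD sL)

    E-D : ∀ {u v} → E u v → Adj D u v
    E-D {u} {v} e = proj₁ (⊓-adj {D = D} {L} {u} {v} e)

    E-L : ∀ {u v} → E u v → L u v ≡ true
    E-L {u} {v} e = proj₂ (⊓-adj {D = D} {L} {u} {v} e)

    E-irr : ∀ {u v} → E u v → u ≢ v
    E-irr e refl = true≢false (E-D e) (iD _)

    noncross : ∀ {a b c d} → E a c → E b d → C a b c → C a c d → ⊥
    noncross e f = nc (E-D e) (E-D f)

    module _ (k : Fin n) where
      Inside : Fin n → Set
      Inside y = ∀ {z z′} → C k z y → E z z′ → z′ ≡ y ⊎ C k z′ y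

      Closed : Fin n → Set
      Closed y = ∀ {z z′} → C k z y → E z z′ → C k z′ y

      -- Invariant of a run begun at `k`, on arrival at `y` from `q`. Alive links from the open arc
      -- between `k` and `y` end in the arc or at `y`; the in-port is `k` or lies past `y`; and the
      -- links of `y` still to be tried lead into the arc. Hence every step moves back towards `k`.
      record Sweep (q y : Fin n) : Set where
        field
          inside : Inside y
          after  : q ≡ k ⊎ C k y q
          ports  : ∀ {w} → E y w → C q w y → C k w y

      module _ {q y} (S : Sweep q y) where
        open Sweep S
        from-k : ∀ {w} → C k w y → C q w y
        from-k c with after
        ... | inj₁ refl = c
        ... | inj₂ a = cyc-rot (cyc-rot (cyc-inner c a))

        from-k₂ : ∀ {w′ w} → C k w′ w → C k w y → C q w′ w
        from-k₂ c d with after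
        ... | inj₁ refl = c
        ... | inj₂ a = cyc-rot (cyc-rot (cyc-inner c (cyc-trans d a)))

        closed : σ y (just q) (L y) ≡ nothing → Closed y
        closed e {z} {z′} c f with inside c f
        ... | inj₂ d = d
        ... | inj₁ refl = ⊥-elim (σ-none {y} {just q} e (E-D (E-sym f)) (E-L (E-sym f)) (from-k c))

        -- A link from the shortened arc to beyond `w` would cross the link from `y` to `w`, and a
        -- link from it to `y` would have been chosen before `w`.
        advance : ∀ {w} → σ y (just q) (L y) ≡ just w → C k w y × Sweep y w
        advance {w} e with σ-some {y} {just q} e
        ... | d , a , b , mn = kwy , record { inside = ins ; after = inj₂ kwy ; ports = prt }
          where
          yw : E y w
          yw = ∧-intro d a
          kwy : C k w y
          kwy = ports yw b
          ins : Inside w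
          ins {z} {z′} c f with inside (cyc-trans c kwy) f
          ... | inj₁ refl = ⊥-elim (mn (E-D (E-sym f)) (E-L (E-sym f)) (from-k (cyc-trans c kwy)) (from-k₂ c kwy))
          ... | inj₂ g with z′ ≟ w
          ...   | yes p = inj₁ p
          ...   | no z′≢w with c-total {k} {z′} {w} (λ { refl → cyc-irrˡ g }) z′≢w (λ { refl → cyc-irrˡ kwy })
          ...     | inj₁ h = inj₂ h
          ...     | inj₂ h = ⊥-elim (noncross f (E-sym yw) (cyc-inner c h) (cyc-inner (cyc-trans c h) g))
          prt : ∀ {w′} → E w w′ → C y w′ w → C k w′ w
          prt {w′} f c with inside kwy f
          ... | inj₁ refl = ⊥-elim (cyc-irrˡ c)
          ... | inj₂ g with c-total {k} {w′} {w} (λ { refl → cyc-irrˡ g }) (E-irr (E-sym f)) (λ { refl → cyc-irrˡ kwy })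
          ...   | inj₁ h = h
          ...   | inj₂ h = ⊥-elim (cyc-asym (cyc-rot (cyc-rot (cyc-inner h g))) c)

      reach-corner : ∀ {q y} m → key k y < m → y ≢ k → Sweep q y → ∃ λ z → Run σ L (just q) y z × z ≢ k × Closed z
      reach-corner {q} {y} (suc m) lt ne S with σ y (just q) (L y) in eq
      ... | nothing = y , exit eq , ne , closed S eq
      ... | just w with advance S eq
      ...   | c , S′ with reach-corner m (ℕ.<-≤-trans (key< k c) (ℕ.≤-pred lt)) (λ { refl → cyc-irrˡ c }) S′
      ...     | z , r , z≢ , cl = z , go eq r , z≢ , cl

      next-corner : (Run σ L nothing k k × (∀ {w} → ¬ E k w)) ⊎ (∃ λ z → Run σ L nothing k z × z ≢ k × Closed z)
      next-corner with σ k nothing (L k) in eq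
      ... | nothing = inj₁ (exit eq , λ e → σ-none {k} {nothing} eq (E-D e) (E-L e) tt)
      ... | just w with σ-some {k} {nothing} eq
      ...   | d , a , _ , mn with reach-corner (bound + bound) (key-bound k w) (E-irr (E-sym (∧-intro d a)))
                 (record { inside = ins ; after = inj₁ refl ; ports = λ _ c → c })
        where
        kw : E k w
        kw = ∧-intro d a
        ins : Inside w
        ins {z} {z′} c f with z′ ≟ w
        ... | yes p = inj₁ p
        ... | no z′≢w with k ≟ z′
        ...   | yes refl = ⊥-elim (mn (E-D (E-sym f)) (E-L (E-sym f)) tt c)
        ...   | no k≢ with c-total {k} {z′} {w} k≢ z′≢w (E-irr kw)
        ...     | inj₁ h = inj₂ h
        ...     | inj₂ h = ⊥-elim (noncross kw f c h)
      ...     | z , r , z≢ , cl = inj₂ (z , go eq r , z≢ , cl)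

    stays : ∀ {k y b c} → Closed k y → C k b y → Conn (D ⊓ L) b c → C k c y
    stays cl i ε = i
    stays cl i (e ◅ es) = stays cl (cl i e) es

    -- The arc from `y` to the next exit `z` is closed under alive links. Were `b` inside it, `y`
    -- could not be connected to `b`. So an exit never jumps over the target, and its key seen from
    -- `b` grows until `b` is met.
    to-target : ∀ {y b} m → (bound + bound) ∸ key b y < m → y ≢ b → Conn (D ⊓ L) y b → Orb σ L y b
    to-target {y} {b} (suc m) lt ne c with next-corner y
    to-target (suc m) lt ne ε | inj₁ (_ , iso) = ⊥-elim (ne refl)
    to-target (suc m) lt ne (e ◅ _) | inj₁ (_ , iso) = ⊥-elim (iso e)
    to-target {y} {b} (suc m) lt ne c | inj₂ (z , r , z≢ , cl) with z ≟ b
    ... | yes refl = one r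
    ... | no z≢b with c-total {b} {y} {z} (ne ∘ sym) (z≢ ∘ sym) (z≢b ∘ sym)
    ...   | inj₂ h = ⊥-elim (cyc-irrˡ (stays cl (cyc-rot (cyc-rot h)) (conn-sym (⊓-symm sD sL) c)))
    ...   | inj₁ h = more r (to-target m
              (ℕ.<-≤-trans (ℕ.∸-monoʳ-< (key< b h) (ℕ.<⇒≤ (key-bound b z))) (ℕ.≤-pred lt))
              z≢b (conn-sym (⊓-symm sD sL) (run-conn {D = D} (λ {v} {p} {al} → valid {v} {p} {al}) r) ◅◅ c))

    round : ∀ {a b} → Conn (D ⊓ L) a b → Orb σ L a b
    round {a} {b} c with next-corner a
    round ε | inj₁ (r , iso) = one r
    round (e ◅ _) | inj₁ (r , iso) = ⊥-elim (iso e)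
    round {a} {b} c | inj₂ (z , r , z≢ , cl) with z ≟ b
    ... | yes refl = one r
    ... | no z≢b = more r (to-target _ (ℕ.n<1+n _) z≢b (conn-sym (⊓-symm sD sL) (run-conn {D = D} (λ {v} {p} {al} → valid {v} {p} {al}) r) ◅◅ c))

    exits : ∀ {s} → ∃ λ a → Run σ L nothing s a
    exits {s} with next-corner s
    ... | inj₁ (r , _) = s , r
    ... | inj₂ (z , r , _) = z , r

  -- All nodes count as terminals here; `tour-forget` later restricts the exits to the actual ones.
  tour : Tour D (λ _ → true)
  tour = record
    { σ = σ ; valid = λ {v} {p} {al} → valid {v} {p} {al}
    ; exits = λ sL _ _ → let (a , r) = exits sL in a , refl , r
    ; round = λ sL _ _ c → round sL c }

-- Weaker guarantees and pieces that share two nodes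

run-hit : ∀ {n} {σ : Pattern n} {L : Rel n} {p s x} → Run σ L p s x → Hit σ L x p s
run-hit (exit _) = at
run-hit (go e r) = go e (run-hit r)

-- Meets s y: starting at s and re-entering after every exit, y is visited.
data Meets {n} (σ : Pattern n) (L : Rel n) (y : Fin n) : Fin n → Set where
  now   : ∀ {s} → Hit σ L y nothing s → Meets σ L y s
  later : ∀ {s c} → Run σ L nothing s c → Meets σ L y c → Meets σ L y s

-- Passing a node of `N` is enough, because this guarantee is used only where standing at a terminal
-- with an alive link to the root already means delivery.
record Roam {n} (D : Rel n) (N : VSet n) : Set where
  field
    σ     : Pattern n
    valid : Valid D σ
    meets : ∀ {L} → Symm L → ∀ {s y} → N y ≡ true → Conn (D ⊓ L) s y → Meets σ L y s

tour-roam : ∀ {n} {D : Rel n} {A : VSet n} → Symm D → Tour D A → Roam D A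
tour-roam {D = D} sD T = record
  { σ = σ ; valid = valid
  ; meets = λ sL iy c → let (a , ia , r) = exits sL iy c in
      later r (orb-meets (round sL ia iy (conn-sym (⊓-symm sD sL) (run-conn valid r) ◅◅ c))) }
  where
  open Tour T
  orb-meets : ∀ {L a b} → Orb σ L a b → Meets σ L b a
  orb-meets (one r) = now (run-hit r)
  orb-meets (more r o) = later r (orb-meets o)

-- Two pieces sharing the nodes a and b; leaving the first one at a shared node means
-- entering the second one there.
module TwoShared {n} {D₁ D₂ : Rel n} (s₁ : Symm D₁) (s₂ : Symm D₂) (a b : Fin n) (side : VSet n)
                 (side-a : side a ≡ true) (side-b : side b ≡ true)
                 (d₁ : ∀ {u v} → Adj D₁ u v → side u ≡ true)
                 (d₂ : ∀ {u v} → Adj D₂ u v → u ≢ a → u ≢ b → side u ≡ false)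
                 (dj : ∀ {u v} → Adj D₁ u v → D₂ u v ≡ false)
                 (σ₁ σ₂ : Pattern n) (v₁ : Valid D₁ σ₁) (v₂ : Valid D₂ σ₂) where
  Z : Fin n → Set
  Z v = v ≡ a ⊎ v ≡ b

  z? : ∀ v → Dec (Z v)
  z? v = (v ≟ a) ⊎-dec (v ≟ b)

  z-side : ∀ {v} → Z v → side v ≡ true
  z-side (inj₁ refl) = side-a
  z-side (inj₂ refl) = side-b

  -- The in-port may be the other shared node, which belongs to both pieces. So the link travelled,
  -- and not the side of the neighbour, tells where the packet comes from; this works because the
  -- link sets are disjoint.
  atZ : Fin n → Maybe (Fin n) → VSet n → Maybe (Fin n)
  atZ v nothing al = σ₁ v nothing al Maybe.<∣> σ₂ v nothing al
  atZ v (just q) al = if D₂ v q then σ₂ v (just q) al else (σ₁ v (just q) al Maybe.<∣> σ₂ v nothing al)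

  σ : Pattern n
  σ v p al with z? v
  ... | yes _ = atZ v p al
  ... | no _ = if side v then σ₁ v p al else σ₂ v p al

  ifb : ∀ {X : Set} {b : Bool} {x y : X} → b ≡ true → (if b then x else y) ≡ x
  ifb refl = refl
  ifb′ : ∀ {X : Set} {b : Bool} {x y : X} → b ≡ false → (if b then x else y) ≡ y
  ifb′ refl = refl

  σ-1 : ∀ {v p al} → ¬ Z v → side v ≡ true → σ v p al ≡ σ₁ v p al
  σ-1 {v} nz sv with z? v
  ... | yes z = ⊥-elim (nz z)
  ... | no _ = ifb sv

  σ-2 : ∀ {v p al} → ¬ Z v → side v ≡ false → σ v p al ≡ σ₂ v p al
  σ-2 {v} nz sv with z? v
  ... | yes z = ⊥-elim (nz z)
  ... | no _ = ifb′ sv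

  σ-z : ∀ {v p al} → Z v → σ v p al ≡ atZ v p al
  σ-z {v} z with z? v
  ... | yes _ = refl
  ... | no nz = ⊥-elim (nz z)

  From₁ : Fin n → Maybe (Fin n) → Set
  From₁ v p = p ≡ nothing ⊎ ∃ λ q → p ≡ just q × D₂ v q ≡ false

  atZ-1 : ∀ {v p al} → From₁ v p → atZ v p al ≡ (σ₁ v p al Maybe.<∣> σ₂ v nothing al)
  atZ-1 (inj₁ refl) = refl
  atZ-1 (inj₂ (q , refl , sq)) = ifb′ sq

  State₁ State₂ : Maybe (Fin n) → Fin n → Set
  State₁ p v = (Z v × From₁ v p) ⊎ (¬ Z v × side v ≡ true)
  State₂ p v = (Z v × ∃ λ q → p ≡ just q × D₂ v q ≡ true) ⊎ (¬ Z v × side v ≡ false)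

  next₁ : ∀ {v w} → Adj D₁ v w → State₁ (just v) w
  next₁ {v} {w} e with z? w
  ... | yes z = inj₁ (z , inj₂ (v , refl , dj (flip-adj s₁ e)))
  ... | no nz = inj₂ (nz , d₁ (flip-adj s₁ e))

  next₂ : ∀ {v w} → Adj D₂ v w → State₂ (just v) w
  next₂ {v} {w} e with z? w
  ... | yes z = inj₁ (z , v , refl , flip-adj s₂ e)
  ... | no nz = inj₂ (nz , d₂ (flip-adj s₂ e) (nz ∘ inj₁) (nz ∘ inj₂))

  start₁ : ∀ {v} → side v ≡ true → State₁ nothing v
  start₁ {v} sv with z? v
  ... | yes z = inj₁ (z , inj₁ refl)
  ... | no nz = inj₂ (nz , sv)

  start₂ : ∀ {v} → side v ≡ false → State₂ nothing v
  start₂ {v} sv = inj₂ ((λ z → true≢false (z-side z) sv) , sv)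

  module _ {L : Rel n} where
    σ-state₁ : ∀ {p v w} → State₁ p v → σ₁ v p (L v) ≡ just w → σ v p (L v) ≡ just w
    σ-state₁ (inj₁ (z , f)) e = trans (σ-z z) (trans (atZ-1 f) (cong (Maybe._<∣> _) e))
    σ-state₁ (inj₂ (nz , sv)) e = trans (σ-1 nz sv) e

    σ-state₂ : ∀ {p v} → State₂ p v → σ v p (L v) ≡ σ₂ v p (L v)
    σ-state₂ (inj₁ (z , q , refl , sq)) = trans (σ-z z) (ifb sq)
    σ-state₂ (inj₂ (nz , sv)) = σ-2 nz sv

    σ-pass : ∀ {p z} → Z z → State₁ p z → σ₁ z p (L z) ≡ nothing → σ z p (L z) ≡ σ₂ z nothing (L z)
    σ-pass zz (inj₁ (z , f)) e = trans (σ-z z) (trans (atZ-1 f) (cong (Maybe._<∣> _) e))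
    σ-pass zz (inj₂ (nz , _)) e = ⊥-elim (nz zz)

    hit₁ : ∀ {p v y} → State₁ p v → Hit σ₁ L y p v → Hit σ L y p v
    hit₁ s at = at
    hit₁ {v = v} s (go e h) = go (σ-state₁ s e) (hit₁ (next₁ (proj₁ (v₁ {v} e))) h)

    hit₂ : ∀ {p v y} → State₂ p v → Hit σ₂ L y p v → Hit σ L y p v
    hit₂ s at = at
    hit₂ {v = v} s (go e h) = go (trans (σ-state₂ s) e) (hit₂ (next₂ (proj₁ (v₂ {v} e))) h)

    run₂ : ∀ {p v x} → State₂ p v → Run σ₂ L p v x → Run σ L p v x
    run₂ s (exit e) = exit (trans (σ-state₂ s) e)
    run₂ {v = v} s (go e r) = go (trans (σ-state₂ s) e) (run₂ (next₂ (proj₁ (v₂ {v} e))) r)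

    pass-run : ∀ {p v z x} → Z z → State₁ p v → Run σ₁ L p v z → Run σ₂ L nothing z x → Run σ L p v x
    pass-run zz s (exit e) (exit e′) = exit (trans (σ-pass zz s e) e′)
    pass-run {v = v} zz s (exit e) (go e′ r) = go (trans (σ-pass zz s e) e′) (run₂ (next₂ (proj₁ (v₂ {v} e′))) r)
    pass-run {v = v} zz s (go e r) r′ = go (σ-state₁ s e) (pass-run zz (next₁ (proj₁ (v₁ {v} e))) r r′)

    pass-hit : ∀ {p v z y} → Z z → State₁ p v → Run σ₁ L p v z → Hit σ₂ L y nothing z → Hit σ L y p v
    pass-hit zz s (exit e) at = at
    pass-hit {v = v} zz s (exit e) (go e′ h) = go (trans (σ-pass zz s e) e′) (hit₂ (next₂ (proj₁ (v₂ {v} e′))) h)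
    pass-hit {v = v} zz s (go e r) h = go (σ-state₁ s e) (pass-hit zz (next₁ (proj₁ (v₁ {v} e))) r h)

  valid : Valid (D₁ ⊔ D₂) σ
  valid {v} {p} {al} e with z? v
  valid {v} {nothing} {al} e | yes _ = orElse (σ₁ v nothing al) _ w₁ w₂ e
    where
    orElse : ∀ {w} (x y : Maybe (Fin n)) → (∀ {w} → x ≡ just w → Adj (D₁ ⊔ D₂) v w × al w ≡ true) →
             (∀ {w} → y ≡ just w → Adj (D₁ ⊔ D₂) v w × al w ≡ true) → (x Maybe.<∣> y) ≡ just w → Adj (D₁ ⊔ D₂) v w × al w ≡ true
    orElse (just x) y f g e = f e
    orElse nothing y f g e = g e
    w₁ : ∀ {w} → σ₁ v nothing al ≡ just w → Adj (D₁ ⊔ D₂) v w × al w ≡ true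
    w₁ e = let (d , l) = v₁ {v} {nothing} e in ∨-introˡ d , l
    w₂ : ∀ {w} → σ₂ v nothing al ≡ just w → Adj (D₁ ⊔ D₂) v w × al w ≡ true
    w₂ {w} e = let (d , l) = v₂ {v} {nothing} e in ∨-introʳ {D₁ v w} d , l
  valid {v} {just q} {al} {w} e | yes _ with D₂ v q | σ₁ v (just q) al in eq
  ... | false | just x = let (d , l) = v₁ {v} {just q} (trans eq e) in ∨-introˡ d , l
  ... | false | nothing = let (d , l) = v₂ {v} {nothing} e in ∨-introʳ {D₁ v w} d , l
  ... | true | _ = let (d , l) = v₂ {v} {just q} e in ∨-introʳ {D₁ v w} d , l
  valid {v} {p} {al} {w} e | no _ with side v
  ... | true = let (d , l) = v₁ {v} {p} e in ∨-introˡ d , l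
  ... | false = let (d , l) = v₂ {v} {p} e in ∨-introʳ {D₁ v w} d , l

  module _ {L : Rel n} where
    C₁ C₂ : Fin n → Fin n → Set
    C₁ = Conn (D₁ ⊓ L)
    C₂ = Conn (D₂ ⊓ L)

    to-z₁ : ∀ {u y} → side u ≡ true → Conn ((D₁ ⊔ D₂) ⊓ L) u y →
            (C₁ u y × side y ≡ true) ⊎ (∃ λ z → Z z × C₁ u z × Conn ((D₁ ⊔ D₂) ⊓ L) z y)
    to-z₁ su ε = inj₁ (ε , su)
    to-z₁ {u} su (_◅_ {j = j} e es) with z? u
    ... | yes z = inj₂ (u , z , ε , e ◅ es)
    ... | no nz with ⊓-adj {D = D₁ ⊔ D₂} {L} {u} {j} e
    ...   | d , l with ∨-true {D₁ u j} d
    ...     | inj₂ d₂′ = ⊥-elim (true≢false su (d₂ d₂′ (nz ∘ inj₁) (nz ∘ inj₂)))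
    ...     | inj₁ d₁′ with to-z₁ (d₁ (flip-adj s₁ d₁′)) es
    ...       | inj₁ (c , sy) = inj₁ (∧-intro d₁′ l ◅ c , sy)
    ...       | inj₂ (z , zz , c , c′) = inj₂ (z , zz , ∧-intro d₁′ l ◅ c , c′)

    to-z₂ : ∀ {u y} → side u ≡ false → Conn ((D₁ ⊔ D₂) ⊓ L) u y →
            (C₂ u y × side y ≡ false) ⊎ (∃ λ z → Z z × C₂ u z × Conn ((D₁ ⊔ D₂) ⊓ L) z y)
    to-z₂ su ε = inj₁ (ε , su)
    to-z₂ {u} su (_◅_ {j = j} e es) with ⊓-adj {D = D₁ ⊔ D₂} {L} {u} {j} e
    ... | d , l with ∨-true {D₁ u j} d
    ...   | inj₁ d₁′ = ⊥-elim (true≢false (d₁ d₁′) su)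
    ...   | inj₂ d₂′ with z? j
    ...     | yes z = inj₂ (j , z , ∧-intro d₂′ l ◅ ε , es)
    ...     | no nz with to-z₂ (d₂ (flip-adj s₂ d₂′) (nz ∘ inj₁) (nz ∘ inj₂)) es
    ...       | inj₁ (c , sy) = inj₁ (∧-intro d₂′ l ◅ c , sy)
    ...       | inj₂ (z , zz , c , c′) = inj₂ (z , zz , ∧-intro d₂′ l ◅ c , c′)

  module _ {L : Rel n} (sL : Symm L) where
    private
      sym₁ : Symm (D₁ ⊓ L)
      sym₁ = ⊓-symm s₁ sL
      sym₂ : Symm (D₂ ⊓ L)
      sym₂ = ⊓-symm s₂ sL

    Joined : Set
    Joined = C₁ {L} a b ⊎ C₂ {L} a b

    joined₁ : ∀ {z u} → Z z → Z u → u ≢ z → C₁ {L} z u → Joined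
    joined₁ (inj₁ refl) (inj₁ refl) ne c = ⊥-elim (ne refl)
    joined₁ (inj₁ refl) (inj₂ refl) ne c = inj₁ c
    joined₁ (inj₂ refl) (inj₁ refl) ne c = inj₁ (conn-sym sym₁ c)
    joined₁ (inj₂ refl) (inj₂ refl) ne c = ⊥-elim (ne refl)

    joined₂ : ∀ {z u} → Z z → Z u → u ≢ z → C₂ {L} z u → Joined
    joined₂ (inj₁ refl) (inj₁ refl) ne c = ⊥-elim (ne refl)
    joined₂ (inj₁ refl) (inj₂ refl) ne c = inj₂ c
    joined₂ (inj₂ refl) (inj₁ refl) ne c = inj₂ (conn-sym sym₂ c)
    joined₂ (inj₂ refl) (inj₂ refl) ne c = ⊥-elim (ne refl)

    Reached : Fin n → Fin n → Set
    Reached z u = (C₁ {L} z u × side u ≡ true) ⊎ (C₂ {L} z u × side u ≡ false)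

    -- A walk from a shared node stays in one piece until it meets a shared node again. Meeting the
    -- other one joins `a` and `b` inside that piece; meeting the same one lets the bookkeeping
    -- start anew.
    track : ∀ {z u y} → Z z → Reached z u → Conn ((D₁ ⊔ D₂) ⊓ L) u y → Joined ⊎ Reached z y
    track zz h ε = inj₂ h
    track {z} {u} zz h (_◅_ {j = j} e es) with ⊓-adj {D = D₁ ⊔ D₂} {L} {u} {j} e
    ... | d , l with ∨-true {D₁ u j} d
    track zz (inj₁ (c , su)) (e ◅ es) | d , l | inj₁ d₁′ = track zz (inj₁ (c ◅◅ (∧-intro d₁′ l ◅ ε) , d₁ (flip-adj s₁ d₁′))) es
    track zz (inj₂ (c , su)) (e ◅ es) | d , l | inj₁ d₁′ = ⊥-elim (true≢false (d₁ d₁′) su)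
    track {z} {u} zz (inj₁ (c , su)) (_◅_ {j = j} e es) | d , l | inj₂ d₂′ with z? u | u ≟ z
    ... | no nu | _ = ⊥-elim (true≢false su (d₂ d₂′ (nu ∘ inj₁) (nu ∘ inj₂)))
    ... | yes zu | no ne = inj₁ (joined₁ zz zu ne c)
    ... | yes zu | yes refl with z? j | j ≟ z
    ...   | no nj | _ = track zz (inj₂ (∧-intro d₂′ l ◅ ε , d₂ (flip-adj s₂ d₂′) (nj ∘ inj₁) (nj ∘ inj₂))) es
    ...   | yes zj | no ne = inj₁ (joined₂ zz zj ne (∧-intro d₂′ l ◅ ε))
    ...   | yes zj | yes refl = track zz (inj₁ (ε , z-side zz)) es
    track {z} {u} zz (inj₂ (c , su)) (_◅_ {j = j} e es) | d , l | inj₂ d₂′ with z? j | j ≟ z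
    ... | no nj | _ = track zz (inj₂ (c ◅◅ (∧-intro d₂′ l ◅ ε) , d₂ (flip-adj s₂ d₂′) (nj ∘ inj₁) (nj ∘ inj₂))) es
    ... | yes zj | no ne = inj₁ (joined₂ zz zj ne (c ◅◅ (∧-intro d₂′ l ◅ ε)))
    ... | yes zj | yes refl = track zz (inj₁ (ε , z-side zz)) es

    join-inv : Conn ((D₁ ⊔ D₂) ⊓ L) a b → Joined
    join-inv c with track (inj₁ refl) (inj₁ (ε , side-a)) c
    ... | inj₁ j = j
    ... | inj₂ (inj₁ (c′ , _)) = inj₁ c′
    ... | inj₂ (inj₂ (_ , sb)) = ⊥-elim (true≢false side-b sb)

    join₁ : ∀ {u v} → C₁ {L} u v → Conn ((D₁ ⊔ D₂) ⊓ L) u v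
    join₁ = conn-mono λ {u} {v} e → let (d , l) = ⊓-adj {D = D₁} {L} {u} {v} e in ∧-intro (∨-introˡ d) l

    join₂ : ∀ {u v} → C₂ {L} u v → Conn ((D₁ ⊔ D₂) ⊓ L) u v
    join₂ = conn-mono λ {u} {v} e → let (d , l) = ⊓-adj {D = D₂} {L} {u} {v} e in ∧-intro (∨-introʳ {D₁ u v} d) l

-- Pieces between a and b that are used when a and b are the only possible exits:
-- each exploration from a reaches b or returns to a.
record Duo {n} (D : Rel n) (a b : Fin n) : Set where
  field
    σ     : Pattern n
    valid : Valid D σ
    enter : ∀ {L} → Symm L → ∀ {s z} → z ≡ a ⊎ z ≡ b → Conn (D ⊓ L) s z →
            (Hit σ L a nothing s × Hit σ L b nothing s) ⊎ (∃ λ x → (x ≡ a ⊎ x ≡ b) × Run σ L nothing s x)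
    to-b  : ∀ {L} → Symm L → Conn (D ⊓ L) a b → Hit σ L b nothing a
    to-a  : ∀ {L} → Symm L → Conn (D ⊓ L) a b → Hit σ L a nothing b
    back  : ∀ {L} → Symm L → ¬ Conn (D ⊓ L) a b → Run σ L nothing a a × Run σ L nothing b b

module TourPair {n} {D : Rel n} (sD : Symm D) {a b : Fin n} (a≢b : a ≢ b) (T : Tour D ⁅ a ∣ b ⁆) where
  open Tour T
  module _ {L : Rel n} (sL : Symm L) where
    stuck : ∀ {x y} → Run σ L nothing x x → Orb σ L x y → x ≡ y
    stuck r (one r′) = run-det r r′
    stuck r (more r′ o) with run-det r r′
    ... | refl = stuck r o

    -- The only alternative is an exit where the packet entered. Runs are determined by their start,
    -- so the orbit would then stay there forever, against `round`.
    swap : ∀ {x y} → (x ≡ a × y ≡ b) ⊎ (x ≡ b × y ≡ a) → Conn (D ⊓ L) x y → Run σ L nothing x y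
    swap (inj₁ (refl , refl)) c with exits sL (pairˡ a b) (ε {x = a})
    ... | x , ix , r with pair-inv {v = a} {b} {x} ix
    ...   | inj₂ refl = r
    ...   | inj₁ refl = ⊥-elim (a≢b (stuck r (round sL (pairˡ a b) (pairʳ a b) c)))
    swap (inj₂ (refl , refl)) c with exits sL (pairʳ a b) (ε {x = b})
    ... | x , ix , r with pair-inv {v = a} {b} {x} ix
    ...   | inj₁ refl = r
    ...   | inj₂ refl = ⊥-elim (a≢b (sym (stuck r (round sL (pairʳ a b) (pairˡ a b) c))))

    stay : ∀ {x} → x ≡ a ⊎ x ≡ b → ¬ Conn (D ⊓ L) a b → Run σ L nothing x x
    stay (inj₁ refl) nc with exits sL (pairˡ a b) (ε {x = a})
    ... | x , ix , r with pair-inv {v = a} {b} {x} ix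
    ...   | inj₁ refl = r
    ...   | inj₂ refl = ⊥-elim (nc (run-conn valid r))
    stay (inj₂ refl) nc with exits sL (pairʳ a b) (ε {x = b})
    ... | x , ix , r with pair-inv {v = a} {b} {x} ix
    ...   | inj₁ refl = ⊥-elim (nc (conn-sym (⊓-symm sD sL) (run-conn valid r)))
    ...   | inj₂ refl = r

  duo : Duo D a b
  duo = record
    { σ = σ ; valid = valid
    ; enter = λ sL {s} {z} zz c → let (x , ix , r) = exits sL {s} {z} (in-pair zz) c in inj₂ (x , pair-inv {v = a} {b} {x} ix , r)
    ; to-b = λ sL c → run-hit (swap sL (inj₁ (refl , refl)) c)
    ; to-a = λ sL c → run-hit (swap sL (inj₂ (refl , refl)) (conn-sym (⊓-symm sD sL) c))
    ; back = λ sL nc → stay sL (inj₁ refl) nc , stay sL (inj₂ refl) nc }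
    where
    in-pair : ∀ {z} → z ≡ a ⊎ z ≡ b → ⁅ a ∣ b ⁆ z ≡ true
    in-pair (inj₁ refl) = pairˡ a b
    in-pair (inj₂ refl) = pairʳ a b

duo-roam : ∀ {n} {D : Rel n} {a b} → Symm D → Duo D a b → Roam D ⁅ a ∣ b ⁆
duo-roam {D = D} {a} {b} sD Du = record
  { σ = σ ; valid = valid
  ; meets = λ sL {s} {y} iy c → go-on sL (pair-inv {v = a} {b} {y} iy) c (enter sL (pair-inv {v = a} {b} {y} iy) c) }
  where
  open Duo Du
  go-on : ∀ {L} → Symm L → ∀ {s y} → y ≡ a ⊎ y ≡ b → Conn (D ⊓ L) s y →
          (Hit σ L a nothing s × Hit σ L b nothing s) ⊎ (∃ λ x → (x ≡ a ⊎ x ≡ b) × Run σ L nothing s x) → Meets σ L y s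
  go-on sL (inj₁ refl) c (inj₁ (h , _)) = now h
  go-on sL (inj₂ refl) c (inj₁ (_ , h)) = now h
  go-on sL (inj₁ refl) c (inj₂ (_ , inj₁ refl , r)) = now (run-hit r)
  go-on sL (inj₂ refl) c (inj₂ (_ , inj₂ refl , r)) = now (run-hit r)
  go-on sL (inj₁ refl) c (inj₂ (_ , inj₂ refl , r)) =
    later r (now (to-a sL (conn-sym (⊓-symm sD sL) c ◅◅ run-conn valid r)))
  go-on sL (inj₂ refl) c (inj₂ (_ , inj₁ refl , r)) =
    later r (now (to-b sL (conn-sym (⊓-symm sD sL) (run-conn valid r) ◅◅ c)))

module Parallel {n} {D₁ D₂ : Rel n} (s₁ : Symm D₁) (s₂ : Symm D₂) (a b : Fin n) (side : VSet n)
                (side-a : side a ≡ true) (side-b : side b ≡ true)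
                (d₁ : ∀ {u v} → Adj D₁ u v → side u ≡ true)
                (d₂ : ∀ {u v} → Adj D₂ u v → u ≢ a → u ≢ b → side u ≡ false)
                (dj : ∀ {u v} → Adj D₁ u v → D₂ u v ≡ false)
                (W₁ : Duo D₁ a b) (W₂ : Duo D₂ a b) where
  private
    module W₁ = Duo W₁
    module W₂ = Duo W₂
  open TwoShared s₁ s₂ a b side side-a side-b d₁ d₂ dj W₁.σ W₂.σ W₁.valid W₂.valid

  module _ {L : Rel n} (sL : Symm L) where
    -- If the second piece joins `a` and `b`, the walk meets one end on leaving the first piece and
    -- the other inside the second, and nothing has to be known about where it goes next. This is
    -- why `Duo.enter` offers its first alternative.
    enter₁ : ∀ {s} → side s ≡ true → (Hit W₁.σ L a nothing s × Hit W₁.σ L b nothing s) ⊎ (∃ λ x → Z x × Run W₁.σ L nothing s x) →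
             (Hit σ L a nothing s × Hit σ L b nothing s) ⊎ (∃ λ x → Z x × Run σ L nothing s x)
    enter₁ ss (inj₁ (h , h′)) = inj₁ (hit₁ (start₁ ss) h , hit₁ (start₁ ss) h′)
    enter₁ ss (inj₂ (x , zx , r)) with conn? (D₂ ⊓ L) a b
    enter₁ ss (inj₂ (x , inj₁ refl , r)) | yes c = inj₁ (hit₁ (start₁ ss) (run-hit r) , pass-hit (inj₁ refl) (start₁ ss) r (W₂.to-b sL c))
    enter₁ ss (inj₂ (x , inj₂ refl , r)) | yes c = inj₁ (pass-hit (inj₂ refl) (start₁ ss) r (W₂.to-a sL c) , hit₁ (start₁ ss) (run-hit r))
    enter₁ ss (inj₂ (x , inj₁ refl , r)) | no nc = inj₂ (a , inj₁ refl , pass-run (inj₁ refl) (start₁ ss) r (proj₁ (W₂.back sL nc)))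
    enter₁ ss (inj₂ (x , inj₂ refl , r)) | no nc = inj₂ (b , inj₂ refl , pass-run (inj₂ refl) (start₁ ss) r (proj₂ (W₂.back sL nc)))

    enter₂ : ∀ {s} → side s ≡ false → (Hit W₂.σ L a nothing s × Hit W₂.σ L b nothing s) ⊎ (∃ λ x → Z x × Run W₂.σ L nothing s x) →
             (Hit σ L a nothing s × Hit σ L b nothing s) ⊎ (∃ λ x → Z x × Run σ L nothing s x)
    enter₂ ss (inj₁ (h , h′)) = inj₁ (hit₂ (start₂ ss) h , hit₂ (start₂ ss) h′)
    enter₂ ss (inj₂ (x , zx , r)) = inj₂ (x , zx , run₂ (start₂ ss) r)

    enter′ : ∀ {s z} → Z z → Conn ((D₁ ⊔ D₂) ⊓ L) s z → (Hit σ L a nothing s × Hit σ L b nothing s) ⊎ (∃ λ x → Z x × Run σ L nothing s x)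
    enter′ {s} zz c with bool-case (side s)
    ... | inj₁ ss with to-z₁ ss c
    ...   | inj₁ (c′ , _) = enter₁ ss (W₁.enter sL zz c′)
    ...   | inj₂ (z′ , zz′ , c′ , _) = enter₁ ss (W₁.enter sL zz′ c′)
    enter′ {s} zz c | inj₂ ss with to-z₂ ss c
    ...   | inj₁ (_ , sz) = ⊥-elim (true≢false (z-side zz) sz)
    ...   | inj₂ (z′ , zz′ , c′ , _) = enter₂ ss (W₂.enter sL zz′ c′)

    to-b′ : Conn ((D₁ ⊔ D₂) ⊓ L) a b → Hit σ L b nothing a
    to-b′ c with conn? (D₁ ⊓ L) a b
    ... | yes c₁ = hit₁ (start₁ side-a) (W₁.to-b sL c₁)
    ... | no n₁ with join-inv sL c
    ...   | inj₁ c₁ = ⊥-elim (n₁ c₁)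
    ...   | inj₂ c₂ = pass-hit (inj₁ refl) (start₁ side-a) (proj₁ (W₁.back sL n₁)) (W₂.to-b sL c₂)

    to-a′ : Conn ((D₁ ⊔ D₂) ⊓ L) a b → Hit σ L a nothing b
    to-a′ c with conn? (D₁ ⊓ L) a b
    ... | yes c₁ = hit₁ (start₁ side-b) (W₁.to-a sL c₁)
    ... | no n₁ with join-inv sL c
    ...   | inj₁ c₁ = ⊥-elim (n₁ c₁)
    ...   | inj₂ c₂ = pass-hit (inj₂ refl) (start₁ side-b) (proj₂ (W₁.back sL n₁)) (W₂.to-a sL c₂)

    back′ : ¬ Conn ((D₁ ⊔ D₂) ⊓ L) a b → Run σ L nothing a a × Run σ L nothing b b
    back′ nc = pass-run (inj₁ refl) (start₁ side-a) (proj₁ r₁) (proj₁ r₂) , pass-run (inj₂ refl) (start₁ side-b) (proj₂ r₁) (proj₂ r₂)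
      where
      r₁ = W₁.back sL (λ c → nc (join₁ sL c))
      r₂ = W₂.back sL (λ c → nc (join₂ sL c))

  duo : Duo (D₁ ⊔ D₂) a b
  duo = record { σ = σ ; valid = λ {v} → valid {v} ; enter = λ sL → enter′ sL ; to-b = λ sL → to-b′ sL ; to-a = λ sL → to-a′ sL ; back = λ sL → back′ sL }

module _ {n} {σ : Pattern n} {L : Rel n} where
  hit-port : ∀ {p q v y} → σ v p (L v) ≡ σ v q (L v) → Hit σ L y p v → Hit σ L y q v
  hit-port e at = at
  hit-port e (go x h) = go (trans (sym e) x) h

  -- The trace of a run that misses `y` is a walk avoiding `y`; hence a node that separates start
  -- and exit is always met.
  run-avoid : ∀ {D} → Valid D σ → ∀ y {p s x} → Run σ L p s x → Hit σ L y p s ⊎ (s ≢ y × Conn ((D ∖ y) ⊓ L) s x)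
  run-avoid val y {p} {s} r with s ≟ y
  ... | yes refl = inj₁ at
  run-avoid val y (exit e) | no ne = inj₂ (ne , ε)
  run-avoid {D} val y {p} {s} (go {w = w} e r) | no ne with run-avoid {D} val y r
  ... | inj₁ h = inj₁ (go e h)
  ... | inj₂ (wy , c) = let (d , l) = val {s} e in inj₂ (ne , ∧-intro (∖-adj {D = D} {y} d ne wy) l ◅ c)

module ForgetHit {n} (σ : Pattern n) (A′ : VSet n) where
  open Forget σ A′
  module _ {L : Rel n} where
    keep-hit : ∀ {p s y} → Run σ L p s y → Hit σ′ L y p s
    keep-hit (exit e) = at
    keep-hit (go e r) = go (σ′-just e) (keep-hit r)

    skip-hit : ∀ {p s c y} → A′ c ≡ false → Run σ L p s c → Hit σ′ L y nothing c → Hit σ′ L y p s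
    skip-hit nc (exit e) h = hit-port (σ′-restart nc e) h
    skip-hit nc (go e r) h = go (σ′-just e) (skip-hit nc r h)

-- A ring: every walk through the first piece between a and b visits all its terminals.
module Wheel {n} {D₁ D₂ : Rel n} (s₁ : Symm D₁) (s₂ : Symm D₂) (a b : Fin n) (a≢b : a ≢ b) (side : VSet n)
             (side-a : side a ≡ true) (side-b : side b ≡ true)
             (d₁ : ∀ {u v} → Adj D₁ u v → side u ≡ true)
             (d₂ : ∀ {u v} → Adj D₂ u v → u ≢ a → u ≢ b → side u ≡ false)
             (dj : ∀ {u v} → Adj D₁ u v → D₂ u v ≡ false)
             {A : VSet n} (A-a : A a ≡ true) (A-b : A b ≡ true) (A-side : ∀ {y} → A y ≡ true → side y ≡ true)
             (cut : ∀ {y} → A y ≡ true → y ≢ a → y ≢ b → ¬ Conn (D₁ ∖ y) a b)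
             (T₁ : Tour D₁ A) (T₂ : Tour D₂ ⁅ a ∣ b ⁆) where
  private
    module T₁ = Tour T₁
    module T₂ = Tour T₂
    module F = Forget T₁.σ ⁅ a ∣ b ⁆
    module FH = ForgetHit T₁.σ ⁅ a ∣ b ⁆

  sub : ⁅ a ∣ b ⁆ ⊆ᵇ A
  sub {v} iv with pair-inv {v = a} {b} {v} iv
  ... | inj₁ refl = A-a
  ... | inj₂ refl = A-b

  T₁′ : Tour D₁ ⁅ a ∣ b ⁆
  T₁′ = tour-forget s₁ (λ {v} → sub {v}) T₁

  σ₁ : Pattern n
  σ₁ = F.σ′
  v₁ : Valid D₁ σ₁
  v₁ {v} {p} {al} = F.valid′ {D = D₁} (λ {v} {p} {al} → T₁.valid {v} {p} {al}) {v} {p} {al}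

  module P₁ = TourPair s₁ a≢b T₁′
  module P₂ = TourPair s₂ a≢b T₂
  open TwoShared s₁ s₂ a b side side-a side-b d₁ d₂ dj σ₁ T₂.σ (λ {v} {p} {al} → v₁ {v} {p} {al}) T₂.valid

  in-pair : ∀ {z} → Z z → ⁅ a ∣ b ⁆ z ≡ true
  in-pair (inj₁ refl) = pairˡ a b
  in-pair (inj₂ refl) = pairʳ a b

  not-pair : ∀ {z} → ¬ Z z → ⁅ a ∣ b ⁆ z ≡ false
  not-pair {z} nz = ¬true λ e → nz (pair-inv {v = a} {b} {z} e)

  module _ {L : Rel n} (sL : Symm L) where
    private
      sym₁ : Symm (D₁ ⊓ L)
      sym₁ = ⊓-symm s₁ sL
      sym₂ : Symm (D₂ ⊓ L)
      sym₂ = ⊓-symm s₂ sL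
      sym₁₂ : Symm ((D₁ ⊔ D₂) ⊓ L)
      sym₁₂ = ⊓-symm (λ u v → cong₂ _∨_ (s₁ u v) (s₂ u v)) sL

    orb-visit : ∀ {x y} → Orb T₁.σ L x y → Hit σ₁ L y nothing x ⊎ (∃ λ z → Z z × Run σ₁ L nothing x z)
    orb-visit (one r) = inj₁ (FH.keep-hit r)
    orb-visit (more {c = c} r o) with z? c
    ... | yes zc = inj₂ (c , zc , F.keep (in-pair zc) r)
    ... | no nc with orb-visit o
    ...   | inj₁ h = inj₁ (FH.skip-hit (not-pair nc) r h)
    ...   | inj₂ (z , zz , r′) = inj₂ (z , zz , F.skip (not-pair nc) r r′)

    visit : ∀ {s y} → A y ≡ true → Conn (D₁ ⊓ L) s y → Hit σ₁ L y nothing s ⊎ (∃ λ z → Z z × Run σ₁ L nothing s z)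
    visit {s} {y} ay c with T₁.exits sL ay c
    ... | x , ax , r with z? x
    ...   | yes zx = inj₂ (x , zx , F.keep (in-pair zx) r)
    ...   | no nx with orb-visit (T₁.round sL ax ay (conn-sym sym₁ (run-conn T₁.valid r) ◅◅ c))
    ...     | inj₁ h = inj₁ (FH.skip-hit (not-pair nx) r h)
    ...     | inj₂ (z , zz , r′) = inj₂ (z , zz , F.skip (not-pair nx) r r′)

    module _ (apart : ¬ Conn (D₁ ⊓ L) a b) where
      -- The forgetful pattern skips exits at inner terminals, and `apart` excludes exits at the
      -- other shared node. Whenever the orbit exits at `z` the search restarts there, so the part
      -- after its last return to `z` gives the hit.
      own-orb : ∀ {z x y} → Z z → Conn (D₁ ⊓ L) z x → Orb T₁.σ L x y → Hit σ₁ L y nothing x ⊎ Hit σ₁ L y nothing z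
      own-orb zz c (one r) = inj₁ (FH.keep-hit r)
      own-orb {z} zz c (more {c = x′} r o) with own-orb zz (c ◅◅ run-conn T₁.valid r) o
      ... | inj₂ h = inj₂ h
      ... | inj₁ h with x′ ≟ z
      ...   | yes refl = inj₂ h
      ...   | no ne = inj₁ (FH.skip-hit (not-pair other) r h)
        where
        other : ¬ Z x′
        other zx with joined₁ sL zz zx ne (c ◅◅ run-conn T₁.valid r)
        ... | inj₁ j = apart j
        ... | inj₂ _ = apart (both zz zx ne (c ◅◅ run-conn T₁.valid r))
          where
          both : ∀ {z u} → Z z → Z u → u ≢ z → Conn (D₁ ⊓ L) z u → Conn (D₁ ⊓ L) a b
          both (inj₁ refl) (inj₁ refl) ne c = ⊥-elim (ne refl)
          both (inj₁ refl) (inj₂ refl) ne c = c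
          both (inj₂ refl) (inj₁ refl) ne c = conn-sym sym₁ c
          both (inj₂ refl) (inj₂ refl) ne c = ⊥-elim (ne refl)

      own : ∀ {z y} → Z z → A y ≡ true → Conn (D₁ ⊓ L) z y → Hit σ L y nothing z
      own {z} {y} zz ay c with own-orb zz ε (T₁.round sL (A-z zz) ay c)
        where
        A-z : Z z → A z ≡ true
        A-z (inj₁ refl) = A-a
        A-z (inj₂ refl) = A-b
      ... | inj₁ h = hit₁ (start₁ (z-side zz)) h
      ... | inj₂ h = hit₁ (start₁ (z-side zz)) h

    other-end : ∀ {z} → Z z → ∃ λ z′ → Z z′ × ((z ≡ a × z′ ≡ b) ⊎ (z ≡ b × z′ ≡ a))
    other-end (inj₁ refl) = b , inj₂ refl , inj₁ (refl , refl)
    other-end (inj₂ refl) = a , inj₁ refl , inj₂ (refl , refl)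

    orient : ∀ {z z′} {R : Rel n} → Symm R → (z ≡ a × z′ ≡ b) ⊎ (z ≡ b × z′ ≡ a) → Conn R a b → Conn R z z′
    orient s (inj₁ (refl , refl)) c = c
    orient s (inj₂ (refl , refl)) c = conn-sym s c

    -- Since the ends are joined, the run from one end leads to the other, and `cut` makes every
    -- inner terminal unavoidable on it.
    crossing-hits : Conn (D₁ ⊓ L) a b → ∀ {z y} → Z z → A y ≡ true → Hit σ L y nothing z
    crossing-hits c {z} {y} zz ay with other-end zz
    ... | z′ , zz′ , o with P₁.swap sL o (orient sym₁ o c)
    ...   | r with run-avoid {σ = σ₁} {D = D₁} (λ {v} {p} {al} → v₁ {v} {p} {al}) y r
    ...     | inj₁ h = hit₁ (start₁ (z-side zz)) h
    ...     | inj₂ (z≢y , c′) with z′ ≟ y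
    ...       | yes refl = hit₁ (start₁ (z-side zz)) (run-hit r)
    ...       | no z′≢y = ⊥-elim (cut ay (proj₁ (ne o)) (proj₂ (ne o)) (undo o (conn-mono (λ {u} {v} e → proj₁ (⊓-adj {D = D₁ ∖ y} {L} {u} {v} e)) c′)))
      where
      ne : (z ≡ a × z′ ≡ b) ⊎ (z ≡ b × z′ ≡ a) → y ≢ a × y ≢ b
      ne (inj₁ (refl , refl)) = z≢y ∘ sym , z′≢y ∘ sym
      ne (inj₂ (refl , refl)) = z′≢y ∘ sym , z≢y ∘ sym
      undo : (z ≡ a × z′ ≡ b) ⊎ (z ≡ b × z′ ≡ a) → Conn (D₁ ∖ y) z z′ → Conn (D₁ ∖ y) a b
      undo (inj₁ (refl , refl)) c = c
      undo (inj₂ (refl , refl)) c = conn-sym (∖-symm s₁ y) c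

    second : ∀ {z} → Z z → ∃ λ x → Z x × Run T₂.σ L nothing z x
    second {z} zz with T₂.exits sL (in-pair zz) (ε {x = z})
    ... | x , ix , r = x , pair-inv {v = a} {b} {x} ix , r

    pass-second : ∀ {s z} → side s ≡ true → Z z → Run σ₁ L nothing s z → ∃ λ x → Z x × Run σ L nothing s x
    pass-second ss zz r with second zz
    ... | x , zx , r₂ = x , zx , pass-run zz (start₁ ss) r r₂

    -- Three situations: the first piece is unbroken and a crossing meets all its terminals; it is
    -- broken and `y` lies on the part at `z`; or `y` lies on the part at the other end, and then
    -- the second piece must carry the packet there.
    from-end : ∀ {z y} → Z z → A y ≡ true → Conn ((D₁ ⊔ D₂) ⊓ L) z y → (∃ λ x → Z x × Conn (D₁ ⊓ L) x y) → Meets σ L y z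
    from-end {z} {y} zz ay c (x , zx , cx) with conn? (D₁ ⊓ L) a b
    ... | yes j = now (crossing-hits j zz ay)
    ... | no nj with x ≟ z
    ...   | yes refl = now (own nj zz ay cx)
    ...   | no ne with joined zz zx
      where
      joined : Z z → Z x → Conn (D₂ ⊓ L) z x
      joined (inj₁ refl) (inj₁ refl) = ⊥-elim (ne refl)
      joined (inj₂ refl) (inj₂ refl) = ⊥-elim (ne refl)
      joined (inj₁ refl) (inj₂ refl) with join-inv sL (c ◅◅ conn-sym sym₁₂ (join₁ sL cx))
      ... | inj₁ j = ⊥-elim (nj j)
      ... | inj₂ j = j
      joined (inj₂ refl) (inj₁ refl) with join-inv sL (conn-sym sym₁₂ (c ◅◅ conn-sym sym₁₂ (join₁ sL cx)))
      ... | inj₁ j = ⊥-elim (nj j)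
      ... | inj₂ j = conn-sym sym₂ j
    ...     | c₂ = later (pass-run zz (start₁ (z-side zz)) (P₁.stay sL zz nj) (P₂.swap sL (ends zz zx) c₂)) (now (own nj zx ay cx))
      where
      ends : Z z → Z x → (z ≡ a × x ≡ b) ⊎ (z ≡ b × x ≡ a)
      ends (inj₁ refl) (inj₁ refl) = ⊥-elim (ne refl)
      ends (inj₁ refl) (inj₂ refl) = inj₁ (refl , refl)
      ends (inj₂ refl) (inj₁ refl) = inj₂ (refl , refl)
      ends (inj₂ refl) (inj₂ refl) = ⊥-elim (ne refl)

    meets′ : ∀ {s y} → A y ≡ true → Conn ((D₁ ⊔ D₂) ⊓ L) s y → Meets σ L y s
    meets′ {s} {y} ay c with bool-case (side s)
    ... | inj₂ ss with to-z₂ ss c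
    ...   | inj₁ (_ , sy) = ⊥-elim (true≢false (A-side ay) sy)
    ...   | inj₂ (z , zz , c₂ , cz) with T₂.exits sL (in-pair zz) c₂
    ...     | x , ix , r with pair-inv {v = a} {b} {x} ix
    ...       | zx = later (run₂ (start₂ ss) r) (from-end zx ay (conn-sym sym₁₂ (join₂ sL (run-conn T₂.valid r)) ◅◅ c) near)
      where
      near : ∃ λ x → Z x × Conn (D₁ ⊓ L) x y
      near with to-z₁ (A-side ay) (conn-sym sym₁₂ c)
      ... | inj₁ (_ , ss′) = ⊥-elim (true≢false ss′ ss)
      ... | inj₂ (x , zx , c₁ , _) = x , zx , conn-sym sym₁ c₁
    meets′ {s} {y} ay c | inj₁ ss with to-z₁ ss c
    ... | inj₁ (c₁ , _) with visit ay c₁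
    ...   | inj₁ h = now (hit₁ (start₁ ss) h)
    ...   | inj₂ (z , zz , r) with pass-second ss zz r
    ...     | x , zx , r′ = later r′ (from-end zx ay (conn-sym sym₁₂ (run-conn (λ {v} → valid {v}) r′) ◅◅ c)
                (z , zz , conn-sym sym₁ (run-conn {D = D₁} (λ {v} {p} {al} → v₁ {v} {p} {al}) r) ◅◅ c₁))
    meets′ {s} {y} ay c | inj₁ ss | inj₂ (z , zz , c₁ , cz) with Tour.exits T₁′ sL (in-pair zz) c₁
    ... | x , ix , r with pass-second ss (pair-inv {v = a} {b} {x} ix) r
    ...   | x′ , zx′ , r′ = later r′ (from-end zx′ ay (conn-sym sym₁₂ (run-conn (λ {v} → valid {v}) r′) ◅◅ c) near)
      where
      near : ∃ λ x → Z x × Conn (D₁ ⊓ L) x y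
      near with to-z₁ (A-side ay) (conn-sym sym₁₂ c)
      ... | inj₂ (x , zx , c₁ , _) = x , zx , conn-sym sym₁ c₁
      ... | inj₁ (c₂ , _) = z , zz , conn-sym sym₁ (c₂ ◅◅ c₁)

  roam : Roam (D₁ ⊔ D₂) A
  roam = record { σ = σ ; valid = λ {v} → valid {v} ; meets = λ sL → meets′ sL }

-- Delivering directly when possible and re-entering otherwise reaches the root.
module Direct {n} {D : Rel n} (t : Fin n) (D₀ : Rel n) (D₀⊆ : ∀ {u v} → Adj D₀ u v → Adj D u v)
              (⊆D₀ : ∀ {u v} → Adj D u v → u ≢ t → v ≢ t → Adj D₀ u v)
              {N : VSet n} (N⊆ : ∀ {y} → Adj D y t → N y ≡ true) (T : Roam D₀ N) where
  private
    module T = Roam T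
    -- No exit survives: a packet that finds its link to the root dead has only the piece to go back
    -- to, so it starts afresh.
    module F = Forget T.σ (λ _ → false)

  σ : Pattern n
  σ u p al = if D u t ∧ al t then just t else F.σ′ u p al

  σ-alive : ∀ {u p al} → D u t ∧ al t ≡ true → σ u p al ≡ just t
  σ-alive e rewrite e = refl
  σ-dead : ∀ {u p al} → D u t ∧ al t ≡ false → σ u p al ≡ F.σ′ u p al
  σ-dead e rewrite e = refl

  valid′ : Valid D σ
  valid′ {u} {p} {al} {w} e with D u t ∧ al t in eq
  valid′ {u} {p} {al} refl | true = ∧-true {D u t} eq
  ... | false = let (a , b) = F.valid′ {D = D₀} T.valid {u} {p} e in D₀⊆ a , b

  module _ {L : Rel n} (sL : Symm L) where
    hit-here : ∀ {p u} → D u t ∧ L u t ≡ true → Hit σ L t p u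
    hit-here e = go (σ-alive e) at

    along : ∀ {p s y} → Hit T.σ L y p s → D y t ∧ L y t ≡ true → Hit σ L t p s
    along at e = hit-here e
    along {p} {s} (go x h) e with bool-case (D s t ∧ L s t)
    ... | inj₁ e′ = hit-here e′
    ... | inj₂ e′ = go (trans (σ-dead e′) (F.σ′-just x)) (along h e)

    after : ∀ {p s a} → Run T.σ L p s a → Hit σ L t nothing a → Hit σ L t p s
    after {p} {s} r h with bool-case (D s t ∧ L s t)
    ... | inj₁ e = hit-here e
    after {p} {s} (exit x) at | inj₂ e = at
    after {p} {s} (exit x) (go y h) | inj₂ e =
      go (trans (trans (σ-dead e) (trans (sym (F.σ′-restart refl x)) (sym (σ-dead e)))) y) h
    after {p} {s} (go x r) h | inj₂ e = go (trans (σ-dead e) (F.σ′-just x)) (after r h)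

    meets-hit : ∀ {s y} → Meets T.σ L y s → D y t ∧ L y t ≡ true → Hit σ L t nothing s
    meets-hit (now h) e = along h e
    meets-hit (later r m) e = after r (meets-hit m e)

    last-link : ∀ {s} → s ≢ t → Conn (D ⊓ L) s t → ∃ λ y → Conn (D₀ ⊓ L) s y × D y t ∧ L y t ≡ true
    last-link ne ε = ⊥-elim (ne refl)
    last-link {s} ne (_◅_ {j = j} e es) with j ≟ t
    ... | yes refl = s , ε , e
    ... | no j≢ = let (y , c , l) = last-link j≢ es
                      (d , al) = ⊓-adj {D = D} {L} {s} {j} e
                  in y , ∧-intro (⊆D₀ d ne j≢) al ◅ c , l

    hits′ : ∀ {s} → Conn (D ⊓ L) s t → Hit σ L t nothing s
    hits′ {s} c with s ≟ t
    ... | yes refl = at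
    ... | no ne with last-link ne c
    ...   | y , c′ , e = meets-hit (T.meets sL (N⊆ (proj₁ (∧-true {D y t} e))) c′) e

  resilient : Resilient D t
  resilient = record { σ = σ ; valid = λ {u} → valid′ {u} ; hits = λ sL → hits′ sL }

-- Rotations of cycles, cutting paths and cycles into segments

++-overlap : ∀ {V : Set} (X : List V) {Y X′ Y′} → X ++ Y ≡ X′ ++ Y′ →
  (∃ λ Z → X′ ≡ X ++ Z × Y ≡ Z ++ Y′) ⊎ (∃ λ Z → X ≡ X′ ++ Z × Y′ ≡ Z ++ Y)
++-overlap [] {X′ = X′} e = inj₁ (X′ , refl , e)
++-overlap (x ∷ X) {X′ = []} e = inj₂ (x ∷ X , refl , sym e)
++-overlap (x ∷ X) {X′ = x′ ∷ X′} e with List.∷-injective e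
... | refl , e′ with ++-overlap X e′
...   | inj₁ (Z , p , q) = inj₁ (Z , cong (x ∷_) p , q)
...   | inj₂ (Z , p , q) = inj₂ (Z , cong (x ∷_) p , q)

Rot : {V : Set} → List V → List V → Set
Rot C C′ = ∃₂ λ X Y → C ≡ X ++ Y × C′ ≡ Y ++ X

module _ {V : Set} where
  rot-sym : ∀ {C C′ : List V} → Rot C C′ → Rot C′ C
  rot-sym (X , Y , p , q) = Y , X , q , p

  rot-trans : ∀ {C C′ C″ : List V} → Rot C C′ → Rot C′ C″ → Rot C C″
  rot-trans (X , Y , refl , refl) (X′ , Y′ , p , refl) with ++-overlap Y {X} {X′} {Y′} p
  ... | inj₁ (Z , refl , refl) = Z , Y′ ++ Y , List.++-assoc Z Y′ Y , sym (List.++-assoc Y′ Y Z)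
  ... | inj₂ (Z , refl , refl) = X ++ X′ , Z , sym (List.++-assoc X X′ Z) , List.++-assoc Z X X′

  rot-++ : ∀ (X : List V) {Y} → Rot (X ++ Y) (Y ++ X)
  rot-++ X = X , _ , refl , refl

  rot-∈ : ∀ {C C′ : List V} {v} → Rot C C′ → v ∈ C → v ∈ C′
  rot-∈ (X , Y , refl , refl) m = ∈-swap X m

  rot-uniq : ∀ {C C′ : List V} → Rot C C′ → Unique C → Unique C′
  rot-uniq (X , Y , refl , refl) u = uniq-swap X u

  rot-length : ∀ {C C′ : List V} → Rot C C′ → length C ≡ length C′
  rot-length (X , Y , refl , refl) = trans (List.length-++ X) (trans (ℕ.+-comm (length X) _) (sym (List.length-++ Y)))

  rot-fixed : ∀ {x} {U U′ : List V} → Unique (x ∷ U) → Rot (x ∷ U) (x ∷ U′) → U ≡ U′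
  rot-fixed u ([] , Y , refl , q) = sym (trans (List.∷-injectiveʳ q) (List.++-identityʳ _))
  rot-fixed u (x ∷ X , [] , refl , q) = trans (List.++-identityʳ X) (sym (List.∷-injectiveʳ q))
  rot-fixed u (x ∷ X , y ∷ Y , refl , q) with List.∷-injective q
  ... | refl , _ = ⊥-elim (uniq-disj (x ∷ X) u (here refl) (here refl))

  split-unique : ∀ {y} (X : List V) {Y X′ Y′} → Unique (X ++ y ∷ Y) → X ++ y ∷ Y ≡ X′ ++ y ∷ Y′ → X ≡ X′ × Y ≡ Y′
  split-unique [] {X′ = []} u e = refl , List.∷-injectiveʳ e
  split-unique [] {X′ = x ∷ X′} u e with List.∷-injective e
  ... | refl , refl = ⊥-elim (uniq-disj (x ∷ []) u (here refl) (∈-++⁺ʳ X′ (here refl)))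
  split-unique (x ∷ X) {X′ = []} u e with List.∷-injective e
  ... | refl , refl = ⊥-elim (uniq-disj (x ∷ []) u (here refl) (∈-++⁺ʳ X (here refl)))
  split-unique (x ∷ X) {X′ = x′ ∷ X′} (_ ∷ u) e with List.∷-injective e
  ... | refl , e′ with split-unique X u e′
  ...   | refl , refl = refl , refl

  -- Two nodes of a repetition-free cycle determine both arcs between them, so facts about arcs
  -- carry over between different rotations.
  arcs-unique : ∀ {x y} {T U T′ U′ : List V} → Unique (x ∷ T ++ y ∷ U) → Rot (x ∷ T ++ y ∷ U) (x ∷ T′ ++ y ∷ U′) → T ≡ T′ × U ≡ U′
  arcs-unique {T = T} u@(_ ∷ u′) r = split-unique T u′ (rot-fixed u r)

  two-arcs : ∀ {C : List V} {p q} → p ∈ C → q ∈ C → p ≢ q → ∃₂ λ S T → Rot C (p ∷ S ++ q ∷ T)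
  two-arcs {C} {p} {q} p∈ q∈ ne with ∈-∃++ p∈
  ... | X , Y , refl with rot-∈ (rot-++ X) q∈
  ...   | here e = ⊥-elim (ne (sym e))
  ...   | there q∈′ with ∈-∃++ q∈′
  ...     | S , T , e = S , T , X , p ∷ Y , refl , cong (p ∷_) (sym e)

uniq-length : ∀ {n} (xs : List (Fin n)) → Unique xs → length xs ≤ n
uniq-length xs u = Fin.injective⇒≤ (lk xs u)
  where
  lk : ∀ {n} (xs : List (Fin n)) → Unique xs → ∀ {i j} → List.lookup xs i ≡ List.lookup xs j → i ≡ j
  lk (x ∷ xs) (p ∷ u) {fzero} {fzero} e = refl
  lk (x ∷ xs) (p ∷ u) {fzero} {fsuc j} e = ⊥-elim (All.lookup p (Mem.∈-lookup j) e)
  lk (x ∷ xs) (p ∷ u) {fsuc i} {fzero} e = ⊥-elim (All.lookup p (Mem.∈-lookup i) (sym e))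
  lk (x ∷ xs) (p ∷ u) {fsuc i} {fsuc j} e = cong fsuc (lk xs u e)

module _ {V : Set} {R : V → V → Set} where
  NonEmpty : List V → Set
  NonEmpty xs = ∃ λ a → a ∈ xs

  data Chain : ∀ {r} → Vec (List V) r → Set where
    last : ∀ {s} → IsPath R s → Chain (s ∷ [])
    link : ∀ {r s s′} {ss : Vec (List V) r} → IsPath R s → SegAdj R s s′ → Chain (s′ ∷ ss) → Chain (s ∷ s′ ∷ ss)

  data AllNE : ∀ {r} → Vec (List V) r → Set where
    []  : AllNE []
    _∷_ : ∀ {r s} {ss : Vec (List V) r} → NonEmpty s → AllNE ss → AllNE (s ∷ ss)

  concat-head : ∀ {r s} {ss : Vec (List V) r} {u w} → NonEmpty s → Path R u (concatV (s ∷ ss)) w → u ∈ s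
  concat-head {s = x ∷ s} {[]} _ p with path-head p
  ... | refl = here refl
  concat-head {s = x ∷ s} {_ ∷ _} _ p with path-head p
  ... | refl = here refl

  concat-cons : ∀ {r s} {ss : Vec (List V) r} → AllNE (s ∷ ss) → ∃₂ λ y ys → concatV (s ∷ ss) ≡ y ∷ ys
  concat-cons {s = []} ((_ , ()) ∷ _)
  concat-cons {s = y ∷ ys} {[]} _ = y , ys , refl
  concat-cons {s = y ∷ ys} {_ ∷ _} _ = y , _ , refl

  ne-head : ∀ {r s} {ss : Vec (List V) r} → AllNE (s ∷ ss) → NonEmpty s
  ne-head (x ∷ _) = x

  -- Turns a path written as a concatenation into the connected segments and the links between
  -- neighbouring segments that `obstruct` asks for.
  chain : ∀ {r} (ss : Vec (List V) (suc r)) → AllNE ss → IsPath R (concatV ss) → Chain ss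
  chain (s ∷ []) _ p = last p
  chain ([] ∷ _ ∷ _) ((_ , ()) ∷ _) p
  chain ((x ∷ s) ∷ s′ ∷ ss) (_ ∷ ne) (u , w , p) with concat-cons ne
  ... | y , ys , eq with path-split x s y ys (subst (λ l → Path R u (x ∷ s ++ l) w) eq p)
  ...   | v , p₁ , r , p₂ = link (u , v , p₁)
    (v , y , path-last∈ p₁ , concat-head {ss = ss} (ne-head ne) (subst (λ l → Path R y l w) (sym eq) p₂) , r)
    (chain (s′ ∷ ss) ne (y , w , subst (λ l → Path R y l w) (sym eq) p₂))

  seg-sym : (∀ {u v} → R u v → R v u) → ∀ {S T} → SegAdj R S T → SegAdj R T S
  seg-sym s (a , b , x , y , r) = b , a , y , x , s r

  Ring : List V → Set
  Ring C = ∃₂ λ u w → Path R u C w × R w u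

  ring-rot : ∀ {C C′} → Rot C C′ → Ring C → Ring C′
  ring-rot ([] , Y , refl , refl) r = subst Ring (sym (List.++-identityʳ Y)) r
  ring-rot (x ∷ X , [] , refl , refl) r = subst Ring (List.++-identityʳ (x ∷ X)) r
  ring-rot (x ∷ X , y ∷ Y , refl , refl) (u , w , p , c) with path-split x X y Y p
  ... | v , p₁ , r , p₂ = y , v , path-++ p₂ c p₁ , r

  ring-path : ∀ {C} → Ring C → IsPath R C
  ring-path (u , w , p , _) = u , w , p

  lastV : ∀ {r} → Vec (List V) (suc r) → List V
  lastV (s ∷ []) = s
  lastV (s ∷ s′ ∷ ss) = lastV (s′ ∷ ss)

  concat-last : ∀ {r} (ss : Vec (List V) (suc r)) → AllNE ss → ∀ {u w} → Path R u (concatV ss) w → w ∈ lastV ss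
  concat-last (s ∷ []) _ p = path-last∈ p
  concat-last ([] ∷ _ ∷ _) ((_ , ()) ∷ _) p
  concat-last ((x ∷ s) ∷ s′ ∷ ss) (_ ∷ ne) {u} {w} p with concat-cons ne
  ... | y , ys , eq with path-split x s y ys (subst (λ l → Path R u (x ∷ s ++ l) w) eq p)
  ...   | v , p₁ , r , p₂ = concat-last (s′ ∷ ss) ne (subst (λ l → Path R y l w) (sym eq) p₂)

  ring-close : ∀ {r} (ss : Vec (List V) (suc r)) → AllNE ss → Ring (concatV ss) → SegAdj R (lastV ss) (Vec.head ss)
  ring-close ss@(s ∷ ss′) (ne ∷ nes) (u , w , p , c) = w , u , concat-last ss (ne ∷ nes) p , concat-head {ss = ss′} ne p , c

all-at : ∀ {X : Set} {P : X → Set} {r} {xs : Vec X r} → VAll.All P xs → ∀ i → P (lookup xs i)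
all-at (p VAll.∷ ps) fzero = p
all-at (p VAll.∷ ps) (fsuc i) = all-at ps i

connected-vtx : ∀ {n} {D : Rel n} {Dir Ext : VSet n} {xs} → Connected (Adj D) xs → Connected (Link D Dir Ext) (List.map vtx xs)
connected-vtx c a b with Mem.∈-map⁻ vtx a | Mem.∈-map⁻ vtx b
... | u , u∈ , refl | v , v∈ , refl = Star.gmap vtx (λ (r , x , y) → dd r , Mem.∈-map⁺ vtx x , Mem.∈-map⁺ vtx y) (c u∈ v∈)

single-connected : ∀ {V : Set} {R : V → V → Set} {x} → Connected R (x ∷ [])
single-connected (here refl) (here refl) = ε

seg-vtx : ∀ {n} {D : Rel n} {Dir Ext : VSet n} {S T} → SegAdj (Adj D) S T → SegAdj (Link D Dir Ext) (List.map vtx S) (List.map vtx T)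
seg-vtx (a , b , x , y , r) = vtx a , vtx b , Mem.∈-map⁺ vtx x , Mem.∈-map⁺ vtx y , dd r

-- Minors from contracted segments; lenses

none : ∀ {n} → VSet n
none _ = false

⁅_⁆ : ∀ {n} → Fin n → VSet n
⁅ e ⁆ v = does (v ≟ e)

_─_ : ∀ {n} → VSet n → Fin n → VSet n
(A ─ e) v = A v ∧ not (does (v ≟ e))

─-intro : ∀ {n} {A : VSet n} {e v} → A v ≡ true → v ≢ e → (A ─ e) v ≡ true
─-intro {e = e} {v} a ne = ∧-intro a (cong not (does-false (v ≟ e) ne))

-- Minors obtained by contracting disjoint paths of D (the segments ss) to single nodes;
-- node 0 of the small graph is the root.
module Obstruct {n} {D : Rel n} (sD : Symm D) (A : VSet n) where
  Touches : List (Fin n) → Set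
  Touches S = ∃ λ a → a ∈ S × A a ≡ true

  module _ {r} (ss : Vec (List (Fin n)) r) (dj : Disj ss) (ps : VAll.All (Connected (Adj D)) ss)
           (es : List (Fin r × Fin r)) (ad : All (λ (i , j) → SegAdj (Adj D) (lookup ss i) (lookup ss j)) es) where
    private
      ∈-inv : ∀ {v : Vtx n} {xs : List (Fin n)} → v ∈ List.map vtx xs → ∃ λ u → u ∈ xs × v ≡ vtx u
      ∈-inv m = Mem.∈-map⁻ vtx m

      inner : ∀ i j {v} → v ∈ List.map vtx (lookup ss i) → v ∈ List.map vtx (lookup ss j) → i ≡ j
      inner i j a b with ∈-inv a | ∈-inv b
      ... | u , m , refl | u′ , m′ , e = dj i j m (subst (_∈ _) (sym (vtx-inj e)) m′)

      lk : ∀ i → lookup (Vec.map (List.map vtx) ss) i ≡ List.map vtx (lookup ss i)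
      lk i = Vec.lookup-map i (List.map vtx) ss

    module _ (as : List (Fin r)) (aa : All (λ i → Touches (lookup ss i)) as) where
      private
        segs : Vec (List (Vtx n)) (suc r)
        segs = (root ∷ []) ∷ Vec.map (List.map vtx) ss

        dj′ : Disj segs
        dj′ fzero fzero _ _ = refl
        dj′ fzero (fsuc j) (here refl) b with ∈-inv (subst (_ ∈_) (lk j) b)
        ... | _ , _ , ()
        dj′ (fsuc i) fzero a (here refl) with ∈-inv (subst (_ ∈_) (lk i) a)
        ... | _ , _ , ()
        dj′ (fsuc i) (fsuc j) a b = cong fsuc (inner i j (subst (_ ∈_) (lk i) a) (subst (_ ∈_) (lk j) b))

        ps′ : ∀ i → Connected (Link D A none) (lookup segs i)
        ps′ fzero = single-connected
        ps′ (fsuc i) = subst (Connected _) (sym (lk i)) (connected-vtx (all-at ps i))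

      es⁺ : List (Fin (suc r) × Fin (suc r))
      es⁺ = List.map (λ (i , j) → fsuc i , fsuc j) es ++ List.map (λ i → fzero , fsuc i) as

      private
        P : Fin (suc r) × Fin (suc r) → Set
        P (i , j) = SegAdj (Link D A none) (lookup segs i) (lookup segs j)
        ad₁ : ∀ {es : List (Fin r × Fin r)} → All (λ (i , j) → SegAdj (Adj D) (lookup ss i) (lookup ss j)) es →
              All P (List.map (λ (i , j) → fsuc i , fsuc j) es)
        ad₁ [] = []
        ad₁ {(i , j) ∷ _} (x ∷ xs) = subst₂ (SegAdj _) (sym (lk i)) (sym (lk j)) (seg-vtx x) ∷ ad₁ xs
        ad₂ : ∀ {as : List (Fin r)} → All (λ i → Touches (lookup ss i)) as → All P (List.map (λ i → fzero , fsuc i) as)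
        ad₂ [] = []
        ad₂ {i ∷ _} ((a , m , t) ∷ xs) =
          (root , vtx a , here refl , subst (_ ∈_) (sym (lk i)) (Mem.∈-map⁺ vtx m) , rd t) ∷ ad₂ xs

      obstruct-connected : (H : Graph) (tH : Node H) (lab : Vec (Maybe (Node H)) (suc r)) →
                 Small.check es⁺ H lab tH fzero ≡ true → Model H tH (Link D A none) root
      obstruct-connected H tH lab e = Segments.seg-model _≟ᵥ_ (link-sym sD) segs dj′ ps′ es⁺ (All.++⁺ (ad₁ ad) (ad₂ aa)) fzero (here refl) H tH lab e

    -- The same with a private node between e and the root, node 1 of the small graph.
    module _ (e : Fin n) (ie : Fin r) (e∈ : e ∈ lookup ss ie)
             (as : List (Fin r)) (aa : All (λ i → ∃ λ a → a ∈ lookup ss i × A a ≡ true × a ≢ e) as) where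
      private
        segs : Vec (List (Vtx n)) (suc (suc r))
        segs = (root ∷ []) ∷ (pend e ∷ []) ∷ Vec.map (List.map vtx) ss

        dj′ : Disj segs
        dj′ fzero fzero _ _ = refl
        dj′ fzero (fsuc fzero) (here refl) (here ())
        dj′ fzero (fsuc (fsuc j)) (here refl) b with ∈-inv (subst (_ ∈_) (lk j) b)
        ... | _ , _ , ()
        dj′ (fsuc fzero) fzero (here refl) (here ())
        dj′ (fsuc (fsuc i)) fzero a (here refl) with ∈-inv (subst (_ ∈_) (lk i) a)
        ... | _ , _ , ()
        dj′ (fsuc fzero) (fsuc fzero) _ _ = refl
        dj′ (fsuc fzero) (fsuc (fsuc j)) (here refl) b with ∈-inv (subst (_ ∈_) (lk j) b)
        ... | _ , _ , ()
        dj′ (fsuc (fsuc i)) (fsuc fzero) a (here refl) with ∈-inv (subst (_ ∈_) (lk i) a)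
        ... | _ , _ , ()
        dj′ (fsuc (fsuc i)) (fsuc (fsuc j)) a b = cong (fsuc ∘ fsuc) (inner i j (subst (_ ∈_) (lk i) a) (subst (_ ∈_) (lk j) b))

        ps′ : ∀ i → Connected (Link D (A ─ e) ⁅ e ⁆) (lookup segs i)
        ps′ fzero = single-connected
        ps′ (fsuc fzero) = single-connected
        ps′ (fsuc (fsuc i)) = subst (Connected _) (sym (lk i)) (connected-vtx (all-at ps i))

      es⁺⁺ : List (Fin (suc (suc r)) × Fin (suc (suc r)))
      es⁺⁺ = (fzero , fsuc fzero) ∷ (fsuc fzero , fsuc (fsuc ie)) ∷
             List.map (λ (i , j) → fsuc (fsuc i) , fsuc (fsuc j)) es ++ List.map (λ i → fzero , fsuc (fsuc i)) as

      private
        P : Fin (suc (suc r)) × Fin (suc (suc r)) → Set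
        P (i , j) = SegAdj (Link D (A ─ e) ⁅ e ⁆) (lookup segs i) (lookup segs j)
        ee : ⁅ e ⁆ e ≡ true
        ee = does-true (e ≟ e) refl
        ad₁ : ∀ {es : List (Fin r × Fin r)} → All (λ (i , j) → SegAdj (Adj D) (lookup ss i) (lookup ss j)) es →
              All P (List.map (λ (i , j) → fsuc (fsuc i) , fsuc (fsuc j)) es)
        ad₁ [] = []
        ad₁ {(i , j) ∷ _} (x ∷ xs) = subst₂ (SegAdj _) (sym (lk i)) (sym (lk j)) (seg-vtx x) ∷ ad₁ xs
        ad₂ : ∀ {as : List (Fin r)} → All (λ i → ∃ λ a → a ∈ lookup ss i × A a ≡ true × a ≢ e) as → All P (List.map (λ i → fzero , fsuc (fsuc i)) as)
        ad₂ [] = []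
        ad₂ {i ∷ _} ((a , m , t , ne) ∷ xs) =
          (root , vtx a , here refl , subst (_ ∈_) (sym (lk i)) (Mem.∈-map⁺ vtx m) , rd (─-intro {A = A} t ne)) ∷ ad₂ xs

      obstruct-pend-connected : (H : Graph) (tH : Node H) (lab : Vec (Maybe (Node H)) (suc (suc r))) →
                      Small.check es⁺⁺ H lab tH fzero ≡ true → Model H tH (Link D (A ─ e) ⁅ e ⁆) root
      obstruct-pend-connected H tH lab c = Segments.seg-model _≟ᵥ_ (link-sym sD) segs dj′ ps′ es⁺⁺
        ((root , pend e , here refl , here refl , rp ee) ∷
         (pend e , vtx e , here refl , subst (_ ∈_) (sym (lk ie)) (Mem.∈-map⁺ vtx e∈) , pd ee) ∷
         All.++⁺ (ad₁ ad) (ad₂ aa)) fzero (here refl) H tH lab c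

  module _ {r} (ss : Vec (List (Fin n)) r) (dj : Disj ss) (ps : VAll.All (IsPath (Adj D)) ss) where
    private
      cs : VAll.All (Connected (Adj D)) ss
      cs = VAll.map (path-connected (λ e → flip-adj sD e)) ps
    obstruct = obstruct-connected ss dj cs
    obstruct-pend = obstruct-pend-connected ss dj cs

Has : ∀ {n} → VSet n → List (Fin n) → Set
Has A S = ∃ λ a → a ∈ S × A a ≡ true

has? : ∀ {n} (A : VSet n) S → Has A S ⊎ (∀ {a} → a ∈ S → A a ≡ false)
has? A [] = inj₂ λ ()
has? A (x ∷ S) with bool-case (A x) | has? A S
... | inj₁ e | _ = inj₁ (x , here refl , e)
... | inj₂ e | inj₁ (a , m , t) = inj₁ (a , there m , t)
... | inj₂ e | inj₂ f = inj₂ λ { (here refl) → e ; (there m) → f m }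

has-++ : ∀ {n} {A : VSet n} S {T} → Has A (S ++ T) → Has A S ⊎ Has A T
has-++ S (a , m , t) with ∈-++⁻ S m
... | inj₁ x = inj₁ (a , x , t)
... | inj₂ x = inj₂ (a , x , t)

has-ne : ∀ {n} {A : VSet n} {S} → Has A S → ∃ λ a → a ∈ S
has-ne (a , m , _) = a , m

split-first : ∀ {n} (A : VSet n) S → Has A S → ∃₂ λ X a → ∃ λ Y → S ≡ X ++ a ∷ Y × A a ≡ true × (∀ {b} → b ∈ X → A b ≡ false)
split-first A (x ∷ S) h with bool-case (A x)
... | inj₁ e = [] , x , S , refl , e , λ ()
split-first A (x ∷ S) (_ , here refl , t) | inj₂ e = ⊥-elim (true≢false t e)
split-first A (x ∷ S) (a , there m , t) | inj₂ e with split-first A S (a , m , t)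
... | X , b , Y , refl , ab , f = x ∷ X , b , Y , refl , ab , λ { (here refl) → e ; (there m) → f m }

split-last : ∀ {n} (A : VSet n) S → Has A S → ∃₂ λ X a → ∃ λ Y → S ≡ X ++ a ∷ Y × A a ≡ true × (∀ {b} → b ∈ Y → A b ≡ false)
split-last A (x ∷ S) h with has? A S
... | inj₁ h′ with split-last A S h′
...   | X , b , Y , refl , ab , f = x ∷ X , b , Y , refl , ab , f
split-last A (x ∷ S) (_ , here refl , t) | inj₂ f = [] , x , S , refl , t , f
split-last A (x ∷ S) (a , there m , t) | inj₂ f = ⊥-elim (true≢false t (f m))

path-adjacent : ∀ {V : Set} {R : V → V → Set} {u w a b} X {Z} → Path R u (X ++ a ∷ b ∷ Z) w → R a b
path-adjacent [] p with path-split _ [] _ _ p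
... | v , q , r , _ with path-last [] q
...   | refl = r
path-adjacent (x ∷ []) (r ∺ p) = path-adjacent [] p
path-adjacent (x ∷ y ∷ X) (r ∺ p) = path-adjacent (y ∷ X) p

module Lenses {n} {D : Rel n} (sD : Symm D) {A : VSet n} (free : ¬ Forb (Link D A none) root) where
  open Obstruct sD A

  R : Fin n → Fin n → Set
  R = Adj D

  -- L₁ and L₂ join the two ends of Q, and all attachments lie on Q.
  record Lens (Q L₁ L₂ : List (Fin n)) : Set where
    field
      h l   : Fin n
      pathQ : Path R h Q l
      path₁ : IsPath R L₁
      path₂ : IsPath R L₂
      h₁    : ∃ λ x → x ∈ L₁ × R x h
      l₁    : ∃ λ x → x ∈ L₁ × R x l
      h₂    : ∃ λ x → x ∈ L₂ × R x h
      l₂    : ∃ λ x → x ∈ L₂ × R x l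
      uniq  : Unique (L₁ ++ L₂ ++ Q)
      cover : ∀ {a} → A a ≡ true → a ∈ Q

    flip : Lens Q L₂ L₁
    flip = record { h = h ; l = l ; pathQ = pathQ ; path₁ = path₂ ; path₂ = path₁ ; h₁ = h₂ ; l₁ = l₂ ; h₂ = h₁ ; l₂ = l₁
      ; uniq = uniq-++ (uniq-left L₂ u₂) (uniq-++ (uniq-left L₁ uniq) (uniq-right L₂ u₂)
                 (λ a b → uniq-disj L₁ uniq a (∈-++⁺ʳ L₂ b)))
                 (λ a b → case ∈-++⁻ L₁ b of λ { (inj₁ c) → uniq-disj L₁ uniq c (∈-++⁺ˡ a) ; (inj₂ c) → uniq-disj L₂ u₂ a c })
      ; cover = cover }
      where
      u₂ : Unique (L₂ ++ Q)
      u₂ = uniq-right L₁ uniq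

  seg : ∀ {S T h} → (∃ λ x → x ∈ S × R x h) → h ∈ T → SegAdj R S T
  seg (x , m , r) h∈ = x , _ , m , h∈ , r

  flipSeg : ∀ {S T} → SegAdj R S T → SegAdj R T S
  flipSeg = seg-sym (λ e → flip-adj sD e)

  K33 : Model K33-e K33-e-root (Link D A none) root → ⊥
  K33 m = free (inj₂ (inj₁ m))
  K24 : Model K24-sub K24-sub-root (Link D A none) root → ⊥
  K24 m = free (inj₂ (inj₂ (inj₂ m)))
  K5 : Model K5-e K5-e-root (Link D A none) root → ⊥
  K5 m = free (inj₁ m)

  module _ {Q L₁ L₂} (Ln : Lens Q L₁ L₂) where
    open Lens Ln

    -- The hubs of the subdivided K_{2,4} are `U₁` and `y ∷ U₃`. They are joined through `L₁`, `L₂`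
    -- and `x`, and once more through `U₂` followed by the root.
    chord-QQ₁ : ∀ {U₁ x U₂ y U₃} → Q ≡ U₁ ++ x ∷ U₂ ++ y ∷ U₃ → R x y → Has A U₂ → Has A U₁ → ⊥
    chord-QQ₁ {U₁} {x} {U₂} {y} {U₃} refl xy b₂ b₁
      with chain (U₁ ∷ (x ∷ []) ∷ U₂ ∷ (y ∷ U₃) ∷ []) (has-ne {A = A} b₁ ∷ (x , here refl) ∷ has-ne {A = A} b₂ ∷ (y , here refl) ∷ []) (h , l , pathQ)
    ... | link p₁ a₁ (link p₂ a₂ (link p₃ a₃ (last p₄))) =
      K24 (obstruct ss (uniq-disjV ss uniq) (path₁ VAll.∷ path₂ VAll.∷ p₁ VAll.∷ p₂ VAll.∷ p₃ VAll.∷ p₄ VAll.∷ VAll.[])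
        ((0F , 2F) ∷ (0F , 5F) ∷ (1F , 2F) ∷ (1F , 5F) ∷ (2F , 3F) ∷ (3F , 5F) ∷ (4F , 5F) ∷ [])
        (seg h₁ h∈ ∷ seg l₁ l∈ ∷ seg h₂ h∈ ∷ seg l₂ l∈ ∷ a₁ ∷ (x , y , here refl , here refl , xy) ∷ a₃ ∷ [])
        (2F ∷ 4F ∷ []) (b₁ ∷ b₂ ∷ []) K24-sub K24-sub-root
        (just 6F ∷ just 3F ∷ just 4F ∷ just 0F ∷ just 5F ∷ just 2F ∷ just 1F ∷ []) refl)
      where
      ss : Vec (List (Fin n)) 6
      ss = L₁ ∷ L₂ ∷ U₁ ∷ (x ∷ []) ∷ U₂ ∷ (y ∷ U₃) ∷ []
      h∈ : h ∈ U₁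
      h∈ = concat-head {R = R} {ss = (x ∷ []) ∷ U₂ ∷ (y ∷ U₃) ∷ []} (has-ne {A = A} b₁) pathQ
      l∈ : l ∈ y ∷ U₃
      l∈ = concat-last {R = R} (U₁ ∷ (x ∷ []) ∷ U₂ ∷ (y ∷ U₃) ∷ []) (has-ne {A = A} b₁ ∷ (x , here refl) ∷ has-ne {A = A} b₂ ∷ (y , here refl) ∷ []) pathQ

    -- The mirror image: the hubs are `U₁ ++ x ∷ []` and `U₃`, joined through `L₁`, `L₂` and `y`,
    -- and through `U₂` followed by the root.
    chord-QQ₃ : ∀ {U₁ x U₂ y U₃} → Q ≡ U₁ ++ x ∷ U₂ ++ y ∷ U₃ → R x y → Has A U₂ → Has A U₃ → ⊥
    chord-QQ₃ {U₁} {x} {U₂} {y} {U₃} refl xy b₂ b₃ = from-chain (chain qs ne (h , l , subst (λ q → Path R h q l) eq pathQ))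
      where
      qs : Vec (List (Fin n)) 4
      qs = (U₁ ++ x ∷ []) ∷ U₂ ∷ (y ∷ []) ∷ U₃ ∷ []
      ss : Vec (List (Fin n)) 6
      ss = L₁ ∷ L₂ ∷ qs
      eq : U₁ ++ x ∷ U₂ ++ y ∷ U₃ ≡ concatV qs
      eq = sym (List.++-assoc U₁ (x ∷ []) (U₂ ++ y ∷ U₃))
      ne : AllNE {R = R} qs
      ne = (x , ∈-++⁺ʳ U₁ (here refl)) ∷ has-ne {A = A} b₂ ∷ (y , here refl) ∷ has-ne {A = A} b₃ ∷ []
      h∈ : h ∈ U₁ ++ x ∷ []
      h∈ = concat-head {R = R} {ss = U₂ ∷ (y ∷ []) ∷ U₃ ∷ []} (ne-head ne) (subst (λ q → Path R h q l) eq pathQ)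
      l∈ : l ∈ U₃
      l∈ = concat-last {R = R} qs ne (subst (λ q → Path R h q l) eq pathQ)
      from-chain : Chain {R = R} qs → ⊥
      from-chain (link p₁ a₁ (link p₂ a₂ (link p₃ a₃ (last p₄)))) =
        K24 (obstruct ss (uniq-disjV ss (subst (λ q → Unique (L₁ ++ L₂ ++ q)) eq uniq))
          (path₁ VAll.∷ path₂ VAll.∷ p₁ VAll.∷ p₂ VAll.∷ p₃ VAll.∷ p₄ VAll.∷ VAll.[])
          ((0F , 2F) ∷ (0F , 5F) ∷ (1F , 2F) ∷ (1F , 5F) ∷ (2F , 3F) ∷ (2F , 4F) ∷ (4F , 5F) ∷ [])
          (seg h₁ h∈ ∷ seg l₁ l∈ ∷ seg h₂ h∈ ∷ seg l₂ l∈ ∷ a₁ ∷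
            (x , y , ∈-++⁺ʳ U₁ (here refl) , here refl , xy) ∷ a₃ ∷ [])
          (3F ∷ 5F ∷ []) (b₂ ∷ b₃ ∷ []) K24-sub K24-sub-root
          (just 6F ∷ just 3F ∷ just 4F ∷ just 1F ∷ just 2F ∷ just 5F ∷ just 0F ∷ []) refl)

    module _ {x U₁ y U₃} (x∈ : x ∈ L₁) (qe : Q ≡ U₁ ++ y ∷ U₃) (xy : R x y) (b₁ : Has A U₁) (b₃ : Has A U₃) where
      private
        qs₃ : Vec (List (Fin n)) 3
        qs₃ = U₁ ∷ (y ∷ []) ∷ U₃ ∷ []
        ne₃ : AllNE {R = R} qs₃
        ne₃ = has-ne {A = A} b₁ ∷ (y , here refl) ∷ has-ne {A = A} b₃ ∷ []
        pQ : Path R h (U₁ ++ y ∷ U₃) l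
        pQ = subst (λ q → Path R h q l) qe pathQ
        uQ : Unique (L₁ ++ L₂ ++ U₁ ++ y ∷ U₃)
        uQ = subst (λ q → Unique (L₁ ++ L₂ ++ q)) qe uniq
        h∈₁ : h ∈ U₁
        h∈₁ = concat-head {R = R} {ss = (y ∷ []) ∷ U₃ ∷ []} (has-ne {A = A} b₁) pQ
        l∈₃ : l ∈ U₃
        l∈₃ = concat-last {R = R} qs₃ ne₃ pQ

      -- K_{3,3} with the root, `L₂` and `y` against `L₁`, `U₁` and `U₃`; the missing link is the
      -- one between the root and `L₁`.
      chord-LQ-adjacent : SegAdj R L₁ L₂ → ⊥
      chord-LQ-adjacent ll with chain qs₃ ne₃ (h , l , pQ)
      ... | link p₁ a₁ (link p₂ a₂ (last p₃)) =
        K33 (obstruct (L₁ ∷ L₂ ∷ qs₃) (uniq-disjV (L₁ ∷ L₂ ∷ qs₃) uQ)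
          (path₁ VAll.∷ path₂ VAll.∷ p₁ VAll.∷ p₂ VAll.∷ p₃ VAll.∷ VAll.[])
          ((0F , 1F) ∷ (1F , 2F) ∷ (1F , 4F) ∷ (0F , 3F) ∷ (2F , 3F) ∷ (3F , 4F) ∷ [])
          (ll ∷ seg h₂ h∈₁ ∷ seg l₂ l∈₃ ∷ (x , y , x∈ , here refl , xy) ∷ a₁ ∷ a₂ ∷ [])
          (2F ∷ 4F ∷ []) (b₁ ∷ b₃ ∷ []) K33-e K33-e-root
          (just 0F ∷ just 3F ∷ just 1F ∷ just 4F ∷ just 2F ∷ just 5F ∷ []) refl)

      -- An attachment off the ends of the lens replaces the link between `L₁` and `L₂`. If it is
      -- `y`, merging `L₂` with `U₃` gives K_5. If it lies before `y`, merging `L₂` with `h` gives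
      -- K_{3,3}, and behind `y` merging with `l` does.
      chord-LQ : ∀ {c} → A c ≡ true → c ≢ h → c ≢ l → ⊥
      chord-LQ {c} ac c≢h c≢l with ∈-++⁻ U₁ (subst (c ∈_) qe (cover ac))
      ... | inj₂ (here refl) with chain qs₃ ne₃ (h , l , pQ)
      ...   | link p₁ a₁ (link p₂ a₂ (last p₃)) =
        K5 (obstruct (L₁ ∷ L₂ ∷ qs₃) (uniq-disjV (L₁ ∷ L₂ ∷ qs₃) uQ)
          (path₁ VAll.∷ path₂ VAll.∷ p₁ VAll.∷ p₂ VAll.∷ p₃ VAll.∷ VAll.[])
          ((0F , 2F) ∷ (0F , 4F) ∷ (0F , 3F) ∷ (2F , 3F) ∷ (3F , 4F) ∷ (1F , 2F) ∷ (1F , 4F) ∷ [])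
          (seg h₁ h∈₁ ∷ seg l₁ l∈₃ ∷ (x , y , x∈ , here refl , xy) ∷ a₁ ∷ a₂ ∷ seg h₂ h∈₁ ∷ seg l₂ l∈₃ ∷ [])
          (2F ∷ 3F ∷ 4F ∷ []) (b₁ ∷ (y , here refl , ac) ∷ b₃ ∷ []) K5-e K5-e-root
          (just 0F ∷ just 1F ∷ just 4F ∷ just 2F ∷ just 3F ∷ just 4F ∷ []) refl)
      chord-LQ {c} ac c≢h c≢l | inj₁ c∈ = in-front U₁ refl c∈
        where
        in-front : ∀ V → U₁ ≡ V → c ∈ V → ⊥
        in-front [] e ()
        in-front (g ∷ U) eU m with path-head (subst (λ V → Path R h (V ++ y ∷ U₃) l) eU pQ) | m
        ... | refl | here e = c≢h e
        ... | refl | there c∈U with chain qs ne (h , l , subst (λ V → Path R h (V ++ y ∷ U₃) l) eU pQ)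
          where
          qs : Vec (List (Fin n)) 4
          qs = (h ∷ []) ∷ U ∷ (y ∷ []) ∷ U₃ ∷ []
          ne : AllNE {R = R} qs
          ne = (h , here refl) ∷ (c , c∈U) ∷ (y , here refl) ∷ has-ne {A = A} b₃ ∷ []
        ...   | link p₁ a₁ (link p₂ a₂ (link p₃ a₃ (last p₄))) =
          K33 (obstruct ss (uniq-disjV ss (subst (λ V → Unique (L₁ ++ L₂ ++ V ++ y ∷ U₃)) eU uQ))
            (path₁ VAll.∷ path₂ VAll.∷ p₁ VAll.∷ p₂ VAll.∷ p₃ VAll.∷ p₄ VAll.∷ VAll.[])
            ((0F , 2F) ∷ (1F , 2F) ∷ (1F , 5F) ∷ (2F , 3F) ∷ (3F , 4F) ∷ (4F , 5F) ∷ (0F , 4F) ∷ [])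
            (seg h₁ (here refl) ∷ seg h₂ (here refl) ∷ seg l₂ l∈₃ ∷ a₁ ∷ a₂ ∷ a₃ ∷ (x , y , x∈ , here refl , xy) ∷ [])
            (3F ∷ 5F ∷ []) ((c , c∈U , ac) ∷ b₃ ∷ []) K33-e K33-e-root
            (just 0F ∷ just 3F ∷ just 1F ∷ just 1F ∷ just 4F ∷ just 2F ∷ just 5F ∷ []) refl)
          where
          ss : Vec (List (Fin n)) 6
          ss = L₁ ∷ L₂ ∷ (h ∷ []) ∷ U ∷ (y ∷ []) ∷ U₃ ∷ []
      chord-LQ {c} ac c≢h c≢l | inj₂ (there c∈) = in-back (List.initLast U₃) refl c∈
        where
        in-back : ∀ {V} → List.InitLast V → U₃ ≡ V → c ∈ V → ⊥
        in-back List.[] e ()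
        in-back (U List.∷ʳ′ g) eU m
          with path-last (U₁ ++ y ∷ U) (subst (λ q → Path R h q l) (trans (cong (λ V → U₁ ++ y ∷ V) eU) (sym (List.++-assoc U₁ (y ∷ U) (g ∷ [])))) pQ)
             | ∈-++⁻ U m
        ... | refl | inj₂ (here e) = c≢l e
        ... | refl | inj₁ c∈U with chain qs ne (h , l , subst (λ V → Path R h (U₁ ++ y ∷ V) l) eU pQ)
          where
          qs : Vec (List (Fin n)) 4
          qs = U₁ ∷ (y ∷ []) ∷ U ∷ (l ∷ []) ∷ []
          ne : AllNE {R = R} qs
          ne = has-ne {A = A} b₁ ∷ (y , here refl) ∷ (c , c∈U) ∷ (l , here refl) ∷ []
        ...   | link p₁ a₁ (link p₂ a₂ (link p₃ a₃ (last p₄))) =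
          K33 (obstruct ss (uniq-disjV ss (subst (λ V → Unique (L₁ ++ L₂ ++ U₁ ++ y ∷ V)) eU uQ))
            (path₁ VAll.∷ path₂ VAll.∷ p₁ VAll.∷ p₂ VAll.∷ p₃ VAll.∷ p₄ VAll.∷ VAll.[])
            ((0F , 5F) ∷ (1F , 5F) ∷ (1F , 2F) ∷ (2F , 3F) ∷ (3F , 4F) ∷ (4F , 5F) ∷ (0F , 3F) ∷ [])
            (seg l₁ (here refl) ∷ seg l₂ (here refl) ∷ seg h₂ h∈₁ ∷ a₁ ∷ a₂ ∷ a₃ ∷ (x , y , x∈ , here refl , xy) ∷ [])
            (2F ∷ 4F ∷ []) (b₁ ∷ (c , c∈U , ac) ∷ []) K33-e K33-e-root
            (just 0F ∷ just 3F ∷ just 1F ∷ just 4F ∷ just 2F ∷ just 5F ∷ just 1F ∷ []) refl)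
          where
          ss : Vec (List (Fin n)) 6
          ss = L₁ ∷ L₂ ∷ U₁ ∷ (y ∷ []) ∷ U ∷ (l ∷ []) ∷ []

    module _ {v x e : Fin n} (av : A v ≡ true) (ax : A x ≡ true) (v≢x : v ≢ x)
             (third : ∀ {v x} → A v ≡ true → A x ≡ true → R v x → ∃ λ b → A b ≡ true × b ≢ v × b ≢ x)
             (ae : A e ≡ true) (free-e : ¬ Forb (Link D (A ─ e) ⁅ e ⁆) root) where

      -- Cut `Q` at its first attachment `a` and its last attachment `b`. By `third` they are not
      -- neighbours on `Q`, so the stretch between them is a third connection parallel to `L₁` and
      -- `L₂`. The private node of `e` completes K_{3,4} minus two links if `e` is strictly between,
      -- and the subdivided K_{2,4} if `e` is `a` or `b`.
      lens-pendant : ⊥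
      lens-pendant with split-first A Q (v , cover av , av)
      ... | X , a , Y , refl , aa , noX = rest-has (split-last A Y rest)
        where
        in-rest : ∀ {c} → A c ≡ true → c ≢ a → c ∈ Y
        in-rest {c} ac ne with ∈-++⁻ X (cover ac)
        ... | inj₁ m = ⊥-elim (true≢false ac (noX m))
        ... | inj₂ (here e) = ⊥-elim (ne e)
        ... | inj₂ (there m) = m
        rest : Has A Y
        rest with v ≟ a
        ... | no ne = v , in-rest av ne , av
        ... | yes refl = x , in-rest ax (v≢x ∘ sym) , ax
        rest-has : (∃₂ λ M b → ∃ λ Z → Y ≡ M ++ b ∷ Z × A b ≡ true × (∀ {c} → c ∈ Z → A c ≡ false)) → ⊥
        rest-has ([] , b , Z , refl , ab , noZ) with third aa ab (path-adjacent X pathQ)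
        ... | c , ac , c≢a , c≢b with in-rest ac c≢a
        ...   | here e′ = c≢b e′
        ...   | there m = true≢false ac (noZ m)
        rest-has (M@(m ∷ M′) , b , Z , refl , ab , noZ) = from-chain (chain qs ne (h , l , pQ))
          where
          qs : Vec (List (Fin n)) 3
          qs = (X ++ a ∷ []) ∷ M ∷ (b ∷ Z) ∷ []
          ss : Vec (List (Fin n)) 5
          ss = L₁ ∷ L₂ ∷ qs
          eq : X ++ a ∷ M ++ b ∷ Z ≡ concatV qs
          eq = sym (List.++-assoc X (a ∷ []) (M ++ b ∷ Z))
          ne : AllNE {R = R} qs
          ne = (a , ∈-++⁺ʳ X (here refl)) ∷ (m , here refl) ∷ (b , here refl) ∷ []
          pQ : Path R h (concatV qs) l
          pQ = subst (λ q → Path R h q l) eq pathQ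
          h∈ : h ∈ X ++ a ∷ []
          h∈ = concat-head {R = R} {ss = M ∷ (b ∷ Z) ∷ []} (ne-head ne) pQ
          l∈ : l ∈ b ∷ Z
          l∈ = concat-last {R = R} qs ne pQ
          a≢b : a ≢ b
          a≢b refl = uniq-disj (X ++ a ∷ []) (subst Unique eq (uniq-right L₂ (uniq-right L₁ uniq)))
                       (∈-++⁺ʳ X (here refl)) (∈-++⁺ʳ M (here refl))
          from-chain : Chain {R = R} qs → ⊥
          from-chain (link p₁ a₁ (link p₂ a₂ (last p₃))) = where-e (cover ae)
            where
            ob = obstruct-pend ss (uniq-disjV ss (subst (λ q → Unique (L₁ ++ L₂ ++ q)) eq uniq))
              (path₁ VAll.∷ path₂ VAll.∷ p₁ VAll.∷ p₂ VAll.∷ p₃ VAll.∷ VAll.[])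
              ((0F , 2F) ∷ (0F , 4F) ∷ (1F , 2F) ∷ (1F , 4F) ∷ (2F , 3F) ∷ (3F , 4F) ∷ [])
              (seg h₁ h∈ ∷ seg l₁ l∈ ∷ seg h₂ h∈ ∷ seg l₂ l∈ ∷ a₁ ∷ a₂ ∷ []) e
            a∈ : a ∈ X ++ a ∷ []
            a∈ = ∈-++⁺ʳ X (here refl)
            in-M : e ∈ M → e ≢ a → e ≢ b → ⊥
            in-M m′ e≢a e≢b = free-e (inj₂ (inj₂ (inj₁ (ob 3F m′ (2F ∷ 4F ∷ [])
              ((a , a∈ , aa , (e≢a ∘ sym)) ∷ (b , here refl , ab , (e≢b ∘ sym)) ∷ [])
              K34-2e K34-2e-root (just 5F ∷ just 2F ∷ just 3F ∷ just 4F ∷ just 0F ∷ just 6F ∷ just 1F ∷ []) refl))))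
            at-a : e ≡ a → ⊥
            at-a refl = free-e (inj₂ (inj₂ (inj₂ (ob 2F a∈ (4F ∷ []) ((b , here refl , ab , (a≢b ∘ sym)) ∷ [])
              K24-sub K24-sub-root (just 6F ∷ just 2F ∷ just 3F ∷ just 4F ∷ just 1F ∷ just 5F ∷ just 0F ∷ []) refl))))
            at-b : e ≡ b → ⊥
            at-b refl = free-e (inj₂ (inj₂ (inj₂ (ob 4F (here refl) (2F ∷ []) ((a , a∈ , aa , a≢b) ∷ [])
              K24-sub K24-sub-root (just 6F ∷ just 2F ∷ just 3F ∷ just 4F ∷ just 0F ∷ just 5F ∷ just 1F ∷ []) refl))))
            where-e : e ∈ X ++ a ∷ M ++ b ∷ Z → ⊥
            where-e m′ with e ≟ a | e ≟ b
            ... | yes p | _ = at-a p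
            ... | no _ | yes p = at-b p
            ... | no e≢a | no e≢b with ∈-++⁻ M (in-rest ae e≢a)
            ...   | inj₁ q = in-M q e≢a e≢b
            ...   | inj₂ (here p) = e≢b p
            ...   | inj₂ (there q) = true≢false ae (noZ q)

-- Ears of a cycle in a graph without cut nodes

module _ {V : Set} where
  ∈-rev : ∀ {v} {xs : List V} → v ∈ reverse xs → v ∈ xs
  ∈-rev = Any.reverse⁻

  rev-∈ : ∀ {v} {xs : List V} → v ∈ xs → v ∈ reverse xs
  rev-∈ = Any.reverse⁺

  uniq-reverse : ∀ {xs : List V} → Unique xs → Unique (reverse xs)
  uniq-reverse {[]} u = u
  uniq-reverse {x ∷ xs} (p ∷ u) = subst Unique (sym (List.unfold-reverse x xs))
    (uniq-++ (uniq-reverse u) ([] ∷ []) λ { a (here refl) → All.lookup p (∈-rev a) refl })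

  reverse-ends : ∀ {p q : V} Ks → reverse (p ∷ Ks ++ q ∷ []) ≡ q ∷ reverse Ks ++ p ∷ []
  reverse-ends {p} {q} Ks = trans (List.unfold-reverse p (Ks ++ q ∷ [])) (cong (_++ p ∷ []) (List.reverse-++ Ks (q ∷ [])))

  path-cut : ∀ {R : V → V → Set} {u w a} X {Y} → Path R u (X ++ a ∷ Y) w → Path R u (X ++ a ∷ []) a × Path R a (a ∷ Y) w
  path-cut [] p with path-head p
  ... | refl = ⟨ _ ⟩ , p
  path-cut (x ∷ []) (r ∺ p) with path-head p
  ... | refl = r ∺ ⟨ _ ⟩ , p
  path-cut (x ∷ x′ ∷ X) (r ∺ p) with path-cut (x′ ∷ X) p
  ... | p₁ , p₂ = r ∺ p₁ , p₂

TwoConnected : ∀ {n} → Rel n → Set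
TwoConnected D = ∀ z {u w} → Active D u → Active D w → u ≢ z → w ≢ z → Conn (D ∖ z) u w

avoid : ∀ {n} {D : Rel n} {w u xs z} → u ≢ w → Path (Adj (D ∖ w)) u xs z → ∀ {v} → v ∈ xs → v ≢ w
avoid ne ⟨ _ ⟩ (here refl) = ne
avoid ne (r ∺ p) (here refl) = ne
avoid {D = D} {w} {u} ne (_∺_ {v = j} r p) (there m) = avoid {D = D} (proj₂ (proj₂ (∖-inv {D = D} {w} {u} {j} r))) p m

module Ears {n} {D : Rel n} (sD : Symm D) (two : TwoConnected D) (C : List (Fin n)) (act : ∀ {v} → v ∈ C → Active D v) where
  R : Fin n → Fin n → Set
  R = Adj D

  record Ear : Set where
    field
      {p q} : Fin n
      Ks    : List (Fin n)
      p∈    : p ∈ C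
      q∈    : q ∈ C
      path  : Path R p (p ∷ Ks ++ q ∷ []) q
      uniq  : Unique (p ∷ Ks ++ q ∷ [])
      off   : ∀ {v} → v ∈ Ks → v ∉ C
    p≢q : p ≢ q
    p≢q e = uniq-disj (p ∷ []) uniq (here refl) (∈-++⁺ʳ Ks (here e))

    flip : Σ (List (Fin n)) λ Ks′ → Path R q (q ∷ Ks′ ++ p ∷ []) p × Unique (q ∷ Ks′ ++ p ∷ []) ×
      (∀ {v} → v ∈ Ks′ → v ∈ Ks) × (∀ {v} → v ∈ Ks → v ∈ Ks′)
    flip = reverse Ks , subst (λ l → Path R q l p) (reverse-ends Ks) (path-reverse (λ e → flip-adj sD e) path) ,
           subst Unique (reverse-ends Ks) (uniq-reverse uniq) , ∈-rev , rev-∈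

  flip-ear : Ear → Ear
  flip-ear E = let (Ks′ , p , u , f , _) = Ear.flip E in
    record { Ks = Ks′ ; p∈ = Ear.q∈ E ; q∈ = Ear.p∈ E ; path = p ; uniq = u ; off = λ m → Ear.off E (f m) }

  walk-to : ∀ {P : Fin n → Set} → (∀ v → Dec (P v)) → ∀ {z₀ w c} → w ≢ z₀ → ¬ P w → Conn (D ∖ z₀) w c → P c →
    ∃₂ λ z ys → P z × z ≢ z₀ × w ∈ ys × Path R w (ys ++ z ∷ []) z × Unique (ys ++ z ∷ []) ×
      (∀ {v} → v ∈ ys → ¬ P v) × (∀ {v} → v ∈ ys → v ≢ z₀)
  walk-to {P} P? {z₀} {w} {c} w≢ ¬pw cn pc with first-hit {R = Adj (D ∖ z₀)} P? cn pc
  ... | z , pz , s with simple-path s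
  ...   | xs , pa , u with path-unhit {R = Adj (D ∖ z₀)} pa
  ...     | ys , refl , f = z , ys , pz , av (path-last∈ pa) , w∈ , path-map (λ {a} {b} r → proj₁ (∖-inv {D = D} {z₀} {a} {b} (proj₁ r))) pa , u , f ,
                            λ m → av (∈-++⁺ˡ m)
    where
    av : ∀ {v} → v ∈ ys ++ z ∷ [] → v ≢ z₀
    av = avoid {D = D} w≢ (path-map proj₁ pa)
    w∈ : w ∈ ys
    w∈ with ∈-++⁻ ys (path-head∈ pa)
    ... | inj₁ m = m
    ... | inj₂ (here refl) = ⊥-elim (¬pw pz)

  -- Removing `p` leaves `w` connected to the rest of the cycle, and the first return to the cycle
  -- closes the ear.
  start-ear : ∀ {p w c} → p ∈ C → w ∉ C → R p w → c ∈ C → c ≢ p → Σ Ear λ E → Ear.p E ≡ p × w ∈ Ear.Ks E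
  start-ear {p} {w} {c} p∈ w∉ pw c∈ c≢p
    with walk-to (_∈? C) {p} {w} (λ { refl → w∉ p∈ }) w∉ (two p (p , flip-adj sD pw) (act c∈) (λ { refl → w∉ p∈ }) c≢p) c∈
  ... | z , ys , z∈ , z≢p , w∈ , pa , u , off , _ = record
    { Ks = ys ; p∈ = p∈ ; q∈ = z∈ ; path = pw ∺ pa
    ; uniq = uniq-++ ([] ∷ []) u λ { (here refl) b → case ∈-++⁻ ys b of λ { (inj₁ m) → off m p∈ ; (inj₂ (here e)) → z≢p (sym e) } }
    ; off = off } , refl , w∈

  attach : (E : Ear) → let open Ear E in ∀ {K₁ w K₂ ys Y q′ z w′} → Ks ≡ K₁ ++ w ∷ K₂ → R w w′ →
    Path R w′ (ys ++ z ∷ []) z → Path R z (Y ++ q′ ∷ []) q′ → Unique ys → Unique (Y ++ q′ ∷ []) → q′ ∈ C →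
    (∀ {v} → v ∈ Y → v ∉ C) → (∀ {v} → v ∈ ys → v ∉ C × v ∉ Ks × v ∉ Y ++ q′ ∷ []) →
    (∀ {v} → v ∈ p ∷ K₁ ++ w ∷ [] → v ∉ Y ++ q′ ∷ []) → ∀ {v} → v ∈ ys → Σ Ear λ E′ → v ∈ Ear.Ks E′
  attach E {K₁} {w} {K₂} {ys} {Y} {q′} {z} {w′} refl ww′ pa pb uy uB q′∈ offY offy dj {v} v∈ = record
    { Ks = K₁ ++ w ∷ ys ++ Y ; p∈ = p∈ ; q∈ = q′∈
    ; path = subst (λ l → Path R p l q′) eq (path-++ front ww′ (join ys pa pb))
    ; uniq = subst Unique eq (uniq-++ uA (uniq-++ uy uB λ a b → proj₂ (proj₂ (offy a)) b) disj)
    ; off = λ m → case ∈-++⁻ K₁ m of λ where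
        (inj₁ a) → off (∈-++⁺ˡ a)
        (inj₂ (here refl)) → off (∈-++⁺ʳ K₁ (here refl))
        (inj₂ (there b)) → case ∈-++⁻ ys b of λ where
          (inj₁ c) → proj₁ (offy c)
          (inj₂ c) → offY c
    } , ∈-++⁺ʳ K₁ (there (∈-++⁺ˡ v∈))
    where
    open Ear E
    join : ∀ {u q Z} ys → Path R u (ys ++ z ∷ []) z → Path R z Z q → Path R u (ys ++ Z) q
    join [] p p′ with path-head p
    ... | refl = p′
    join (y ∷ []) (r ∺ p) p′ with path-head p
    ... | refl = r ∺ p′
    join (y ∷ y′ ∷ ys) (r ∺ p) p′ = r ∺ join (y′ ∷ ys) p p′
    A = p ∷ K₁ ++ w ∷ []
    eqA : p ∷ (K₁ ++ w ∷ K₂) ++ q ∷ [] ≡ (p ∷ K₁) ++ w ∷ (K₂ ++ q ∷ [])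
    eqA = cong (p ∷_) (List.++-assoc K₁ (w ∷ K₂) (q ∷ []))
    front : Path R p A w
    front = proj₁ (path-cut (p ∷ K₁) (subst (λ l → Path R p l q) eqA path))
    uA : Unique A
    uA = uniq-left A (subst Unique (trans eqA (cong (p ∷_) (sym (List.++-assoc K₁ (w ∷ []) _)))) uniq)
    eq : A ++ (ys ++ (Y ++ q′ ∷ [])) ≡ p ∷ (K₁ ++ w ∷ ys ++ Y) ++ q′ ∷ []
    eq = cong (p ∷_) (trans (List.++-assoc K₁ (w ∷ []) _)
      (trans (cong (λ l → K₁ ++ w ∷ l) (sym (List.++-assoc ys Y (q′ ∷ [])))) (sym (List.++-assoc K₁ (w ∷ ys ++ Y) (q′ ∷ [])))))
    disj : ∀ {x} → x ∈ A → x ∈ ys ++ (Y ++ q′ ∷ []) → ⊥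
    disj a b with ∈-++⁻ ys b
    ... | inj₂ c = dj a c
    ... | inj₁ c with a
    ...   | here refl = proj₁ (offy c) p∈
    ...   | there a′ with ∈-++⁻ K₁ a′
    ...     | inj₁ d = proj₁ (proj₂ (offy c)) (∈-++⁺ˡ d)
    ...     | inj₂ (here refl) = proj₁ (proj₂ (offy c)) (∈-++⁺ʳ K₁ (here refl))

  -- The new branch ends at z, on C or behind w on the ear.
  extend-right : (E : Ear) → let open Ear E in ∀ {K₁ w K₂ ys z w′} → Ks ≡ K₁ ++ w ∷ K₂ → R w w′ →
    Path R w′ (ys ++ z ∷ []) z → Unique (ys ++ z ∷ []) → (∀ {v} → v ∈ ys → v ∉ C × v ∉ Ks) →
    (z ∈ C × z ≢ p) ⊎ z ∈ K₂ → ∀ {v} → v ∈ ys → Σ Ear λ E′ → v ∈ Ear.Ks E′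
  extend-right E {K₁} {w} {K₂} {ys} {z} refl ww′ pa u offy (inj₁ (z∈ , z≢p)) =
    attach E {K₁} {w} {K₂} {ys} {[]} refl ww′ pa ⟨ z ⟩ (uniq-left ys u) ([] ∷ []) z∈ (λ ())
      (λ m → proj₁ (offy m) , proj₂ (offy m) , λ { (here refl) → proj₁ (offy m) z∈ })
      λ { (here refl) (here e) → z≢p (sym e)
        ; (there m) (here refl) → case ∈-++⁻ K₁ m of λ where
            (inj₁ a) → Ear.off E (∈-++⁺ˡ a) z∈
            (inj₂ (here refl)) → Ear.off E (∈-++⁺ʳ K₁ (here refl)) z∈ }
  extend-right E {K₁} {w} {K₂} {ys} {z} refl ww′ pa u offy (inj₂ z∈) with ∈-∃++ z∈
  ... | X , Y , refl =
    attach E {K₁} {w} {X ++ z ∷ Y} {ys} {z ∷ Y} refl ww′ pa (proj₂ (path-cut ((p ∷ K₁) ++ w ∷ X) (subst (λ l → Path R p l q) eq path)))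
      (uniq-left ys u) (uniq-right ((p ∷ K₁) ++ w ∷ X) (subst Unique eq uniq)) q∈
      (λ { (here refl) → off (∈-++⁺ʳ K₁ (there (∈-++⁺ʳ X (here refl))))
         ; (there m) → off (∈-++⁺ʳ K₁ (there (∈-++⁺ʳ X (there m)))) })
      (λ m → proj₁ (offy m) , proj₂ (offy m) , λ b → case ∈-++⁻ (z ∷ Y) b of λ where
         (inj₁ c) → proj₂ (offy m) (∈-++⁺ʳ K₁ (there (∈-++⁺ʳ X c)))
         (inj₂ (here refl)) → proj₁ (offy m) q∈)
      (λ a b → uniq-disj ((p ∷ K₁) ++ w ∷ X) (subst Unique eq uniq) (sub a) b)
    where
    open Ear E
    eq : p ∷ (K₁ ++ w ∷ X ++ z ∷ Y) ++ q ∷ [] ≡ ((p ∷ K₁) ++ w ∷ X) ++ z ∷ (Y ++ q ∷ [])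
    eq = trans (cong (λ l → p ∷ l ++ q ∷ []) (sym (List.++-assoc K₁ (w ∷ X) (z ∷ Y))))
               (cong (p ∷_) (List.++-assoc (K₁ ++ w ∷ X) (z ∷ Y) (q ∷ [])))
    sub : ∀ {v} → v ∈ p ∷ K₁ ++ w ∷ [] → v ∈ (p ∷ K₁) ++ w ∷ X
    sub (here e) = here e
    sub (there m) with ∈-++⁻ K₁ m
    ... | inj₁ a = there (∈-++⁺ˡ a)
    ... | inj₂ (here refl) = there (∈-++⁺ʳ K₁ (here refl))

  -- After removing `w`, some walk leads from `w′` to a first node `z` of the cycle or the ear. If
  -- `z` is on the ear, the detour replaces the stretch between `w` and `z`; if `z` is on the cycle,
  -- it becomes an end of the new ear, the other being an end of the old ear different from `z`.
  -- Reversal reduces all cases to `extend-right`.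
  extend : (E : Ear) → ∀ {w w′} → w ∈ Ear.Ks E → R w w′ → w′ ∉ C → w′ ∉ Ear.Ks E → Σ Ear λ E′ → w′ ∈ Ear.Ks E′
  extend E {w} {w′} w∈ ww′ w′∉C w′∉K
    with walk-to (λ v → (v ∈? C) ⊎-dec (v ∈? Ear.Ks E)) {w} {w′} {Ear.q E} (λ { refl → w′∉K w∈ })
           (λ { (inj₁ m) → w′∉C m ; (inj₂ m) → w′∉K m })
           (two w (w , flip-adj sD ww′) (act (Ear.q∈ E)) (λ { refl → w′∉K w∈ }) (λ { refl → Ear.off E w∈ (Ear.q∈ E) }))
           (inj₁ (Ear.q∈ E))
  ... | z , ys , pz , z≢w , w′∈ , pa , u , off , _ = place pz
    where
    open Ear E using (p; q; Ks; p≢q)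
    offy : ∀ {v} → v ∈ ys → v ∉ C × v ∉ Ks
    offy m = (λ a → off m (inj₁ a)) , (λ a → off m (inj₂ a))
    flipped : (z ∈ C × z ≢ q) ⊎ (∃₂ λ K₁ K₂ → reverse Ks ≡ K₁ ++ w ∷ K₂ × z ∈ K₂) → Σ Ear λ E′ → w′ ∈ Ear.Ks E′
    flipped (inj₁ h) with ∈-∃++ (rev-∈ w∈)
    ... | K₁ , K₂ , e = extend-right (flip-ear E) {K₁} e ww′ pa u (λ m → proj₁ (offy m) , λ a → proj₂ (offy m) (∈-rev a)) (inj₁ h) w′∈
    flipped (inj₂ (K₁ , K₂ , e , m′)) = extend-right (flip-ear E) {K₁} e ww′ pa u (λ m → proj₁ (offy m) , λ a → proj₂ (offy m) (∈-rev a)) (inj₂ m′) w′∈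
    place : z ∈ C ⊎ z ∈ Ks → Σ Ear λ E′ → w′ ∈ Ear.Ks E′
    place (inj₁ z∈) with z ≟ p
    ... | yes refl = flipped (inj₁ (z∈ , p≢q))
    ... | no z≢p with ∈-∃++ w∈
    ...   | K₁ , K₂ , e = extend-right E {K₁} e ww′ pa u offy (inj₁ (z∈ , z≢p)) w′∈
    place (inj₂ z∈) with ∈-∃++ w∈
    ... | K₁ , K₂ , e with ∈-++⁻ K₁ (subst (z ∈_) e z∈)
    ...   | inj₂ (here z≡w) = ⊥-elim (z≢w z≡w)
    ...   | inj₂ (there m) = extend-right E {K₁} e ww′ pa u offy (inj₂ m) w′∈
    ...   | inj₁ m = flipped (inj₂ (reverse K₂ , reverse K₁ , eqr , rev-∈ m))
      where
      eqr : reverse Ks ≡ reverse K₂ ++ w ∷ reverse K₁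
      eqr = trans (cong reverse e) (trans (List.reverse-++ K₁ (w ∷ K₂))
        (trans (cong (_++ reverse K₁) (List.unfold-reverse w K₂)) (List.++-assoc (reverse K₂) (w ∷ []) (reverse K₁))))

  -- An ear is pushed along a walk to `b`: a step off the cycle starts one, a step off the current
  -- ear extends it.
  ear-through : ∀ {c c′ b} → c ∈ C → c′ ∈ C → c ≢ c′ → Conn D c b → b ∉ C → Σ Ear λ E → b ∈ Ear.Ks E
  ear-through {c} {c′} c∈ c′∈ ne cn b∉ = case scan (inj₁ c∈) cn of λ { (inj₁ m) → ⊥-elim (b∉ m) ; (inj₂ h) → h }
    where
    other : ∀ p → ∃ λ x → x ∈ C × x ≢ p
    other p with c ≟ p
    ... | no x = c , c∈ , x
    ... | yes refl = c′ , c′∈ , ne ∘ sym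
    scan : ∀ {u b} → u ∈ C ⊎ (Σ Ear λ E → u ∈ Ear.Ks E) → Conn D u b → b ∈ C ⊎ (Σ Ear λ E → b ∈ Ear.Ks E)
    scan s ε = s
    scan {u} s (_◅_ {j = v} e es) with v ∈? C
    ... | yes m = scan (inj₁ m) es
    scan {u} (inj₁ u∈) (_◅_ {j = v} e es) | no v∉ with other u
    ... | x , x∈ , x≢ = let (E , _ , m) = start-ear u∈ v∉ e x∈ x≢ in scan (inj₂ (E , m)) es
    scan {u} (inj₂ (E , m)) (_◅_ {j = v} e es) | no v∉ with v ∈? Ear.Ks E
    ... | yes m′ = scan (inj₂ (E , m′)) es
    ... | no v∉K = scan (inj₂ (extend E m e v∉ v∉K)) es

-- Crossing chords of a cycle

record Crossing {n} (D : Rel n) (C : List (Fin n)) : Set where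
  constructor crossing
  field
    {p r q s} : Fin n
    s₁ s₂ s₃ s₄ : List (Fin n)
    rot : Rot C (p ∷ s₁ ++ r ∷ s₂ ++ q ∷ s₃ ++ s ∷ s₄)
    pq : Adj D p q
    rs : Adj D r s

module Cycles {n} {D : Rel n} (sD : Symm D) {A : VSet n} (free : ¬ Forb (Link D A none) root) where
  open Obstruct sD A
  open Lenses sD {A} free

  Third : Set
  Third = ∀ {v x} → A v ≡ true → A x ≡ true → R v x → ∃ λ b → A b ≡ true × b ≢ v × b ≢ x

  record Cycle : Set where
    field
      C     : List (Fin n)
      ring  : Ring {R = R} C
      uniq  : Unique C

  module _ (K : Cycle) (cover : ∀ {a} → A a ≡ true → a ∈ Cycle.C K) where
    open Cycle K

    rotate : Crossing D C → Crossing D C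
    rotate (crossing {p} {r} {q} {s} s₁ s₂ s₃ s₄ rot pq rs) = crossing s₂ s₃ s₄ s₁
      (rot-trans rot (p ∷ s₁ , r ∷ s₂ ++ q ∷ s₃ ++ s ∷ s₄ , refl ,
        cong (r ∷_) (trans (cong (s₂ ++_) (sym (List.++-assoc (q ∷ s₃) (s ∷ s₄) (p ∷ s₁)))) (sym (List.++-assoc s₂ (q ∷ s₃ ++ s ∷ s₄) (p ∷ s₁))))))
      rs (flip-adj sD pq)

    rotate³ : Crossing D C → Crossing D C
    rotate³ X = rotate (rotate (rotate X))

    module _ (X : Crossing D C) where
      open Crossing X
      private
        L : List (Fin n)
        L = p ∷ s₁ ++ r ∷ s₂ ++ q ∷ s₃ ++ s ∷ s₄
        ringL : Ring {R = R} L
        ringL = ring-rot rot ring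
        uniqL : Unique L
        uniqL = rot-uniq rot uniq
        Z : List (Fin n)
        Z = s₃ ++ s ∷ s₄
        s∈Z : s ∈ Z
        s∈Z = ∈-++⁺ʳ s₃ (here refl)

      eqR : ∀ l → p ∷ s₁ ++ r ∷ l ≡ p ∷ (s₁ ++ r ∷ []) ++ l
      eqR l = cong (p ∷_) (sym (List.++-assoc s₁ (r ∷ []) l))

      eqT : p ∷ s₁ ++ r ∷ s₂ ++ q ∷ Z ≡ p ∷ (s₁ ++ r ∷ s₂) ++ q ∷ Z
      eqT = cong (p ∷_) (sym (List.++-assoc s₁ (r ∷ s₂) (q ∷ Z)))

      -- The chord merges `p` and `q` into one node of K_{3,3}, on the side of `r` and the root; the
      -- other side is `s₁`, `s₂` and the stretch with `s`. This and the next three lemmas cover, up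
      -- to rotation, an attachment inside `s₁` together with one off the closed arc from `p` to
      -- `r`.
      pair-s₁s₂ : Has A s₁ → Has A s₂ → ⊥
      pair-s₁s₂ b₁ b₂ with chain ss ne (ring-path rg) | ring-close ss ne rg
        where
        ss : Vec (List (Fin n)) 6
        ss = (p ∷ []) ∷ s₁ ∷ (r ∷ []) ∷ s₂ ∷ (q ∷ []) ∷ Z ∷ []
        ne : AllNE {R = R} ss
        ne = (p , here refl) ∷ has-ne {A = A} b₁ ∷ (r , here refl) ∷ has-ne {A = A} b₂ ∷ (q , here refl) ∷ (s , s∈Z) ∷ []
        rg : Ring {R = R} (concatV ss)
        rg = ringL
      ... | link p1 a1 (link p2 a2 (link p3 a3 (link p4 a4 (link p5 a5 (last p6))))) | c =
        K33 (obstruct ss (uniq-disjV ss (uniqL)) (p1 VAll.∷ p2 VAll.∷ p3 VAll.∷ p4 VAll.∷ p5 VAll.∷ p6 VAll.∷ VAll.[])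
          ((0F , 1F) ∷ (1F , 2F) ∷ (2F , 3F) ∷ (3F , 4F) ∷ (4F , 5F) ∷ (5F , 0F) ∷ (2F , 5F) ∷ (0F , 4F) ∷ [])
          (a1 ∷ a2 ∷ a3 ∷ a4 ∷ a5 ∷ c ∷ (r , s , here refl , s∈Z , rs) ∷ (p , q , here refl , here refl , pq) ∷ [])
          (1F ∷ 3F ∷ []) (b₁ ∷ b₂ ∷ []) K33-e K33-e-root
          (just 0F ∷ just 1F ∷ just 4F ∷ just 2F ∷ just 5F ∷ just 1F ∷ just 3F ∷ []) refl)
        where
        ss : Vec (List (Fin n)) 6
        ss = (p ∷ []) ∷ s₁ ∷ (r ∷ []) ∷ s₂ ∷ (q ∷ []) ∷ Z ∷ []

      pair-ps₂ : A p ≡ true → Has A s₂ → ⊥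
      pair-ps₂ b₁ b₂ with chain ss ne (ring-path rg) | ring-close ss ne rg
        where
        ss : Vec (List (Fin n)) 5
        ss = (p ∷ []) ∷ (s₁ ++ r ∷ []) ∷ s₂ ∷ (q ∷ []) ∷ Z ∷ []
        ne : AllNE {R = R} ss
        ne = (p , here refl) ∷ (r , ∈-++⁺ʳ s₁ (here refl)) ∷ has-ne {A = A} b₂ ∷ (q , here refl) ∷ (s , s∈Z) ∷ []
        rg : Ring {R = R} (concatV ss)
        rg = subst Ring (eqR (s₂ ++ q ∷ Z)) ringL
      ... | link p1 a1 (link p2 a2 (link p3 a3 (link p4 a4 (last p5)))) | c =
        K33 (obstruct ss (uniq-disjV ss (subst Unique (eqR (s₂ ++ q ∷ Z)) uniqL)) (p1 VAll.∷ p2 VAll.∷ p3 VAll.∷ p4 VAll.∷ p5 VAll.∷ VAll.[])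
          ((0F , 1F) ∷ (1F , 2F) ∷ (2F , 3F) ∷ (3F , 4F) ∷ (4F , 0F) ∷ (1F , 4F) ∷ (0F , 3F) ∷ [])
          (a1 ∷ a2 ∷ a3 ∷ a4 ∷ c ∷ (r , s , ∈-++⁺ʳ s₁ (here refl) , s∈Z , rs) ∷ (p , q , here refl , here refl , pq) ∷ [])
          (0F ∷ 2F ∷ []) ((p , here refl , b₁) ∷ b₂ ∷ []) K33-e K33-e-root
          (just 0F ∷ just 4F ∷ just 1F ∷ just 5F ∷ just 2F ∷ just 3F ∷ []) refl)
        where
        ss : Vec (List (Fin n)) 5
        ss = (p ∷ []) ∷ (s₁ ++ r ∷ []) ∷ s₂ ∷ (q ∷ []) ∷ Z ∷ []

      pair-s₁q : Has A s₁ → A q ≡ true → ⊥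
      pair-s₁q b₁ b₂ with chain ss ne (ring-path rg) | ring-close ss ne rg
        where
        ss : Vec (List (Fin n)) 5
        ss = (p ∷ []) ∷ s₁ ∷ (r ∷ s₂) ∷ (q ∷ []) ∷ Z ∷ []
        ne : AllNE {R = R} ss
        ne = (p , here refl) ∷ has-ne {A = A} b₁ ∷ (r , here refl) ∷ (q , here refl) ∷ (s , s∈Z) ∷ []
        rg : Ring {R = R} (concatV ss)
        rg = ringL
      ... | link p1 a1 (link p2 a2 (link p3 a3 (link p4 a4 (last p5)))) | c =
        K33 (obstruct ss (uniq-disjV ss (uniqL)) (p1 VAll.∷ p2 VAll.∷ p3 VAll.∷ p4 VAll.∷ p5 VAll.∷ VAll.[])
          ((0F , 1F) ∷ (1F , 2F) ∷ (2F , 3F) ∷ (3F , 4F) ∷ (4F , 0F) ∷ (2F , 4F) ∷ (0F , 3F) ∷ [])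
          (a1 ∷ a2 ∷ a3 ∷ a4 ∷ c ∷ (r , s , here refl , s∈Z , rs) ∷ (p , q , here refl , here refl , pq) ∷ [])
          (1F ∷ 3F ∷ []) (b₁ ∷ (q , here refl , b₂) ∷ []) K33-e K33-e-root
          (just 0F ∷ just 1F ∷ just 4F ∷ just 2F ∷ just 5F ∷ just 3F ∷ []) refl)
        where
        ss : Vec (List (Fin n)) 5
        ss = (p ∷ []) ∷ s₁ ∷ (r ∷ s₂) ∷ (q ∷ []) ∷ Z ∷ []

      pair-s₁s₃ : Has A s₁ → Has A s₃ → ⊥
      pair-s₁s₃ b₁ b₃ with chain ss ne (ring-path rg) | ring-close ss ne rg
        where
        ss : Vec (List (Fin n)) 6
        ss = (p ∷ []) ∷ s₁ ∷ (r ∷ s₂) ∷ (q ∷ []) ∷ s₃ ∷ (s ∷ s₄) ∷ []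
        ne : AllNE {R = R} ss
        ne = (p , here refl) ∷ has-ne {A = A} b₁ ∷ (r , here refl) ∷ (q , here refl) ∷ has-ne {A = A} b₃ ∷ (s , here refl) ∷ []
        rg : Ring {R = R} (concatV ss)
        rg = ringL
      ... | link p1 a1 (link p2 a2 (link p3 a3 (link p4 a4 (link p5 a5 (last p6))))) | c =
        K33 (obstruct ss (uniq-disjV ss (uniqL)) (p1 VAll.∷ p2 VAll.∷ p3 VAll.∷ p4 VAll.∷ p5 VAll.∷ p6 VAll.∷ VAll.[])
          ((0F , 1F) ∷ (1F , 2F) ∷ (2F , 3F) ∷ (3F , 4F) ∷ (4F , 5F) ∷ (5F , 0F) ∷ (2F , 5F) ∷ (0F , 3F) ∷ [])
          (a1 ∷ a2 ∷ a3 ∷ a4 ∷ a5 ∷ c ∷ (r , s , here refl , here refl , rs) ∷ (p , q , here refl , here refl , pq) ∷ [])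
          (1F ∷ 4F ∷ []) (b₁ ∷ b₃ ∷ []) K33-e K33-e-root
          (just 0F ∷ just 1F ∷ just 3F ∷ just 2F ∷ just 4F ∷ just 0F ∷ just 5F ∷ []) refl)
        where
        ss : Vec (List (Fin n)) 6
        ss = (p ∷ []) ∷ s₁ ∷ (r ∷ s₂) ∷ (q ∷ []) ∷ s₃ ∷ (s ∷ s₄) ∷ []

      triple-R : A p ≡ true → A q ≡ true → Has A (s₁ ++ r ∷ s₂) → ⊥
      triple-R ap aq b with chain ss ne (ring-path rg) | ring-close ss ne rg
        where
        ss : Vec (List (Fin n)) 4
        ss = (p ∷ []) ∷ (s₁ ++ r ∷ s₂) ∷ (q ∷ []) ∷ Z ∷ []
        ne : AllNE {R = R} ss
        ne = (p , here refl) ∷ (r , ∈-++⁺ʳ s₁ (here refl)) ∷ (q , here refl) ∷ (s , s∈Z) ∷ []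
        rg : Ring {R = R} (concatV ss)
        rg = subst Ring eqT ringL
      ... | link p1 a1 (link p2 a2 (link p3 a3 (last p4))) | c =
        K5 (obstruct ss (uniq-disjV ss (subst Unique eqT uniqL)) (p1 VAll.∷ p2 VAll.∷ p3 VAll.∷ p4 VAll.∷ VAll.[])
          ((0F , 1F) ∷ (1F , 2F) ∷ (2F , 3F) ∷ (3F , 0F) ∷ (1F , 3F) ∷ (0F , 2F) ∷ [])
          (a1 ∷ a2 ∷ a3 ∷ c ∷ (r , s , ∈-++⁺ʳ s₁ (here refl) , s∈Z , rs) ∷ (p , q , here refl , here refl , pq) ∷ [])
          (0F ∷ 2F ∷ 1F ∷ []) ((p , here refl , ap) ∷ (q , here refl , aq) ∷ b ∷ []) K5-e K5-e-root
          (just 0F ∷ just 2F ∷ just 3F ∷ just 4F ∷ just 1F ∷ []) refl)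
        where
        ss : Vec (List (Fin n)) 4
        ss = (p ∷ []) ∷ (s₁ ++ r ∷ s₂) ∷ (q ∷ []) ∷ Z ∷ []

      triple-Z : A p ≡ true → A q ≡ true → Has A Z → ⊥
      triple-Z ap aq b with chain ss ne (ring-path rg) | ring-close ss ne rg
        where
        ss : Vec (List (Fin n)) 4
        ss = (p ∷ []) ∷ (s₁ ++ r ∷ s₂) ∷ (q ∷ []) ∷ Z ∷ []
        ne : AllNE {R = R} ss
        ne = (p , here refl) ∷ (r , ∈-++⁺ʳ s₁ (here refl)) ∷ (q , here refl) ∷ (s , s∈Z) ∷ []
        rg : Ring {R = R} (concatV ss)
        rg = subst Ring eqT ringL
      ... | link p1 a1 (link p2 a2 (link p3 a3 (last p4))) | c =
        K5 (obstruct ss (uniq-disjV ss (subst Unique eqT uniqL)) (p1 VAll.∷ p2 VAll.∷ p3 VAll.∷ p4 VAll.∷ VAll.[])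
          ((0F , 1F) ∷ (1F , 2F) ∷ (2F , 3F) ∷ (3F , 0F) ∷ (1F , 3F) ∷ (0F , 2F) ∷ [])
          (a1 ∷ a2 ∷ a3 ∷ c ∷ (r , s , ∈-++⁺ʳ s₁ (here refl) , s∈Z , rs) ∷ (p , q , here refl , here refl , pq) ∷ [])
          (0F ∷ 2F ∷ 3F ∷ []) ((p , here refl , ap) ∷ (q , here refl , aq) ∷ b ∷ []) K5-e K5-e-root
          (just 0F ∷ just 2F ∷ just 1F ∷ just 3F ∷ just 4F ∷ []) refl)
        where
        ss : Vec (List (Fin n)) 4
        ss = (p ∷ []) ∷ (s₁ ++ r ∷ s₂) ∷ (q ∷ []) ∷ Z ∷ []

      triple : A p ≡ true → A q ≡ true → ∀ {c} → A c ≡ true → c ≢ p → c ≢ q → ⊥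
      triple ap aq {c} ac c≢p c≢q with ∈-++⁻ (p ∷ s₁ ++ r ∷ s₂) (subst (c ∈_) eqT (rot-∈ rot (cover ac)))
      ... | inj₁ (here e) = c≢p e
      ... | inj₁ (there m) = triple-R ap aq (c , m , ac)
      ... | inj₂ (here e) = c≢q e
      ... | inj₂ (there m) = triple-Z ap aq (c , m , ac)

      arc-Q arc-L : List (Fin n)
      arc-Q = p ∷ s₁ ++ r ∷ []
      arc-L = s₂ ++ q ∷ []

      arc-eq : L ≡ arc-Q ++ arc-L ++ Z
      arc-eq = trans (eqR (s₂ ++ q ∷ Z)) (cong (λ l → p ∷ (s₁ ++ r ∷ []) ++ l) (sym (List.++-assoc s₂ (q ∷ []) Z)))

      arc-rot : Rot C (arc-Q ++ arc-L ++ Z)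
      arc-rot = subst (Rot C) arc-eq rot

      -- The chords make both remaining arcs reach both ends. `arc-L` meets `r` along the cycle and
      -- `p` by the chord from `q`; `Z` meets `p` along the cycle and `r` by the chord from `s`.
      arc-lens : (∀ {a} → A a ≡ true → a ∈ arc-Q) → Lens arc-Q arc-L Z × SegAdj R arc-L Z
      arc-lens cov with ringL
      ... | u , w , pa , wu with path-head pa | path-cut (p ∷ s₁) pa
      ...   | refl | front , back with chain ss ne (r , w , subst (λ l → Path R r (r ∷ l) w) (sym (List.++-assoc s₂ (q ∷ []) Z)) back)
        where
        ss : Vec (List (Fin n)) 3
        ss = (r ∷ []) ∷ arc-L ∷ Z ∷ []
        ne : AllNE {R = R} ss
        ne = (r , here refl) ∷ (q , ∈-++⁺ʳ s₂ (here refl)) ∷ (s , s∈Z) ∷ []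
      ...     | link p₁ (_ , x , here refl , x∈ , rx) (link p₂ a₂ (last p₃)) = record
        { h = p ; l = r ; pathQ = front ; path₁ = p₂ ; path₂ = p₃
        ; h₁ = q , ∈-++⁺ʳ s₂ (here refl) , flip-adj sD pq ; l₁ = x , x∈ , flip-adj sD rx
        ; h₂ = w , w∈ , wu ; l₂ = s , s∈Z , flip-adj sD rs
        ; uniq = subst Unique (List.++-assoc arc-L Z arc-Q) (uniq-swap arc-Q (subst Unique arc-eq uniqL))
        ; cover = cov } , a₂
        where
        w∈ : w ∈ Z
        w∈ = concat-last {R = R} ((r ∷ s₂ ++ q ∷ []) ∷ Z ∷ []) ((r , here refl) ∷ (s , s∈Z) ∷ [])
               (subst (λ l → Path R r (r ∷ l) w) (sym (List.++-assoc s₂ (q ∷ []) Z)) back)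

    -- Two attachments not on a common closed arc between the ends of the chords, or three
    -- attachments including both ends of a chord, give a minor.
    module _ (third : Third)
             (one-arc : (X : Crossing D C) → (∀ {a} → A a ≡ true → a ∈ arc-Q X) → ⊥) where
      inside : (X : Crossing D C) → ¬ Has A (Crossing.s₁ X)
      inside X b₁ = one-arc X within
        where
        open Crossing X
        within : ∀ {a} → A a ≡ true → a ∈ arc-Q X
        within {a} aa with ∈-++⁻ (p ∷ s₁) (rot-∈ rot (cover aa))
        ... | inj₁ m = ∈-++⁺ˡ m
        ... | inj₂ (here refl) = ∈-++⁺ʳ (p ∷ s₁) (here refl)
        ... | inj₂ (there m) with ∈-++⁻ s₂ m
        ...   | inj₁ m₂ = ⊥-elim (pair-s₁s₂ X b₁ (a , m₂ , aa))
        ...   | inj₂ (here refl) = ⊥-elim (pair-s₁q X b₁ aa)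
        ...   | inj₂ (there m′) with ∈-++⁻ s₃ m′
        ...     | inj₁ m₃ = ⊥-elim (pair-s₁s₃ X b₁ (a , m₃ , aa))
        ...     | inj₂ (here refl) = ⊥-elim (pair-ps₂ (rotate³ X) aa b₁)
        ...     | inj₂ (there m₄) = ⊥-elim (pair-s₁s₂ (rotate³ X) (a , m₄ , aa) b₁)

      chord-ends : (X : Crossing D C) → A (Crossing.p X) ≡ true → A (Crossing.q X) ≡ true → ⊥
      chord-ends X ap aq with third ap aq (Crossing.pq X)
      ... | b , ab , b≢p , b≢q = triple X ap aq ab b≢p b≢q

      corners : (X : Crossing D C) → ∀ {a} → A a ≡ true →
                a ≡ Crossing.p X ⊎ a ≡ Crossing.r X ⊎ a ≡ Crossing.q X ⊎ a ≡ Crossing.s X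
      corners X {a} aa with ∈-++⁻ (p ∷ s₁) (rot-∈ rot (cover aa))
        where open Crossing X
      ... | inj₁ (here e) = inj₁ e
      ... | inj₁ (there m) = ⊥-elim (inside X (a , m , aa))
      ... | inj₂ (here e) = inj₂ (inj₁ e)
      ... | inj₂ (there m) with ∈-++⁻ (Crossing.s₂ X) m
      ...   | inj₁ m₂ = ⊥-elim (inside (rotate X) (a , m₂ , aa))
      ...   | inj₂ (here e) = inj₂ (inj₂ (inj₁ e))
      ...   | inj₂ (there m′) with ∈-++⁻ (Crossing.s₃ X) m′
      ...     | inj₁ m₃ = ⊥-elim (inside (rotate (rotate X)) (a , m₃ , aa))
      ...     | inj₂ (here e) = inj₂ (inj₂ (inj₂ e))
      ...     | inj₂ (there m₄) = ⊥-elim (inside (rotate³ X) (a , m₄ , aa))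

      consecutive : (X : Crossing D C) → A (Crossing.q X) ≡ false → A (Crossing.s X) ≡ false → ⊥
      consecutive X nq ns = one-arc X λ {a} aa → case corners X aa of λ where
        (inj₁ e) → here e
        (inj₂ (inj₁ e)) → there (∈-++⁺ʳ (Crossing.s₁ X) (here e))
        (inj₂ (inj₂ (inj₁ e))) → ⊥-elim (true≢false aa (trans (cong A e) nq))
        (inj₂ (inj₂ (inj₂ e))) → ⊥-elim (true≢false aa (trans (cong A e) ns))

      -- Attachments sit only at the four corners and never at both ends of a chord. So two
      -- neighbouring corners are free of them, and the other two span a single arc.
      no-crossing : Crossing D C → ⊥
      no-crossing X with bool-case (A (Crossing.p X)) | bool-case (A (Crossing.q X)) | bool-case (A (Crossing.r X)) | bool-case (A (Crossing.s X))
      ... | inj₁ p | inj₁ q | _ | _ = chord-ends X p q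
      ... | _ | _ | inj₁ r | inj₁ s = chord-ends (rotate X) r s
      ... | _ | inj₂ q | _ | inj₂ s = consecutive X q s
      ... | inj₂ p | _ | _ | inj₂ s = consecutive (rotate X) s p
      ... | inj₂ p | _ | inj₂ r | _ = consecutive (rotate (rotate X)) p r
      ... | _ | inj₂ q | inj₂ r | _ = consecutive (rotate³ X) r q

-- From a cycle without crossing chords to a drawing

position : ∀ {n} → List (Fin n) → Fin n → ℕ
-- Nodes off the list are placed behind it by their own index, which keeps all positions distinct.
position [] v = toℕ v
position (x ∷ xs) v with v ≟ x
... | yes _ = 0
... | no _ = suc (position xs v)

module _ {n : ℕ} where
  position-inj : ∀ (xs : List (Fin n)) {u v} → position xs u ≡ position xs v → u ≡ v
  position-inj [] e = toℕ-injective e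
  position-inj (x ∷ xs) {u} {v} e with u ≟ x | v ≟ x
  ... | yes refl | yes refl = refl
  position-inj (x ∷ xs) () | yes _ | no _
  position-inj (x ∷ xs) () | no _ | yes _
  ... | no _ | no _ = position-inj xs (ℕ.suc-injective e)

  position-bound : ∀ (xs : List (Fin n)) v → position xs v < length xs + n
  position-bound [] v = toℕ<n v
  position-bound (x ∷ xs) v with v ≟ x
  ... | yes _ = s≤s z≤n
  ... | no _ = s≤s (position-bound xs v)

  position-shift : ∀ (xs : List (Fin n)) {ys v} → v ∉ xs → position (xs ++ ys) v ≡ length xs + position ys v
  position-shift [] v∉ = refl
  position-shift (x ∷ xs) {v = v} v∉ with v ≟ x
  ... | yes e = ⊥-elim (v∉ (here e))
  ... | no _ = cong suc (position-shift xs (v∉ ∘ there))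

  position-in : ∀ {xs ys : List (Fin n)} {v} → v ∈ xs → position (xs ++ ys) v < length xs
  position-in {x ∷ xs} {v = v} m with v ≟ x
  ... | yes _ = s≤s z≤n
  position-in {x ∷ xs} (here e) | no ne = ⊥-elim (ne e)
  position-in {x ∷ xs} (there m) | no _ = s≤s (position-in m)

  position-prefix : ∀ {xs ys : List (Fin n)} {v} → v ∈ xs → position (xs ++ ys) v ≡ position xs v
  position-prefix {x ∷ xs} {v = v} m with v ≟ x
  ... | yes _ = refl
  position-prefix {x ∷ xs} (here e) | no ne = ⊥-elim (ne e)
  position-prefix {x ∷ xs} (there m) | no _ = cong suc (position-prefix m)

  Before : List (Fin n) → Fin n → Fin n → Set
  Before xs b c = ∃₂ λ P Q → ∃ λ S → xs ≡ P ++ b ∷ Q ++ c ∷ S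

  before : ∀ (xs : List (Fin n)) {b c} → b ∈ xs → c ∈ xs → position xs b < position xs c → Before xs b c
  before (x ∷ xs) {b} {c} b∈ c∈ lt with b ≟ x | c ≟ x
  ... | yes refl | yes refl = ⊥-elim (ℕ.<-irrefl refl lt)
  ... | no _ | yes refl = case lt of λ ()
  before (x ∷ xs) b∈ (here e) lt | yes refl | no ne = ⊥-elim (ne e)
  before (x ∷ xs) b∈ (there c∈) lt | yes refl | no ne with ∈-∃++ c∈
  ... | Q , S , refl = [] , Q , S , refl
  before (x ∷ xs) (here e) c∈ lt | no ne | no ne′ = ⊥-elim (ne e)
  before (x ∷ xs) b∈ (here e) lt | no ne | no ne′ = ⊥-elim (ne′ e)
  before (x ∷ xs) (there b∈) (there c∈) (s≤s lt) | no _ | no _ with before xs b∈ c∈ lt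
  ... | P , Q , S , refl = x ∷ P , Q , S , refl

  before-left : ∀ {xs ys : List (Fin n)} {b c} → Before xs b c → Before (xs ++ ys) b c
  before-left {ys = ys} {b} {c} (P , Q , S , refl) = P , Q , S ++ ys ,
    trans (List.++-assoc P (b ∷ Q ++ c ∷ S) ys) (cong (λ l → P ++ b ∷ l) (List.++-assoc Q (c ∷ S) ys))

  before-right : ∀ xs {ys : List (Fin n)} {b c} → Before ys b c → Before (xs ++ ys) b c
  before-right xs {b = b} {c} (P , Q , S , refl) = xs ++ P , Q , S , sym (List.++-assoc xs P (b ∷ Q ++ c ∷ S))

  before-across : ∀ {xs ys : List (Fin n)} {b c} → b ∈ xs → c ∈ ys → Before (xs ++ ys) b c
  before-across {b = b} {c} b∈ c∈ with ∈-∃++ b∈ | ∈-∃++ c∈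
  ... | P , Q , refl | Q′ , S , refl = P , Q ++ Q′ , S ,
    trans (List.++-assoc P (b ∷ Q) (Q′ ++ c ∷ S)) (cong (λ l → P ++ b ∷ l) (sym (List.++-assoc Q Q′ (c ∷ S))))

  module _ (X : List (Fin n)) {a Y} (u : Unique (X ++ a ∷ Y)) where
    private
      C : List (Fin n)
      C = X ++ a ∷ Y
      pos : Fin n → ℕ
      pos = position C
      ∉X : ∀ {v} → v ∈ a ∷ Y → v ∉ X
      ∉X m m′ = uniq-disj X u m′ m
      pos-a : pos a ≡ length X
      pos-a = trans (position-shift X (∉X (here refl))) (trans (cong (length X +_) zero-head) (ℕ.+-identityʳ _))
        where
        zero-head : position (a ∷ Y) a ≡ 0
        zero-head with a ≟ a
        ... | yes _ = refl
        ... | no ne = ⊥-elim (ne refl)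
      left : ∀ {v} → v ∈ X → pos v < pos a
      left {v} m = subst (pos v <_) (sym pos-a) (position-in {X} m)
      right : ∀ {v} → v ∈ Y → pos a < pos v
      right {v} m with v ≟ a | position-shift X {a ∷ Y} {v} (∉X (there m))
      ... | yes refl | _ = ⊥-elim (uniq-disj (a ∷ []) (uniq-right X u) (here refl) m)
      ... | no ne | e = subst₂ _<_ (sym pos-a) (sym e) (ℕ.m<m+n (length X) (s≤s z≤n))

    -- Cyclic order of positions is order on the list rotated to start at a.
    cyc-before : ∀ {b c} → b ∈ Y ++ X → c ∈ Y ++ X → Cyc (pos a) (pos b) (pos c) → Before (Y ++ X) b c
    cyc-before {b} {c} b∈ c∈ cy with ∈-++⁻ Y b∈ | ∈-++⁻ Y c∈
    ... | inj₁ bY | inj₂ cX = before-across bY cX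
    ... | inj₁ bY | inj₁ cY = before-left (before Y bY cY
            (ℕ.+-cancelˡ-< (length (X ++ a ∷ [])) _ _ (subst₂ _<_ (shift bY) (shift cY) (lt cy))))
      where
      assoc : X ++ a ∷ Y ≡ (X ++ a ∷ []) ++ Y
      assoc = sym (List.++-assoc X (a ∷ []) Y)
      shift : ∀ {v} → v ∈ Y → pos v ≡ length (X ++ a ∷ []) + position Y v
      shift {v} m = trans (cong (λ l → position l v) assoc)
        (position-shift (X ++ a ∷ []) λ m′ → uniq-disj (X ++ a ∷ []) (subst Unique assoc u) m′ m)
      lt : Cyc (pos a) (pos b) (pos c) → pos b < pos c
      lt (C1 _ q) = q
      lt (C2 q _) = q
      lt (C3 q _) = ⊥-elim (ℕ.<-asym q (right cY))
    ... | inj₂ bX | inj₁ cY = ⊥-elim (no′ cy)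
      where
      no′ : ¬ Cyc (pos a) (pos b) (pos c)
      no′ (C1 p _) = ℕ.<-asym p (left bX)
      no′ (C2 _ q) = ℕ.<-asym q (right cY)
      no′ (C3 q _) = ℕ.<-asym q (right cY)
    ... | inj₂ bX | inj₂ cX = before-right Y (before X bX cX (subst₂ _<_ (position-prefix bX) (position-prefix cX) (lt cy)))
      where
      lt : Cyc (pos a) (pos b) (pos c) → pos b < pos c
      lt (C1 p _) = ⊥-elim (ℕ.<-asym p (left bX))
      lt (C2 q _) = q
      lt (C3 _ p) = ⊥-elim (ℕ.<-asym p (left bX))

  before-both : ∀ {W : List (Fin n)} {b c d} → Unique W → Before W b c → Before W c d →
    ∃₂ λ P Q → ∃₂ λ S T → W ≡ P ++ b ∷ Q ++ c ∷ S ++ d ∷ T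
  before-both {b = b} {c} {d} u (P , Q , S , refl) (P′ , Q′ , S′ , e) with split-unique (P ++ b ∷ Q) (subst Unique assoc u) (trans (sym assoc) e)
    where
    assoc : P ++ b ∷ Q ++ c ∷ S ≡ (P ++ b ∷ Q) ++ c ∷ S
    assoc = sym (List.++-assoc P (b ∷ Q) (c ∷ S))
  ... | refl , refl = P , Q , Q′ , S′ , refl

-- A violation of `nc`, read along the list rotated to start at `a`, is a `Crossing`.
hamiltonian : ∀ {n} {D : Rel n} → Symm D → Irr D → (C : List (Fin n)) → Unique C → (∀ {v} → Active D v → v ∈ C) → ¬ Crossing D C → NonCrossing D
hamiltonian {n} {D} sD iD C u ham none = record
  { pos = position C ; bound = length C + n ; pos< = position-bound C ; inj = position-inj C ; nc = nc }
  where
  nc : ∀ {a b c d} → Adj D a c → Adj D b d → Cyc (position C a) (position C b) (position C c) → Cyc (position C a) (position C c) (position C d) → ⊥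
  nc {a} {b} {c} {d} ac bd x y with ∈-∃++ (ham (c , ac))
  ... | X , Y , refl with before-both (uniq-right (a ∷ []) (uniq-swap X u)) (cyc-before X u (rest bC x₁) (rest cC x₂) x) (cyc-before X u (rest cC x₂) (rest dC x₃) y)
    where
    bC = ham (d , bd)
    cC = ham (a , flip-adj sD ac)
    dC = ham (b , flip-adj sD bd)
    x₁ : b ≢ a
    x₁ refl = cyc-irrˡ x
    x₂ : c ≢ a
    x₂ refl = cyc-irrˡ y
    x₃ : d ≢ a
    x₃ refl = cyc-irrˡ (cyc-rot (cyc-rot y))
    rest : ∀ {v} → v ∈ X ++ a ∷ Y → v ≢ a → v ∈ Y ++ X
    rest m ne with ∈-swap X m
    ... | here e = ⊥-elim (ne e)
    ... | there m′ = m′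
  ...   | P , Q , S , T , e = none (crossing P Q S T (X , a ∷ Y , refl , cong (a ∷_) (sym e)) ac bd)

-- Growing a cycle through all attachments

exit-edge : ∀ {n} {E : Fin n → Fin n → Set} (C : List (Fin n)) {c v} → Star E c v → c ∈ C → v ∉ C → ∃₂ λ p w → p ∈ C × w ∉ C × E p w
exit-edge C ε c∈ v∉ = ⊥-elim (v∉ c∈)
exit-edge C {c} (_◅_ {j = j} e es) c∈ v∉ with j ∈? C
... | yes j∈ = exit-edge C es j∈ v∉
... | no j∉ = c , j , c∈ , j∉ , e

either-order : ∀ {n} {Q : List (Fin n)} {x y} → x ∈ Q → y ∈ Q → x ≢ y → Before Q x y ⊎ Before Q y x
either-order {x = x} {y} x∈ y∈ ne with ∈-∃++ x∈
... | P , S , refl with ∈-++⁻ P y∈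
...   | inj₂ (here e) = ⊥-elim (ne (sym e))
...   | inj₂ (there m) with ∈-∃++ m
...     | P′ , S′ , refl = inj₁ (P , P′ , S′ , refl)
either-order {x = x} {y} x∈ y∈ ne | P , S , refl | inj₁ m with ∈-∃++ m
... | P′ , S′ , refl = inj₂ (P′ , S′ , S , List.++-assoc P′ (y ∷ S′) (x ∷ S))

module Grow {n} {D : Rel n} (sD : Symm D) (iD : Irr D) (two : TwoConnected D)
            (conn : ∀ {u v} → Active D u → Active D v → Conn D u v)
            {A : VSet n} (free : ¬ Forb (Link D A none) root) (actA : ∀ {a} → A a ≡ true → Active D a) where
  open Obstruct sD A
  open Lenses sD {A} free
  open Cycles sD {A} free

  record Loop : Set where
    field
      cyc   : Cycle
    open Cycle cyc public
    field
      act   : ∀ {v} → v ∈ C → Active D v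
      {c c′} : Fin n
      c∈    : c ∈ C
      c′∈   : c′ ∈ C
      c≢c′  : c ≢ c′

  -- An ear through b, together with an arc S of the loop between its ends without attachments.
  record Arc (K : Loop) (b : Fin n) : Set where
    open Loop K
    field
      {p q} : Fin n
      Ks S T : List (Fin n)
      rot   : Rot C (p ∷ S ++ q ∷ T)
      noS   : ∀ {a} → a ∈ S → A a ≡ false
      path  : Path R p (p ∷ Ks ++ q ∷ []) q
      uniqK : Unique (p ∷ Ks ++ q ∷ [])
      off   : ∀ {v} → v ∈ Ks → v ∉ C
      b∈    : b ∈ Ks

  ends : ∀ {p q} K {b} → b ∈ K → Path R p (p ∷ K ++ q ∷ []) q → IsPath R K × (∃ λ x → x ∈ K × R x p) × (∃ λ x → x ∈ K × R x q)
  ends {p} {q} K {b} b∈ pa with chain ((p ∷ []) ∷ K ∷ (q ∷ []) ∷ []) ((p , here refl) ∷ (b , b∈) ∷ (q , here refl) ∷ []) (p , q , pa)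
  ... | link _ (_ , x , here refl , x∈ , px) (link pk (y , _ , y∈ , here refl , yq) (last _)) = pk , (x , x∈ , flip-adj sD px) , (y , y∈ , yq)

  module _ (K : Loop) where
    open Loop K

    -- A theta graph with attachments inside two of its three paths: `p`, `q` and the root against
    -- `Ks`, `S` and `T` form K_{3,3}, with the link from the root to `Ks` missing.
    clash : ∀ {p q Ks S T b} → Rot C (p ∷ S ++ q ∷ T) → Path R p (p ∷ Ks ++ q ∷ []) q → Unique (p ∷ Ks ++ q ∷ []) →
            (∀ {v} → v ∈ Ks → v ∉ C) → b ∈ Ks → Has A S → Has A T → ⊥
    clash {p} {q} {Ks} {S} {T} rot pa u off b∈ hS hT with chain ss ne (ring-path rg) | ring-close ss ne rg | ends Ks b∈ pa
      where
      ss : Vec (List (Fin n)) 4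
      ss = (p ∷ []) ∷ S ∷ (q ∷ []) ∷ T ∷ []
      ne : AllNE {R = R} ss
      ne = (p , here refl) ∷ has-ne {A = A} hS ∷ (q , here refl) ∷ has-ne {A = A} hT ∷ []
      rg : Ring {R = R} (concatV ss)
      rg = ring-rot rot ring
    ... | link p₁ a₁ (link p₂ a₂ (link p₃ a₃ (last p₄))) | c | pk , kp , kq =
      K33 (obstruct ss (uniq-disjV ss (uniq-++ (uniq-left Ks (uniq-right (p ∷ []) u)) (rot-uniq rot uniq) λ m m′ → off m (rot-∈ (rot-sym rot) m′)))
        (pk VAll.∷ p₁ VAll.∷ p₂ VAll.∷ p₃ VAll.∷ p₄ VAll.∷ VAll.[])
        ((0F , 1F) ∷ (0F , 3F) ∷ (1F , 2F) ∷ (2F , 3F) ∷ (3F , 4F) ∷ (4F , 1F) ∷ [])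
        (seg kp (here refl) ∷ seg kq (here refl) ∷ a₁ ∷ a₂ ∷ a₃ ∷ c ∷ [])
        (2F ∷ 4F ∷ []) (hS ∷ hT ∷ []) K33-e K33-e-root
        (just 0F ∷ just 3F ∷ just 1F ∷ just 4F ∷ just 2F ∷ just 5F ∷ []) refl)
      where
      ss : Vec (List (Fin n)) 5
      ss = Ks ∷ (p ∷ []) ∷ S ∷ (q ∷ []) ∷ T ∷ []

    open Ears sD two C act hiding (R)

    -- By `clash` one of the two arcs between the ends of the ear has no attachment; the ear is
    -- turned so that this arc becomes `S`.
    orient : ∀ {b} (E : Ear) → b ∈ Ear.Ks E → Σ (Arc K b) λ a → Arc.p a ≡ Ear.p E ⊎ Arc.q a ≡ Ear.p E
    orient {b} E b∈ with two-arcs (Ear.p∈ E) (Ear.q∈ E) (Ear.p≢q E)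
    ... | S , T , rot with has? A S
    ...   | inj₂ noS = record { Ks = Ks ; S = S ; T = T ; rot = rot ; noS = noS ; path = path ; uniqK = Ear.uniq E ; off = off ; b∈ = b∈ } , inj₁ refl
      where open Ear E
    ...   | inj₁ hS with has? A T
    ...     | inj₁ hT = ⊥-elim (clash rot (Ear.path E) (Ear.uniq E) (Ear.off E) b∈ hS hT)
    ...     | inj₂ noT with Ear.flip E
    ...       | Ks′ , pa , u , f , g = record { Ks = Ks′ ; S = T ; T = S ; rot = rot-trans rot (rot-++ (p ∷ S)) ; noS = noT
                  ; path = pa ; uniqK = u ; off = λ m → off (f m) ; b∈ = g b∈ } , inj₂ refl
      where open Ear E

    module _ {b} (a : Arc K b) where
      open Arc a
      private
        rg : Ring {R = R} (p ∷ S ++ q ∷ T)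
        rg = ring-rot rot ring
        uS : Unique (p ∷ S ++ q ∷ T)
        uS = rot-uniq rot uniq

      p∈C : p ∈ C
      p∈C = rot-∈ (rot-sym rot) (here refl)

      -- Exchanging the arc `S` for the ear gains `b` and loses no attachment.
      splice : Loop
      splice with rg
      ... | u , w , pa , wu with path-head pa | path-cut (p ∷ S) pa
      ...   | refl | _ , back = record
        { cyc = record { C = p ∷ Ks ++ q ∷ T ; ring = p , w , join (p ∷ Ks) path back , wu
                       ; uniq = uniq-++ (uniq-left (p ∷ Ks) uniqK) (uniq-right (p ∷ S) uS) λ where
                           (here refl) m → uniq-disj (p ∷ S) uS (here refl) m
                           (there m) m′ → off m (rot-∈ (rot-sym rot) (∈-++⁺ʳ (p ∷ S) m′)) }
        ; act = λ { (here refl) → act p∈C ; (there m) → case ∈-++⁻ Ks m of λ where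
            (inj₁ k) → actK k
            (inj₂ t) → act (rot-∈ (rot-sym rot) (∈-++⁺ʳ (p ∷ S) t)) }
        ; c∈ = here refl ; c′∈ = ∈-++⁺ʳ (p ∷ Ks) (here refl)
        ; c≢c′ = λ e → uniq-disj (p ∷ []) uniqK (here refl) (∈-++⁺ʳ Ks (here e)) }
        where
        join : ∀ {u Z} ys {w} → Path R u (ys ++ q ∷ []) q → Path R q Z w → Path R u (ys ++ Z) w
        join [] p p′ with path-head p
        ... | refl = p′
        join (y ∷ []) (r ∺ p) p′ with path-head p
        ... | refl = r ∺ p′
        join (y ∷ y′ ∷ ys) (r ∺ p) p′ = r ∺ join (y′ ∷ ys) p p′
        succ : ∀ {u xs w} → Path R u xs w → ∀ {v} → v ∈ xs → v ≡ w ⊎ Active D v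
        succ ⟨ u ⟩ (here e) = inj₁ e
        succ (r ∺ pa) (here refl) = inj₂ (_ , r)
        succ (r ∺ pa) (there m) = succ pa m
        actK : ∀ {v} → v ∈ Ks → Active D v
        actK m with succ path (there (∈-++⁺ˡ m))
        ... | inj₂ h = h
        ... | inj₁ refl = ⊥-elim (uniq-disj (p ∷ Ks) uniqK (there m) (here refl))

      splice-⊇ : ∀ {v} → v ∈ C → v ∉ S → v ∈ Loop.C splice
      splice-⊇ m v∉S with rg
      ... | u , w , pa , wu with path-head pa | path-cut (p ∷ S) pa
      ...   | refl | _ , back with ∈-++⁻ (p ∷ S) (rot-∈ rot m)
      ...     | inj₁ (here e) = here e
      ...     | inj₁ (there m′) = ⊥-elim (v∉S m′)
      ...     | inj₂ m′ = ∈-++⁺ʳ (p ∷ Ks) m′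

      splice-b : b ∈ Loop.C splice
      splice-b with rg
      ... | u , w , pa , wu with path-head pa | path-cut (p ∷ S) pa
      ...   | refl | _ , back = there (∈-++⁺ˡ b∈)

      splice-longer : S ≡ [] → length C < length (Loop.C splice)
      splice-longer refl with rg
      ... | u , w , pa , wu with path-head pa | path-cut (p ∷ []) pa
      ...   | refl | _ , back = subst (_< length (p ∷ Ks ++ q ∷ T)) (sym (rot-length rot))
                (s≤s (subst (suc (length T) <_) (sym (List.length-++ Ks)) (ℕ.m<n+m (suc (length T)) (nonempty b∈))))
        where
        nonempty : ∀ {v} {xs : List (Fin n)} → v ∈ xs → 0 < length xs
        nonempty (here _) = s≤s z≤n
        nonempty (there _) = s≤s z≤n

      -- A nonempty `S` and the ear are two attachment-free connections between `p` and `q`, while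
      -- all attachments lie on the remaining arc.
      arc-lens′ : (∀ {a} → A a ≡ true → a ∈ C) → ∀ {s} → s ∈ S →
        Σ (Lens (q ∷ T ++ p ∷ []) S Ks) λ Ln → Lens.h Ln ≡ q × Lens.l Ln ≡ p
      arc-lens′ cover s∈ with rg
      ... | u , w , pa , wu with path-head pa | path-cut (p ∷ S) pa
      ...   | refl | front , back with ends S s∈ front | ends Ks b∈ path
      ...     | pS , Sp , Sq | pK , Kp , Kq = record
        { h = q ; l = p ; pathQ = path-++ back wu ⟨ p ⟩ ; path₁ = pS ; path₂ = pK
        ; h₁ = Sq ; l₁ = Sp ; h₂ = Kq ; l₂ = Kp
        ; uniq = uniq-++ (uniq-left S (uniq-right (p ∷ []) uS))
                  (uniq-++ (uniq-left Ks (uniq-right (p ∷ []) uniqK)) (uniq-right S uSQ)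
                     (λ m m′ → off m (rot-∈ (rot-sym rot) (∈-swap (S ++ q ∷ T) (subst (_ ∈_) (sym (List.++-assoc S (q ∷ T) (p ∷ []))) (∈-++⁺ʳ S m′))))))
                  λ m m′ → case ∈-++⁻ Ks m′ of λ where
                    (inj₁ k) → off k (rot-∈ (rot-sym rot) (there (∈-++⁺ˡ m)))
                    (inj₂ k) → uniq-disj S uSQ m k
        ; cover = cov } , refl , refl
        where
        uSQ : Unique (S ++ (q ∷ T ++ p ∷ []))
        uSQ = subst Unique (List.++-assoc S (q ∷ T) (p ∷ [])) (uniq-swap (p ∷ []) uS)
        cov : ∀ {a} → A a ≡ true → a ∈ q ∷ T ++ p ∷ []
        cov aa with ∈-++⁻ (p ∷ S) (rot-∈ rot (cover aa))
        ... | inj₁ (here refl) = ∈-++⁺ʳ (q ∷ T) (here refl)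
        ... | inj₁ (there m) = ⊥-elim (true≢false aa (noS m))
        ... | inj₂ m = ∈-++⁺ˡ m

  Covers : Loop → Set
  Covers K = ∀ {a} → A a ≡ true → a ∈ Loop.C K

  absorb : ∀ K {a} → A a ≡ true → Σ Loop λ K′ → a ∈ Loop.C K′ × (∀ {b} → A b ≡ true → b ∈ Loop.C K → b ∈ Loop.C K′)
  absorb K {a} aa with a ∈? Loop.C K
  ... | yes m = K , m , λ _ m → m
  ... | no a∉ with Ears.ear-through sD two (Loop.C K) (Loop.act K) (Loop.c∈ K) (Loop.c′∈ K) (Loop.c≢c′ K) (conn (Loop.act K (Loop.c∈ K)) (actA aa)) a∉
  ...   | E , a∈ with orient K E a∈
  ...     | ar , _ = splice K ar , splice-b K ar , λ ab m → splice-⊇ K ar m λ m′ → true≢false ab (Arc.noS ar m′)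

  -- A single link traversed there and back counts as a loop, which spares the search for a first
  -- proper cycle.
  edge-loop : ∀ {u w} → R u w → Loop
  edge-loop {u} {w} e = record
    { cyc = record { C = u ∷ w ∷ [] ; ring = u , w , e ∺ ⟨ w ⟩ , flip-adj sD e ; uniq = (ne ∷ []) ∷ [] ∷ [] }
    ; act = λ { (here refl) → w , e ; (there (here refl)) → u , flip-adj sD e }
    ; c∈ = here refl ; c′∈ = there (here refl) ; c≢c′ = ne }
    where
    ne : u ≢ w
    ne refl = true≢false e (iD u)

  covering : Loop → Σ Loop Covers
  covering K = let (K′ , f) = all-of (allFin n) in K′ , λ {a} aa → f (∈-allFin a) aa
    where
    all-of : ∀ as → Σ Loop λ K′ → ∀ {a} → a ∈ as → A a ≡ true → a ∈ Loop.C K′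
    all-of [] = K , λ ()
    all-of (a ∷ as) with all-of as | bool-case (A a)
    ... | K′ , f | inj₂ na = K′ , λ { (here refl) aa → ⊥-elim (true≢false aa na) ; (there m) aa → f m aa }
    ... | K′ , f | inj₁ ya with absorb K′ ya
    ...   | K″ , m , g = K″ , λ { (here refl) _ → m ; (there m′) aa → g aa (f m′ aa) }

  Ham : Loop → Set
  Ham K = ∀ {v} → Active D v → v ∈ Loop.C K

  module _ (Good : Fin n → Set)
           (pick : ∀ K → Covers K → ∀ {v} → Active D v → v ∉ Loop.C K → ∃₂ λ p w → p ∈ Loop.C K × w ∉ Loop.C K × R p w × Good p) where
    Stuck : Loop → Set
    Stuck K = ∃ λ b → Σ (Arc K b) λ a → (∃ λ s → s ∈ Arc.S a) × (Good (Arc.p a) ⊎ Good (Arc.q a))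

    -- An ear is started at a `Good` node of the loop. If its free arc is empty, splicing lengthens
    -- the loop; otherwise ear and arc form a lens. `Good` lets the caller prescribe where such a
    -- lens is anchored.
    grow : ∀ m K → Covers K → n ∸ length (Loop.C K) < m → Σ Loop λ K′ → Covers K′ × (Ham K′ ⊎ Stuck K′)
    grow (suc m) K cov lt with any? (λ v → active? D v ×-dec ¬? (v ∈? Loop.C K))
    ... | no none = K , cov , inj₁ λ {v} av → dec-stable (v ∈? Loop.C K) λ v∉ → none (v , av , v∉)
    ... | yes (v , av , v∉) with pick K cov av v∉
    ...   | p , w , p∈ , w∉ , pw , gp with other
      where
      other : ∃ λ x → x ∈ Loop.C K × x ≢ p
      other with Loop.c K ≟ p
      ... | no ne = Loop.c K , Loop.c∈ K , ne
      ... | yes refl = Loop.c′ K , Loop.c′∈ K , Loop.c≢c′ K ∘ sym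
    ...     | x , x∈ , x≢ with Ears.start-ear sD two (Loop.C K) (Loop.act K) p∈ w∉ pw x∈ x≢
    ...       | E , refl , w∈ with orient K E w∈
    ...         | ar , o with Arc.S ar in eq
    ...           | s ∷ S = K , cov , inj₂ (w , ar , (s , subst (s ∈_) (sym eq) (here refl)) ,
                      (case o of λ { (inj₁ e) → inj₁ (subst Good (sym e) gp) ; (inj₂ e) → inj₂ (subst Good (sym e) gp) }))
    ...           | [] = grow m (splice K ar) (λ aa → splice-⊇ K ar (cov aa) λ m → true≢false aa (Arc.noS ar m))
                      (ℕ.<-≤-trans (ℕ.∸-monoʳ-< (splice-longer K ar eq) (uniq-length _ (Loop.uniq (splice K ar)))) (ℕ.≤-pred lt))

  any-exit : ∀ K → ∀ {v} → Active D v → v ∉ Loop.C K → ∃₂ λ p w → p ∈ Loop.C K × w ∉ Loop.C K × R p w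
  any-exit K av v∉ = exit-edge (Loop.C K) (conn (Loop.act K (Loop.c∈ K)) av) (Loop.c∈ K) v∉

  module _ (third : Third) where
    -- Both obstacles to a drawing, a loop that stops growing and a pair of crossing chords, produce
    -- a lens, which the private path of `e` excludes.
    outerplanar-pendant : ∀ {v x e} → A v ≡ true → A x ≡ true → v ≢ x → A e ≡ true → ¬ Forb (Link D (A ─ e) ⁅ e ⁆) root → NonCrossing D
    outerplanar-pendant {v} av ax ne ae fe with covering (edge-loop (proj₂ (actA av)))
    ... | K₀ , cov₀ with grow (λ _ → ⊤) (λ K _ a b → let (p , w , x , y , z) = any-exit K a b in p , w , x , y , z , tt) _ K₀ cov₀ (ℕ.n<1+n _)
    ...   | K , cov , inj₂ (b , ar , (s , s∈) , _) = ⊥-elim (lens-pendant (proj₁ (arc-lens′ K ar cov s∈)) av ax ne third ae fe)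
    ...   | K , cov , inj₁ ham = hamiltonian sD iD (Loop.C K) (Loop.uniq K) ham
            (no-crossing (Loop.cyc K) cov third λ X c → lens-pendant (proj₁ (arc-lens (Loop.cyc K) cov X c)) av ax ne third ae fe)

  record Long (K : Loop) : Set where
    open Loop K
    field
      {x y} : Fin n
      T₁ T₂ : List (Fin n)
      rot   : Rot C (x ∷ T₁ ++ y ∷ T₂)
      chord : R x y
      has₁  : Has A T₁
      has₂  : Has A T₂

  swap-long : ∀ {K} → Long K → Long K
  swap-long {K} l = record { T₁ = T₂ ; T₂ = T₁ ; rot = rot-trans rot (rot-++ (x ∷ T₁)) ; chord = flip-adj sD chord ; has₁ = has₂ ; has₂ = has₁ }
    where open Long l

  -- Where a chord with attachments strictly on both sides can lie relative to a lens with
  -- attachments on `Q` only: both ends on `Q`, or one of them on `M`. The two cases match the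
  -- hypotheses of the `chord` lemmas.
  data Located (Q M : List (Fin n)) : Set where
    inner : ∀ {U₁ x U₂ y U₃} → Q ≡ U₁ ++ x ∷ U₂ ++ y ∷ U₃ → R x y → Has A U₂ → Has A U₁ ⊎ Has A U₃ → Located Q M
    outer : ∀ {z U₁ y U₃} → z ∈ M → Q ≡ U₁ ++ y ∷ U₃ → R z y → Has A U₁ → Has A U₃ → Located Q M

  module _ (K : Loop) (Q M : List (Fin n)) (rQ : Rot (Loop.C K) (Q ++ M)) (noM : ∀ {a} → a ∈ M → A a ≡ false) where
    private
      no-has : ∀ {S} → (∀ {a} → a ∈ S → a ∈ M) → Has A S → ⊥
      no-has f (a , m , t) = true≢false t (noM (f m))

      arcs : (l : Long K) → let open Long l in ∀ {T U} → Rot (Loop.C K) (x ∷ T ++ y ∷ U) → Has A T × Has A U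
      arcs l r with arcs-unique (rot-uniq (Long.rot l) (Loop.uniq K)) (rot-trans (rot-sym (Long.rot l)) r)
      ... | refl , refl = Long.has₁ l , Long.has₂ l

      rotated : ∀ U₁ {x} S {y} W → Rot (Loop.C K) (U₁ ++ x ∷ S ++ y ∷ W) → Rot (Loop.C K) (x ∷ S ++ y ∷ W ++ U₁)
      rotated U₁ {x} S {y} W r = rot-trans r (U₁ , x ∷ S ++ y ∷ W , refl , cong (x ∷_) (sym (List.++-assoc S (y ∷ W) U₁)))

      in-Q : (l : Long K) → let open Long l in Before Q x y → Located Q M
      in-Q l (U₁ , U₂ , U₃ , refl) with arcs l (rotated U₁ U₂ (U₃ ++ M) (subst (Rot _) assoc rQ))
        where
        open Long l
        assoc : (U₁ ++ x ∷ U₂ ++ y ∷ U₃) ++ M ≡ U₁ ++ x ∷ U₂ ++ y ∷ U₃ ++ M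
        assoc = trans (List.++-assoc U₁ (x ∷ U₂ ++ y ∷ U₃) M) (cong (λ l → U₁ ++ x ∷ l) (List.++-assoc U₂ (y ∷ U₃) M))
      ... | h₂ , h with has-++ (U₃ ++ M) h
      ...   | inj₂ h₁ = inner refl (Long.chord l) h₂ (inj₁ h₁)
      ...   | inj₁ h′ with has-++ U₃ h′
      ...     | inj₁ h₃ = inner refl (Long.chord l) h₂ (inj₂ h₃)
      ...     | inj₂ h₃ = ⊥-elim (no-has id h₃)

      in-M : (l : Long K) → let open Long l in Before M x y → ⊥
      in-M l (M₁ , M₂ , M₃ , refl) with arcs l (rotated (Q ++ M₁) M₂ M₃ (subst (Rot _) (sym (List.++-assoc Q M₁ _)) rQ))
      ... | h , _ = no-has (λ m → ∈-++⁺ʳ M₁ (there (∈-++⁺ˡ m))) h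

      mixed : (l : Long K) → let open Long l in x ∈ Q → y ∈ M → Located Q M
      mixed l x∈ y∈ with ∈-∃++ x∈ | ∈-∃++ y∈
      ... | U₁ , U₃ , refl | M₁ , M₂ , refl with arcs l (rotated U₁ (U₃ ++ M₁) M₂ (subst (Rot _) assoc rQ))
        where
        open Long l
        assoc : (U₁ ++ x ∷ U₃) ++ M₁ ++ y ∷ M₂ ≡ U₁ ++ x ∷ (U₃ ++ M₁) ++ y ∷ M₂
        assoc = trans (List.++-assoc U₁ (x ∷ U₃) (M₁ ++ y ∷ M₂)) (cong (λ l → U₁ ++ x ∷ l) (sym (List.++-assoc U₃ M₁ (y ∷ M₂))))
      ...   | h₁ , h₂ with has-++ U₃ h₁ | has-++ M₂ h₂
      ...     | inj₁ g | inj₂ g′ = outer (∈-++⁺ʳ M₁ (here refl)) refl (flip-adj sD (Long.chord l)) g′ g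
      ...     | inj₂ g | _ = ⊥-elim (no-has ∈-++⁺ˡ g)
      ...     | _ | inj₁ g = ⊥-elim (no-has (λ m → ∈-++⁺ʳ M₁ (there m)) g)

    locate-long : Long K → Located Q M
    locate-long l with ∈-++⁻ Q (rot-∈ rQ (rot-∈ (rot-sym rot) (here refl))) | ∈-++⁻ Q (rot-∈ rQ (rot-∈ (rot-sym rot) (∈-++⁺ʳ (x ∷ T₁) (here refl))))
      where open Long l
    ... | inj₁ a | inj₂ b = mixed l a b
    ... | inj₂ a | inj₁ b = mixed (swap-long l) b a
    ... | inj₁ a | inj₁ b with either-order a b (λ e → true≢false (Long.chord l) (trans (cong (λ z → D z (Long.y l)) e) (iD _)))
    ...   | inj₁ o = in-Q l o
    ...   | inj₂ o = in-Q (swap-long l) o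
    locate-long l | inj₂ a | inj₂ b with either-order a b (λ e → true≢false (Long.chord l) (trans (cong (λ z → D z (Long.y l)) e) (iD _)))
    ...   | inj₁ o = ⊥-elim (in-M l o)
    ...   | inj₂ o = ⊥-elim (in-M (swap-long l) o)

  TwoOthers : Fin n → Set
  TwoOthers p = ∃₂ λ c c′ → A c ≡ true × A c′ ≡ true × c ≢ c′ × c ≢ p × c′ ≢ p

  third-point : ∀ {p} q → TwoOthers p → ∃ λ c → A c ≡ true × c ≢ p × c ≢ q
  third-point q (c , c′ , a , a′ , ne , x , x′) with c ≟ q
  ... | no c≢ = c , a , x , c≢
  ... | yes refl = c′ , a′ , x′ , ne ∘ sym

  lens-inner : ∀ {Q L₁ L₂} → Lens Q L₁ L₂ → ∀ {U₁ x U₂ y U₃} → Q ≡ U₁ ++ x ∷ U₂ ++ y ∷ U₃ → R x y → Has A U₂ → Has A U₁ ⊎ Has A U₃ → ⊥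
  lens-inner Ln e r h (inj₁ h₁) = chord-QQ₁ Ln e r h h₁
  lens-inner Ln e r h (inj₂ h₃) = chord-QQ₃ Ln e r h h₃

  -- A long chord takes over the part of the private path: together with a lens it gives a minor.
  -- For a stuck loop `TwoOthers` supplies an attachment off both ends of the lens; for crossing
  -- chords the two sides of the lens are adjacent along the cycle instead.
  outerplanar-long : Third → ∀ K → Covers K → Long K → Ham K ⊎ (∃ λ b → Σ (Arc K b) λ a → (∃ λ s → s ∈ Arc.S a) × (TwoOthers (Arc.p a) ⊎ TwoOthers (Arc.q a))) → NonCrossing D
  outerplanar-long third K cov l (inj₂ (b , ar , (s , s∈) , g)) = ⊥-elim (bad (arc-lens′ K ar cov s∈))
    where
    open Arc ar
    pick-c : TwoOthers p ⊎ TwoOthers q → ∃ λ c → A c ≡ true × c ≢ q × c ≢ p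
    pick-c (inj₁ g) = let (c , a , x , y) = third-point q g in c , a , y , x
    pick-c (inj₂ g) = third-point p g
    c : ∃ λ c → A c ≡ true × c ≢ q × c ≢ p
    c = pick-c g
    bad : (Σ (Lens (q ∷ T ++ p ∷ []) S Ks) λ Ln → Lens.h Ln ≡ q × Lens.l Ln ≡ p) → ⊥
    bad (Ln , refl , refl) with locate-long K (q ∷ T ++ p ∷ []) S (rot-trans rot (p ∷ S , q ∷ T , refl , List.++-assoc (q ∷ T) (p ∷ []) S)) noS l
    ... | inner e r h h′ = lens-inner Ln e r h h′
    ... | outer z∈ e r h₁ h₃ = let (_ , ac , x , y) = c in chord-LQ Ln z∈ e r h₁ h₃ ac x y
  outerplanar-long third K cov l (inj₁ ham) = hamiltonian sD iD (Loop.C K) (Loop.uniq K) ham (no-crossing (Loop.cyc K) cov third bad)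
    where
    bad : (X : Crossing D (Loop.C K)) → (∀ {a} → A a ≡ true → a ∈ arc-Q (Loop.cyc K) cov X) → ⊥
    bad X c with arc-lens (Loop.cyc K) cov X c
    ... | Ln , adj with locate-long K (arc-Q (Loop.cyc K) cov X) (arc-L (Loop.cyc K) cov X ++ _) (arc-rot (Loop.cyc K) cov X) noM l
      where
      noM : ∀ {a} → a ∈ arc-L (Loop.cyc K) cov X ++ _ → A a ≡ false
      noM {a} m = ¬true λ aa → uniq-disj (arc-Q (Loop.cyc K) cov X) (rot-uniq (arc-rot (Loop.cyc K) cov X) (Loop.uniq K)) (c aa) m
    ...   | inner e r h h′ = lens-inner Ln e r h h′
    ...   | outer z∈ e r h₁ h₃ with ∈-++⁻ (arc-L (Loop.cyc K) cov X) z∈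
    ...     | inj₁ m = chord-LQ-adjacent Ln m e r h₁ h₃ adj
    ...     | inj₂ m = chord-LQ-adjacent (Lens.flip Ln) m e r h₁ h₃ (flipSeg adj)

-- Components off the cycle, two-node separations and rings

module Split {n} {D : Rel n} (sD : Symm D) (iD : Irr D) (two : TwoConnected D)
             (conn : ∀ {u v} → Active D u → Active D v → Conn D u v)
             {A : VSet n} (free : ¬ Forb (Link D A none) root) (actA : ∀ {a} → A a ≡ true → Active D a) where
  open Obstruct sD A
  open Lenses sD {A} free
  open Cycles sD {A} free
  open Grow sD iD two conn {A} free actA

  module OffLoop (K : Loop) where
    open Loop K

    offD : Rel n
    offD u w = D u w ∧ (not (does (u ∈? C)) ∧ not (does (w ∈? C)))

    offD-inv : ∀ {u w} → Adj offD u w → R u w × u ∉ C × w ∉ C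
    offD-inv {u} {w} e with ∧-true {D u w} e
    ... | r , e′ with ∧-true {not (does (u ∈? C))} e′
    ...   | a , b = r , does-no (u ∈? C) (not-true a) , does-no (w ∈? C) (not-true b)

    offD-adj : ∀ {u w} → R u w → u ∉ C → w ∉ C → Adj offD u w
    offD-adj {u} {w} r a b = ∧-intro r (∧-intro (cong not (does-false (u ∈? C) a)) (cong not (does-false (w ∈? C) b)))

    offD-symm : Symm offD
    offD-symm u w = cong₂ _∧_ (sD u w) (Bool.∧-comm (not (does (u ∈? C))) _)

    off-end : ∀ {u w} → u ∉ C → Conn offD u w → w ∉ C
    off-end h ε = h
    off-end {u} h (_◅_ {j = j} e es) = off-end (proj₂ (proj₂ (offD-inv {u} {j} e))) es

    Touch : Fin n → Fin n → Set
    Touch v p = ∃ λ p₁ → Conn offD v p₁ × R p₁ p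

    -- A path through the component of `v` off the loop is an ear, to which `clash` applies.
    clash-off : ∀ {p q S T v} → Rot C (p ∷ S ++ q ∷ T) → v ∉ C → Touch v p → Touch v q → Has A S → Has A T → ⊥
    clash-off {p} {q} {S} {T} {v} rot v∉ (p₁ , cp , ep) (q₁ , cq , eq) hS hT
      with simple-path (conn-sym {D = offD} offD-symm cp ◅◅ cq)
    ... | Ks , pa , u = clash K rot
      (flip-adj sD ep ∺ path-++ (path-map (λ {x} {y} e → proj₁ (offD-inv {x} {y} e)) pa) eq ⟨ q ⟩)
      (uniq-++ {xs = p ∷ []} ([] ∷ []) (uniq-++ u ([] ∷ []) λ { m (here refl) → off m q∈ })
        λ { (here refl) m → case ∈-++⁻ Ks m of λ { (inj₁ k) → off k p∈ ; (inj₂ (here e)) → p≢q e } })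
      off (path-head∈ pa) hS hT
      where
      p∈ : p ∈ C
      p∈ = rot-∈ (rot-sym rot) (here refl)
      q∈ : q ∈ C
      q∈ = rot-∈ (rot-sym rot) (∈-++⁺ʳ (p ∷ S) (here refl))
      p≢q : p ≢ q
      p≢q refl = uniq-disj (p ∷ []) (rot-uniq rot uniq) (here refl) (∈-++⁺ʳ S (here refl))
      off : ∀ {x} → x ∈ Ks → x ∉ C
      off m = off-end (off-end v∉ cp) (reach pa m)
        where
        reach : ∀ {u xs w} → Path (Adj offD) u xs w → ∀ {x} → x ∈ xs → Conn offD u x
        reach ⟨ u ⟩ (here refl) = ε
        reach (r ∺ p) (here refl) = ε
        reach (r ∺ p) (there m) = r ◅ reach p m

    data Hop (E : Rel n) (P Q : Fin n → Set) : Set where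
      edge-hop : ∀ {x y} → P x → Q y → Adj E x y → Hop E P Q
      off-hop  : ∀ {x y v} → P x → Q y → v ∉ C → Active E v → Touch v x → Touch v y → Hop E P Q

    module _ {E : Rel n} (sE : Symm E) (E⊆ : ∀ {u v} → Adj E u v → R u v) {P Q : Fin n → Set} (Q⊆ : ∀ {v} → Q v → v ∈ C)
             (classify : ∀ {u v} → Adj E u v → v ∈ C → P v ⊎ Q v) where
      -- The walk is followed to its first arrival in `Q`. Just before, it was at a node of `P` or
      -- in one component off the loop that it had entered from `P`.
      hop : ∀ {x w} → P x → Conn E x w → Q w → (∀ {v} → P v → Q v → ⊥) → Hop E P Q
      hop-off : ∀ {x v w} → P x → v ∉ C → Active E v → Touch v x → Conn E v w → Q w → (∀ {v} → P v → Q v → ⊥) → Hop E P Q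
      hop px ε qw dj = ⊥-elim (dj px qw)
      hop {x} px (_◅_ {j = j} e es) qw dj with j ∈? C
      ... | no j∉ = hop-off px j∉ (x , flip-adj sE e) (j , ε , flip-adj sD (E⊆ e)) es qw dj
      ... | yes j∈ with classify e j∈
      ...   | inj₁ pj = hop pj es qw dj
      ...   | inj₂ qj = edge-hop px qj e
      hop-off px v∉ av tv ε qw dj = ⊥-elim (v∉ (Q⊆ qw))
      hop-off {x} {v} px v∉ av tv@(x₁ , c , r) (_◅_ {j = j} e es) qw dj with j ∈? C
      ... | no j∉ = hop-off px j∉ (v , flip-adj sE e) (x₁ , flip-adj offD-symm {v} {j} (offD-adj (E⊆ e) v∉ j∉) ◅ c , r) es qw dj
      ... | yes j∈ with classify e j∈
      ...   | inj₁ pj = hop pj es qw dj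
      ...   | inj₂ qj = off-hop px qj v∉ av tv (v , ε , E⊆ e)

    component : Fin n → List (Fin n)
    component v = List.filter (λ u → conn? offD v u) (allFin n)

    in-component : ∀ {v u} → Conn offD v u → u ∈ component v
    in-component {v} {u} c = Mem.∈-filter⁺ (λ u → conn? offD v u) (∈-allFin u) c

    component-conn : ∀ {v u} → u ∈ component v → Conn offD v u
    component-conn {v} m = proj₂ (Mem.∈-filter⁻ (λ u → conn? offD v u) {xs = allFin n} m)

    component-connected : ∀ v → Connected R (component v)
    component-connected v {a} {b} ma mb = Star.reverse (λ (r , x , y) → flip-adj sD r , y , x) (from ε (component-conn ma)) ◅◅ from ε (component-conn mb)
      where
      from : ∀ {x y} → Conn offD v x → Conn offD x y → Star (λ x y → R x y × x ∈ component v × y ∈ component v) x y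
      from c ε = ε
      from {x} c (_◅_ {j = j} e es) =
        (proj₁ (offD-inv {x} {j} e) , in-component c , in-component (c ◅◅ (e ◅ ε))) ◅ from (c ◅◅ (e ◅ ε)) es

    -- K_5: the component of `v` and the three arcs that begin at the attachments are joined
    -- pairwise, and the root misses only the component.
    three-touch : ∀ {a b c S T U v} → Rot C (a ∷ S ++ b ∷ T ++ c ∷ U) → A a ≡ true → A b ≡ true → A c ≡ true →
                  v ∉ C → Touch v a → Touch v b → Touch v c → ⊥
    three-touch {a} {b} {c} {S} {T} {U} {v} rot aa ab ac v∉ (a₁ , ca , ra) (b₁ , cb , rb) (c₁ , cc , rc)
      with chain qs ne (ring-path rg) | ring-close qs ne rg
      where
      qs : Vec (List (Fin n)) 3
      qs = (a ∷ S) ∷ (b ∷ T) ∷ (c ∷ U) ∷ []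
      ne : AllNE {R = R} qs
      ne = (a , here refl) ∷ (b , here refl) ∷ (c , here refl) ∷ []
      rg : Ring {R = R} (concatV qs)
      rg = ring-rot rot ring
    ... | link p₁ e₁ (link p₂ e₂ (last p₃)) | e₃ =
      K5 (obstruct-connected ss (uniq-disjV ss uS)
        (component-connected v VAll.∷ pc p₁ VAll.∷ pc p₂ VAll.∷ pc p₃ VAll.∷ VAll.[])
        ((1F , 2F) ∷ (2F , 3F) ∷ (3F , 1F) ∷ (0F , 1F) ∷ (0F , 2F) ∷ (0F , 3F) ∷ [])
        (e₁ ∷ e₂ ∷ e₃ ∷ (a₁ , a , in-component ca , here refl , ra) ∷ (b₁ , b , in-component cb , here refl , rb) ∷
          (c₁ , c , in-component cc , here refl , rc) ∷ [])
        (1F ∷ 2F ∷ 3F ∷ []) ((a , here refl , aa) ∷ (b , here refl , ab) ∷ (c , here refl , ac) ∷ []) K5-e K5-e-root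
        (just 0F ∷ just 1F ∷ just 2F ∷ just 3F ∷ just 4F ∷ []) refl)
      where
      pc : ∀ {s} → IsPath R s → Connected R s
      pc = path-connected (λ e → flip-adj sD e)
      ss : Vec (List (Fin n)) 4
      ss = component v ∷ (a ∷ S) ∷ (b ∷ T) ∷ (c ∷ U) ∷ []
      uS : Unique (component v ++ (a ∷ S ++ b ∷ T ++ c ∷ U))
      uS = uniq-++ (AllPairs.filter⁺ (λ u → conn? offD v u) (AllPairs.tabulate⁺ id)) (rot-uniq rot uniq)
             λ m m′ → off-end v∉ (component-conn m) (rot-∈ (rot-sym rot) m′)

    module _ {a b S T} (rot : Rot C (a ∷ S ++ b ∷ T)) where
      arcs-ST : ∀ {x y} → x ∈ S → y ∈ T → ∃₂ λ T₁ T₂ → Rot C (x ∷ T₁ ++ y ∷ T₂) × b ∈ T₁ × a ∈ T₂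
      arcs-ST {x} {y} x∈ y∈ with ∈-∃++ x∈ | ∈-∃++ y∈
      ... | S₁ , S₂ , refl | T₁ , T₂ , refl = S₂ ++ b ∷ T₁ , T₂ ++ a ∷ S₁ ,
        rot-trans rot (a ∷ S₁ , x ∷ S₂ ++ b ∷ T₁ ++ y ∷ T₂ , cong (a ∷_) (List.++-assoc S₁ (x ∷ S₂) _) ,
          cong (x ∷_) (trans (List.++-assoc S₂ (b ∷ T₁) (y ∷ T₂ ++ a ∷ S₁))
            (trans (cong (λ l → S₂ ++ b ∷ l) (sym (List.++-assoc T₁ (y ∷ T₂) (a ∷ S₁)))) (sym (List.++-assoc S₂ (b ∷ T₁ ++ y ∷ T₂) (a ∷ S₁)))))) ,
        ∈-++⁺ʳ S₂ (here refl) , ∈-++⁺ʳ T₂ (here refl)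

      long-ST : A a ≡ true → A b ≡ true → ∀ {x y} → x ∈ S → y ∈ T → R x y → Long K
      long-ST aa ab x∈ y∈ r with arcs-ST x∈ y∈
      ... | T₁ , T₂ , rot′ , b∈ , a∈ = record { T₁ = T₁ ; T₂ = T₂ ; rot = rot′ ; chord = r ; has₁ = _ , b∈ , ab ; has₂ = _ , a∈ , aa }

      clash-ST : A a ≡ true → A b ≡ true → ∀ {x y v} → x ∈ S → y ∈ T → v ∉ C → Touch v x → Touch v y → ⊥
      clash-ST aa ab x∈ y∈ v∉ tx ty with arcs-ST x∈ y∈
      ... | T₁ , T₂ , rot′ , b∈ , a∈ = clash-off rot′ v∉ tx ty (_ , b∈ , ab) (_ , a∈ , aa)

      side : ∀ {v} → v ∈ C → v ≢ a → v ≢ b → v ∈ S ⊎ v ∈ T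
      side m ne ne′ with ∈-++⁻ (a ∷ S) (rot-∈ rot m)
      ... | inj₁ (here e) = ⊥-elim (ne e)
      ... | inj₁ (there m′) = inj₁ m′
      ... | inj₂ (here e) = ⊥-elim (ne′ e)
      ... | inj₂ (there m′) = inj₂ m′

      sides-disjoint : ∀ {v} → v ∈ S → v ∈ T → ⊥
      sides-disjoint m m′ = uniq-disj (a ∷ S) (rot-uniq rot uniq) (there m) (there m′)

      side-act : ∀ {v} → v ∈ S ⊎ v ∈ T → v ∈ C × v ≢ a × v ≢ b
      side-act (inj₁ m) = rot-∈ (rot-sym rot) (there (∈-++⁺ˡ m)) ,
        (λ { refl → uniq-disj (a ∷ []) (rot-uniq rot uniq) (here refl) (∈-++⁺ˡ m) }) ,
        λ { refl → uniq-disj (a ∷ S) (rot-uniq rot uniq) (there m) (here refl) }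
      side-act (inj₂ m) = rot-∈ (rot-sym rot) (∈-++⁺ʳ (a ∷ S) (there m)) ,
        (λ { refl → uniq-disj (a ∷ S) (rot-uniq rot uniq) (here refl) (there m) }) ,
        λ { refl → uniq-disj (a ∷ S ++ b ∷ []) (subst Unique (cong (a ∷_) (sym (List.++-assoc S (b ∷ []) T))) (rot-uniq rot uniq)) (there (∈-++⁺ʳ S (here refl))) m }

      Rest : Rel n
      Rest = D ∖ a ∖ b

      rest-symm : Symm Rest
      rest-symm = ∖-symm (∖-symm sD a) b

      rest-inv : ∀ {u v} → Adj Rest u v → R u v × (u ≢ a × v ≢ a) × (u ≢ b × v ≢ b)
      rest-inv {u} {v} e with ∖-inv {D = D ∖ a} {b} {u} {v} e
      ... | e′ , x with ∖-inv {D = D} {a} {u} {v} e′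
      ...   | r , y = r , y , x

      hop-ST : ∀ {x y} → x ∈ S → y ∈ T → Conn Rest x y → Hop Rest (_∈ S) (_∈ T)
      hop-ST x∈ y∈ c = hop rest-symm (λ {u} {v} e → proj₁ (rest-inv {u} {v} e)) (λ m → proj₁ (side-act (inj₂ m)))
        (λ {u} {v} e m → let (_ , (_ , x) , (_ , y)) = rest-inv {u} {v} e in side m x y) x∈ c y∈ sides-disjoint

      -- A passage from `S` to `T` is either a link, which has `b` and `a` on its two sides and so
      -- is long, or a component off the loop, excluded by `clash-off`.
      cross-ST : A a ≡ true → A b ≡ true → ∀ {x y} → x ∈ S → y ∈ T → Conn Rest x y → Long K
      cross-ST aa ab x∈ y∈ c with hop-ST x∈ y∈ c
      ... | edge-hop {x} {y} xs yt e = long-ST aa ab xs yt (proj₁ (rest-inv {x} {y} e))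
      ... | off-hop xs yt v∉ _ tx ty = ⊥-elim (clash-ST aa ab xs yt v∉ tx ty)

  -- As `a` and `b` are not adjacent, both arcs between them have inner nodes, and connecting these
  -- off `a` and `b` yields a long chord. Ears are started away from `a` and `b`, so that these two
  -- serve as `TwoOthers`.
  outerplanar-two : ∀ {a b} → A a ≡ true → A b ≡ true → a ≢ b → D a b ≡ false → (∀ {c} → A c ≡ true → c ≡ a ⊎ c ≡ b) →
    (∀ {u v} → Active D u → Active D v → u ≢ a → u ≢ b → v ≢ a → v ≢ b → Conn (D ∖ a ∖ b) u v) → NonCrossing D
  outerplanar-two {a} {b} aa ab a≢b nab only rest with covering (edge-loop (proj₂ (actA aa)))
  ... | K₀ , cov₀ with grow TwoOthers pick _ K₀ cov₀ (ℕ.n<1+n _)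
    where
    arcs : ∀ K → Covers K → ∃₂ λ S T → Rot (Loop.C K) (a ∷ S ++ b ∷ T) × (∃ λ s → s ∈ S) × ∃ λ t → t ∈ T
    arcs K cov with two-arcs (cov aa) (cov ab) a≢b
    ... | [] , T , rot = ⊥-elim (true≢false (path-adjacent [] (proj₁ (proj₂ (proj₂ (ring-rot rot (Loop.ring K)))))) nab)
    ... | s ∷ S , [] , rot = ⊥-elim (true≢false (path-adjacent [] (proj₁ (proj₂ (proj₂ (ring-rot (rot-++ (a ∷ s ∷ S)) (ring-rot rot (Loop.ring K))))))) (trans (sD b a) nab))
    ... | s ∷ S , t ∷ T , rot = s ∷ S , t ∷ T , rot , (s , here refl) , (t , here refl)
    pick : ∀ K → Covers K → ∀ {v} → Active D v → v ∉ Loop.C K → ∃₂ λ p w → p ∈ Loop.C K × w ∉ Loop.C K × R p w × TwoOthers p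
    pick K cov {v} av v∉ with arcs K cov
    ... | S , T , rot , (s , s∈) , _ with OffLoop.side-act K rot (inj₁ s∈)
    ...   | s∈C , s≢a , s≢b with exit-edge (Loop.C K) (rest (Loop.act K s∈C) av s≢a s≢b (λ { refl → v∉ (cov aa) }) (λ { refl → v∉ (cov ab) })) s∈C v∉
    ...     | p , w , p∈ , w∉ , e with OffLoop.rest-inv K rot {p} {w} e
    ...       | r , (p≢a , _) , (p≢b , _) = p , w , p∈ , w∉ , r , a , b , aa , ab , a≢b , p≢a ∘ sym , p≢b ∘ sym
  ...   | K , cov , h with two-arcs (cov aa) (cov ab) a≢b
  ...     | [] , T , rot = ⊥-elim (true≢false (path-adjacent [] (proj₁ (proj₂ (proj₂ (ring-rot rot (Loop.ring K)))))) nab)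
  ...     | s ∷ S , [] , rot = ⊥-elim (true≢false (path-adjacent [] (proj₁ (proj₂ (proj₂ (ring-rot (rot-++ (a ∷ s ∷ S)) (ring-rot rot (Loop.ring K))))))) (trans (sD b a) nab))
  ...     | s ∷ S , t ∷ T , rot with OffLoop.side-act K {S = s ∷ S} {t ∷ T} rot (inj₁ (here refl)) | OffLoop.side-act K {S = s ∷ S} {t ∷ T} rot (inj₂ (here refl))
  ...       | s∈ , s≢a , s≢b | t∈ , t≢a , t≢b = outerplanar-long third K cov
              (OffLoop.cross-ST K {S = s ∷ S} {t ∷ T} rot aa ab (here refl) (here refl) (rest (Loop.act K s∈) (Loop.act K t∈) s≢a s≢b t≢a t≢b)) h
    where
    third : Third
    third {v} {x} av ax r with only av | only ax
    ... | inj₁ refl | inj₁ refl = ⊥-elim (true≢false r (iD a))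
    ... | inj₁ refl | inj₂ refl = ⊥-elim (true≢false r nab)
    ... | inj₂ refl | inj₁ refl = ⊥-elim (true≢false r (trans (sD b a) nab))
    ... | inj₂ refl | inj₂ refl = ⊥-elim (true≢false r (iD b))

  LongAt : Loop → Fin n → Fin n → Set
  LongAt K x y = ∃₂ λ T₁ T₂ → Rot (Loop.C K) (x ∷ T₁ ++ y ∷ T₂) × R x y × Has A T₁ × Has A T₂

  longAt? : ∀ K x y → Dec (LongAt K x y)
  longAt? K x y with x ∈? Loop.C K | y ∈? Loop.C K | x ≟ y | true? (D x y)
  ... | no x∉ | _ | _ | _ = no λ (_ , _ , rot , _) → x∉ (rot-∈ (rot-sym rot) (here refl))
  ... | yes _ | no y∉ | _ | _ = no λ (T₁ , _ , rot , _) → y∉ (rot-∈ (rot-sym rot) (∈-++⁺ʳ (x ∷ T₁) (here refl)))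
  ... | yes _ | yes _ | yes refl | _ = no λ (_ , _ , _ , r , _) → true≢false r (iD x)
  ... | yes _ | yes _ | no _ | no nr = no λ (_ , _ , _ , r , _) → nr r
  ... | yes x∈ | yes y∈ | no x≢y | yes r with two-arcs x∈ y∈ x≢y
  ...   | T₁ , T₂ , rot with has? A T₁ | has? A T₂
  ...     | inj₁ h₁ | inj₁ h₂ = yes (T₁ , T₂ , rot , r , h₁ , h₂)
  ...     | inj₂ f | _ = no λ (U₁ , U₂ , rot′ , _ , (a , m , t) , _) →
              case arcs-unique (rot-uniq rot (Loop.uniq K)) (rot-trans (rot-sym rot) rot′) of λ { (refl , refl) → true≢false t (f m) }
  ...     | inj₁ _ | inj₂ f = no λ (U₁ , U₂ , rot′ , _ , _ , (a , m , t)) →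
              case arcs-unique (rot-uniq rot (Loop.uniq K)) (rot-trans (rot-sym rot) rot′) of λ { (refl , refl) → true≢false t (f m) }

  long? : ∀ K → Dec (∃₂ λ x y → LongAt K x y)
  long? K = any? λ x → any? λ y → longAt? K x y

  -- D is the union of the edges touching W and the remaining edges; the two parts meet in a, b.
  record RingSplit : Set where
    field
      {a b c} : Fin n
      W       : VSet n
      A-a     : A a ≡ true
      A-b     : A b ≡ true
      a≢b     : a ≢ b
      A-c     : A c ≡ true
      W-a     : W a ≡ false
      W-b     : W b ≡ false
      W-c     : W c ≡ true
      closed  : ∀ {u v} → R u v → W u ≡ true → v ≡ a ⊎ v ≡ b ⊎ W v ≡ true
      W-A     : ∀ {d} → A d ≡ true → d ≢ a → d ≢ b → W d ≡ true
      W-conn  : ∀ {v} → W v ≡ true → Conn (D ∖ a ∖ b) c v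
      outside : Conn (λ u v → D u v ∧ (not (W u) ∧ not (W v))) a b
      cut     : ∀ {d} → A d ≡ true → W d ≡ true → ¬ Conn ((λ u v → D u v ∧ (W u ∨ W v)) ∖ d) a b

  module _ (K : Loop) (cov : Covers K) (short : ¬ ∃₂ λ x y → LongAt K x y)
           {a b c S T} (rot : Rot (Loop.C K) (a ∷ S ++ b ∷ T)) (aa : A a ≡ true) (ab : A b ≡ true) (ac : A c ≡ true) (c∈ : c ∈ T)
           (noS : ∀ {x} → x ∈ S → A x ≡ false) where
    open Loop K hiding (c; c∈)
    open OffLoop K

    private
      Rs : Rel n
      Rs = Rest rot

      W : VSet n
      W v = does (conn? Rs c v)

      W-conn : ∀ {v} → W v ≡ true → Conn Rs c v
      W-conn {v} e = does-yes (conn? Rs c v) e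

      W-intro : ∀ {v} → Conn Rs c v → W v ≡ true
      W-intro {v} h = does-true (conn? Rs c v) h

      nlong : Long K → ⊥
      nlong l = short (_ , _ , Long.T₁ l , Long.T₂ l , Long.rot l , Long.chord l , Long.has₁ l , Long.has₂ l)

      W-not : ∀ {v} → W v ≡ true → v ≢ a × v ≢ b
      W-not {v} w with c ≟ v
      ... | yes refl = proj₂ (side-act rot (inj₂ c∈))
      ... | no ne with conn-end (rest-symm rot) ne (W-conn w)
      ...   | u , e = let (_ , (x , _) , (y , _)) = rest-inv rot {v} {u} e in x , y

      closed : ∀ {u v} → R u v → W u ≡ true → v ≡ a ⊎ v ≡ b ⊎ W v ≡ true
      closed {u} {v} r w with v ≟ a | v ≟ b
      ... | yes e | _ = inj₁ e
      ... | no _ | yes e = inj₂ (inj₁ e)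
      ... | no va | no vb = inj₂ (inj₂ (W-intro (W-conn w ◅◅ (∖-adj {D = D ∖ a} {b} (∖-adj {D = D} {a} r (proj₁ (W-not w)) va) (proj₂ (W-not w)) vb ◅ ε))))

      T-path : IsPath R T
      T-path with chain ((a ∷ S) ∷ (b ∷ []) ∷ T ∷ []) ((a , here refl) ∷ (b , here refl) ∷ (c , c∈) ∷ []) (ring-path (ring-rot rot ring))
      ... | link _ _ (link _ _ (last p)) = p

      T-W : ∀ {v} → v ∈ T → W v ≡ true
      T-W m = W-intro (Star.map (λ {x} {y} (r , x∈ , y∈) →
        let (_ , xa , xb) = side-act rot (inj₂ x∈) ; (_ , ya , yb) = side-act rot (inj₂ y∈) in
        ∖-adj {D = D ∖ a} {b} (∖-adj {D = D} {a} r xa ya) xb yb)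
        (path-connected (λ e → flip-adj sD e) T-path c∈ m))

      -- Otherwise `S` and `T` would be connected off `a` and `b`, which `cross-ST` turns into a
      -- long chord.
      S-W : ∀ {v} → v ∈ S → W v ≡ false
      S-W m = ¬true λ w → nlong (cross-ST rot aa ab m c∈ (conn-sym (rest-symm rot) (W-conn w)))

      outside : Conn (λ u v → D u v ∧ (not (W u) ∧ not (W v))) a b
      outside with ring-rot rot ring
      ... | u , w , pa , _ with path-head pa | path-cut (a ∷ S) pa
      ...   | refl | front , _ = Star.map (λ (r , x , y) → ∧-intro r (∧-intro (cong not (nW x)) (cong not (nW y))))
                (path-connected (λ e → flip-adj sD e) (a , b , front) (here refl) (∈-++⁺ʳ (a ∷ S) (here refl)))
        where
        nW : ∀ {v} → v ∈ a ∷ S ++ b ∷ [] → W v ≡ false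
        nW (here refl) = ¬true λ w → proj₁ (W-not w) refl
        nW (there m) with ∈-++⁻ S m
        ... | inj₁ x = S-W x
        ... | inj₂ (here refl) = ¬true λ w → proj₂ (W-not w) refl

      first-touch : ∀ {v u} → Conn offD v u → u ∉ C → Conn Rs u c → ∃ λ j → j ∈ C × Touch v j × Conn Rs j c
      first-touch h u∉ ε = ⊥-elim (u∉ (proj₁ (side-act rot (inj₂ c∈))))
      first-touch {v} {u} h u∉ (_◅_ {j = j} e es) with j ∈? C
      ... | yes j∈ = j , j∈ , (u , h , proj₁ (rest-inv rot {u} {j} e)) , es
      ... | no j∉ = first-touch (h ◅◅ (offD-adj (proj₁ (rest-inv rot {u} {j} e)) u∉ j∉ ◅ ε)) j∉ es

      D′ : Rel n
      D′ u v = D u v ∧ (W u ∨ W v)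

      D′-symm : Symm D′
      D′-symm u v = cong₂ _∧_ (sD u v) (Bool.∨-comm (W u) _)

      module Cut {d} (ad : A d ≡ true) {T₁ T₂} (eT : T ≡ T₁ ++ d ∷ T₂) where
        rot₂ : Rot C (a ∷ S ++ b ∷ T₁ ++ d ∷ T₂)
        rot₂ = subst (λ T → Rot C (a ∷ S ++ b ∷ T)) eT rot

        P Q : Fin n → Set
        P v = v ∈ T₂ ++ a ∷ []
        Q v = v ∈ b ∷ T₁

        E : Rel n
        E = D′ ∖ d

        E-inv : ∀ {u v} → Adj E u v → R u v × W u ∨ W v ≡ true × v ≢ d
        E-inv {u} {v} e with ∖-inv {D = D′} {d} {u} {v} e
        ... | e′ , _ , vd = let (r , w) = ∧-true {D u v} e′ in r , w , vd

        E-W : ∀ {u v} → Adj E u v → v ≡ a ⊎ v ≡ b ⊎ W v ≡ true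
        E-W {u} {v} e with E-inv {u} {v} e
        ... | r , w , _ with ∨-true {W u} w
        ...   | inj₁ wu = closed r wu
        ...   | inj₂ wv = inj₂ (inj₂ wv)

        in-T : ∀ {v} → v ∈ C → v ≢ a → v ≢ b → W v ≡ true → v ∈ T
        in-T m va vb w with side rot m va vb
        ... | inj₁ s = ⊥-elim (true≢false w (S-W s))
        ... | inj₂ t = t

        T-PQ : ∀ {v} → v ∈ T → v ≡ d ⊎ P v ⊎ Q v
        T-PQ m with ∈-++⁻ T₁ (subst (_ ∈_) eT m)
        ... | inj₁ x = inj₂ (inj₂ (there x))
        ... | inj₂ (here e) = inj₁ e
        ... | inj₂ (there x) = inj₂ (inj₁ (∈-++⁺ˡ x))

        classify : ∀ {u v} → Adj E u v → v ∈ C → P v ⊎ Q v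
        classify {u} {v} e v∈ with v ≟ a | v ≟ b
        ... | yes refl | _ = inj₁ (∈-++⁺ʳ T₂ (here refl))
        ... | no _ | yes refl = inj₂ (here refl)
        ... | no va | no vb with E-W {u} {v} e
        ...   | inj₁ x = ⊥-elim (va x)
        ...   | inj₂ (inj₁ x) = ⊥-elim (vb x)
        ...   | inj₂ (inj₂ w) with T-PQ (in-T v∈ va vb w)
        ...     | inj₁ x = ⊥-elim (proj₂ (proj₂ (E-inv {u} {v} e)) x)
        ...     | inj₂ h = h

        loop-eq : Rot C ((b ∷ T₁) ++ d ∷ (T₂ ++ a ∷ []) ++ S)
        loop-eq = rot-trans rot₂ (a ∷ S , b ∷ T₁ ++ d ∷ T₂ , refl ,
          trans (cong (λ l → b ∷ T₁ ++ d ∷ l) (List.++-assoc T₂ (a ∷ []) S)) (sym (List.++-assoc (b ∷ T₁) (d ∷ T₂) (a ∷ S))))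

        locP : ∀ {x} → P x → ∃₂ λ X₁ X₂ → T₂ ++ a ∷ [] ≡ X₁ ++ x ∷ X₂ × (x ≢ a → a ∈ X₂)
        locP px with ∈-++⁻ T₂ px
        ... | inj₂ (here refl) = T₂ , [] , refl , λ ne → ⊥-elim (ne refl)
        ... | inj₁ m with ∈-∃++ m
        ...   | X₁ , X₂ , refl = X₁ , X₂ ++ a ∷ [] , List.++-assoc X₁ _ _ , λ _ → ∈-++⁺ʳ X₂ (here refl)

        locQ : ∀ {y} → Q y → ∃₂ λ Y₁ Y₂ → b ∷ T₁ ≡ Y₁ ++ y ∷ Y₂ × (y ≢ b → b ∈ Y₁)
        locQ (here refl) = [] , T₁ , refl , λ ne → ⊥-elim (ne refl)
        locQ (there m) with ∈-∃++ m
        ... | Y₁ , Y₂ , refl = b ∷ Y₁ , Y₂ , refl , λ _ → here refl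

        arcs-PQ : ∀ {x y} → P x → Q y → ¬ (x ≡ a × y ≡ b) → ∃₂ λ U₁ U₂ → Rot C (y ∷ U₁ ++ x ∷ U₂) × Has A U₁ × Has A U₂
        arcs-PQ {x} {y} px qy ne with locP px | locQ qy
        ... | X₁ , X₂ , ex , fx | Y₁ , Y₂ , ey , fy = Y₂ ++ d ∷ X₁ , X₂ ++ S ++ Y₁ ,
          rot-trans (subst (Rot C) eq loop-eq) (Y₁ , y ∷ Y₂ ++ d ∷ X₁ ++ x ∷ X₂ ++ S , refl , eq′) ,
          (d , ∈-++⁺ʳ Y₂ (here refl) , ad) , other
          where
          eq : (b ∷ T₁) ++ d ∷ (T₂ ++ a ∷ []) ++ S ≡ Y₁ ++ y ∷ Y₂ ++ d ∷ X₁ ++ x ∷ X₂ ++ S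
          eq = trans (cong₂ (λ l m → l ++ d ∷ m ++ S) ey ex)
            (trans (List.++-assoc Y₁ (y ∷ Y₂) _) (cong (λ l → Y₁ ++ y ∷ Y₂ ++ d ∷ l) (List.++-assoc X₁ (x ∷ X₂) S)))
          eq′ : y ∷ (Y₂ ++ d ∷ X₁) ++ x ∷ X₂ ++ S ++ Y₁ ≡ (y ∷ Y₂ ++ d ∷ X₁ ++ x ∷ X₂ ++ S) ++ Y₁
          eq′ = cong (y ∷_) (trans (List.++-assoc Y₂ (d ∷ X₁) _) (trans
            (cong (λ l → Y₂ ++ d ∷ X₁ ++ x ∷ l) (sym (List.++-assoc X₂ S Y₁)))
            (trans (cong (λ l → Y₂ ++ d ∷ l) (sym (List.++-assoc X₁ (x ∷ X₂ ++ S) Y₁))) (sym (List.++-assoc Y₂ (d ∷ X₁ ++ x ∷ X₂ ++ S) Y₁)))))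
          other : Has A (X₂ ++ S ++ Y₁)
          other with x ≟ a | y ≟ b
          ... | no xa | _ = a , ∈-++⁺ˡ (fx xa) , aa
          ... | yes _ | no yb = b , ∈-++⁺ʳ X₂ (∈-++⁺ʳ S (fy yb)) , ab
          ... | yes e | yes e′ = ⊥-elim (ne (e , e′))

        touch-PQ : ∀ {x y v} → P x → Q y → ¬ (x ≡ a × y ≡ b) → v ∉ C → Touch v x → Touch v y → ⊥
        touch-PQ px qy ne v∉ tx ty with arcs-PQ px qy ne
        ... | _ , _ , r , h₁ , h₂ = clash-off r v∉ ty tx h₁ h₂

        a∈T⊥ : ∀ {j} → j ∈ T → j ≢ a × j ≢ b
        a∈T⊥ m = proj₂ (side-act rot (inj₂ m))

        -- A component touching `a` and `b` also touches the loop at some `j` in `T`, on the way to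
        -- `c`. If `j` is `d`, three attachments are touched; otherwise `j` and one of `a`, `b` have
        -- attachments on both arcs between them.
        through-ab : ∀ {v} → v ∉ C → Active E v → Touch v a → Touch v b → ⊥
        through-ab {v} v∉ (u , e) ta tb with E-W {u} {v} (flip-adj (∖-symm {D = D′} D′-symm d) {v} {u} e)
        ... | inj₁ refl = v∉ (cov aa)
        ... | inj₂ (inj₁ refl) = v∉ (cov ab)
        ... | inj₂ (inj₂ wv) with first-touch ε v∉ (conn-sym (rest-symm rot) (W-conn wv))
        ...   | j , j∈ , tj , cj with W-intro (conn-sym (rest-symm rot) cj)
        ...     | wj with in-T j∈ (proj₁ (W-not wj)) (proj₂ (W-not wj)) wj
        ...       | jT with T-PQ jT
        ...         | inj₁ refl = three-touch rot₂ aa ab ad v∉ ta tb tj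
        ...         | inj₂ (inj₁ pj) = touch-PQ pj (here refl) (λ (e₁ , _) → proj₁ (a∈T⊥ jT) e₁) v∉ tj tb
        ...         | inj₂ (inj₂ qj) = touch-PQ (∈-++⁺ʳ T₂ (here refl)) qj (λ (_ , e₂) → proj₂ (a∈T⊥ jT) e₂) v∉ ta tj

        disjoint-PQ : ∀ {v} → P v → Q v → ⊥
        disjoint-PQ p q = uniq-disj (b ∷ T₁) (rot-uniq loop-eq uniq) q (there (∈-++⁺ˡ p))

        -- Off `d`, the loop nodes met are in `P`, which ends at `a`, or in `Q`, which begins at
        -- `b`. A direct passage between the two has `d` on one side and `a` or `b` on the other,
        -- unless it joins `a` to `b` itself. No link of `D′` does that, and `through-ab` treats the
        -- components.
        cut : ¬ Conn E a b
        cut c′ with hop (∖-symm {D = D′} D′-symm d) (λ {u} {v} e → proj₁ (E-inv {u} {v} e))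
                     (λ m → rot-∈ (rot-sym loop-eq) (∈-++⁺ˡ m)) (λ {u} {v} → classify {u} {v}) {a} {b} (∈-++⁺ʳ T₂ (here refl)) c′ (here refl) disjoint-PQ
        ... | edge-hop {x} {y} px qy e with (x ≟ a) ×-dec (y ≟ b)
        ...   | no ne = let (U₁ , U₂ , r , h₁ , h₂) = arcs-PQ px qy ne in
                  nlong (record { T₁ = U₁ ; T₂ = U₂ ; rot = r ; chord = flip-adj sD (proj₁ (E-inv {x} {y} e)) ; has₁ = h₁ ; has₂ = h₂ })
        ...   | yes (refl , refl) with ∨-true {W x} (proj₁ (proj₂ (E-inv {x} {y} e)))
        ...     | inj₁ w = proj₁ (W-not w) refl
        ...     | inj₂ w = proj₂ (W-not w) refl
        cut c′ | off-hop {x} {y} px qy v∉ av tx ty with (x ≟ a) ×-dec (y ≟ b)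
        ... | no ne = touch-PQ px qy ne v∉ tx ty
        ... | yes (refl , refl) = through-ab v∉ av tx ty

    ring-split : RingSplit
    ring-split = record
      { W = W ; A-a = aa ; A-b = ab ; a≢b = a≢b ; A-c = ac
      ; W-a = ¬true (λ w → proj₁ (W-not w) refl) ; W-b = ¬true (λ w → proj₂ (W-not w) refl) ; W-c = W-intro ε
      ; closed = closed
      ; W-A = λ ad da db → case side rot (cov ad) da db of λ { (inj₁ s) → ⊥-elim (true≢false ad (noS s)) ; (inj₂ t) → T-W t }
      ; W-conn = W-conn ; outside = outside
      ; cut = λ {d} ad wd c′ → case side rot (cov ad) (proj₁ (W-not wd)) (proj₂ (W-not wd)) of λ where
          (inj₁ s) → true≢false wd (S-W s)
          (inj₂ t) → let (T₁ , T₂ , e) = ∈-∃++ t in Cut.cut ad e c′ }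
      where
      a≢b : a ≢ b
      a≢b refl = uniq-disj (a ∷ []) (rot-uniq rot uniq) (here refl) (∈-++⁺ʳ S (here refl))

  -- A long chord leads to a drawing. Without one, `a₀` and the next attachment `b` on the loop
  -- bound an arc free of attachments, and a third attachment lies on the other arc.
  outerplanar-or-split : (∀ p → TwoOthers p) → ∀ {a₀ a₁ a₂} → A a₀ ≡ true → A a₁ ≡ true → A a₂ ≡ true → a₀ ≢ a₁ → a₀ ≢ a₂ → a₁ ≢ a₂ →
                         NonCrossing D ⊎ RingSplit
  outerplanar-or-split others {a₀} {a₁} {a₂} A₀ A₁ A₂ n₀₁ n₀₂ n₁₂ with covering (edge-loop (proj₂ (actA A₀)))
  ... | K₀ , cov₀ with grow TwoOthers (λ K _ a b → let (p , w , x , y , z) = any-exit K a b in p , w , x , y , z , others p) _ K₀ cov₀ (ℕ.n<1+n _)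
  ...   | K , cov , h with long? K
  ...     | yes (x , y , T₁ , T₂ , rot , r , h₁ , h₂) = inj₁ (outerplanar-long third K cov
              (record { T₁ = T₁ ; T₂ = T₂ ; rot = rot ; chord = r ; has₁ = h₁ ; has₂ = h₂ }) h)
    where
    third : Third
    third {v} {x} _ _ _ = let (c , ac , cv , cx) = third-point x (others v) in c , ac , cv , cx
  ...     | no short with ∈-∃++ (cov A₀)
  ...       | X , Y , e with split-first A (Y ++ X) (a₁ , in-rest A₁ (n₀₁ ∘ sym) , A₁)
    where
    in-rest : ∀ {v} → A v ≡ true → v ≢ a₀ → v ∈ Y ++ X
    in-rest av ne with ∈-swap X (subst (_ ∈_) e (cov av))
    ... | here e′ = ⊥-elim (ne e′)
    ... | there m = m
  ...         | S , b , T , e′ , ab , noS = inj₂ (pick-c (b ≟ a₁))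
    where
    rot : Rot (Loop.C K) (a₀ ∷ S ++ b ∷ T)
    rot = X , a₀ ∷ Y , e , cong (a₀ ∷_) (sym e′)
    in-T : ∀ {v} → A v ≡ true → v ≢ a₀ → v ≢ b → v ∈ T
    in-T av v0 vb with ∈-++⁻ (a₀ ∷ S) (rot-∈ rot (cov av))
    ... | inj₁ (here x) = ⊥-elim (v0 x)
    ... | inj₁ (there m) = ⊥-elim (true≢false av (noS m))
    ... | inj₂ (here x) = ⊥-elim (vb x)
    ... | inj₂ (there m) = m
    pick-c : Dec (b ≡ a₁) → RingSplit
    pick-c (no ne) = ring-split K cov short rot A₀ ab A₁ (in-T A₁ (n₀₁ ∘ sym) (ne ∘ sym)) noS
    pick-c (yes refl) = ring-split K cov short rot A₀ ab A₂ (in-T A₂ (n₀₂ ∘ sym) (n₁₂ ∘ sym)) noS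

-- Induction on the number of links; pieces and their reductions

cnt : {X : Set} → (X → Bool) → List X → ℕ
cnt f [] = 0
cnt f (x ∷ l) = if f x then suc (cnt f l) else cnt f l

module _ {X : Set} {f g : X → Bool} (le : ∀ {x} → f x ≡ true → g x ≡ true) where
  cnt-mono : ∀ l → cnt f l ≤ cnt g l
  cnt-mono [] = z≤n
  cnt-mono (x ∷ l) with f x in fx | g x in gx
  ... | true | true = s≤s (cnt-mono l)
  ... | true | false = ⊥-elim (true≢false (le fx) gx)
  ... | false | true = ℕ.m≤n⇒m≤1+n (cnt-mono l)
  ... | false | false = cnt-mono l

  cnt-strict : ∀ {l x} → x ∈ l → g x ≡ true → f x ≡ false → cnt f l < cnt g l
  cnt-strict {x ∷ l} (here refl) gx fx rewrite gx | fx = s≤s (cnt-mono l)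
  cnt-strict {y ∷ l} (there m) gx fx with f y in fy | g y in gy
  ... | true | true = s≤s (cnt-strict m gx fx)
  ... | true | false = ⊥-elim (true≢false (le fy) gy)
  ... | false | true = ℕ.m≤n⇒m≤1+n (cnt-strict m gx fx)
  ... | false | false = cnt-strict m gx fx

edges : ∀ {n} → Rel n → ℕ
edges {n} D = cnt (λ (u , v) → D u v) (List.cartesianProduct (allFin n) (allFin n))

_⊆ʳ_ : ∀ {n} → Rel n → Rel n → Set
D ⊆ʳ D′ = ∀ {u v} → Adj D u v → Adj D′ u v

edges-strict : ∀ {n} {D D′ : Rel n} → D ⊆ʳ D′ → ∀ {u v} → Adj D′ u v → D u v ≡ false → edges D < edges D′
edges-strict le {u} {v} e f = cnt-strict (λ {x} → le {proj₁ x} {proj₂ x}) (Mem.∈-cartesianProduct⁺ (∈-allFin u) (∈-allFin v)) e f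

-- One end in `S` suffices, so the links from `S` to its boundary are included and boundary nodes
-- belong to the part without being in `S`.
Half : ∀ {n} → Rel n → VSet n → Rel n
Half D S u v = D u v ∧ (S u ∨ S v)

module _ {n} {D : Rel n} {S : VSet n} where
  half-inv : ∀ {u v} → Adj (Half D S) u v → Adj D u v × (S u ≡ true ⊎ S v ≡ true)
  half-inv {u} {v} e with ∧-true {D u v} e
  ... | d , s = d , ∨-true {S u} s

  half-intro : ∀ {u v} → Adj D u v → S u ≡ true ⊎ S v ≡ true → Adj (Half D S) u v
  half-intro d (inj₁ s) = ∧-intro d (∨-introˡ s)
  half-intro {u} d (inj₂ s) = ∧-intro d (∨-introʳ {S u} s)

  half-symm : Symm D → Symm (Half D S)
  half-symm s u v = cong₂ _∧_ (s u v) (Bool.∨-comm (S u) _)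

  half-irr : Irr D → Irr (Half D S)
  half-irr i u = cong (_∧ _) (i u)

  half-∖ : ∀ {z} → Half (D ∖ z) S ⊆ʳ (Half D S ∖ z)
  half-∖ {z} {u} {v} e with ∧-true {(D ∖ z) u v} e
  ... | d , s with ∖-inv {D = D} {z} {u} {v} d
  ...   | d′ , a , b = ∖-adj {D = Half D S} {z} (∧-intro d′ s) a b

∖-avoid : ∀ {n} {D : Rel n} {z u v} → u ≢ z → Conn (D ∖ z) u v → v ≢ z
∖-avoid ne ε = ne
∖-avoid {D = D} {z} {u} ne (_◅_ {j = j} e es) = ∖-avoid {D = D} (proj₂ (proj₂ (∖-inv {D = D} {z} {u} {j} e))) es

walk-side : ∀ {n} {D G : Rel n} → G ⊆ʳ D → (S : VSet n) (B : Fin n → Set) →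
  (∀ {u v} → Adj D u v → S u ≡ true → B v ⊎ S v ≡ true) → ∀ {u t} → S u ≡ true → Conn G u t →
  (∃ λ y → B y × Conn (Half G S) u y) ⊎ (S t ≡ true × Conn (Half G S) u t)
walk-side sub S B cl su ε = inj₂ (su , ε)
walk-side {D = D} {G} sub S B cl {u} su (_◅_ {j = j} e es) with cl (sub e) su
... | inj₁ b = inj₁ (j , b , half-intro {D = G} {S} e (inj₁ su) ◅ ε)
... | inj₂ sj with walk-side {D = D} {G} sub S B cl sj es
...   | inj₁ (y , b , c) = inj₁ (y , b , half-intro {D = G} {S} e (inj₁ su) ◅ c)
...   | inj₂ (st , c) = inj₂ (st , half-intro {D = G} {S} e (inj₁ su) ◅ c)

-- `leads` says that, once the root is added, no single node of the piece separates another active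
-- node from the root.
record Piece {n} (D : Rel n) (Dir Ext : VSet n) : Set where
  field
    symm  : Symm D
    irr   : Irr D
    conn  : ∀ {u v} → Active D u → Active D v → Conn D u v
    act   : ∀ {a} → (Dir ∪ Ext) a ≡ true → Active D a
    leads : ∀ z {w} → Active D w → w ≢ z → ∃ λ a → (Dir ∪ Ext) a ≡ true × a ≢ z × Conn (D ∖ z) w a
    free  : ¬ Bad D Dir Ext

-- Contracting private nodes into the root and deleting edges and attachments.
weaken : ∀ {n} {D D′ : Rel n} {Dir Ext Dir′ Ext′ : VSet n} → D′ ⊆ʳ D → Ext′ ⊆ᵇ Ext →
  (∀ {u} → Dir′ u ≡ true → Dir u ≡ true ⊎ (Ext u ≡ true × Ext′ u ≡ false)) →
  Bad D′ Dir′ Ext′ → Bad D Dir Ext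
weaken {n} {D} {D′} {Dir} {Ext} {Dir′} {Ext′} subD subE subDir = forb-contract record
  { to = f ; fibre = λ {v} {a} {b} p q → fib a b (img a p) (img b q) ; lift = lift ; root = refl }
  where
  f : Vtx n → Maybe (Vtx n)
  f root = just root
  f (vtx v) = just (vtx v)
  f (pend v) = if Ext′ v then just (pend v) else if Ext v then just root else nothing
  data Img : Vtx n → Vtx n → Set where
    i-root : Img root root
    i-vtx  : ∀ {v} → Img (vtx v) (vtx v)
    i-pend : ∀ {v} → Img (pend v) (pend v)
    i-rt   : ∀ {v} → Ext v ≡ true → f (pend v) ≡ just root → Img (pend v) root
  img : ∀ a {x} → f a ≡ just x → Img a x
  img root refl = i-root
  img (vtx v) refl = i-vtx
  img (pend v) e with Ext′ v in e₁ | Ext v in e₂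
  img (pend v) refl | true | _ = i-pend
  img (pend v) refl | false | true = i-rt e₂ (eq e₁ e₂)
    where
    eq : Ext′ v ≡ false → Ext v ≡ true → f (pend v) ≡ just root
    eq a b rewrite a | b = refl
  fib : ∀ a b {x} → Img a x → Img b x → Star (Within (Link D Dir Ext) f x) a b
  fib _ _ i-root i-root = ε
  fib _ _ i-root (i-rt e q) = (rp e , refl , q) ◅ ε
  fib _ _ (i-rt e q) i-root = (pr e , q , refl) ◅ ε
  fib _ _ (i-rt e q) (i-rt e′ q′) = (pr e , q , refl) ◅ (rp e′ , refl , q′) ◅ ε
  fib _ _ i-vtx i-vtx = ε
  fib _ _ i-pend i-pend = ε
  keep : ∀ {v} → Ext′ v ≡ true → f (pend v) ≡ just (pend v)
  keep e rewrite e = refl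
  drop : ∀ {v} → Ext v ≡ true → Ext′ v ≡ false → f (pend v) ≡ just root
  drop e e′ rewrite e | e′ = refl
  lift : ∀ {u v} → Link D′ Dir′ Ext′ u v → ∃₂ λ a b → f a ≡ just u × f b ≡ just v × Link D Dir Ext a b
  lift (dd e) = _ , _ , refl , refl , dd (subD e)
  lift (dr {u} e) with subDir e
  ... | inj₁ d = vtx u , root , refl , refl , dr d
  ... | inj₂ (x , y) = vtx u , pend u , refl , drop x y , dp x
  lift (rd {u} e) with subDir e
  ... | inj₁ d = root , vtx u , refl , refl , rd d
  ... | inj₂ (x , y) = pend u , vtx u , drop x y , refl , pd x
  lift (dp {u} e) = vtx u , pend u , refl , keep e , dp (subE e)
  lift (pd {u} e) = pend u , vtx u , keep e , refl , pd (subE e)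
  lift (pr {u} e) = pend u , root , keep e , refl , pr (subE e)
  lift (rp {u} e) = root , pend u , refl , keep e , rp (subE e)

_∩_ : ∀ {n} → VSet n → VSet n → VSet n
(A ∩ B) v = A v ∧ B v

-- Contracting a connected set K attached at z to a private node of z.
contract-to-pendant : ∀ {n} {D D′ : Rel n} {Dir Ext Dir′ Ext′ : VSet n} → Symm D → D′ ⊆ʳ D → (z w : Fin n) (K : VSet n) →
  (∀ {u v} → Adj D′ u v → K u ≡ false × K v ≡ false) →
  (∀ {v} → K v ≡ true → Star (λ x y → Adj D x y × K x ≡ true × K y ≡ true) w v) → K z ≡ false →
  (∃ λ x → K x ≡ true × Adj D x z) → (∃ λ a → K a ≡ true × (Dir ∪ Ext) a ≡ true) →
  (∀ {u} → Dir′ u ≡ true → Dir u ≡ true × K u ≡ false) →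
  (∀ {u} → Ext′ u ≡ true → u ≡ z ⊎ (Ext u ≡ true × K u ≡ false)) →
  Bad D′ Dir′ Ext′ → Bad D Dir Ext
contract-to-pendant {n} {D} {D′} {Dir} {Ext} {Dir′} {Ext′} sD subD z w K out K-conn Kz (x , Kx , xz) (a , Ka , Aa) sDir sExt = forb-contract record
  { to = f ; fibre = λ {v} {a} {b} p q → fib (img a p) (img b q) ; lift = lift ; root = refl }
  where
  f : Vtx n → Maybe (Vtx n)
  f root = just root
  f (vtx v) = if K v then just (pend z) else just (vtx v)
  f (pend v) = if K v ∧ Ext v then just root else (if does (v ≟ z) then nothing else just (pend v))
  f-K : ∀ {v} → K v ≡ true → f (vtx v) ≡ just (pend z)
  f-K e rewrite e = refl
  f-v : ∀ {v} → K v ≡ false → f (vtx v) ≡ just (vtx v)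
  f-v e rewrite e = refl
  f-rt : ∀ {v} → K v ≡ true → Ext v ≡ true → f (pend v) ≡ just root
  f-rt e e′ rewrite e | e′ = refl
  f-p : ∀ {v} → K v ≡ false → v ≢ z → f (pend v) ≡ just (pend v)
  f-p {v} e ne rewrite e | does-false (v ≟ z) ne = refl
  data Img : Vtx n → Vtx n → Set where
    i-root : Img root root
    i-K    : ∀ {v} → K v ≡ true → Img (vtx v) (pend z)
    i-vtx  : ∀ {v} → Img (vtx v) (vtx v)
    i-pend : ∀ {v} → v ≢ z → Img (pend v) (pend v)
    i-rt   : ∀ {v} → K v ≡ true → Ext v ≡ true → Img (pend v) root
  img : ∀ a {x} → f a ≡ just x → Img a x
  img root refl = i-root
  img (vtx v) e with K v in e₁
  img (vtx v) refl | true = i-K e₁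
  img (vtx v) refl | false = i-vtx
  img (pend v) e with K v in e₁ | Ext v in e₂ | v ≟ z
  img (pend v) refl | true | true | _ = i-rt e₁ e₂
  img (pend v) refl | true | false | no ne = i-pend ne
  img (pend v) refl | false | _ | no ne = i-pend ne
  W : Vtx n → Vtx n → Vtx n → Set
  W = Within (Link D Dir Ext) f
  K-star : ∀ {u v} → Star (λ x y → Adj D x y × K x ≡ true × K y ≡ true) u v → Star (W (pend z)) (vtx u) (vtx v)
  K-star = Star.gmap vtx λ (e , p , q) → dd e , f-K p , f-K q
  fib : ∀ {a b x} → Img a x → Img b x → Star (W x) a b
  fib i-root i-root = ε
  fib i-root (i-rt k e) = (rp e , refl , f-rt k e) ◅ ε
  fib (i-rt k e) i-root = (pr e , f-rt k e , refl) ◅ ε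
  fib (i-rt k e) (i-rt k′ e′) = (pr e , f-rt k e , refl) ◅ (rp e′ , refl , f-rt k′ e′) ◅ ε
  fib i-vtx i-vtx = ε
  fib (i-pend _) (i-pend _) = ε
  fib (i-K _) (i-pend ne) = ⊥-elim (ne refl)
  fib (i-pend ne) (i-K _) = ⊥-elim (ne refl)
  fib (i-K k) (i-K k′) = K-star (Star.reverse (λ (e , p , q) → flip-adj sD e , q , p) (K-conn k) ◅◅ K-conn k′)
  link-a : ∃₂ λ p q → f p ≡ just (pend z) × f q ≡ just root × Link D Dir Ext p q
  link-a with ∨-true {Dir a} Aa
  ... | inj₁ d = vtx a , root , f-K Ka , refl , dr d
  ... | inj₂ e = vtx a , pend a , f-K Ka , f-rt Ka e , dp e
  swap : ∀ {u v} → (∃₂ λ p q → f p ≡ just u × f q ≡ just v × Link D Dir Ext p q) → ∃₂ λ p q → f p ≡ just v × f q ≡ just u × Link D Dir Ext p q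
  swap (p , q , a , b , l) = q , p , b , a , link-sym sD l
  l-dr : ∀ {u} → Dir′ u ≡ true → ∃₂ λ p q → f p ≡ just (vtx u) × f q ≡ just root × Link D Dir Ext p q
  l-dr {u} e = let (d , k) = sDir e in vtx u , root , f-v k , refl , dr d
  not-z : ∀ {u} → Ext′ u ≡ true → u ≢ z → Ext u ≡ true × K u ≡ false
  not-z e ne with sExt e
  ... | inj₁ p = ⊥-elim (ne p)
  ... | inj₂ h = h
  l-dp : ∀ {u} → Ext′ u ≡ true → ∃₂ λ p q → f p ≡ just (vtx u) × f q ≡ just (pend u) × Link D Dir Ext p q
  l-dp {u} e with u ≟ z
  ... | yes refl = vtx z , vtx x , f-v Kz , f-K Kx , dd (flip-adj sD xz)
  ... | no ne = let (e′ , k) = not-z e ne in vtx u , pend u , f-v k , f-p k ne , dp e′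
  l-pr : ∀ {u} → Ext′ u ≡ true → ∃₂ λ p q → f p ≡ just (pend u) × f q ≡ just root × Link D Dir Ext p q
  l-pr {u} e with u ≟ z
  ... | yes refl = link-a
  ... | no ne = let (e′ , k) = not-z e ne in pend u , root , f-p k ne , refl , pr e′
  lift : ∀ {u v} → Link D′ Dir′ Ext′ u v → ∃₂ λ p q → f p ≡ just u × f q ≡ just v × Link D Dir Ext p q
  lift (dd {u} {v} e) = let (k , k′) = out e in vtx u , vtx v , f-v k , f-v k′ , dd (subD e)
  lift (dr e) = l-dr e
  lift (rd e) = swap (l-dr e)
  lift (dp e) = l-dp e
  lift (pd e) = swap (l-dp e)
  lift (pr e) = l-pr e
  lift (rp e) = swap (l-pr e)

-- A side S of the cut node z, with a node w beyond z, is again a piece, extended at z.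
module SplitAt {n} {D : Rel n} {Dir Ext : VSet n} (Pc : Piece D Dir Ext) (z : Fin n) (S : VSet n)
               (closed : ∀ {u v} → Adj D u v → S u ≡ true → v ≡ z ⊎ S v ≡ true) (z∉S : S z ≡ false)
               {s w : Fin n} (s∈ : S s ≡ true) (s-act : Active D s) (w-act : Active D w) (w≢z : w ≢ z) (w∉S : S w ≡ false) where
  open Piece Pc

  S≢z : ∀ {v} → S v ≡ true → v ≢ z
  S≢z sv refl = true≢false sv z∉S

  stays : ∀ {u v} → S u ≡ true → Conn (D ∖ z) u v → S v ≡ true
  stays su ε = su
  stays {u} su (_◅_ {j = j} e es) with ∖-inv {D = D} {z} {u} {j} e
  ... | d , _ , jz with closed d su
  ...   | inj₁ p = ⊥-elim (jz p)
  ...   | inj₂ sj = stays sj es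

  K : VSet n
  K v = does (conn? (D ∖ z) w v)

  K-conn : ∀ {v} → K v ≡ true → Conn (D ∖ z) w v
  K-conn {v} e = does-yes (conn? (D ∖ z) w v) e

  K-intro : ∀ {v} → Conn (D ∖ z) w v → K v ≡ true
  K-intro {v} c = does-true (conn? (D ∖ z) w v) c

  K∩S : ∀ {v} → K v ≡ true → S v ≡ true → ⊥
  K∩S k sv = true≢false (stays sv (conn-sym (∖-symm symm z) (K-conn k))) w∉S

  K-z : K z ≡ false
  K-z = ¬true λ k → ∖-avoid {D = D} w≢z (K-conn k) refl

  s≢z : s ≢ z
  s≢z = S≢z s∈

  s-to-z : Conn (Half D S) s z
  s-to-z with walk-side {D = D} id S (_≡ z) closed s∈ (conn s-act w-act)
  ... | inj₁ (_ , refl , c) = c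
  ... | inj₂ (sw , _) = ⊥-elim (true≢false sw w∉S)

  z-act : Active (Half D S) z
  z-act = conn-end (half-symm {S = S} symm) s≢z s-to-z

  z-act′ : Active D z
  z-act′ = let (u , e) = z-act in u , proj₁ (half-inv {D = D} {S} {z} {u} e)

  K-near : ∃ λ x → K x ≡ true × Adj D x z
  K-near = nearest (K-intro ε) w≢z (conn w-act z-act′)
    where
    nearest : ∀ {u} → K u ≡ true → u ≢ z → Conn D u z → ∃ λ x → K x ≡ true × Adj D x z
    nearest k ne ε = ⊥-elim (ne refl)
    nearest {u} k ne (_◅_ {j = j} e es) with j ≟ z
    ... | yes refl = u , k , e
    ... | no jz = nearest (K-intro (K-conn k ◅◅ (∖-adj {D = D} {z} e ne jz ◅ ε))) jz es

  half-side : ∀ {u} → Active (Half D S) u → u ≡ z ⊎ S u ≡ true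
  half-side {u} (v , e) with half-inv {D = D} {S} {u} {v} e
  ... | d , inj₁ su = inj₂ su
  ... | d , inj₂ sv = closed (flip-adj symm d) sv

  to-z : ∀ {u} → Active (Half D S) u → Conn (Half D S) u z
  to-z {u} au with half-side au
  ... | inj₁ refl = ε
  ... | inj₂ su with walk-side {D = D} id S (_≡ z) closed su (conn (proj₁ au , proj₁ (half-inv {D = D} {S} {u} (proj₂ au))) z-act′)
  ...   | inj₁ (_ , refl , c) = c
  ...   | inj₂ (sz , _) = ⊥-elim (true≢false sz z∉S)

  Dir′ Ext′ : VSet n
  Dir′ = Dir ∩ S
  Ext′ = (Ext ∩ S) ∪ ⁅ z ⁆

  in-A : ∀ {a} → (Dir ∪ Ext) a ≡ true → S a ≡ true → (Dir′ ∪ Ext′) a ≡ true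
  in-A {a} aa sa with ∨-true {Dir a} aa
  ... | inj₁ d = ∨-introˡ (∧-intro d sa)
  ... | inj₂ e = ∨-introʳ {Dir′ a} (∨-introˡ (∧-intro e sa))

  in-z : (Dir′ ∪ Ext′) z ≡ true
  in-z = ∨-introʳ {Dir′ z} (∨-introʳ {(Ext ∩ S) z} (does-true (z ≟ z) refl))

  from-A : ∀ {a} → (Dir′ ∪ Ext′) a ≡ true → a ≡ z ⊎ ((Dir ∪ Ext) a ≡ true × S a ≡ true)
  from-A {a} aa with ∨-true {Dir′ a} aa
  ... | inj₁ d = let (x , y) = ∧-true {Dir a} d in inj₂ (∨-introˡ x , y)
  ... | inj₂ e with ∨-true {(Ext ∩ S) a} e
  ...   | inj₁ e′ = let (x , y) = ∧-true {Ext a} e′ in inj₂ (∨-introʳ {Dir a} x , y)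
  ...   | inj₂ e′ = inj₁ (does-yes (a ≟ z) e′)

  piece : Piece (Half D S) Dir′ Ext′
  piece = record
    { symm = half-symm {S = S} symm ; irr = half-irr {D = D} {S} irr
    ; conn = λ au av → to-z au ◅◅ conn-sym (half-symm {S = S} symm) (to-z av)
    ; act = act′ ; leads = leads′ ; free = free ∘ bad }
    where
    act′ : ∀ {a} → (Dir′ ∪ Ext′) a ≡ true → Active (Half D S) a
    act′ aa with from-A aa
    ... | inj₁ refl = z-act
    ... | inj₂ (x , sa) = let (v , e) = act x in v , half-intro {D = D} {S} e (inj₁ sa)
    leads′ : ∀ z′ {u} → Active (Half D S) u → u ≢ z′ → ∃ λ a → (Dir′ ∪ Ext′) a ≡ true × a ≢ z′ × Conn (Half D S ∖ z′) u a
    leads′ z′ {u} au ne with half-side au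
    ... | inj₁ refl = z , in-z , ne , ε
    ... | inj₂ su with leads z′ (proj₁ au , proj₁ (half-inv {D = D} {S} {u} (proj₂ au))) ne
    ...   | a , aa , a≢ , c with walk-side {D = D} (λ {x} {y} e → proj₁ (∖-inv {D = D} {z′} {x} {y} e)) S (_≡ z) closed su c
    ...     | inj₂ (sa , c′) = a , in-A aa sa , a≢ , conn-mono (half-∖ {D = D} {S} {z′}) c′
    ...     | inj₁ (_ , refl , c′) = z , in-z , ∖-avoid {D = Half D S} ne (conn-mono (half-∖ {D = D} {S} {z′}) c′) ,
                                     conn-mono (half-∖ {D = D} {S} {z′}) c′
    off-K : ∀ {u v} → Adj (Half D S) u v → K u ≡ false
    off-K {u} {v} e with half-side (v , e)
    ... | inj₁ refl = K-z
    ... | inj₂ su = ¬true λ k → K∩S k su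
    K-star : ∀ {u v} → K u ≡ true → Conn (D ∖ z) u v → Star (λ x y → Adj D x y × K x ≡ true × K y ≡ true) u v
    K-star k ε = ε
    K-star {u} k (_◅_ {j = j} e es) = (proj₁ (∖-inv {D = D} {z} {u} {j} e) , k , kj) ◅ K-star kj es
      where kj = K-intro (K-conn k ◅◅ (e ◅ ε))
    bad : Bad (Half D S) Dir′ Ext′ → Bad D Dir Ext
    bad = contract-to-pendant symm (λ {u} {v} e → proj₁ (half-inv {D = D} {S} {u} {v} e)) z w K
      (λ {u} {v} e → off-K e , off-K (flip-adj (half-symm {S = S} symm) {u} {v} e))
      (λ k → K-star (K-intro ε) (K-conn k)) K-z K-near
      (let (a , aa , _ , c) = leads z w-act w≢z in a , K-intro c , aa)
      (λ {u} e → let (x , y) = ∧-true {Dir u} e in x , ¬true λ k → K∩S k y)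
      (λ {u} e → case ∨-true {(Ext ∩ S) u} e of λ where
        (inj₁ e′) → let (x , y) = ∧-true {Ext u} e′ in inj₂ (x , ¬true λ k → K∩S k y)
        (inj₂ e′) → inj₁ (does-yes (u ≟ z) e′))

-- Tours for pieces with a cut node or a private path

CutNode : ∀ {n} → Rel n → Set
CutNode D = ∃ λ z → ∃₂ λ w₁ w₂ → (Active D w₁ × w₁ ≢ z) × (Active D w₂ × w₂ ≢ z) × ¬ Conn (D ∖ z) w₁ w₂

cut-node? : ∀ {n} (D : Rel n) → Dec (CutNode D)
cut-node? D = any? λ z → any? λ w₁ → any? λ w₂ →
  (active? D w₁ ×-dec ¬? (w₁ ≟ z)) ×-dec (active? D w₂ ×-dec ¬? (w₂ ≟ z)) ×-dec ¬? (conn? (D ∖ z) w₁ w₂)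

two-connected : ∀ {n} {D : Rel n} → ¬ CutNode D → TwoConnected D
two-connected {D = D} nc z {u} {w} au aw uz wz =
  dec-stable (conn? (D ∖ z) u w) λ n → nc (z , u , w , (au , uz) , (aw , wz) , n)

circle-tour : ∀ {n} {D : Rel n} {A : VSet n} → Symm D → Irr D → NonCrossing D → Tour D A
circle-tour s i N = tour-forget s (λ _ → refl) (Circle.tour s i N)

Above : ℕ → ℕ → Set
Above n m = ∀ {D : Rel n} {Dir Ext} → edges D < m → Piece D Dir Ext → (∃ λ e → Ext e ≡ true) → Tour D (Dir ∪ Ext)

half-smaller : ∀ {n} {D : Rel n} {S : VSet n} {u v} → Adj D u v → S u ≡ false → S v ≡ false → edges (Half D S) < edges D
half-smaller {D = D} {S} {u} {v} e a b = edges-strict {D = Half D S} {D} (λ {x} {y} h → proj₁ (half-inv {D = D} {S} {x} {y} h)) e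
  (¬true λ h → case proj₂ (half-inv {D = D} {S} {u} {v} h) of λ { (inj₁ x) → true≢false x a ; (inj₂ x) → true≢false x b })

-- On both sides `z` becomes a terminal with a private path, so the induction hypothesis applies to
-- them even if the piece itself has no such terminal.
cut-tour : ∀ {n} {D : Rel n} {Dir Ext} → Above n (edges D) → Piece D Dir Ext → CutNode D → Tour D (Dir ∪ Ext)
cut-tour {n} {D} {Dir} {Ext} ih Pc (z , w₁ , w₂ , (act₁ , w₁z) , (act₂ , w₂z) , sep) =
  tour-forget symm (λ {v} → sub {v}) (tour-resp both-D D-both id id
    (Glue.tour (P₁.symm) (P₂.symm) (P₁.irr) (P₂.irr) T₁ T₂ z Sp₁.in-z Sp₂.in-z S₁ dd₁ dd₂ aa₁ aa₂))
  where
  open Piece Pc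
  S₁ S₂ : VSet n
  S₁ v = does (conn? (D ∖ z) w₁ v)
  S₂ v = not (S₁ v) ∧ not (does (v ≟ z))
  S₁-conn : ∀ {v} → S₁ v ≡ true → Conn (D ∖ z) w₁ v
  S₁-conn {v} e = does-yes (conn? (D ∖ z) w₁ v) e
  S₁-intro : ∀ {v} → Conn (D ∖ z) w₁ v → S₁ v ≡ true
  S₁-intro {v} c = does-true (conn? (D ∖ z) w₁ v) c
  S₁≢z : ∀ {v} → S₁ v ≡ true → v ≢ z
  S₁≢z e = ∖-avoid {D = D} w₁z (S₁-conn e)
  closed₁ : ∀ {u v} → Adj D u v → S₁ u ≡ true → v ≡ z ⊎ S₁ v ≡ true
  closed₁ {u} {v} e su with v ≟ z
  ... | yes p = inj₁ p
  ... | no vz = inj₂ (S₁-intro (S₁-conn su ◅◅ (∖-adj {D = D} {z} e (S₁≢z su) vz ◅ ε)))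
  S₂-intro : ∀ {v} → S₁ v ≡ false → v ≢ z → S₂ v ≡ true
  S₂-intro {v} e ne = ∧-intro (cong not e) (cong not (does-false (v ≟ z) ne))
  S₂-inv : ∀ {v} → S₂ v ≡ true → S₁ v ≡ false × v ≢ z
  S₂-inv {v} e = let (a , b) = ∧-true {not (S₁ v)} e in not-true a , does-no (v ≟ z) (not-true b)
  closed₂ : ∀ {u v} → Adj D u v → S₂ u ≡ true → v ≡ z ⊎ S₂ v ≡ true
  closed₂ {u} {v} e su = decide (v ≟ z) (bool-case (S₁ v))
    where
    decide : Dec (v ≡ z) → S₁ v ≡ true ⊎ S₁ v ≡ false → v ≡ z ⊎ S₂ v ≡ true
    decide (yes p) _ = inj₁ p
    decide (no vz) (inj₂ nv) = inj₂ (S₂-intro nv vz)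
    decide (no vz) (inj₁ sv) with closed₁ (flip-adj symm e) sv
    ... | inj₁ p = ⊥-elim (proj₂ (S₂-inv su) p)
    ... | inj₂ p = ⊥-elim (true≢false p (proj₁ (S₂-inv su)))
  z∉S₁ : S₁ z ≡ false
  z∉S₁ = ¬true λ e → S₁≢z e refl
  z∉S₂ : S₂ z ≡ false
  z∉S₂ = ¬true λ e → proj₂ (S₂-inv e) refl
  w₂∉S₁ : S₁ w₂ ≡ false
  w₂∉S₁ = ¬true λ e → sep (S₁-conn e)
  w₁∉S₂ : S₂ w₁ ≡ false
  w₁∉S₂ = ¬true λ e → true≢false (S₁-intro ε) (proj₁ (S₂-inv e))
  module Sp₁ = SplitAt Pc z S₁ closed₁ z∉S₁ (S₁-intro ε) act₁ act₂ w₂z w₂∉S₁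
  module Sp₂ = SplitAt Pc z S₂ closed₂ z∉S₂ (S₂-intro w₂∉S₁ w₂z) act₂ act₁ w₁z w₁∉S₂
  module P₁ = Piece Sp₁.piece
  module P₂ = Piece Sp₂.piece
  ext-z : ∀ {S : VSet n} → ((Ext ∩ S) ∪ ⁅ z ⁆) z ≡ true
  ext-z {S} = ∨-introʳ {(Ext ∩ S) z} (does-true (z ≟ z) refl)
  T₁ : Tour (Half D S₁) (Sp₁.Dir′ ∪ Sp₁.Ext′)
  T₁ = ih (half-smaller {D = D} {S₁} (proj₂ act₂) w₂∉S₁ (out (proj₂ act₂))) Sp₁.piece (z , ext-z {S₁})
    where
    out : ∀ {u} → Adj D w₂ u → S₁ u ≡ false
    out e = ¬true λ su → case closed₁ (flip-adj symm e) su of λ { (inj₁ p) → w₂z p ; (inj₂ p) → true≢false p w₂∉S₁ }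
  T₂ : Tour (Half D S₂) (Sp₂.Dir′ ∪ Sp₂.Ext′)
  T₂ = ih (half-smaller {D = D} {S₂} (proj₂ act₁) w₁∉S₂ (out (proj₂ act₁))) Sp₂.piece (z , ext-z {S₂})
    where
    out : ∀ {u} → Adj D w₁ u → S₂ u ≡ false
    out e = ¬true λ su → case closed₂ (flip-adj symm e) su of λ { (inj₁ p) → w₁z p ; (inj₂ p) → true≢false p w₁∉S₂ }
  dd₁ : ∀ {u v} → u ≢ z → Adj (Half D S₁) u v → S₁ u ≡ true
  dd₁ {u} {v} ne e with Sp₁.half-side (v , e)
  ... | inj₁ p = ⊥-elim (ne p)
  ... | inj₂ s = s
  dd₂ : ∀ {u v} → u ≢ z → Adj (Half D S₂) u v → S₁ u ≡ false
  dd₂ {u} {v} ne e with Sp₂.half-side (v , e)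
  ... | inj₁ p = ⊥-elim (ne p)
  ... | inj₂ s = proj₁ (S₂-inv s)
  aa₁ : ∀ {u} → u ≢ z → (Sp₁.Dir′ ∪ Sp₁.Ext′) u ≡ true → S₁ u ≡ true
  aa₁ ne e with Sp₁.from-A e
  ... | inj₁ p = ⊥-elim (ne p)
  ... | inj₂ (_ , s) = s
  aa₂ : ∀ {u} → u ≢ z → (Sp₂.Dir′ ∪ Sp₂.Ext′) u ≡ true → S₁ u ≡ false
  aa₂ ne e with Sp₂.from-A e
  ... | inj₁ p = ⊥-elim (ne p)
  ... | inj₂ (_ , s) = proj₁ (S₂-inv s)
  both-D : ∀ {u v} → Adj (Half D S₁ ⊔ Half D S₂) u v → Adj D u v
  both-D {u} {v} e with ∨-true {Half D S₁ u v} e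
  ... | inj₁ h = proj₁ (half-inv {D = D} {S₁} {u} {v} h)
  ... | inj₂ h = proj₁ (half-inv {D = D} {S₂} {u} {v} h)
  D-both : ∀ {u v} → Adj D u v → Adj (Half D S₁ ⊔ Half D S₂) u v
  D-both {u} {v} e = decide (bool-case (S₁ u)) (bool-case (S₁ v)) (u ≟ z)
    where
    decide : S₁ u ≡ true ⊎ S₁ u ≡ false → S₁ v ≡ true ⊎ S₁ v ≡ false → Dec (u ≡ z) → Adj (Half D S₁ ⊔ Half D S₂) u v
    decide (inj₁ s) _ _ = ∨-introˡ (half-intro {D = D} {S₁} e (inj₁ s))
    decide (inj₂ _) (inj₁ s) _ = ∨-introˡ (half-intro {D = D} {S₁} e (inj₂ s))
    decide (inj₂ ns) (inj₂ _) (no ne) = ∨-introʳ {Half D S₁ u v} (half-intro {D = D} {S₂} e (inj₁ (S₂-intro ns ne)))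
    decide (inj₂ _) (inj₂ ns) (yes refl) =
      ∨-introʳ {Half D S₁ u v} (half-intro {D = D} {S₂} e (inj₂ (S₂-intro ns λ { refl → true≢false e (irr _) })))
  sub : (Dir ∪ Ext) ⊆ᵇ ((Sp₁.Dir′ ∪ Sp₁.Ext′) ∪ (Sp₂.Dir′ ∪ Sp₂.Ext′))
  sub {a} aa = decide (bool-case (S₁ a)) (a ≟ z)
    where
    decide : S₁ a ≡ true ⊎ S₁ a ≡ false → Dec (a ≡ z) → ((Sp₁.Dir′ ∪ Sp₁.Ext′) ∪ (Sp₂.Dir′ ∪ Sp₂.Ext′)) a ≡ true
    decide (inj₁ s) _ = ∨-introˡ (Sp₁.in-A aa s)
    decide (inj₂ _) (yes refl) = ∨-introˡ Sp₁.in-z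
    decide (inj₂ ns) (no ne) = ∨-introʳ {(Sp₁.Dir′ ∪ Sp₁.Ext′) a} (Sp₂.in-A aa (S₂-intro ns ne))

module RemoveEdge {n} {D : Rel n} (sD : Symm D) {a b : Fin n} (a≢b : a ≢ b) (ab : Adj D a b) where
  D⁻ : Rel n
  D⁻ u v = D u v ∧ not (edge a b u v)

  D⁻-inv : ∀ {u v} → Adj D⁻ u v → Adj D u v × ¬ Adj (edge a b) u v
  D⁻-inv {u} {v} e = let (d , x) = ∧-true {D u v} e in d , λ y → true≢false y (not-true x)

  D⁻-adj : ∀ {u v} → Adj D u v → (u ≢ a × u ≢ b) ⊎ (v ≢ a × v ≢ b) ⊎ (u ≢ a × v ≢ a) ⊎ (u ≢ b × v ≢ b) → Adj D⁻ u v
  D⁻-adj {u} {v} d h = ∧-intro d (cong not (¬true λ e → bad (edge-inv {v = a} {b} {u} {v} e) h))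
    where
    bad : (u ≡ a × v ≡ b) ⊎ (u ≡ b × v ≡ a) → (u ≢ a × u ≢ b) ⊎ (v ≢ a × v ≢ b) ⊎ (u ≢ a × v ≢ a) ⊎ (u ≢ b × v ≢ b) → ⊥
    bad (inj₁ (x , y)) (inj₁ (p , q)) = p x
    bad (inj₁ (x , y)) (inj₂ (inj₁ (p , q))) = q y
    bad (inj₁ (x , y)) (inj₂ (inj₂ (inj₁ (p , q)))) = p x
    bad (inj₁ (x , y)) (inj₂ (inj₂ (inj₂ (p , q)))) = q y
    bad (inj₂ (x , y)) (inj₁ (p , q)) = q x
    bad (inj₂ (x , y)) (inj₂ (inj₁ (p , q))) = p y
    bad (inj₂ (x , y)) (inj₂ (inj₂ (inj₁ (p , q)))) = q y
    bad (inj₂ (x , y)) (inj₂ (inj₂ (inj₂ (p , q)))) = p x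

  D⁻-symm : Symm D⁻
  D⁻-symm u v = cong₂ (λ x y → x ∧ not y) (sD u v) (edge-symm {v = a} {b} u v)

  D⁻-ab : D⁻ a b ≡ false
  D⁻-ab = ¬true λ e → proj₂ (D⁻-inv {a} {b} e) (edge-adj {v = a} {b})

  smaller : edges D⁻ < edges D
  smaller = edges-strict {D = D⁻} {D} (λ {u} {v} e → proj₁ (D⁻-inv {u} {v} e)) ab D⁻-ab

  back : ∀ {u v} → Adj (D⁻ ⊔ edge a b) u v → Adj D u v
  back {u} {v} e with ∨-true {D⁻ u v} e
  ... | inj₁ x = proj₁ (D⁻-inv {u} {v} x)
  ... | inj₂ x with edge-inv {v = a} {b} {u} {v} x
  ...   | inj₁ (refl , refl) = ab
  ...   | inj₂ (refl , refl) = flip-adj sD ab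

  forth : ∀ {u v} → Adj D u v → Adj (D⁻ ⊔ edge a b) u v
  forth {u} {v} e with bool-case (edge a b u v)
  ... | inj₁ x = ∨-introʳ {D⁻ u v} x
  ... | inj₂ x = ∨-introˡ (∧-intro e (cong not x))

  -- A walk that avoids `a` or avoids `b` does not use the removed link, and having no cut node
  -- provides such walks. Between `a` and `b` themselves the third node `w` serves as a stopover.
  piece : ∀ {Dir Ext} → Piece D Dir Ext → TwoConnected D → (Dir ∪ Ext) a ≡ true → (Dir ∪ Ext) b ≡ true →
          (∀ {c} → (Dir ∪ Ext) c ≡ true → c ≡ a ⊎ c ≡ b) → (∃ λ w → Active D w × w ≢ a × w ≢ b) → Piece D⁻ Dir Ext
  piece {Dir} {Ext} Pc two Aa Ab only (w , aw , wa , wb) = record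
    { symm = D⁻-symm ; irr = λ u → cong (_∧ _) (irr u)
    ; conn = λ {u} {v} au av → to-a (wide au) ◅◅ conn-sym D⁻-symm (to-a (wide av))
    ; act = λ {c} Ac → case only Ac of λ { (inj₁ refl) → conn-end D⁻-symm wa (to-a aw) ; (inj₂ refl) → conn-end D⁻-symm wb (to-b aw) }
    ; leads = λ z {u} au uz → let (c , Ac , cz , p) = leads z (wide au) uz in first-A z uz p Ac
    ; free = free ∘ weaken (λ {u} {v} e → proj₁ (D⁻-inv {u} {v} e)) id (λ d → inj₁ d) }
    where
    open Piece Pc
    wide : ∀ {u} → Active D⁻ u → Active D u
    wide {u} (v , e) = v , proj₁ (D⁻-inv {u} {v} e)
    without : ∀ {z u v} → z ≡ a ⊎ z ≡ b → Conn (D ∖ z) u v → Conn D⁻ u v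
    without (inj₁ refl) = conn-mono λ {u} {v} e → let (d , x , y) = ∖-inv {D = D} {a} {u} {v} e in D⁻-adj d (inj₂ (inj₂ (inj₁ (x , y))))
    without (inj₂ refl) = conn-mono λ {u} {v} e → let (d , x , y) = ∖-inv {D = D} {b} {u} {v} e in D⁻-adj d (inj₂ (inj₂ (inj₂ (x , y))))
    to-a : ∀ {u} → Active D u → Conn D⁻ u a
    to-a {u} au with u ≟ b
    ... | no ub = without (inj₂ refl) (two b au (act Aa) ub a≢b)
    ... | yes refl = without (inj₁ refl) (two a au aw (a≢b ∘ sym) wa) ◅◅ without (inj₂ refl) (two b aw (act Aa) wb a≢b)
    to-b : ∀ {u} → Active D u → Conn D⁻ u b
    to-b {u} au with u ≟ a
    ... | no ua = without (inj₁ refl) (two a au (act Ab) ua (a≢b ∘ sym))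
    ... | yes refl = without (inj₂ refl) (two b au aw a≢b wb) ◅◅ without (inj₁ refl) (two a aw (act Ab) wa (a≢b ∘ sym))
    first-A : ∀ z {u c} → u ≢ z → Conn (D ∖ z) u c → (Dir ∪ Ext) c ≡ true → ∃ λ d → (Dir ∪ Ext) d ≡ true × d ≢ z × Conn (D⁻ ∖ z) u d
    first-A z {u} uz ε Ac = u , Ac , uz , ε
    first-A z {u} uz (_◅_ {j = j} e es) Ac with u ≟ a | u ≟ b
    ... | yes refl | _ = a , Aa , uz , ε
    ... | no _ | yes refl = b , Ab , uz , ε
    ... | no ua | no ub with ∖-inv {D = D} {z} {u} {j} e
    ...   | d , _ , jz with first-A z jz es Ac
    ...     | x , Ax , xz , c = x , Ax , xz , ∖-adj {D = D⁻} {z} (D⁻-adj d (inj₁ (ua , ub))) uz jz ◅ c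

-- A violation of `nc` needs more than two distinct positions.
edge-noncrossing : ∀ {n} {D : Rel n} {a b} → Irr D → (∀ {u} → Active D u → u ≡ a ⊎ u ≡ b) → Symm D → NonCrossing D
edge-noncrossing {n} {D} {a} {b} iD only sD = record
  { pos = toℕ ; bound = n ; pos< = toℕ<n ; inj = toℕ-injective ; nc = nc }
  where
  nc : ∀ {x y z w} → Adj D x z → Adj D y w → Cyc (toℕ x) (toℕ y) (toℕ z) → Cyc (toℕ x) (toℕ z) (toℕ w) → ⊥
  nc {x} {y} {z} {w} e f c d with only (z , e) | only (x , flip-adj sD e) | only (w , f)
  ... | inj₁ refl | inj₁ refl | _ = true≢false e (iD _)
  ... | inj₂ refl | inj₂ refl | _ = true≢false e (iD _)
  ... | inj₁ refl | inj₂ refl | inj₁ refl = cyc-irrˡ c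
  ... | inj₁ refl | inj₂ refl | inj₂ refl = cyc-irr c
  ... | inj₂ refl | inj₁ refl | inj₁ refl = cyc-irr c
  ... | inj₂ refl | inj₁ refl | inj₂ refl = cyc-irrˡ c

-- Shortening private paths to direct links is a contraction, so the lemmas that know direct
-- attachments only apply to every piece.
merge-free : ∀ {n} {D : Rel n} {Dir Ext} → Piece D Dir Ext → ¬ Forb (Link D (Dir ∪ Ext) none) root
merge-free {Dir = Dir} Pc = Piece.free Pc ∘ weaken id (λ ()) λ {u} e → case ∨-true {Dir u} e of λ { (inj₁ d) → inj₁ d ; (inj₂ x) → inj₂ (x , refl) }

-- Without a cut node the piece is drawn on a circle as long as two adjacent attachments never occur
-- without a third. The exception is a piece with exactly two attachments joined by a link: that
-- link is removed and restored by `AddEdge`, unless there are no further nodes.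
tour-extended : ∀ m {n} → Above n m
tour-extended (suc m) {n} {D} {Dir} {Ext} lt Pc (e , ee) with cut-node? D
... | yes cut = cut-tour (λ l → tour-extended m (ℕ.<-≤-trans l (ℕ.≤-pred lt))) Pc cut
... | no ncut = solve (any? λ b → (true? ((Dir ∪ Ext) b)) ×-dec (¬? (b ≟ e) ×-dec ¬? (b ≟ x)))
  where
  open Piece Pc
  A : VSet n
  A = Dir ∪ Ext
  two : TwoConnected D
  two = two-connected ncut
  Ae : A e ≡ true
  Ae = ∨-introʳ {Dir e} ee
  other : ∃ λ x → A x ≡ true × x ≢ e
  other = let (u , eu) = act Ae ; (x , Ax , xe , _) = leads e (e , flip-adj symm eu) (λ p → true≢false (subst (Adj D e) p eu) (irr e)) in x , Ax , xe
  x : Fin n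
  x = proj₁ other
  Ax : A x ≡ true
  Ax = proj₁ (proj₂ other)
  e≢x : e ≢ x
  e≢x = proj₂ (proj₂ other) ∘ sym
  free-e : ¬ Forb (Link D (A ─ e) ⁅ e ⁆) root
  free-e = free ∘ weaken id (λ {v} h → case does-yes (v ≟ e) h of λ { refl → ee })
    λ {u} h → let (a , ne) = ∧-true {A u} h in case ∨-true {Dir u} a of λ { (inj₁ d) → inj₁ d ; (inj₂ y) → inj₂ (y , not-true ne) }
  module G = Grow symm irr two conn {A} (merge-free Pc) act
  module C = Cycles symm {A} (merge-free Pc)
  drawn : C.Third → Tour D A
  drawn third = circle-tour symm irr (G.outerplanar-pendant third Ae Ax e≢x Ae free-e)
  solve : Dec (∃ λ b → A b ≡ true × b ≢ e × b ≢ x) → Tour D A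
  solve (yes (b , Ab , be , bx)) = drawn third
    where
    third : C.Third
    third {v} {w} _ _ _ with e ≟ v | e ≟ w
    ... | no a | no c = e , Ae , a , c
    third {v} {w} _ _ _ | yes refl | _ with x ≟ w
    ... | no c = x , Ax , e≢x ∘ sym , c
    ... | yes refl = b , Ab , be , bx
    third {v} {w} _ _ _ | no _ | yes refl with x ≟ v
    ... | no c = x , Ax , c , e≢x ∘ sym
    ... | yes refl = b , Ab , bx , be
  solve (no none′) with true? (D e x)
  ... | no nex = drawn third
    where
    ends : ∀ {c} → A c ≡ true → c ≡ e ⊎ c ≡ x
    ends {c} Ac with c ≟ e | c ≟ x
    ... | yes p | _ = inj₁ p
    ... | no _ | yes p = inj₂ p
    ... | no p | no q = ⊥-elim (none′ (c , Ac , p , q))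
    third : C.Third
    third {v} {w} Av Aw r with ends Av | ends Aw
    ... | inj₁ refl | inj₁ refl = ⊥-elim (true≢false r (irr _))
    ... | inj₁ refl | inj₂ refl = ⊥-elim (nex r)
    ... | inj₂ refl | inj₁ refl = ⊥-elim (nex (flip-adj symm r))
    ... | inj₂ refl | inj₂ refl = ⊥-elim (true≢false r (irr _))
  ... | yes ex with any? (λ w → active? D w ×-dec (¬? (w ≟ e) ×-dec ¬? (w ≟ x)))
  ...   | no alone = circle-tour symm irr (edge-noncrossing {a = e} {x} irr only symm)
    where
    only : ∀ {u} → Active D u → u ≡ e ⊎ u ≡ x
    only {u} au with u ≟ e | u ≟ x
    ... | yes p | _ = inj₁ p
    ... | no _ | yes p = inj₂ p
    ... | no p | no q = ⊥-elim (alone (u , au , p , q))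
  ...   | yes w = tour-resp RE.back RE.forth pair-A A-pair
            (AddEdge.tour RE.D⁻-symm e x e≢x RE.D⁻-ab (tour-resp id id A-pair pair-A
              (tour-extended m (ℕ.<-≤-trans RE.smaller (ℕ.≤-pred lt)) (RE.piece Pc two Ae Ax ends w) (e , ee))))
    where
    module RE = RemoveEdge symm e≢x ex
    ends : ∀ {c} → A c ≡ true → c ≡ e ⊎ c ≡ x
    ends {c} Ac with c ≟ e | c ≟ x
    ... | yes p | _ = inj₁ p
    ... | no _ | yes p = inj₂ p
    ... | no p | no q = ⊥-elim (none′ (c , Ac , p , q))
    pair-A : ⁅ e ∣ x ⁆ ⊆ᵇ A
    pair-A {v} h with pair-inv {v = e} {x} {v} h
    ... | inj₁ refl = Ae
    ... | inj₂ refl = Ax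
    A-pair : A ⊆ᵇ ⁅ e ∣ x ⁆
    A-pair Ac with ends Ac
    ... | inj₁ refl = pairˡ e x
    ... | inj₂ refl = pairʳ e x

-- Pieces with two terminals

duo-resp : ∀ {n} {D D′ : Rel n} {a b} → D ⊆ʳ D′ → D′ ⊆ʳ D → Duo D a b → Duo D′ a b
duo-resp {n} {D} {D′} f g Du = record
  { σ = σ ; valid = λ {v} {p} e → let (x , y) = valid {v} {p} e in f x , y
  ; enter = λ sL zz c → enter sL zz (back′ c) ; to-b = λ sL c → to-b sL (back′ c) ; to-a = λ sL c → to-a sL (back′ c)
  ; back = λ {L} sL nc → back sL (nc ∘ conn-mono λ {u} {v} e → let (p , q) = ⊓-adj {D = D} {L} {u} {v} e in ∧-intro (f p) q) }
  where
  open Duo Du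
  back′ : ∀ {L a b} → Conn (D′ ⊓ L) a b → Conn (D ⊓ L) a b
  back′ {L} = conn-mono λ {u} {v} e → let (p , q) = ⊓-adj {D = D′} {L} {u} {v} e in ∧-intro (g p) q

roam-resp : ∀ {n} {D D′ : Rel n} {A A′ : VSet n} → D ⊆ʳ D′ → D′ ⊆ʳ D → A′ ⊆ᵇ A → Roam D A → Roam D′ A′
roam-resp {D = D} {D′} f g h Ro = record
  { σ = σ ; valid = λ {v} {p} e → let (x , y) = valid {v} {p} e in f x , y
  ; meets = λ {L} sL iy c → meets sL (h iy) (conn-mono (λ {u} {v} e → let (p , q) = ⊓-adj {D = D′} {L} {u} {v} e in ∧-intro (g p) q) c) }
  where open Roam Ro

module Side₂ {n} {D : Rel n} (sD : Symm D) (iD : Irr D) (two : TwoConnected D) {a b : Fin n} (aa : Active D a) (ab : Active D b) (a≢b : a ≢ b)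
             (S : VSet n) (closed : ∀ {u v} → Adj D u v → S u ≡ true → (v ≡ a ⊎ v ≡ b) ⊎ S v ≡ true)
             (a∉S : S a ≡ false) (b∉S : S b ≡ false) (S-act : ∀ {v} → S v ≡ true → Active D v) where
  H : Rel n
  H = Half D S

  H-symm : Symm H
  H-symm = half-symm {S = S} sD

  S≢a : ∀ {v} → S v ≡ true → v ≢ a
  S≢a s refl = true≢false s a∉S

  S≢b : ∀ {v} → S v ≡ true → v ≢ b
  S≢b s refl = true≢false s b∉S

  -- A walk off `z` to one of the pair exists in the whole piece. It can leave `S` only at `a` or
  -- `b`, and up to that point it uses links of the part.
  to-pair : ∀ z {u} → S u ≡ true → u ≢ z → ∀ {t} → t ≡ a ⊎ t ≡ b → t ≢ z → ∃ λ y → (y ≡ a ⊎ y ≡ b) × y ≢ z × Conn (H ∖ z) u y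
  to-pair z {u} su uz {t} pt tz with walk-side {D = D} (λ {x} {y} e → proj₁ (∖-inv {D = D} {z} {x} {y} e)) S (λ y → y ≡ a ⊎ y ≡ b) closed su
      (two z (S-act su) (t-act pt) uz tz)
    where
    t-act : ∀ {t} → t ≡ a ⊎ t ≡ b → Active D t
    t-act (inj₁ refl) = aa
    t-act (inj₂ refl) = ab
  ... | inj₁ (y , py , c) = let c′ = conn-mono (half-∖ {D = D} {S} {z}) c in y , py , ∖-avoid {D = H} uz c′ , c′
  to-pair z su uz (inj₁ refl) tz | inj₂ (sa , _) = ⊥-elim (true≢false sa a∉S)
  to-pair z su uz (inj₂ refl) tz | inj₂ (sb , _) = ⊥-elim (true≢false sb b∉S)

  to-a : ∀ {u} → S u ≡ true → Conn H u a
  to-a su with to-pair b su (S≢b su) (inj₁ refl) a≢b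
  ... | _ , inj₁ refl , _ , c = ∖-conn {D = H} c
  ... | _ , inj₂ refl , ne , _ = ⊥-elim (ne refl)

  to-b : ∀ {u} → S u ≡ true → Conn H u b
  to-b su with to-pair a su (S≢a su) (inj₂ refl) (a≢b ∘ sym)
  ... | _ , inj₁ refl , ne , _ = ⊥-elim (ne refl)
  ... | _ , inj₂ refl , _ , c = ∖-conn {D = H} c

  half-side : ∀ {u} → Active H u → (u ≡ a ⊎ u ≡ b) ⊎ S u ≡ true
  half-side {u} (v , e) with half-inv {D = D} {S} {u} {v} e
  ... | d , inj₁ su = inj₂ su
  ... | d , inj₂ sv = closed (flip-adj sD d) sv

  module _ {s} (s∈ : S s ≡ true) where
    all-to-a : ∀ {u} → Active H u → Conn H u a
    all-to-a au with half-side au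
    ... | inj₁ (inj₁ refl) = ε
    ... | inj₁ (inj₂ refl) = conn-sym H-symm (to-b s∈) ◅◅ to-a s∈
    ... | inj₂ su = to-a su

    pair-act : ∀ {t} → t ≡ a ⊎ t ≡ b → Active H t
    pair-act (inj₁ refl) = conn-end H-symm (S≢a s∈) (to-a s∈)
    pair-act (inj₂ refl) = conn-end H-symm (S≢b s∈) (to-b s∈)

    conn-H : ∀ {u v} → Active H u → Active H v → Conn H u v
    conn-H au av = all-to-a au ◅◅ conn-sym H-symm (all-to-a av)

  leads-pair : ∀ z {u} → Active H u → u ≢ z → ∃ λ y → (y ≡ a ⊎ y ≡ b) × y ≢ z × Conn (H ∖ z) u y
  leads-pair z {u} au uz with half-side au
  ... | inj₁ p = u , p , uz , ε
  ... | inj₂ su with a ≟ z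
  ...   | no az = to-pair z su uz (inj₁ refl) az
  ...   | yes refl = to-pair a su uz (inj₂ refl) (a≢b ∘ sym)

  piece : ∀ {s} → S s ≡ true → ¬ Bad D ⁅ a ∣ b ⁆ none → Piece H ⁅ a ∣ b ⁆ none
  piece s∈ fr = record
    { symm = H-symm ; irr = half-irr {D = D} {S} iD ; conn = conn-H s∈
    ; act = λ {t} e → pair-act s∈ (in-pair e)
    ; leads = λ z au uz → let (y , py , yz , c) = leads-pair z au uz in y , ∨-introˡ (pair-in py) , yz , c
    ; free = fr ∘ weaken (λ {u} {v} e → proj₁ (half-inv {D = D} {S} {u} {v} e)) id inj₁ }
    where
    in-pair : ∀ {t} → (⁅ a ∣ b ⁆ ∪ none) t ≡ true → t ≡ a ⊎ t ≡ b
    in-pair {t} e with ∨-true {⁅ a ∣ b ⁆ t} e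
    ... | inj₁ x = pair-inv {v = a} {b} {t} x
    pair-in : ∀ {t} → t ≡ a ⊎ t ≡ b → ⁅ a ∣ b ⁆ t ≡ true
    pair-in (inj₁ refl) = pairˡ a b
    pair-in (inj₂ refl) = pairʳ a b

∪-none : ∀ {n} {A : VSet n} → (A ∪ none) ⊆ᵇ A
∪-none {A = A} {v} e with ∨-true {A v} e
... | inj₁ x = x

-- A cut node gives a tour. Otherwise the link between `a` and `b`, or a separation by the pair,
-- splits the piece into parallel parts; if neither is present, `outerplanar-two` draws it.
duo-two : ∀ m {n} {D : Rel n} {a b} → edges D < m → Piece D ⁅ a ∣ b ⁆ none → a ≢ b → Duo D a b
duo-two (suc m) {n} {D} {a} {b} lt Pc a≢b with cut-node? D
... | yes cut = TourPair.duo symm a≢b (tour-resp id id (λ {v} → ∪-none {A = ⁅ a ∣ b ⁆} {v}) ∨-introˡ (cut-tour (tour-extended _) Pc cut))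
  where open Piece Pc
... | no ncut = joined (true? (D a b))
  where
  open Piece Pc
  two : TwoConnected D
  two = two-connected ncut
  Aa : (⁅ a ∣ b ⁆ ∪ none) a ≡ true
  Aa = ∨-introˡ (pairˡ a b)
  Ab : (⁅ a ∣ b ⁆ ∪ none) b ≡ true
  Ab = ∨-introˡ (pairʳ a b)
  only : ∀ {c} → (⁅ a ∣ b ⁆ ∪ none) c ≡ true → c ≡ a ⊎ c ≡ b
  only {c} e = pair-inv {v = a} {b} {c} (∪-none {A = ⁅ a ∣ b ⁆} {c} e)
  in-pair : ∀ {t} → t ≡ a ⊎ t ≡ b → ⁅ a ∣ b ⁆ t ≡ true
  in-pair (inj₁ refl) = pairˡ a b
  in-pair (inj₂ refl) = pairʳ a b

  drawn : NonCrossing D → Duo D a b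
  drawn N = TourPair.duo symm a≢b (circle-tour symm irr N)

  with-edge : Adj D a b → (∃ λ w → Active D w × w ≢ a × w ≢ b) → Duo D a b
  with-edge e w = duo-resp (λ {u} {v} x → RE.back {u} {v} (flip∨ {edge a b u v} x)) (λ {u} {v} x → flip∨ {RE.D⁻ u v} (RE.forth x))
    (Parallel.duo (edge-symm {v = a} {b}) RE.D⁻-symm a b ⁅ a ∣ b ⁆ (pairˡ a b) (pairʳ a b)
      (λ {u} {v} x → in-pair (ends {u} {v} x)) (λ {u} _ ua ub → ¬true λ x → case pair-inv {v = a} {b} {u} x of λ { (inj₁ p) → ua p ; (inj₂ p) → ub p })
      (λ {u} {v} x → ¬true λ y → proj₂ (RE.D⁻-inv {u} {v} y) x)
      (TourPair.duo (edge-symm {v = a} {b}) a≢b (circle-tour (edge-symm {v = a} {b}) edge-irr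
        (edge-noncrossing {a = a} {b} edge-irr (λ {u} (v , x) → ends {u} {v} x) (edge-symm {v = a} {b}))))
      (duo-two m (ℕ.<-≤-trans RE.smaller (ℕ.≤-pred lt)) (RE.piece Pc two Aa Ab only w) a≢b))
    where
    module RE = RemoveEdge symm a≢b e
    flip∨ : ∀ {x y} → x ∨ y ≡ true → y ∨ x ≡ true
    flip∨ {x} {y} h = trans (Bool.∨-comm y x) h
    ends : ∀ {u v} → Adj (edge a b) u v → u ≡ a ⊎ u ≡ b
    ends {u} {v} x with edge-inv {v = a} {b} {u} {v} x
    ... | inj₁ (p , _) = inj₁ p
    ... | inj₂ (p , _) = inj₂ p
    edge-irr : Irr (edge a b)
    edge-irr u = ¬true λ x → case edge-inv {v = a} {b} {u} {u} x of λ { (inj₁ (refl , q)) → a≢b q ; (inj₂ (refl , q)) → a≢b (sym q) }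

  Separated : Set
  Separated = ∃₂ λ u v → Active D u × Active D v × (u ≢ a × u ≢ b) × (v ≢ a × v ≢ b) × ¬ Conn (D ∖ a ∖ b) u v

  separated? : Dec Separated
  separated? = any? λ u → any? λ v → active? D u ×-dec active? D v ×-dec (¬? (u ≟ a) ×-dec ¬? (u ≟ b)) ×-dec
    (¬? (v ≟ a) ×-dec ¬? (v ≟ b)) ×-dec ¬? (conn? (D ∖ a ∖ b) u v)

  parallel : D a b ≡ false → Separated → Duo D a b
  parallel nab (u₀ , v₀ , au , av , (ua , ub) , (va , vb) , sep) = duo-resp both-D D-both
    (Parallel.duo P₁.H-symm P₂.H-symm a b side (side-pair (inj₁ refl)) (side-pair (inj₂ refl))
      (λ {u} {v} e → case P₁.half-side {u} (v , e) of λ { (inj₁ p) → side-pair p ; (inj₂ s) → ∨-introˡ s })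
      (λ {u} {v} e ua ub → case P₂.half-side {u} (v , e) of λ { (inj₁ (inj₁ p)) → ⊥-elim (ua p) ; (inj₁ (inj₂ p)) → ⊥-elim (ub p) ; (inj₂ s) → not-side s })
      (λ {u} {v} e → ¬true λ f → apart {u} {v} e f)
      (duo-two m (ℕ.<-≤-trans (half-smaller {D = D} {S₁} (proj₂ av) v∉S₁ (out₁ (proj₂ av))) (ℕ.≤-pred lt)) (P₁.piece (S₁-intro ε) free) a≢b)
      (duo-two m (ℕ.<-≤-trans (half-smaller {D = D} {S₂} (proj₂ au) u∉S₂ (out₂ (proj₂ au))) (ℕ.≤-pred lt)) (P₂.piece (S₂-intro v∉S₁ va vb av) free) a≢b))
    where
    Rs : Rel n
    Rs = D ∖ a ∖ b
    S₁ S₂ : VSet n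
    S₁ v = does (conn? Rs u₀ v)
    S₂ v = does ((¬? (true? (S₁ v)) ×-dec active? D v) ×-dec (¬? (v ≟ a) ×-dec ¬? (v ≟ b)))
    S₁-conn : ∀ {v} → S₁ v ≡ true → Conn Rs u₀ v
    S₁-conn {v} e = does-yes (conn? Rs u₀ v) e
    S₁-intro : ∀ {v} → Conn Rs u₀ v → S₁ v ≡ true
    S₁-intro {v} c = does-true (conn? Rs u₀ v) c
    S₁≢b : ∀ {v} → S₁ v ≡ true → v ≢ b
    S₁≢b e = ∖-avoid {D = D ∖ a} ub (S₁-conn e)
    S₁≢a : ∀ {v} → S₁ v ≡ true → v ≢ a
    S₁≢a e = ∖-avoid {D = D} ua (∖-conn {D = D ∖ a} {b} (S₁-conn e))
    S₂-inv : ∀ {v} → S₂ v ≡ true → S₁ v ≡ false × Active D v × v ≢ a × v ≢ b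
    S₂-inv {v} e with does-yes ((¬? (true? (S₁ v)) ×-dec active? D v) ×-dec (¬? (v ≟ a) ×-dec ¬? (v ≟ b))) e
    ... | (ns , act) , va , vb = ¬true ns , act , va , vb
    S₂-intro : ∀ {v} → S₁ v ≡ false → v ≢ a → v ≢ b → Active D v → S₂ v ≡ true
    S₂-intro {v} ns va vb act = does-true ((¬? (true? (S₁ v)) ×-dec active? D v) ×-dec (¬? (v ≟ a) ×-dec ¬? (v ≟ b)))
      (((λ s → true≢false s ns) , act) , va , vb)
    closed₁ : ∀ {u v} → Adj D u v → S₁ u ≡ true → (v ≡ a ⊎ v ≡ b) ⊎ S₁ v ≡ true
    closed₁ {u} {v} e su with (v ≟ a) ⊎-dec (v ≟ b)
    ... | yes p = inj₁ p
    ... | no np = inj₂ (S₁-intro (S₁-conn su ◅◅ (∖-adj {D = D ∖ a} {b} (∖-adj {D = D} {a} e (S₁≢a su) (np ∘ inj₁)) (S₁≢b su) (np ∘ inj₂) ◅ ε)))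
    closed₂ : ∀ {u v} → Adj D u v → S₂ u ≡ true → (v ≡ a ⊎ v ≡ b) ⊎ S₂ v ≡ true
    closed₂ {u} {v} e su = decide ((v ≟ a) ⊎-dec (v ≟ b)) (bool-case (S₁ v))
      where
      decide : Dec (v ≡ a ⊎ v ≡ b) → S₁ v ≡ true ⊎ S₁ v ≡ false → (v ≡ a ⊎ v ≡ b) ⊎ S₂ v ≡ true
      decide (yes p) _ = inj₁ p
      decide (no np) (inj₂ ns) = inj₂ (S₂-intro ns (np ∘ inj₁) (np ∘ inj₂) (u , flip-adj symm e))
      decide (no np) (inj₁ s) with S₂-inv su | closed₁ (flip-adj symm e) s
      ... | ns , _ , _ , _ | inj₂ s′ = ⊥-elim (true≢false s′ ns)
      ... | _ , _ , ua′ , _ | inj₁ (inj₁ p) = ⊥-elim (ua′ p)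
      ... | _ , _ , _ , ub′ | inj₁ (inj₂ p) = ⊥-elim (ub′ p)
    act-S₁ : ∀ {v} → S₁ v ≡ true → Active D v
    act-S₁ {v} e with u₀ ≟ v
    ... | yes refl = au
    ... | no ne = conn-end symm ne (∖-conn {D = D} {a} (∖-conn {D = D ∖ a} {b} (S₁-conn e)))
    module P₁ = Side₂ symm irr two (act Aa) (act Ab) a≢b S₁ closed₁ (¬true λ e → S₁≢a e refl) (¬true λ e → S₁≢b e refl) act-S₁
    module P₂ = Side₂ symm irr two (act Aa) (act Ab) a≢b S₂ closed₂ (¬true λ e → proj₁ (proj₂ (proj₂ (S₂-inv e))) refl)
                  (¬true λ e → proj₂ (proj₂ (proj₂ (S₂-inv e))) refl) (λ e → proj₁ (proj₂ (S₂-inv e)))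
    S₁₂ : ∀ {u v} → Adj D u v → S₁ u ≡ true → S₂ u ≡ true ⊎ S₂ v ≡ true → ⊥
    S₁₂ d s (inj₁ s′) = true≢false s (proj₁ (S₂-inv s′))
    S₁₂ d s (inj₂ s′) with closed₂ (flip-adj symm d) s′
    ... | inj₁ (inj₁ p) = S₁≢a s p
    ... | inj₁ (inj₂ p) = S₁≢b s p
    ... | inj₂ s″ = true≢false s (proj₁ (S₂-inv s″))
    apart : ∀ {u v} → Adj (Half D S₁) u v → Adj (Half D S₂) u v → ⊥
    apart {u} {v} e f with half-inv {D = D} {S₁} {u} {v} e | proj₂ (half-inv {D = D} {S₂} {u} {v} f)
    ... | d , inj₁ s | s′ = S₁₂ d s s′
    ... | d , inj₂ s | inj₁ s′ = S₁₂ (flip-adj symm d) s (inj₂ s′)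
    ... | d , inj₂ s | inj₂ s′ = S₁₂ (flip-adj symm d) s (inj₁ s′)
    v∉S₁ : S₁ v₀ ≡ false
    v∉S₁ = ¬true λ e → sep (S₁-conn e)
    u∉S₂ : S₂ u₀ ≡ false
    u∉S₂ = ¬true λ e → true≢false (S₁-intro ε) (proj₁ (S₂-inv e))
    out₁ : ∀ {w} → Adj D v₀ w → S₁ w ≡ false
    out₁ e = ¬true λ s → case closed₁ (flip-adj symm e) s of λ { (inj₁ (inj₁ p)) → va p ; (inj₁ (inj₂ p)) → vb p ; (inj₂ p) → true≢false p v∉S₁ }
    out₂ : ∀ {w} → Adj D u₀ w → S₂ w ≡ false
    out₂ e = ¬true λ s → case closed₂ (flip-adj symm e) s of λ { (inj₁ (inj₁ p)) → ua p ; (inj₁ (inj₂ p)) → ub p ; (inj₂ p) → true≢false p u∉S₂ }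
    side : VSet n
    side v = S₁ v ∨ ⁅ a ∣ b ⁆ v
    side-pair : ∀ {v} → v ≡ a ⊎ v ≡ b → side v ≡ true
    side-pair {v} p = ∨-introʳ {S₁ v} (in-pair p)
    not-side : ∀ {v} → S₂ v ≡ true → side v ≡ false
    not-side {v} s with S₂-inv s
    ... | ns , _ , xa , xb = ¬true λ h → case ∨-true {S₁ v} h of λ where
      (inj₁ x) → true≢false x ns
      (inj₂ x) → case pair-inv {v = a} {b} {v} x of λ { (inj₁ p) → xa p ; (inj₂ p) → xb p }
    no-edge : ∀ {u v} → Adj D u v → u ≡ a ⊎ u ≡ b → v ≡ a ⊎ v ≡ b → ⊥
    no-edge d (inj₁ refl) (inj₁ refl) = true≢false d (irr _)
    no-edge d (inj₂ refl) (inj₂ refl) = true≢false d (irr _)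
    no-edge d (inj₁ refl) (inj₂ refl) = true≢false d nab
    no-edge d (inj₂ refl) (inj₁ refl) = true≢false (flip-adj symm d) nab
    both-D : ∀ {u v} → Adj (Half D S₁ ⊔ Half D S₂) u v → Adj D u v
    both-D {u} {v} e with ∨-true {Half D S₁ u v} e
    ... | inj₁ h = proj₁ (half-inv {D = D} {S₁} {u} {v} h)
    ... | inj₂ h = proj₁ (half-inv {D = D} {S₂} {u} {v} h)
    D-both : ∀ {u v} → Adj D u v → Adj (Half D S₁ ⊔ Half D S₂) u v
    D-both {u} {v} e = decide (bool-case (S₁ u)) (bool-case (S₁ v)) ((u ≟ a) ⊎-dec (u ≟ b)) ((v ≟ a) ⊎-dec (v ≟ b))
      where
      decide : S₁ u ≡ true ⊎ S₁ u ≡ false → S₁ v ≡ true ⊎ S₁ v ≡ false → Dec (u ≡ a ⊎ u ≡ b) → Dec (v ≡ a ⊎ v ≡ b) →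
               Adj (Half D S₁ ⊔ Half D S₂) u v
      decide (inj₁ s) _ _ _ = ∨-introˡ (half-intro {D = D} {S₁} e (inj₁ s))
      decide (inj₂ _) (inj₁ s) _ _ = ∨-introˡ (half-intro {D = D} {S₁} e (inj₂ s))
      decide (inj₂ ns) (inj₂ _) (no p) _ = ∨-introʳ {Half D S₁ u v} (half-intro {D = D} {S₂} e (inj₁ (S₂-intro ns (p ∘ inj₁) (p ∘ inj₂) (v , e))))
      decide (inj₂ _) (inj₂ ns) (yes _) (no p) =
        ∨-introʳ {Half D S₁ u v} (half-intro {D = D} {S₂} e (inj₂ (S₂-intro ns (p ∘ inj₁) (p ∘ inj₂) (u , flip-adj symm e))))
      decide (inj₂ _) (inj₂ _) (yes p) (yes q) = ⊥-elim (no-edge e p q)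

  joined : Dec (Adj D a b) → Duo D a b
  joined (yes e) with any? (λ w → active? D w ×-dec (¬? (w ≟ a) ×-dec ¬? (w ≟ b)))
  ... | yes w = with-edge e w
  ... | no alone = drawn (edge-noncrossing {a = a} {b} irr (λ {u} au → only′ u au) symm)
    where
    only′ : ∀ u → Active D u → u ≡ a ⊎ u ≡ b
    only′ u au with u ≟ a | u ≟ b
    ... | yes p | _ = inj₁ p
    ... | no _ | yes p = inj₂ p
    ... | no p | no q = ⊥-elim (alone (u , au , p , q))
  joined (no ne) with separated?
  ... | yes s = parallel (¬true ne) s
  ... | no ns = drawn (Split.outerplanar-two symm irr two conn {⁅ a ∣ b ⁆ ∪ none} (merge-free Pc) act Aa Ab a≢b (¬true ne) only
                  λ {u} {v} au av ua ub va vb → dec-stable (conn? (D ∖ a ∖ b) u v) λ nc → ns (u , v , au , av , (ua , ub) , (va , vb) , nc))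

-- Rings, and pieces with direct terminals in general

module RingRoam {n} {D : Rel n} {Dir : VSet n} (Pc : Piece D Dir none) (two : TwoConnected D) where
  open Piece Pc
  private
    A : VSet n
    A = Dir ∪ none
    module Sp = Split symm irr two conn {A} (merge-free Pc) act

  module _ (RS : Sp.RingSplit) where
    open Sp.RingSplit RS
    private
      Wc : ∀ {u v} → Adj D u v → W u ≡ true → (v ≡ a ⊎ v ≡ b) ⊎ W v ≡ true
      Wc e w with closed e w
      ... | inj₁ p = inj₁ (inj₁ p)
      ... | inj₂ (inj₁ p) = inj₁ (inj₂ p)
      ... | inj₂ (inj₂ s) = inj₂ s

      W-act : ∀ {v} → W v ≡ true → Active D v
      W-act {v} w with c ≟ v
      ... | yes refl = act A-c
      ... | no ne = conn-end symm ne (∖-conn {D = D} {a} (∖-conn {D = D ∖ a} {b} (W-conn w)))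

      module P₁ = Side₂ symm irr two (act A-a) (act A-b) a≢b W Wc W-a W-b W-act

      a≢c : a ≢ c
      a≢c refl = true≢false W-c W-a
      b≢c : b ≢ c
      b≢c refl = true≢false W-c W-b

      piece₁ : Piece P₁.H A none
      piece₁ = record
        { symm = P₁.H-symm ; irr = half-irr {D = D} {W} irr ; conn = P₁.conn-H W-c
        ; act = λ {d} e → act₁ (∪-none {A = A} {d} e)
        ; leads = λ z au uz → let (y , py , yz , p) = P₁.leads-pair z au uz in y , ∨-introˡ (pair-A py) , yz , p
        ; free = merge-free Pc ∘ weaken {Dir = A} {Dir′ = A} (λ {u} {v} e → proj₁ (half-inv {D = D} {W} {u} {v} e)) id inj₁ }
        where
        pair-A : ∀ {t} → t ≡ a ⊎ t ≡ b → A t ≡ true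
        pair-A (inj₁ refl) = A-a
        pair-A (inj₂ refl) = A-b
        act₁ : ∀ {d} → A d ≡ true → Active P₁.H d
        act₁ {d} ad with d ≟ a | d ≟ b
        ... | yes p | _ = P₁.pair-act W-c (inj₁ p)
        ... | no _ | yes p = P₁.pair-act W-c (inj₂ p)
        ... | no p | no q = conn-end P₁.H-symm (p ∘ sym) (conn-sym P₁.H-symm (P₁.to-a (W-A ad p q)))

      -- In the part around `W` the attachment `c` separates `a` from `b`. It is thus a cut node,
      -- which yields a tour although all terminals are direct.
      T₁ : Tour P₁.H (A ∪ none)
      T₁ = cut-tour (tour-extended _) piece₁
        (c , a , b , (P₁.pair-act W-c (inj₁ refl) , a≢c) , (P₁.pair-act W-c (inj₂ refl) , b≢c) , cut A-c W-c)

      D₂ : Rel n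
      D₂ u v = D u v ∧ (not (W u) ∧ not (W v))

      D₂-inv : ∀ {u v} → Adj D₂ u v → Adj D u v × W u ≡ false × W v ≡ false
      D₂-inv {u} {v} e = let (d , x) = ∧-true {D u v} e ; (y , z) = ∧-true {not (W u)} x in d , not-true y , not-true z

      D₂-intro : ∀ {u v} → Adj D u v → W u ≡ false → W v ≡ false → Adj D₂ u v
      D₂-intro d x y = ∧-intro d (∧-intro (cong not x) (cong not y))

      D₂-symm : Symm D₂
      D₂-symm u v = cong₂ _∧_ (symm u v) (Bool.∧-comm (not (W u)) _)

      S : VSet n
      S v = does ((¬? (true? (W v)) ×-dec active? D v) ×-dec (¬? (v ≟ a) ×-dec ¬? (v ≟ b)))

      S-inv : ∀ {v} → S v ≡ true → W v ≡ false × Active D v × v ≢ a × v ≢ b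
      S-inv {v} e with does-yes ((¬? (true? (W v)) ×-dec active? D v) ×-dec (¬? (v ≟ a) ×-dec ¬? (v ≟ b))) e
      ... | (ns , ac) , va , vb = ¬true ns , ac , va , vb

      S-intro : ∀ {v} → W v ≡ false → v ≢ a → v ≢ b → Active D v → S v ≡ true
      S-intro {v} ns va vb ac = does-true ((¬? (true? (W v)) ×-dec active? D v) ×-dec (¬? (v ≟ a) ×-dec ¬? (v ≟ b)))
        (((λ s → true≢false s ns) , ac) , va , vb)

      Sc : ∀ {u v} → Adj D u v → S u ≡ true → (v ≡ a ⊎ v ≡ b) ⊎ S v ≡ true
      Sc {u} {v} e su = decide ((v ≟ a) ⊎-dec (v ≟ b)) (bool-case (W v))
        where
        decide : Dec (v ≡ a ⊎ v ≡ b) → W v ≡ true ⊎ W v ≡ false → (v ≡ a ⊎ v ≡ b) ⊎ S v ≡ true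
        decide (yes p) _ = inj₁ p
        decide (no np) (inj₂ ns) = inj₂ (S-intro ns (np ∘ inj₁) (np ∘ inj₂) (u , flip-adj symm e))
        decide (no np) (inj₁ w) with S-inv su | Wc (flip-adj symm e) w
        ... | ns , _ , _ , _ | inj₂ w′ = ⊥-elim (true≢false w′ ns)
        ... | _ , _ , ua , _ | inj₁ (inj₁ p) = ⊥-elim (ua p)
        ... | _ , _ , _ , ub | inj₁ (inj₂ p) = ⊥-elim (ub p)

      module P₂ = Side₂ symm irr two (act A-a) (act A-b) a≢b S Sc (¬true λ e → proj₁ (proj₂ (proj₂ (S-inv e))) refl)
                    (¬true λ e → proj₂ (proj₂ (proj₂ (S-inv e))) refl) (λ e → proj₁ (proj₂ (S-inv e)))

      not-W : ∀ {u} → (u ≡ a ⊎ u ≡ b) ⊎ S u ≡ true → W u ≡ false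
      not-W (inj₁ (inj₁ refl)) = W-a
      not-W (inj₁ (inj₂ refl)) = W-b
      not-W (inj₂ s) = proj₁ (S-inv s)

      H₂⊆ : P₂.H ⊆ʳ D₂
      H₂⊆ {u} {v} e = D₂-intro (proj₁ (half-inv {D = D} {S} {u} {v} e)) (not-W (P₂.half-side {u} (v , e)))
        (not-W (P₂.half-side {v} (u , flip-adj P₂.H-symm {u} {v} e)))

      side₂ : ∀ {u} → Active D₂ u → (u ≡ a ⊎ u ≡ b) ⊎ S u ≡ true
      side₂ {u} (v , e) with (u ≟ a) ⊎-dec (u ≟ b) | D₂-inv {u} {v} e
      ... | yes p | _ = inj₁ p
      ... | no np | d , wu , _ = inj₂ (S-intro wu (np ∘ inj₁) (np ∘ inj₂) (v , d))

      to-a₂ : ∀ {u} → Active D₂ u → Conn D₂ u a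
      to-a₂ au with side₂ au
      ... | inj₁ (inj₁ refl) = ε
      ... | inj₁ (inj₂ refl) = conn-sym D₂-symm outside
      ... | inj₂ s = conn-mono H₂⊆ (P₂.to-a s)

      ∖-mono : ∀ {G G′ : Rel n} → G ⊆ʳ G′ → ∀ z → (G ∖ z) ⊆ʳ (G′ ∖ z)
      ∖-mono {G} {G′} f z {u} {v} e with ∖-inv {D = G} {z} {u} {v} e
      ... | d , x , y = ∖-adj {D = G′} {z} (f d) x y

      W-star : ∀ {u v} → W u ≡ true → Conn (D ∖ a ∖ b) u v → Star (λ x y → Adj D x y × W x ≡ true × W y ≡ true) u v
      W-star w ε = ε
      W-star {u} w (_◅_ {j = j} e es) with ∖-inv {D = D ∖ a} {b} {u} {j} e
      ... | e′ , _ , jb with ∖-inv {D = D} {a} {u} {j} e′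
      ...   | d , _ , ja with Wc d w
      ...     | inj₁ (inj₁ p) = ⊥-elim (ja p)
      ...     | inj₁ (inj₂ p) = ⊥-elim (jb p)
      ...     | inj₂ wj = (d , w , wj) ◅ W-star wj es

      W-near-b : ∃ λ x → W x ≡ true × Adj D x b
      W-near-b with P₁.pair-act W-c (inj₂ refl)
      ... | x , e with half-inv {D = D} {W} {b} {x} e
      ...   | d , inj₁ w = ⊥-elim (true≢false w W-b)
      ...   | d , inj₂ w = x , w , flip-adj symm d

      -- `W` contains the attachment `c`; contracted and hung onto `b` it becomes a private path, so
      -- `tour-extended` applies to the rest of the ring.
      piece₂ : Piece D₂ ⁅ a ⁆ ⁅ b ⁆
      piece₂ = record
        { symm = D₂-symm ; irr = λ u → cong (_∧ _) (irr u)
        ; conn = λ au av → to-a₂ au ◅◅ conn-sym D₂-symm (to-a₂ av)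
        ; act = λ {d} e → act₂ d (pair-inv {v = a} {b} {d} e) ; leads = leads₂
        ; free = merge-free Pc ∘ contract-to-pendant {Dir = A} {none} {⁅ a ⁆} {⁅ b ⁆} symm (λ {u} {v} e → proj₁ (D₂-inv {u} {v} e)) b c W
            (λ {u} {v} e → proj₂ (D₂-inv {u} {v} e)) (λ w → W-star W-c (W-conn w)) W-b W-near-b (c , W-c , ∨-introˡ A-c)
            (λ {u} e → case does-yes (u ≟ a) e of λ { refl → A-a , W-a }) (λ {u} e → inj₁ (does-yes (u ≟ b) e)) }
        where
        pair-in : ∀ {t} → t ≡ a ⊎ t ≡ b → (⁅ a ⁆ ∪ ⁅ b ⁆) t ≡ true
        pair-in (inj₁ refl) = pairˡ a b
        pair-in (inj₂ refl) = pairʳ a b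
        act₂ : ∀ d → d ≡ a ⊎ d ≡ b → Active D₂ d
        act₂ d (inj₁ refl) = conn-end D₂-symm (a≢b ∘ sym) (conn-sym D₂-symm outside)
        act₂ d (inj₂ refl) = conn-end D₂-symm a≢b outside
        leads₂ : ∀ z {u} → Active D₂ u → u ≢ z → ∃ λ y → (⁅ a ⁆ ∪ ⁅ b ⁆) y ≡ true × y ≢ z × Conn (D₂ ∖ z) u y
        leads₂ z {u} au uz with side₂ au
        ... | inj₁ p = u , pair-in p , uz , ε
        ... | inj₂ s with P₂.leads-pair z {u} (conn-end P₂.H-symm (proj₁ (proj₂ (proj₂ (S-inv s))) ∘ sym) (conn-sym P₂.H-symm (P₂.to-a s))) uz
        ...   | y , py , yz , p = y , pair-in py , yz , conn-mono (∖-mono {P₂.H} {D₂} H₂⊆ z) p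

      T₂ : Tour D₂ ⁅ a ∣ b ⁆
      T₂ = tour-extended _ (ℕ.n<1+n _) piece₂ (b , does-true (b ≟ b) refl)

      side : VSet n
      side v = W v ∨ ⁅ a ∣ b ⁆ v

      side-pair : ∀ {v} → v ≡ a ⊎ v ≡ b → side v ≡ true
      side-pair {v} (inj₁ refl) = ∨-introʳ {W v} (pairˡ a b)
      side-pair {v} (inj₂ refl) = ∨-introʳ {W v} (pairʳ a b)

      both-D : ∀ {u v} → Adj (P₁.H ⊔ D₂) u v → Adj D u v
      both-D {u} {v} e with ∨-true {P₁.H u v} e
      ... | inj₁ h = proj₁ (half-inv {D = D} {W} {u} {v} h)
      ... | inj₂ h = proj₁ (D₂-inv {u} {v} h)

      D-both : ∀ {u v} → Adj D u v → Adj (P₁.H ⊔ D₂) u v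
      D-both {u} {v} e with bool-case (W u) | bool-case (W v)
      ... | inj₁ w | _ = ∨-introˡ (half-intro {D = D} {W} e (inj₁ w))
      ... | inj₂ _ | inj₁ w = ∨-introˡ (half-intro {D = D} {W} e (inj₂ w))
      ... | inj₂ n | inj₂ n′ = ∨-introʳ {P₁.H u v} (D₂-intro e n n′)

      A-side : ∀ {y} → A y ≡ true → side y ≡ true
      A-side {y} ay with y ≟ a | y ≟ b
      ... | yes p | _ = ∨-introʳ {W y} refl
      ... | no _ | yes p = ∨-introʳ {W y} refl
      ... | no p | no q = ∨-introˡ (W-A ay p q)

    ring-roam : Roam D Dir
    ring-roam = roam-resp both-D D-both ∨-introˡ
      (Wheel.roam P₁.H-symm D₂-symm a b a≢b side (side-pair (inj₁ refl)) (side-pair (inj₂ refl))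
        (λ {u} {v} e → case P₁.half-side {u} (v , e) of λ { (inj₁ p) → side-pair p ; (inj₂ s) → ∨-introˡ s })
        (λ {u} {v} e ua ub → ¬true λ h → case ∨-true {W u} h of λ where
          (inj₁ w) → true≢false w (proj₁ (proj₂ (D₂-inv {u} {v} e)))
          (inj₂ p) → case pair-inv {v = a} {b} {u} p of λ { (inj₁ q) → ua q ; (inj₂ q) → ub q })
        (λ {u} {v} e → ¬true λ f → let (_ , nu , nv) = D₂-inv {u} {v} f in
          case proj₂ (half-inv {D = D} {W} {u} {v} e) of λ { (inj₁ w) → true≢false w nu ; (inj₂ w) → true≢false w nv })
        {A} A-a A-b A-side (λ ay p q → cut ay (W-A ay p q))
        (tour-resp id id (λ {v} → ∪-none {A = A} {v}) ∨-introˡ T₁) T₂)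

-- Three attachments are the threshold: with two the parallel construction applies, and from three
-- on a piece without cut node is drawn or is a ring.
roam-piece : ∀ {n} {D : Rel n} {Dir} → Piece D Dir none → (∃ λ u → Active D u) → Roam D Dir
roam-piece {n} {D} {Dir} Pc (u , au) with cut-node? D
... | yes cut = roam-resp id id ∨-introˡ (tour-roam (Piece.symm Pc) (cut-tour (tour-extended _) Pc cut))
... | no ncut = solve
  where
  open Piece Pc
  A : VSet n
  A = Dir ∪ none
  two : TwoConnected D
  two = two-connected ncut
  first : ∃ λ a → A a ≡ true
  first = let (v , e) = au ; (a , Aa , _) = leads v (v , e) (λ p → true≢false (subst (Adj D u) (sym p) e) (irr u)) in a , Aa
  second : ∀ {a} → A a ≡ true → ∃ λ b → A b ≡ true × b ≢ a
  second {a} Aa = let (w , e) = act Aa ; (b , Ab , ne , _) = leads a (a , flip-adj symm e) (λ p → true≢false (subst (Adj D a) p e) (irr a)) in b , Ab , ne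
  solve : Roam D Dir
  solve with first
  ... | a , Aa with second Aa
  ...   | b , Ab , b≢a with any? (λ c → true? (A c) ×-dec (¬? (c ≟ a) ×-dec ¬? (c ≟ b)))
  ...     | no none′ = roam-resp id id (λ {y} d → A-pair (∨-introˡ d)) (duo-roam symm (duo-two _ (ℕ.n<1+n _) pair (b≢a ∘ sym)))
    where
    A-pair : A ⊆ᵇ ⁅ a ∣ b ⁆
    A-pair {y} d with y ≟ a | y ≟ b
    ... | yes _ | _ = refl
    ... | no _ | yes _ = refl
    ... | no p | no q = ⊥-elim (none′ (y , d , p , q))
    pair-A : (⁅ a ∣ b ⁆ ∪ none) ⊆ᵇ A
    pair-A {y} e with pair-inv {v = a} {b} {y} (∪-none {A = ⁅ a ∣ b ⁆} {y} e)
    ... | inj₁ refl = Aa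
    ... | inj₂ refl = Ab
    pair : Piece D ⁅ a ∣ b ⁆ none
    pair = record
      { symm = symm ; irr = irr ; conn = conn ; act = λ {d} e → act (pair-A {d} e)
      ; leads = λ z w ne → let (y , Ay , yz , c) = leads z w ne in y , ∨-introˡ (A-pair Ay) , yz , c
      ; free = free ∘ weaken id id λ {y} e → inj₁ (∪-none {A = Dir} {y} (pair-A {y} (∨-introˡ e))) }
  ...     | yes (c , Ac , c≢a , c≢b) = drawn (Sp.outerplanar-or-split others Aa Ab Ac (b≢a ∘ sym) (c≢a ∘ sym) (c≢b ∘ sym))
    where
    module Sp = Split symm irr two conn {A} (merge-free Pc) act
    module Gr = Grow symm irr two conn {A} (merge-free Pc) act
    others : ∀ p → Gr.TwoOthers p
    others p with a ≟ p | b ≟ p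
    ... | no x | no y = a , b , Aa , Ab , b≢a ∘ sym , x , y
    ... | yes refl | _ = b , c , Ab , Ac , c≢b ∘ sym , b≢a , c≢a
    ... | no x | yes refl = a , c , Aa , Ac , c≢a ∘ sym , b≢a ∘ sym , c≢b
    drawn : NonCrossing D ⊎ Sp.RingSplit → Roam D Dir
    drawn (inj₁ N) = tour-roam symm (circle-tour symm irr N)
    drawn (inj₂ RS) = RingRoam.ring-roam Pc two RS

-- Reducing the whole graph to a piece around the root

forb-mono : ∀ {n} {D D′ : Rel n} {t} → D ⊆ʳ D′ → Forb (Adj D) t → Forb (Adj D′) t
forb-mono f = forb-contract record
  { to = just ; fibre = λ { refl refl → ε } ; lift = λ {u} {v} e → u , v , refl , refl , f e ; root = refl }

resilient-on : ∀ {n} {D D′ : Rel n} {t} → D′ ⊆ʳ D → (∀ {L} → ∀ {s} → Conn (D ⊓ L) s t → Conn (D′ ⊓ L) s t) → Resilient D′ t → Resilient D t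
resilient-on f g Re = record
  { σ = σ ; valid = λ {v} {p} e → let (x , y) = valid {v} {p} e in f x , y ; hits = λ {L} sL c → hits sL (g {L} c) }
  where open Resilient Re

no-active-roam : ∀ {n} {D : Rel n} {N} → (∀ u → ¬ Active D u) → Roam D N
no-active-roam {D = D} na = record
  { σ = λ _ _ _ → nothing ; valid = λ ()
  ; meets = λ { {L} _ _ ε → now at ; {L} _ {s} _ (_◅_ {j = j} e _) → ⊥-elim (na s (j , proj₁ (⊓-adj {D = D} {L} {s} {j} e))) } }

-- The part `S` behind `c` is solved with `c` as its root, the remainder with the original root.
-- Once the packet has left `S`, the second pattern uses no link into `S`, so the two phases never
-- mix.
module Pocket {n} {D : Rel n} (sD : Symm D) (iD : Irr D) {t c : Fin n} (c≢t : c ≢ t) (S : VSet n)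
              (closed : ∀ {u v} → Adj D u v → S u ≡ true → v ≡ c ⊎ S v ≡ true) (c∉S : S c ≡ false) (t∉S : S t ≡ false)
              (c-t : Conn D c t) where
  S′ : VSet n
  S′ v = not (S v) ∧ not (does (v ≟ c))

  D₁ D₂ : Rel n
  D₁ = Half D S′
  D₂ = Half D S

  S′-inv : ∀ {v} → S′ v ≡ true → S v ≡ false × v ≢ c
  S′-inv {v} e = let (a , b) = ∧-true {not (S v)} e in not-true a , does-no (v ≟ c) (not-true b)

  S′-intro : ∀ {v} → S v ≡ false → v ≢ c → S′ v ≡ true
  S′-intro {v} e ne = ∧-intro (cong not e) (cong not (does-false (v ≟ c) ne))

  closed′ : ∀ {u v} → Adj D u v → S v ≡ true → u ≡ c ⊎ S u ≡ true
  closed′ e = closed (flip-adj sD e)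

  D₁-intro : ∀ {u v} → Adj D u v → S u ≡ false → S v ≡ false → Adj D₁ u v
  D₁-intro {u} {v} e su sv = decide (u ≟ c)
    where
    decide : Dec (u ≡ c) → Adj D₁ u v
    decide (no uc) = half-intro {D = D} {S′} e (inj₁ (S′-intro su uc))
    decide (yes refl) = half-intro {D = D} {S′} e (inj₂ (S′-intro sv λ { refl → true≢false e (iD _) }))

  D₂-intro : ∀ {u v} → Adj D u v → S u ≡ true → Adj D₂ u v
  D₂-intro e su = half-intro {D = D} {S} e (inj₁ su)

  D₁-out : ∀ {u v} → Adj D₁ u v → S u ≡ false
  D₁-out {u} {v} e with half-inv {D = D} {S′} {u} {v} e
  ... | d , inj₁ x = proj₁ (S′-inv x)
  ... | d , inj₂ x = ¬true λ su → case closed d su of λ { (inj₁ p) → proj₂ (S′-inv x) p ; (inj₂ sv) → true≢false sv (proj₁ (S′-inv x)) }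

  D₂-in : ∀ {u v} → Adj D₂ u v → u ≡ c ⊎ S u ≡ true
  D₂-in {u} {v} e with half-inv {D = D} {S} {u} {v} e
  ... | d , inj₁ x = inj₂ x
  ... | d , inj₂ x = closed′ d x

  module _ {L : Rel n} where
    split : ∀ {u} → Conn (D ⊓ L) u t → (S u ≡ false → Conn (D₁ ⊓ L) u t) × (S u ≡ true → Conn (D₂ ⊓ L) u c × Conn (D₁ ⊓ L) c t)
    split ε = (λ _ → ε) , λ s → ⊥-elim (true≢false s t∉S)
    split {u} (_◅_ {j = j} e es) with ⊓-adj {D = D} {L} {u} {j} e | split es | bool-case (S j)
    ... | d , l | f , g | inj₂ nj = (λ nu → ∧-intro (D₁-intro d nu nj) l ◅ f nj) ,
          λ su → case closed d su of λ { (inj₁ refl) → (∧-intro (D₂-intro d su) l ◅ ε) , f nj ; (inj₂ sj) → ⊥-elim (true≢false sj nj) }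
    ... | d , l | f , g | inj₁ sj = (λ nu → case closed′ d sj of λ { (inj₁ refl) → proj₂ (g sj) ; (inj₂ su) → ⊥-elim (true≢false su nu) }) ,
          λ su → (∧-intro (D₂-intro d su) l ◅ proj₁ (g sj)) , proj₂ (g sj)

  module _ (R₁ : Resilient D₁ t) (R₂ : Resilient D₂ c) where
    private
      module R₁ = Resilient R₁
      module R₂ = Resilient R₂

    fromS : Maybe (Fin n) → Bool
    fromS nothing = false
    fromS (just q) = S q

    σ : Pattern n
    -- Outside `S`, an in-port in `S` means arrival at `c`. It is forgotten there, because the
    -- second phase is planned from a start at `c`.
    σ v p al = if S v then R₂.σ v p al else (if fromS p then R₁.σ v nothing al else R₁.σ v p al)

    σ-S : ∀ {v p al} → S v ≡ true → σ v p al ≡ R₂.σ v p al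
    σ-S e rewrite e = refl
    σ-1 : ∀ {v p al} → S v ≡ false → fromS p ≡ false → σ v p al ≡ R₁.σ v p al
    σ-1 e e′ rewrite e | e′ = refl
    σ-c : ∀ {v p al} → S v ≡ false → fromS p ≡ true → σ v p al ≡ R₁.σ v nothing al
    σ-c e e′ rewrite e | e′ = refl

    valid : Valid D σ
    valid {v} {p} {al} e with S v
    ... | true = let (x , y) = R₂.valid {v} {p} e in proj₁ (half-inv {D = D} {S} {v} x) , y
    ... | false with fromS p
    ...   | true = let (x , y) = R₁.valid {v} {nothing} e in proj₁ (half-inv {D = D} {S′} {v} x) , y
    ...   | false = let (x , y) = R₁.valid {v} {p} e in proj₁ (half-inv {D = D} {S′} {v} x) , y

    module _ {L : Rel n} where
      hit₁ : ∀ {p v} → S v ≡ false → fromS p ≡ false → Hit R₁.σ L t p v → Hit σ L t p v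
      hit₁ nv np at = at
      hit₁ {p} {v} nv np (go {w = w} e h) = go (trans (σ-1 nv np) e)
        (hit₁ (D₁-out (flip-adj (half-symm {S = S′} sD) {v} {w} (proj₁ (R₁.valid {v} e)))) nv h)

      arrive : ∀ {p} → fromS p ≡ true → Hit σ L t nothing c → Hit σ L t p c
      arrive fp at = at
      arrive fp (go e h) = go (trans (trans (σ-c c∉S fp) (sym (σ-1 {p = nothing} c∉S refl))) e) h

      hit₂ : ∀ {p v} → S v ≡ true → Hit R₂.σ L c p v → Hit σ L t nothing c → Hit σ L t p v
      hit₂ sv at h′ = ⊥-elim (true≢false sv c∉S)
      hit₂ {p} {v} sv (go {w = w} e h) h′ with D₂-in {w} {v} (flip-adj (half-symm {S = S} sD) {v} {w} (proj₁ (R₂.valid {v} e)))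
      ... | inj₂ sw = go (trans (σ-S sv) e) (hit₂ sw h h′)
      ... | inj₁ refl = go (trans (σ-S sv) e) (arrive sv h′)

    glued : Resilient D t
    glued = record { σ = σ ; valid = λ {v} {p} → valid {v} {p} ; hits = λ {L} sL {s} c → hits′ sL c (bool-case (S s)) }
      where
      hits′ : ∀ {L} → Symm L → ∀ {s} → Conn (D ⊓ L) s t → S s ≡ true ⊎ S s ≡ false → Hit σ L t nothing s
      hits′ sL c′ (inj₂ ns) = hit₁ ns refl (R₁.hits sL (proj₁ (split c′) ns))
      hits′ sL c′ (inj₁ ss) = let (c₂ , c₁) = proj₂ (split c′) ss in
        hit₂ ss (R₂.hits sL c₂) (hit₁ c∉S refl (R₁.hits sL c₁))

  -- The root set of a minor of (D₂ , c) absorbs a connected part containing c and t.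
  pocket-forb : Forb (Adj D₂) c → Forb (Adj D) t
  pocket-forb = forb-contract record
    { to = f ; fibre = λ {v} {a} {b} p q → fib (img a p) (img b q)
    ; lift = λ {u} {v} e → u , v , f-in (D₂-in e) , f-in (D₂-in (flip-adj (half-symm {S = S} sD) {u} {v} e)) , proj₁ (half-inv {D = D} {S} {u} {v} e)
    ; root = f-T t∉S ε }
    where
    outer : Rel n
    outer u v = D u v ∧ (not (S u) ∧ not (S v))
    outer-symm : Symm outer
    outer-symm u v = cong₂ _∧_ (sD u v) (Bool.∧-comm (not (S u)) _)
    outer-intro : ∀ {u v} → Adj D u v → S u ≡ false → S v ≡ false → Adj outer u v
    outer-intro d x y = ∧-intro d (∧-intro (cong not x) (cong not y))
    T? : ∀ v → Dec (Conn outer t v)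
    T? v = conn? outer t v
    f : Fin n → Maybe (Fin n)
    f v = if S v then just v else (if does (T? v) then just c else nothing)
    f-T : ∀ {v} → S v ≡ false → Conn outer t v → f v ≡ just c
    f-T {v} ns h rewrite ns | does-true (T? v) h = refl
    f-S : ∀ {v} → S v ≡ true → f v ≡ just v
    f-S s rewrite s = refl
    t-c : Conn outer t c
    t-c = conn-sym outer-symm (to-t c∉S c-t)
      where
      escape : ∀ {u} → S u ≡ true → Conn D u t → Conn outer c t
      to-t : ∀ {u} → S u ≡ false → Conn D u t → Conn outer u t
      escape su ε = ⊥-elim (true≢false su t∉S)
      escape {u} su (_◅_ {j = j} e es) with closed e su
      ... | inj₁ refl = to-t c∉S es
      ... | inj₂ sj = escape sj es
      to-t nu ε = ε
      to-t {u} nu (_◅_ {j = j} e es) with bool-case (S j)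
      ... | inj₂ nj = outer-intro e nu nj ◅ to-t nj es
      ... | inj₁ sj with closed′ e sj
      ...   | inj₁ refl = escape sj es
      ...   | inj₂ su = ⊥-elim (true≢false su nu)
    f-in : ∀ {u} → u ≡ c ⊎ S u ≡ true → f u ≡ just u
    f-in (inj₁ refl) = f-T c∉S t-c
    f-in (inj₂ s) = f-S s
    data Img : Fin n → Fin n → Set where
      i-S : ∀ {v} → S v ≡ true → Img v v
      i-T : ∀ {v} → S v ≡ false → Conn outer t v → Img v c
    img : ∀ v {x} → f v ≡ just x → Img v x
    img v e with S v in s | T? v
    img v refl | true | _ = i-S s
    img v refl | false | yes h = i-T s h
    star : ∀ {u v} → S u ≡ false → Conn outer t u → Conn outer u v → Star (Within (Adj D) f c) u v
    star s h ε = ε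
    star {u} s h (_◅_ {j = j} e es) with ∧-true {D u j} e
    ... | d , x = let nj = not-true (proj₂ (∧-true {not (S u)} x)) ; hj = h ◅◅ (e ◅ ε) in
                  (d , f-T s h , f-T nj hj) ◅ star nj hj es
    fib : ∀ {a b x} → Img a x → Img b x → Star (Within (Adj D) f x) a b
    fib (i-S _) (i-S _) = ε
    fib (i-S s) (i-T _ _) = ⊥-elim (true≢false s c∉S)
    fib (i-T _ _) (i-S s) = ⊥-elim (true≢false s c∉S)
    fib (i-T s h) (i-T s′ h′) = star s h (conn-sym outer-symm h ◅◅ h′)

-- A packet that reaches `t` is delivered, so it never passes from one side of the root to the other
-- and the two patterns do not interact.
module RootCut {n} {D : Rel n} (sD : Symm D) {t : Fin n} (S : VSet n)
               (closed : ∀ {u v} → Adj D u v → S u ≡ true → v ≡ t ⊎ S v ≡ true) (t∉S : S t ≡ false)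
               (R₁ : Resilient (Half D S) t) (R₂ : Resilient (Half D (λ v → not (S v) ∧ not (does (v ≟ t)))) t) where
  private
    module R₁ = Resilient R₁
    module R₂ = Resilient R₂
    S′ : VSet n
    S′ v = not (S v) ∧ not (does (v ≟ t))

  σ : Pattern n
  σ v p al = if S v then R₁.σ v p al else R₂.σ v p al

  σ-1 : ∀ {v p al} → S v ≡ true → σ v p al ≡ R₁.σ v p al
  σ-1 e rewrite e = refl
  σ-2 : ∀ {v p al} → S v ≡ false → σ v p al ≡ R₂.σ v p al
  σ-2 e rewrite e = refl

  valid : Valid D σ
  valid {v} {p} e with S v
  ... | true = let (x , y) = R₁.valid {v} {p} e in proj₁ (half-inv {D = D} {S} {v} x) , y
  ... | false = let (x , y) = R₂.valid {v} {p} e in proj₁ (half-inv {D = D} {S′} {v} x) , y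

  S′-out : ∀ {v} → S′ v ≡ true → S v ≡ false × v ≢ t
  S′-out {v} e = let (a , b) = ∧-true {not (S v)} e in not-true a , does-no (v ≟ t) (not-true b)

  S′-intro : ∀ {v} → S v ≡ false → v ≢ t → S′ v ≡ true
  S′-intro {v} e ne = ∧-intro (cong not e) (cong not (does-false (v ≟ t) ne))

  next₁ : ∀ {u v} → Adj (Half D S) u v → v ≡ t ⊎ S v ≡ true
  next₁ {u} {v} e with half-inv {D = D} {S} {u} {v} e
  ... | d , inj₁ x = closed d x
  ... | d , inj₂ x = inj₂ x

  next₂ : ∀ {u v} → Adj (Half D S′) u v → v ≡ t ⊎ S v ≡ false
  next₂ {u} {v} e with half-inv {D = D} {S′} {u} {v} e | bool-case (S v)
  ... | _ | inj₂ nv = inj₂ nv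
  ... | d , inj₂ x | inj₁ sv = ⊥-elim (true≢false sv (proj₁ (S′-out x)))
  ... | d , inj₁ x | inj₁ sv with closed (flip-adj sD d) sv
  ...   | inj₁ p = ⊥-elim (proj₂ (S′-out x) p)
  ...   | inj₂ su = ⊥-elim (true≢false su (proj₁ (S′-out x)))

  module _ {L : Rel n} where
    hit₁ : ∀ {p v} → S v ≡ true → Hit R₁.σ L t p v → Hit σ L t p v
    hit₁ sv at = at
    hit₁ {p} {v} sv (go {w = w} e h) with next₁ {v} {w} (proj₁ (R₁.valid {v} e))
    ... | inj₁ refl = go (trans (σ-1 sv) e) at
    ... | inj₂ sw = go (trans (σ-1 sv) e) (hit₁ sw h)

    hit₂ : ∀ {p v} → S v ≡ false → Hit R₂.σ L t p v → Hit σ L t p v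
    hit₂ nv at = at
    hit₂ {p} {v} nv (go {w = w} e h) with next₂ {v} {w} (proj₁ (R₂.valid {v} e))
    ... | inj₁ refl = go (trans (σ-2 nv) e) at
    ... | inj₂ nw = go (trans (σ-2 nv) e) (hit₂ nw h)

    part₁ : ∀ {s} → S s ≡ true → Conn (D ⊓ L) s t → Conn (Half D S ⊓ L) s t
    part₁ ss ε = ε
    part₁ {s} ss (_◅_ {j = j} e es) with ⊓-adj {D = D} {L} {s} {j} e
    ... | d , l with closed d ss
    ...   | inj₁ refl = ∧-intro (half-intro {D = D} {S} d (inj₁ ss)) l ◅ ε
    ...   | inj₂ sj = ∧-intro (half-intro {D = D} {S} d (inj₁ ss)) l ◅ part₁ sj es

    part₂ : ∀ {s} → S s ≡ false → Conn (D ⊓ L) s t → Conn (Half D S′ ⊓ L) s t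
    part₂ ns ε = ε
    part₂ {s} ns (_◅_ {j = j} e es) with ⊓-adj {D = D} {L} {s} {j} e
    ... | d , l = decide (s ≟ t) (j ≟ t) (bool-case (S j))
      where
      decide : Dec (s ≡ t) → Dec (j ≡ t) → S j ≡ true ⊎ S j ≡ false → Conn (Half D S′ ⊓ L) s t
      decide (yes refl) _ _ = ε
      decide (no st) (yes refl) _ = ∧-intro (half-intro {D = D} {S′} d (inj₁ (S′-intro ns st))) l ◅ ε
      decide (no st) (no jt) (inj₂ nj) = ∧-intro (half-intro {D = D} {S′} d (inj₁ (S′-intro ns st))) l ◅ part₂ nj es
      decide (no st) (no jt) (inj₁ sj) with closed (flip-adj sD d) sj
      ... | inj₁ p = ⊥-elim (st p)
      ... | inj₂ ss = ⊥-elim (true≢false ss ns)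

  glued : Resilient D t
  glued = record { σ = σ ; valid = λ {v} {p} → valid {v} {p} ; hits = λ {L} sL {s} c → hits′ sL c (bool-case (S s)) }
    where
    hits′ : ∀ {L} → Symm L → ∀ {s} → Conn (D ⊓ L) s t → S s ≡ true ⊎ S s ≡ false → Hit σ L t nothing s
    hits′ sL c (inj₁ ss) = hit₁ ss (R₁.hits sL (part₁ ss c))
    hits′ sL c (inj₂ ns) = hit₂ ns (R₂.hits sL (part₂ ns c))

last-hop : ∀ {n} {D : Rel n} {s t} → s ≢ t → Conn D s t → ∃ λ y → Conn (D ∖ t) s y × Adj D y t
last-hop ne ε = ⊥-elim (ne refl)
last-hop {D = D} {s} {t} ne (_◅_ {j = j} e es) with j ≟ t
... | yes refl = s , ε , e
... | no j≢ = let (y , c , l) = last-hop j≢ es in y , ∖-adj {D = D} {t} e ne j≢ ◅ c , l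

∖-swap : ∀ {n} {D : Rel n} {y z} → (D ∖ y ∖ z) ⊆ʳ (D ∖ z ∖ y)
∖-swap {D = D} {y} {z} {u} {v} e =
  let (e₁ , uz , vz) = ∖-inv {D = D ∖ y} {z} {u} {v} e ; (e₂ , uy , vy) = ∖-inv {D = D} {y} {u} {v} e₁
  in ∖-adj {D = D ∖ z} {y} (∖-adj {D = D} {z} e₂ uz vz) uy vy

-- If no other node separates anything from the root and the root separates nothing, the graph
-- without the root is one piece, with the neighbours of the root as direct terminals.
module Block {n} {D : Rel n} {t : Fin n} (sD : Symm D) (iD : Irr D)
             (reach : ∀ {v} → Active D v → Conn D v t)
             (avoid : ∀ {z w} → z ≢ t → Active D w → w ≢ z → Conn (D ∖ z) w t)
             (beside : ∀ {u v} → Active D u → Active D v → u ≢ t → v ≢ t → Conn (D ∖ t) u v)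
             (free : ¬ Forb (Adj D) t) where
  private
    H : Rel n
    H = D ∖ t
    N : VSet n
    N u = D u t

    H-act : ∀ {u} → Active H u → Active D u × u ≢ t
    H-act {u} (v , e) = let (d , ut , _) = ∖-inv {D = D} {t} {u} {v} e in (v , d) , ut

    N≢t : ∀ {u} → N u ≡ true → u ≢ t
    N≢t e refl = true≢false e (iD _)

    as-root : Contract (Link H N none) root (Adj D) t
    as-root = record
      { to = just ∘ f ; fibre = λ {_} {a} {b} p q → fib (f-inj a b (trans (just-inj p) (sym (just-inj q)))) ; lift = lift
      ; root = cong just f-t }
      where
      f : Fin n → Vtx n
      f v = if does (v ≟ t) then root else vtx v
      f-t : f t ≡ root
      f-t rewrite does-true (t ≟ t) refl = refl
      f-v : ∀ {v} → v ≢ t → f v ≡ vtx v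
      f-v {v} ne rewrite does-false (v ≟ t) ne = refl
      just-inj : ∀ {a b : Vtx n} → just a ≡ just b → a ≡ b
      just-inj refl = refl
      f-inj : ∀ a b → f a ≡ f b → a ≡ b
      f-inj a b e with a ≟ t | b ≟ t
      ... | yes refl | yes refl = refl
      ... | no _ | no _ = vtx-inj e
      fib : ∀ {a b x} → a ≡ b → Star (Within (Adj D) (just ∘ f) x) a b
      fib refl = ε
      lift : ∀ {u v} → Link H N none u v → ∃₂ λ a b → just (f a) ≡ just u × just (f b) ≡ just v × Adj D a b
      lift (dd {u} {v} e) = let (d , ut , vt) = ∖-inv {D = D} {t} {u} {v} e in u , v , cong just (f-v ut) , cong just (f-v vt) , d
      lift (dr {u} e) = u , t , cong just (f-v (N≢t e)) , cong just f-t , e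
      lift (rd {u} e) = t , u , cong just f-t , cong just (f-v (N≢t e)) , flip-adj sD e

    piece : ∀ {h} → Active H h → Piece H N none
    piece {h} h-act = record
      { symm = ∖-symm sD t ; irr = λ u → cong (_∧ _) (iD u)
      ; conn = λ a b → let (a′ , a≢t) = H-act a ; (b′ , bt) = H-act b in beside a′ b′ a≢t bt
      ; act = λ {a} e → act (∪-none {A = N} {a} e) ; leads = leads ; free = free ∘ forb-contract as-root }
      where
      act : ∀ {a} → N a ≡ true → Active H a
      act {a} e with h ≟ a
      ... | yes refl = h-act
      ... | no ne = let (h′ , ht) = H-act h-act in conn-end (∖-symm sD t) ne (beside h′ (t , e) ht (N≢t e))
      leads : ∀ z {w} → Active H w → w ≢ z → ∃ λ a → (N ∪ none) a ≡ true × a ≢ z × Conn (H ∖ z) w a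
      leads z {w} w-act wz with H-act w-act
      ... | w′ , wt with z ≟ t
      ...   | yes refl = let (y , c , l) = last-hop wt (reach w′) in
                y , ∨-introˡ l , N≢t l , conn-mono (λ {u} {v} e → let (_ , ut , vt) = ∖-inv {D = D} {t} {u} {v} e in ∖-adj {D = H} {t} e ut vt) c
      ...   | no zt = let (y , c , l) = last-hop wt (avoid zt w′ wz) ; (l′ , yz , _) = ∖-inv {D = D} {z} {y} {t} l in
                y , ∨-introˡ l′ , yz , conn-mono (λ {u} {v} → ∖-swap {D = D} {z} {t} {u} {v}) c

    roam : Roam H N
    roam with any? (active? H)
    ... | yes (h , ha) = roam-piece (piece ha) (h , ha)
    ... | no na = no-active-roam λ u a → na (u , a)

  resilient : Resilient D t
  resilient = Direct.resilient t H (λ {u} {v} e → proj₁ (∖-inv {D = D} {t} {u} {v} e)) (∖-adj {D = D} {t}) id roam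

-- Each of the three reductions leaves parts with fewer links and no new minor; where none applies,
-- their negations are the hypotheses of `Block`.
resilient-free : ∀ m {n} {D : Rel n} t → edges D < m → Symm D → Irr D → ¬ Forb (Adj D) t → Resilient D t
resilient-free (suc m) {n} {D} t lt sD iD free =
  by-reach (any? λ v → active? D v ×-dec ¬? (conn? D v t))
  where
  shrink : ∀ (S : VSet n) {u v} t → Adj D u v → S u ≡ false → S v ≡ false → ¬ Forb (Adj (Half D S)) t → Resilient (Half D S) t
  shrink S t e a b = resilient-free m t (ℕ.<-≤-trans (half-smaller {D = D} {S} e a b) (ℕ.≤-pred lt)) (half-symm {S = S} sD) (half-irr {D = D} {S} iD)

  half-free : ∀ (S : VSet n) → ¬ Forb (Adj (Half D S)) t
  half-free S = free ∘ forb-mono (λ {u} {v} e → proj₁ (half-inv {D = D} {S} {u} {v} e))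

  component : (∃ λ v → Active D v × ¬ Conn D v t) → Resilient D t
  component (v , (x , vx) , nc) = resilient-on {D′ = Half D S} (λ {u} {w} e → proj₁ (half-inv {D = D} {S} {u} {w} e)) stay
    (shrink S t vx (¬true (nc ∘ S-conn)) (¬true λ s → nc (vx ◅ S-conn s)) (half-free S))
    where
    S : VSet n
    S u = does (conn? D u t)
    S-conn : ∀ {u} → S u ≡ true → Conn D u t
    S-conn {u} = does-yes (conn? D u t)
    stay : ∀ {L : Rel n} {s} → Conn (D ⊓ L) s t → Conn (Half D S ⊓ L) s t
    stay ε = ε
    stay {L} {s} (_◅_ {j = j} e es) with ⊓-adj {D = D} {L} {s} {j} e
    ... | d , l = ∧-intro (half-intro {D = D} {S} d (inj₁ (does-true (conn? D s t)
                    (d ◅ conn-mono (λ {a} {b} x → proj₁ (⊓-adj {D = D} {L} {a} {b} x)) es)))) l ◅ stay es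

  module From (c w : Fin n) (w≢c : w ≢ c) where
    S : VSet n
    S v = does (conn? (D ∖ c) w v)
    S-conn : ∀ {v} → S v ≡ true → Conn (D ∖ c) w v
    S-conn {v} = does-yes (conn? (D ∖ c) w v)
    w∈S : S w ≡ true
    w∈S = does-true (conn? (D ∖ c) w w) ε
    c∉S : S c ≡ false
    c∉S = ¬true λ s → ∖-avoid {D = D} w≢c (S-conn s) refl
    outside : ∀ {v} → ¬ Conn (D ∖ c) w v → S v ≡ false
    outside nc = ¬true (nc ∘ S-conn)
    closed : ∀ {u v} → Adj D u v → S u ≡ true → v ≡ c ⊎ S v ≡ true
    closed {u} {v} e su with v ≟ c
    ... | yes p = inj₁ p
    ... | no vc = inj₂ (does-true (conn? (D ∖ c) w v) (S-conn su ◅◅ (∖-adj {D = D} {c} e (∖-avoid {D = D} w≢c (S-conn su)) vc ◅ ε)))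
    apart : ∀ {u v} → Adj D u v → S u ≡ false → u ≢ c → S v ≡ false
    apart e nu uc = ¬true λ sv → case closed (flip-adj sD e) sv of λ { (inj₁ p) → uc p ; (inj₂ su) → true≢false su nu }
    S′ : VSet n
    S′ v = not (S v) ∧ not (does (v ≟ c))
    S⇒¬S′ : ∀ {v} → v ≡ c ⊎ S v ≡ true → S′ v ≡ false
    S⇒¬S′ {v} h = ¬true λ s → let (a , b) = ∧-true {not (S v)} s in
      case h of λ { (inj₁ p) → does-no (v ≟ c) (not-true b) p ; (inj₂ q) → true≢false q (not-true a) }

  pocket : (∀ {v} → Active D v → Conn D v t) → (∃₂ λ c w → c ≢ t × Active D w × w ≢ c × ¬ Conn (D ∖ c) w t) → Resilient D t
  pocket reach (c , w , c≢t , w-act , w≢c , nc) = P.glued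
    (shrink F.S′ t (proj₂ w-act) (F.S⇒¬S′ (inj₂ F.w∈S)) (F.S⇒¬S′ (F.closed (proj₂ w-act) F.w∈S)) (half-free F.S′))
    (shrink F.S c (proj₂ t-act) t∉S (F.apart (proj₂ t-act) t∉S (c≢t ∘ sym)) (free ∘ P.pocket-forb))
    where
    module F = From c w w≢c
    t∉S : F.S t ≡ false
    t∉S = F.outside nc
    exits : ∀ {u} → F.S u ≡ true → Conn D u t → Conn D c t
    exits su ε = ⊥-elim (true≢false su t∉S)
    exits su (e ◅ es) with F.closed e su
    ... | inj₁ refl = es
    ... | inj₂ sj = exits sj es
    t-act : Active D t
    t-act = conn-end sD (λ { refl → true≢false F.w∈S t∉S }) (reach w-act)
    module P = Pocket sD iD c≢t F.S F.closed F.c∉S t∉S (exits F.w∈S (reach w-act))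

  root-cut : (∃₂ λ u v → Active D u × Active D v × u ≢ t × v ≢ t × ¬ Conn (D ∖ t) u v) → Resilient D t
  root-cut (u , v , u-act , v-act , u≢t , v≢t , nc) = RootCut.glued sD F.S F.closed F.c∉S
    (shrink F.S t (proj₂ v-act) (F.outside nc) (F.apart (proj₂ v-act) (F.outside nc) v≢t) (half-free F.S))
    (shrink F.S′ t (proj₂ u-act) (F.S⇒¬S′ (inj₂ F.w∈S)) (F.S⇒¬S′ (F.closed (proj₂ u-act) F.w∈S)) (half-free F.S′))
    where module F = From t u u≢t

  by-reach : Dec (∃ λ v → Active D v × ¬ Conn D v t) → Resilient D t
  by-reach (yes h) = component h
  by-reach (no nr) = by-pocket (any? λ c → any? λ w → ¬? (c ≟ t) ×-dec active? D w ×-dec ¬? (w ≟ c) ×-dec ¬? (conn? (D ∖ c) w t))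
    where
    reach : ∀ {v} → Active D v → Conn D v t
    reach {v} a = dec-stable (conn? D v t) λ n → nr (v , a , n)
    by-pocket : Dec (∃₂ λ c w → c ≢ t × Active D w × w ≢ c × ¬ Conn (D ∖ c) w t) → Resilient D t
    by-pocket (yes h) = pocket reach h
    by-pocket (no np) with any? (λ u → any? λ v → active? D u ×-dec active? D v ×-dec ¬? (u ≟ t) ×-dec ¬? (v ≟ t) ×-dec ¬? (conn? (D ∖ t) u v))
    ... | yes h = root-cut h
    ... | no nb = Block.resilient sD iD reach
      (λ {z} {w} zt a wz → dec-stable (conn? (D ∖ z) w t) λ n → np (z , w , zt , a , wz , n))
      (λ {u} {v} a b ut vt → dec-stable (conn? (D ∖ t) u v) λ n → nb (u , v , a , b , ut , vt , n)) free

-- Forwarding patterns as in the definition of perfect resilience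

module Routes (G : Graph) (t : Node G) (R : Resilient (adj G) t) where
  open Resilient R

  module _ (v : Node G) (fl : Node G → Bool) where
    Free : Node G → Set
    Free u = Edge G v u × fl u ≡ false

    free? : ∀ u → Dec (Free u)
    free? u = true? (adj G v u) ×-dec (fl u Bool.≟ false)

    -- A valid forwarding function may give up only when all links fail, whereas the constructed
    -- pattern may stop earlier. Any alive link will do then: a packet that has to arrive only
    -- follows answers the pattern does give.
    fallback : Maybe (Node G)
    fallback with any? free?
    ... | yes (u , _) = just u
    ... | no _ = nothing

    π′ : Maybe (Node G) → Maybe (Node G)
    π′ (just w) = just w
    π′ nothing = fallback

  π : FwdPattern G
  π v p fl = π′ v fl (σ v p (not ∘ fl))

  π-valid : ValidPattern G t π
  π-valid v _ p fl _ sub with σ v p (not ∘ fl) in eq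
  ... | just w = let (e , a) = valid {v} {p} eq in inj₂ (w , refl , e , not-true a)
  ... | nothing with any? (free? v fl)
  ...   | yes (u , e , f) = inj₂ (u , refl , e , f)
  ...   | no nf = inj₁ (refl , λ u e → dec-stable (true? (fl u)) λ n → nf (u , e , ¬true n))

  module _ (F : FailureSet G) (sF : SymmetricF G F) where
    -- Non-links count as alive, which makes the row `L v` definitionally the complement of
    -- `failedAt G F v`.
    L : Rel (size G)
    L u v = not (adj G u v ∧ F u v)

    L-symm : Symm L
    L-symm u v = cong not (cong₂ _∧_ (adj-sym G u v) (sF u v))

    alive : ∀ {s} → ConnAvoiding G F s t → Conn (adj G ⊓ L) s t
    alive here = ε
    alive (step {u} {v} e f c) = ∧-intro e (cong not (trans (cong (adj G u v ∧_) f) (Bool.∧-zeroʳ _))) ◅ alive c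

    follow : ∀ s i {p v} → route G π F s i ≡ (p , v) → Hit σ L t p v → RoutingContains G π F s t
    follow s i e at = i , cong proj₂ e
    follow s i {p} {v} e (go {w = w} x h) = follow s (suc i) next h
      where
      next : route G π F s (suc i) ≡ (just v , w)
      next rewrite e | x = refl

  perfect : PerfectlyResilient G t
  perfect = π , π-valid , λ s F sF c → follow F sF s 0 refl (hits (L-symm F sF) (alive F sF c))

-- An adversary plays against unknown forwarding rules of H. A query is a node, an in-port and the row of
-- alive neighbours; a scenario is a start node and a list of failed links.
module Adversary (H : Graph) (tH : Node H) where
  Row Query Pos Scenario : Set
  Row = Vec Bool (size H)
  Query = Node H × Maybe (Node H) × Row
  Pos = Node H × Maybe (Node H)
  Scenario = Node H × List (Node H × Node H)

  listed : List (Node H × Node H) → Node H → Node H → Bool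
  listed [] x y = false
  listed ((a , b) ∷ l) x y = edge a b x y ∨ listed l x y

  alive : Scenario → Rel (size H)
  alive (_ , l) x y = adj H x y ∧ not (listed l x y)

  row : Scenario → Node H → Row
  row S x = Vec.tabulate (alive S x)

  infix 4 _≟ᵖ_ _≟ᵠ_
  _≟ᵖ_ : (a b : Pos) → Dec (a ≡ b)
  _≟ᵖ_ = ×.≡-dec _≟_ (Maybe.≡-dec _≟_)

  _≟ᵠ_ : (a b : Query) → Dec (a ≡ b)
  _≟ᵠ_ = ×.≡-dec _≟_ (×.≡-dec (Maybe.≡-dec _≟_) (Vec.≡-dec Bool._≟_))

  recall : List (Query × Node H) → Query → Maybe (Node H)
  recall [] q = nothing
  recall ((q′ , w) ∷ Γ) q = if does (q′ ≟ᵠ q) then just w else recall Γ q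

  elem : Pos → List Pos → Bool
  elem a [] = false
  elem a (b ∷ l) = does (a ≟ᵖ b) ∨ elem a l

  allL : (Pos → Bool) → List Pos → Bool
  allL f [] = true
  allL f (a ∷ l) = f a ∧ allL f l

  hasIn : Maybe (Node H) → List Pos → Node H → Bool
  hasIn nothing l x = false
  hasIn (just w) l x = elem (w , just x) l

  -- The visited positions form a trap: every recorded answer leads to another of them and none is
  -- at the root, although the root is still connected to the start.
  loops : List (Query × Node H) → Scenario → List Pos → Bool
  loops Γ S l = does (conn? (alive S) (proj₁ S) tH) ∧ (elem (proj₁ S , nothing) l
    ∧ allL (λ (x , p) → not (does (x ≟ tH)) ∧ hasIn (recall Γ (x , p , row S x)) l x) l)

  enters : Node H → Maybe (Node H) → Bool
  enters x nothing = true
  enters x (just y) = adj H x y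

  mutual
    refutes : ℕ → List (Query × Node H) → List Scenario → Bool
    refutes zero Γ Ss = false
    refutes (suc f) Γ [] = false
    refutes (suc f) Γ (S ∷ Ss) = explores f Γ S Ss [] (proj₁ S , nothing)

    -- A packet that reaches the root costs the adversary only this scenario, since the answers
    -- learnt stay in `Γ` for the following ones. A position met twice closes the loop.
    explores : ℕ → List (Query × Node H) → Scenario → List Scenario → List Pos → Pos → Bool
    explores zero Γ S Ss l a = false
    explores (suc f) Γ S Ss l (x , p) =
      if does (x ≟ tH) then refutes f Γ Ss
      else if elem (x , p) l then loops Γ S l
      else follows (recall Γ (x , p , row S x)) f Γ S Ss l x p

    follows : Maybe (Node H) → ℕ → List (Query × Node H) → Scenario → List Scenario → List Pos → Node H → Maybe (Node H) → Bool
    follows (just w) f Γ S Ss l x p = explores f Γ S Ss ((x , p) ∷ l) (w , just x)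
    follows nothing f Γ S Ss l x p = enters x p ∧ (anyF (lookup (row S x)) ∧ allF λ w →
      lookup (row S x) w ⇒ᵇ explores f (((x , p , row S x) , w) ∷ Γ) S Ss ((x , p) ∷ l) (w , just x))

  elem-sound : ∀ a l → elem a l ≡ true → a ∈ l
  elem-sound a (b ∷ l) e with ∨-true {does (a ≟ᵖ b)} e
  ... | inj₁ x = here (does-yes (a ≟ᵖ b) x)
  ... | inj₂ x = there (elem-sound a l x)

  allL-sound : ∀ f l → allL f l ≡ true → ∀ {a} → a ∈ l → f a ≡ true
  allL-sound f (a ∷ l) e (here refl) = proj₁ (∧-true {f a} e)
  allL-sound f (a ∷ l) e (there m) = allL-sound f l (proj₂ (∧-true {f a} e)) m

  row-alive : ∀ S x y → lookup (row S x) y ≡ alive S x y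
  row-alive S x y = Vec.lookup∘tabulate (alive S x) y

  listed-symm : ∀ l → Symm (listed l)
  listed-symm [] x y = refl
  listed-symm ((a , b) ∷ l) x y = cong₂ _∨_ (edge-symm {v = a} {b} x y) (listed-symm l x y)

  row-symm : ∀ S x y → lookup (row S x) y ≡ lookup (row S y) x
  row-symm S x y = trans (row-alive S x y) (trans (cong₂ _∧_ (adj-sym H x y) (cong not (listed-symm (proj₂ S) x y))) (sym (row-alive S y x)))

  -- `K` relates queries to truthful answers. `learn` is doubly negated, as it is not decided
  -- whether a packet ever leaves a branch set; the aim is a contradiction, so this is enough.
  module Sound (K : Query → Node H → Set)
               (learn : ∀ x p r {w} → x ≢ tH → enters x p ≡ true → lookup r w ≡ true →
                        ¬ ¬ ∃ λ w → lookup r w ≡ true × K (x , p , r) w)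
               (escape : ∀ S (l : List Pos) → Conn (alive S) (proj₁ S) tH → (proj₁ S , nothing) ∈ l →
                         (∀ {x p} → (x , p) ∈ l → x ≢ tH × ∃ λ w → K (x , p , row S x) w × (w , just x) ∈ l) → ⊥) where
    Known : List (Query × Node H) → Set
    Known = All λ (q , w) → K q w

    recall-sound : ∀ {Γ q w} → Known Γ → recall Γ q ≡ just w → K q w
    recall-sound {(q′ , _) ∷ Γ} {q} (k ∷ ks) e with q′ ≟ᵠ q
    recall-sound (k ∷ ks) refl | yes refl = k
    ... | no _ = recall-sound ks e

    loops-sound : ∀ {Γ S l} → Known Γ → loops Γ S l ≡ true → ⊥
    loops-sound {Γ} {S} {l} ks e with ∧-true {does (conn? (alive S) (proj₁ S) tH)} e
    ... | c , e′ with ∧-true {elem (proj₁ S , nothing) l} e′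
    ...   | m , e″ = escape S l (does-yes (conn? (alive S) (proj₁ S) tH) c) (elem-sound (proj₁ S , nothing) l m) λ {x} {p} m′ →
            let (nt , h) = ∧-true {not (does (x ≟ tH))} (allL-sound _ l e″ m′) in
            does-no (x ≟ tH) (not-true nt) , known (recall Γ (x , p , row S x)) refl h
      where
      known : ∀ {x p} m → recall Γ (x , p , row S x) ≡ m → hasIn m l x ≡ true → ∃ λ w → K (x , p , row S x) w × (w , just x) ∈ l
      known {x} (just w) r h = w , recall-sound ks r , elem-sound (w , just x) l h

    mutual
      refutes-sound : ∀ f {Γ Ss} → Known Γ → refutes f Γ Ss ≡ true → ⊥
      refutes-sound (suc f) {Ss = S ∷ Ss} ks e = explores-sound f ks e

      explores-sound : ∀ f {Γ S Ss l a} → Known Γ → explores f Γ S Ss l a ≡ true → ⊥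
      explores-sound (suc f) {Γ} {S} {Ss} {l} {x , p} ks e with x ≟ tH
      ... | yes _ = refutes-sound f ks e
      ... | no xt with elem (x , p) l
      ...   | true = loops-sound {Γ} {S} {l} ks e
      ...   | false = follows-sound f (recall Γ (x , p , row S x)) xt ks e

      follows-sound : ∀ f m {Γ S Ss l x p} → x ≢ tH → Known Γ → follows m f Γ S Ss l x p ≡ true → ⊥
      follows-sound f (just w) xt ks e = explores-sound f ks e
      follows-sound f nothing {S = S} {x = x} {p} xt ks e with ∧-true {enters x p} e
      ... | en , e′ with ∧-true {anyF (lookup (row S x))} e′
      ...   | an , e″ = let (w₀ , a₀) = anyF-sound (lookup (row S x)) an in
        learn x p (row S x) xt en a₀ λ (w , a , k) → explores-sound f (k ∷ ks) (⇒ᵇ-sound (allF-sound _ e″ w) a)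

-- Routing in G inside the branch sets of a minor H, with one surviving link of G for each alive link of H.
module Simulate {H : Graph} {tH : Node H} {G : Graph} {t : Node G} (π : FwdPattern G) (π-valid : ValidPattern G t π)
                (resilient : ∀ s F → SymmetricF G F → ConnAvoiding G F s t → RoutingContains G π F s t)
                (M : RootedMinor H tH G t) where
  open RootedMinor M
  open Adversary H tH

  ends : Node H → Node H → Node G × Node G
  ends x y with true? (adj H x y)
  ... | yes e = let (u , v , _) = linked x y e in u , v
  ... | no _ = t , t

  ends-spec : ∀ {x y} → Edge H x y →
    branch (proj₁ (ends x y)) ≡ just x × branch (proj₂ (ends x y)) ≡ just y × Edge G (proj₁ (ends x y)) (proj₂ (ends x y))
  ends-spec {x} {y} e with true? (adj H x y)
  ... | yes e′ = proj₂ (proj₂ (linked x y e′))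
  ... | no ne = ⊥-elim (ne e)

  -- The endpoint in the branch set of x of the link of G chosen for {x , y}.
  port : Node H → Node H → Node G
  port x y = if does (toℕ x <? toℕ y) then proj₁ (ends x y) else proj₂ (ends y x)

  -- Comparing indices picks one orientation of each link of `H`, so that `port x y` and `port y x`
  -- are the two ends of the same witness of `linked`.
  port-spec : ∀ {x y} → Edge H x y → branch (port x y) ≡ just x × Edge G (port x y) (port y x)
  port-spec {x} {y} e with bool-case (does (toℕ x <? toℕ y)) | bool-case (does (toℕ y <? toℕ x))
  ... | inj₁ p | inj₁ q = ⊥-elim (ℕ.<-asym (does-yes (toℕ x <? toℕ y) p) (does-yes (toℕ y <? toℕ x) q))
  ... | inj₁ p | inj₂ q rewrite p | q = let (a , b , c) = ends-spec e in a , c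
  ... | inj₂ p | inj₁ q rewrite p | q = let (a , b , c) = ends-spec (trans (adj-sym H y x) e) in b , trans (adj-sym G _ _) c
  ... | inj₂ p | inj₂ q with toℕ-injective (ℕ.≤-antisym (ℕ.≮⇒≥ (does-no (toℕ y <? toℕ x) q)) (ℕ.≮⇒≥ (does-no (toℕ x <? toℕ y) p)))
  ...   | refl = ⊥-elim (true≢false e (adj-irrefl H x))

  -- Between two branch sets only the chosen link can survive, and it does so exactly when the row
  -- says so. Branch sets stay intact inside, and nodes outside all of them are cut off.
  blocked : Node H → Row → Node G → Maybe (Node H) → Node G → Bool
  blocked x r u nothing v = true
  blocked x r u (just y) v = if does (x ≟ y) then false else not (lookup r y ∧ (does (u ≟ port x y) ∧ does (v ≟ port y x)))

  failsFrom : Scenario → Maybe (Node H) → Node G → Maybe (Node H) → Node G → Bool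
  failsFrom S nothing u b v = true
  failsFrom S (just x) u b v = blocked x (row S x) u b v

  fails : Scenario → FailureSet G
  fails S u v = failsFrom S (branch u) u (branch v) v

  -- Depends only on the row of x, whatever the rest of the scenario.
  local : Node H → Row → Node G → Node G → Bool
  local x r u v = adj G u v ∧ blocked x r u (branch v) v

  failedAt-local : ∀ S {x u} → branch u ≡ just x → failedAt G (fails S) u ≡ local x (row S x) u
  failedAt-local S {u = u} e = cong (λ b v → adj G u v ∧ failsFrom S b u (branch v) v) e

  fails-symm : ∀ S → SymmetricF G (fails S)
  fails-symm S u v with branch u | branch v
  ... | nothing | nothing = refl
  ... | nothing | just _ = refl
  ... | just _ | nothing = refl
  ... | just x | just y with x ≟ y | y ≟ x
  ...   | yes _ | yes _ = refl
  ...   | yes p | no q = ⊥-elim (q (sym p))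
  ...   | no p | yes q = ⊥-elim (p (sym q))
  ...   | no _ | no _ = cong not (cong₂ _∧_ (row-symm S x y) (Bool.∧-comm (does (u ≟ port x y)) _))

  fails-within : ∀ S {x u v} → branch u ≡ just x → branch v ≡ just x → fails S u v ≡ false
  fails-within S {x} bu bv rewrite bu | bv | does-true (x ≟ x) refl = refl

  fails-port : ∀ S {x y} → Adj (alive S) x y → fails S (port x y) (port y x) ≡ false
  fails-port S {x} {y} a rewrite proj₁ (port-spec {x} {y} (proj₁ (∧-true {adj H x y} a)))
    | proj₁ (port-spec {y} {x} (trans (adj-sym H y x) (proj₁ (∧-true {adj H x y} a)))) | row-alive S x y | a
    | does-true (port x y ≟ port x y) refl | does-true (port y x ≟ port y x) refl with x ≟ y
  ... | yes _ = refl
  ... | no _ = refl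

  within-branch : ∀ S {x u v} → branch v ≡ just x → PathWithin G (λ w → branch w ≡ just x) u v →
                  ∀ {w} → ConnAvoiding G (fails S) v w → ConnAvoiding G (fails S) u w
  within-branch S bv (here _) c = c
  within-branch S bv (step bu e p) c = step e (fails-within S bu (start p)) (within-branch S bv p c)
    where
    start : ∀ {x u v} → PathWithin G (λ w → branch w ≡ just x) u v → branch u ≡ just x
    start (here b) = b
    start (step b _ _) = b

  lift-conn : ∀ S {x u} → branch u ≡ just x → Conn (alive S) x tH → ConnAvoiding G (fails S) u t
  lift-conn S {u = u} bu ε = within-branch S rooted (connected tH u t bu rooted) here
  lift-conn S {x} {u} bu (_◅_ {j = y} a c) =
    let e = proj₁ (∧-true {adj H x y} a)
        (bx , l) = port-spec {x} {y} e
        by = proj₁ (port-spec {y} {x} (trans (adj-sym H y x) e))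
    in within-branch S bx (connected x u (port x y) bu bx) (step l (fails-port S {x} {y} a) (lift-conn S by c))

  -- A partial relation: a walk that circles inside the branch set forever has no derivation.
  data Exits (x : Node H) (r : Row) : Maybe (Node G) → Node G → Node H → Set where
    leave : ∀ {p u v y} → π u p (local x r u) ≡ just v → branch v ≡ just y → y ≢ x → Exits x r p u y
    stay  : ∀ {p u v y} → π u p (local x r u) ≡ just v → branch v ≡ just x → Exits x r (just u) v y → Exits x r p u y

  just-inj : {A : Set} {a b : A} → just a ≡ just b → a ≡ b
  just-inj refl = refl

  exits-unique : ∀ {x r p u y y′} → Exits x r p u y → Exits x r p u y′ → y ≡ y′
  exits-unique (leave e b _) (leave e′ b′ _) with just-inj (trans (sym e) e′)
  ... | refl = just-inj (trans (sym b) b′)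
  exits-unique (leave e b ne) (stay e′ b′ _) with just-inj (trans (sym e) e′)
  ... | refl = ⊥-elim (ne (just-inj (trans (sym b) b′)))
  exits-unique (stay e b _) (leave e′ b′ ne) with just-inj (trans (sym e) e′)
  ... | refl = ⊥-elim (ne (just-inj (trans (sym b′) b)))
  exits-unique (stay e _ x) (stay e′ _ x′) with just-inj (trans (sym e) e′)
  ... | refl = exits-unique x x′

  Crosses : Node H → Row → Node G → Node G → Node H → Set
  Crosses x r u v y = y ≢ x × lookup r y ≡ true × u ≡ port x y × v ≡ port y x

  forward : ∀ {x r p u v} → x ≢ tH → branch u ≡ just x → InPort G u p → π u p (local x r u) ≡ just v →
            Edge G u v × ∃ λ y → branch v ≡ just y × (y ≡ x ⊎ Crosses x r u v y)
  forward {x} {r} {p} {u} {v} xt bu ip e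
    with π-valid u (λ { refl → xt (just-inj (trans (sym bu) rooted)) }) p (local x r u) ip (λ w → proj₁ ∘ ∧-true {adj G u w})
  ... | inj₁ (e′ , _) = case trans (sym e) e′ of λ ()
  ... | inj₂ (v′ , e′ , l , f) with just-inj (trans (sym e) e′)
  ...   | refl with unblocked (trans (cong (_∧ blocked x r u (branch v) v) (sym l)) f)
    where
    unblocked : blocked x r u (branch v) v ≡ false → ∃ λ y → branch v ≡ just y × (y ≡ x ⊎ Crosses x r u v y)
    unblocked f with branch v
    unblocked () | nothing
    ... | just y with x ≟ y
    ...   | yes refl = y , refl , inj₁ refl
    ...   | no ne with ∧-true {lookup r y} (Bool.not-injective {y = true} f)
    ...     | a , b with ∧-true {does (u ≟ port x y)} b
    ...       | b₁ , b₂ = y , refl , inj₂ (ne ∘ sym , a , does-yes (u ≟ port x y) b₁ , does-yes (v ≟ port y x) b₂)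
  ...   | h = l , h

  exits-alive : ∀ {x r p u y} → x ≢ tH → branch u ≡ just x → InPort G u p → Exits x r p u y → lookup r y ≡ true
  exits-alive {x} {r} {p} {u} xt bu ip (leave e b ne) with forward {x} {r} {p} {u} xt bu ip e
  ... | _ , y′ , b′ , h with just-inj (trans (sym b) b′) | h
  ...   | refl | inj₁ q = ⊥-elim (ne q)
  ...   | refl | inj₂ (_ , a , _) = a
  exits-alive {x} {r} {p} {u} xt bu ip (stay {v = v} e b ex) =
    exits-alive xt b (trans (adj-sym G v u) (proj₁ (forward {x} {r} {p} {u} xt bu ip e))) ex

  inPort : Node H → Maybe (Node H) → Maybe (Node G)
  inPort x = Maybe.map λ y → port y x

  entry : Node H → Maybe (Node H) → Node G
  entry x nothing = proj₁ (nonempty x)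
  entry x (just y) = port x y

  entry-spec : ∀ x p → enters x p ≡ true → branch (entry x p) ≡ just x × InPort G (entry x p) (inPort x p)
  entry-spec x nothing e = proj₂ (nonempty x) , tt
  entry-spec x (just y) e = port-spec e

  -- Only the row of `x` enters, not the rest of the scenario, so an answer learnt in one scenario
  -- remains valid in all later ones.
  K : Query → Node H → Set
  K (x , p , r) w = ∀ {y} → Exits x r (inPort x p) (entry x p) y → y ≡ w

  -- A walk that never leaves the branch set is compatible with every answer.
  learn : ∀ x p r {w} → x ≢ tH → enters x p ≡ true → lookup r w ≡ true → ¬ ¬ ∃ λ w → lookup r w ≡ true × K (x , p , r) w
  learn x p r {w} xt en a k = k (w , a , λ {y} ex → ⊥-elim (k (y , exits-alive xt (proj₁ sp) (proj₂ sp) ex , λ ex′ → exits-unique ex′ ex)))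
    where sp = entry-spec x p en

  module _ (S : Scenario) (l : List Pos)
           (stays : ∀ {x p} → (x , p) ∈ l → x ≢ tH × ∃ λ w → K (x , p , row S x) w × (w , just x) ∈ l) where
    -- `prefix` says that any exit continuing the present walk is an exit of the walk begun at the
    -- last entry. This ties the next branch set to the answer recorded for that entry.
    record Inside (p : Maybe (Node G)) (u : Node G) : Set where
      field
        {x}    : Node H
        {q}    : Maybe (Node H)
        member : (x , q) ∈ l
        within : branch u ≡ just x
        port-ok : InPort G u p
        prefix : ∀ {y} → Exits x (row S x) p u y → Exits x (row S x) (inPort x q) (entry x q) y

    advance : ∀ {p u} → Inside p u → let s = routeStep G π (fails S) (p , u) in Inside (proj₁ s) (proj₂ s)
    advance {p} {u} I with π u p (failedAt G (fails S) u) in eq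
    ... | nothing = I
    ... | just v = moved (forward {x} {row S x} {p} {u} (proj₁ (stays member)) within port-ok out)
      where
      open Inside I
      out : π u p (local x (row S x) u) ≡ just v
      out = trans (sym (cong (π u p) (failedAt-local S within))) eq
      moved : (Edge G u v × ∃ λ y → branch v ≡ just y × (y ≡ x ⊎ Crosses x (row S x) u v y)) → Inside (just u) v
      moved (e , y , b , inj₁ refl) = record
        { member = member ; within = b ; port-ok = trans (adj-sym G v u) e ; prefix = prefix ∘ stay out b }
      moved (e , y , b , inj₂ (ne , _ , pu , pv)) with stays member
      ... | _ , w , k , m with k (prefix (leave out b ne))
      ...   | refl = record { member = m ; within = b ; port-ok = trans (adj-sym G v u) e
                       ; prefix = λ {z} → subst₂ (λ a b → Exits w (row S w) (just a) b z) pu pv }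

    confined : (proj₁ S , nothing) ∈ l → ∀ i → let s = route G π (fails S) (proj₁ (nonempty (proj₁ S))) i in Inside (proj₁ s) (proj₂ s)
    confined m zero = record { member = m ; within = proj₂ (nonempty (proj₁ S)) ; port-ok = tt ; prefix = id }
    confined m (suc i) = advance (confined m i)

  escape : ∀ S (l : List Pos) → Conn (alive S) (proj₁ S) tH → (proj₁ S , nothing) ∈ l →
           (∀ {x p} → (x , p) ∈ l → x ≢ tH × ∃ λ w → K (x , p , row S x) w × (w , just x) ∈ l) → ⊥
  escape S l c m stays
    with resilient (proj₁ (nonempty (proj₁ S))) (fails S) (fails-symm S) (lift-conn S (proj₂ (nonempty (proj₁ S))) c)
  ... | i , e = let I = confined S l stays m i in
    proj₁ (stays (Inside.member I)) (just-inj (trans (sym (Inside.within I)) (trans (cong branch e) rooted)))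

refuted : ∀ (H : Graph) (tH : Node H) f Ss → Adversary.refutes H tH f [] Ss ≡ true → ∀ {G t} → PerfectlyResilient G t → ¬ RootedMinor H tH G t
refuted H tH f Ss e (π , valid , res) M = Adversary.Sound.refutes-sound H tH S.K S.learn S.escape f [] e
  where module S = Simulate π valid res M

-- Failure scenarios against the four graphs

K5-scenarios : List (Node K5-e × List (Node K5-e × Node K5-e))
K5-scenarios =
  (1F , (0F , 2F) ∷ (0F , 4F) ∷ (1F , 3F) ∷ (1F , 4F) ∷ (2F , 4F) ∷ (3F , 4F) ∷ []) ∷
  (1F , (0F , 2F) ∷ (0F , 3F) ∷ (1F , 2F) ∷ (1F , 4F) ∷ (2F , 3F) ∷ (2F , 4F) ∷ []) ∷
  (1F , (0F , 3F) ∷ (0F , 4F) ∷ (1F , 2F) ∷ (1F , 3F) ∷ (2F , 3F) ∷ (3F , 4F) ∷ []) ∷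
  (2F , (0F , 2F) ∷ (0F , 4F) ∷ (1F , 2F) ∷ (2F , 3F) ∷ (3F , 4F) ∷ []) ∷
  (1F , (0F , 3F) ∷ (0F , 4F) ∷ (1F , 2F) ∷ (1F , 4F) ∷ (2F , 4F) ∷ (3F , 4F) ∷ []) ∷
  (4F , (0F , 2F) ∷ (0F , 4F) ∷ (1F , 4F) ∷ (2F , 3F) ∷ (3F , 4F) ∷ []) ∷
  (2F , (0F , 2F) ∷ (0F , 3F) ∷ (1F , 2F) ∷ (2F , 4F) ∷ (3F , 4F) ∷ []) ∷
  (1F , (0F , 2F) ∷ (0F , 3F) ∷ (1F , 3F) ∷ (1F , 4F) ∷ (2F , 3F) ∷ (3F , 4F) ∷ []) ∷
  (4F , (0F , 3F) ∷ (0F , 4F) ∷ (1F , 4F) ∷ (2F , 3F) ∷ (2F , 4F) ∷ []) ∷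
  (3F , (0F , 3F) ∷ (0F , 4F) ∷ (1F , 3F) ∷ (2F , 3F) ∷ (2F , 4F) ∷ []) ∷
  (3F , (0F , 2F) ∷ (0F , 3F) ∷ (1F , 3F) ∷ (2F , 4F) ∷ (3F , 4F) ∷ []) ∷
  (4F , (0F , 2F) ∷ (0F , 4F) ∷ (2F , 3F) ∷ (2F , 4F) ∷ (3F , 4F) ∷ []) ∷
  (4F , (0F , 3F) ∷ (0F , 4F) ∷ (2F , 3F) ∷ (2F , 4F) ∷ (3F , 4F) ∷ []) ∷
  (3F , (0F , 2F) ∷ (0F , 3F) ∷ (2F , 4F) ∷ (3F , 4F) ∷ []) ∷
  (1F , (0F , 2F) ∷ (0F , 4F) ∷ (2F , 3F) ∷ (3F , 4F) ∷ []) ∷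
  (1F , (0F , 2F) ∷ (0F , 3F) ∷ (2F , 4F) ∷ (3F , 4F) ∷ []) ∷
  (1F , (0F , 3F) ∷ (0F , 4F) ∷ (2F , 3F) ∷ (2F , 4F) ∷ []) ∷
  (1F , (0F , 2F) ∷ (0F , 4F) ∷ (1F , 2F) ∷ (1F , 3F) ∷ (2F , 3F) ∷ (2F , 4F) ∷ []) ∷
  []

K33-scenarios : List (Node K33-e × List (Node K33-e × Node K33-e))
K33-scenarios =
  (2F , (0F , 4F) ∷ (1F , 3F) ∷ (2F , 3F) ∷ (2F , 5F) ∷ []) ∷
  (4F , (0F , 4F) ∷ (1F , 4F) ∷ (2F , 5F) ∷ []) ∷
  (5F , (0F , 5F) ∷ (1F , 4F) ∷ (2F , 5F) ∷ []) ∷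
  (1F , (0F , 5F) ∷ (1F , 3F) ∷ (1F , 4F) ∷ (2F , 3F) ∷ []) ∷
  (2F , (0F , 5F) ∷ (1F , 3F) ∷ (2F , 3F) ∷ (2F , 4F) ∷ []) ∷
  (5F , (0F , 5F) ∷ (1F , 5F) ∷ (2F , 4F) ∷ []) ∷
  (4F , (0F , 4F) ∷ (1F , 5F) ∷ (2F , 4F) ∷ []) ∷
  (1F , (0F , 4F) ∷ (1F , 3F) ∷ (1F , 5F) ∷ (2F , 3F) ∷ []) ∷
  (3F , (0F , 5F) ∷ (2F , 3F) ∷ (2F , 4F) ∷ (2F , 5F) ∷ []) ∷
  (3F , (0F , 4F) ∷ (2F , 5F) ∷ []) ∷
  (3F , (0F , 5F) ∷ (2F , 4F) ∷ []) ∷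
  (3F , (0F , 5F) ∷ (1F , 4F) ∷ []) ∷
  (3F , (0F , 5F) ∷ (1F , 3F) ∷ (1F , 4F) ∷ (1F , 5F) ∷ []) ∷
  (3F , (0F , 4F) ∷ (1F , 5F) ∷ []) ∷
  []

K34-scenarios : List (Node K34-2e × List (Node K34-2e × Node K34-2e))
K34-scenarios =
  (4F , (0F , 3F) ∷ (0F , 5F) ∷ (1F , 3F) ∷ (1F , 4F) ∷ (2F , 5F) ∷ (2F , 6F) ∷ []) ∷
  (6F , (0F , 3F) ∷ (0F , 5F) ∷ (1F , 3F) ∷ (1F , 6F) ∷ (2F , 5F) ∷ (2F , 6F) ∷ []) ∷
  (4F , (0F , 3F) ∷ (0F , 4F) ∷ (1F , 3F) ∷ (1F , 5F) ∷ (2F , 5F) ∷ (2F , 6F) ∷ []) ∷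
  (3F , (0F , 3F) ∷ (0F , 4F) ∷ (1F , 4F) ∷ (1F , 5F) ∷ (2F , 5F) ∷ (2F , 6F) ∷ []) ∷
  (3F , (0F , 4F) ∷ (0F , 5F) ∷ (1F , 3F) ∷ (1F , 4F) ∷ (2F , 5F) ∷ (2F , 6F) ∷ []) ∷
  (6F , (0F , 4F) ∷ (0F , 5F) ∷ (1F , 4F) ∷ (1F , 6F) ∷ (2F , 5F) ∷ (2F , 6F) ∷ []) ∷
  (6F , (0F , 3F) ∷ (0F , 6F) ∷ (1F , 3F) ∷ (1F , 5F) ∷ (2F , 5F) ∷ (2F , 6F) ∷ []) ∷
  (6F , (0F , 4F) ∷ (0F , 6F) ∷ (1F , 4F) ∷ (1F , 5F) ∷ (2F , 5F) ∷ (2F , 6F) ∷ []) ∷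
  (3F , (0F , 3F) ∷ (0F , 6F) ∷ (1F , 5F) ∷ (1F , 6F) ∷ (2F , 5F) ∷ (2F , 6F) ∷ []) ∷
  (4F , (0F , 4F) ∷ (0F , 6F) ∷ (1F , 5F) ∷ (1F , 6F) ∷ (2F , 5F) ∷ (2F , 6F) ∷ []) ∷
  (6F , (0F , 5F) ∷ (1F , 4F) ∷ (1F , 6F) ∷ (2F , 5F) ∷ (2F , 6F) ∷ []) ∷
  (6F , (0F , 5F) ∷ (1F , 3F) ∷ (1F , 6F) ∷ (2F , 5F) ∷ (2F , 6F) ∷ []) ∷
  (4F , (0F , 5F) ∷ (1F , 5F) ∷ (1F , 6F) ∷ []) ∷
  (3F , (0F , 5F) ∷ (1F , 5F) ∷ (1F , 6F) ∷ []) ∷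
  (0F , (0F , 3F) ∷ (0F , 4F) ∷ (0F , 5F) ∷ (1F , 3F) ∷ (1F , 4F) ∷ (2F , 5F) ∷ []) ∷
  (4F , (0F , 3F) ∷ (0F , 5F) ∷ (1F , 3F) ∷ (1F , 5F) ∷ []) ∷
  (3F , (0F , 4F) ∷ (0F , 5F) ∷ (1F , 4F) ∷ (1F , 5F) ∷ []) ∷
  (1F , (0F , 3F) ∷ (0F , 4F) ∷ (1F , 3F) ∷ (1F , 4F) ∷ (1F , 5F) ∷ (2F , 5F) ∷ []) ∷
  []

K24-scenarios : List (Node K24-sub × List (Node K24-sub × Node K24-sub))
K24-scenarios =
  (1F , (0F , 3F) ∷ (0F , 5F) ∷ (1F , 2F) ∷ (1F , 3F) ∷ (1F , 5F) ∷ (2F , 6F) ∷ []) ∷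
  (0F , (0F , 3F) ∷ (0F , 5F) ∷ (1F , 3F) ∷ (1F , 5F) ∷ (6F , 0F) ∷ []) ∷
  (5F , (0F , 3F) ∷ (1F , 3F) ∷ (1F , 5F) ∷ (6F , 0F) ∷ []) ∷
  (4F , (0F , 3F) ∷ (1F , 3F) ∷ (1F , 4F) ∷ (6F , 0F) ∷ []) ∷
  (3F , (0F , 5F) ∷ (1F , 3F) ∷ (1F , 5F) ∷ (6F , 0F) ∷ []) ∷
  (3F , (0F , 4F) ∷ (1F , 3F) ∷ (1F , 4F) ∷ (6F , 0F) ∷ []) ∷
  (5F , (0F , 4F) ∷ (1F , 4F) ∷ (1F , 5F) ∷ (6F , 0F) ∷ []) ∷
  (4F , (0F , 5F) ∷ (1F , 4F) ∷ (1F , 5F) ∷ (6F , 0F) ∷ []) ∷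
  (3F , (0F , 3F) ∷ (0F , 5F) ∷ (1F , 5F) ∷ (2F , 6F) ∷ []) ∷
  (3F , (0F , 3F) ∷ (0F , 4F) ∷ (0F , 5F) ∷ (1F , 5F) ∷ (6F , 0F) ∷ []) ∷
  (4F , (0F , 4F) ∷ (0F , 5F) ∷ (1F , 5F) ∷ (2F , 6F) ∷ []) ∷
  (4F , (0F , 5F) ∷ (1F , 5F) ∷ (6F , 0F) ∷ []) ∷
  (5F , (0F , 3F) ∷ (0F , 5F) ∷ (1F , 3F) ∷ (2F , 6F) ∷ []) ∷
  (4F , (0F , 3F) ∷ (1F , 3F) ∷ (6F , 0F) ∷ []) ∷
  (2F , (0F , 3F) ∷ (0F , 4F) ∷ (1F , 3F) ∷ (2F , 6F) ∷ []) ∷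
  (3F , (0F , 5F) ∷ (1F , 5F) ∷ (6F , 0F) ∷ []) ∷
  (2F , (0F , 4F) ∷ (0F , 5F) ∷ (1F , 4F) ∷ (2F , 6F) ∷ []) ∷
  (2F , (0F , 3F) ∷ (0F , 4F) ∷ (1F , 4F) ∷ (2F , 6F) ∷ []) ∷
  (3F , (0F , 4F) ∷ (1F , 4F) ∷ (6F , 0F) ∷ []) ∷
  (5F , (0F , 3F) ∷ (1F , 3F) ∷ (6F , 0F) ∷ []) ∷
  (5F , (0F , 4F) ∷ (1F , 4F) ∷ (6F , 0F) ∷ []) ∷
  []

no-forbidden : ∀ {G t} → PerfectlyResilient G t → ¬ ForbiddenRootedMinor G t
-- The number 200 is fuel for the depth of the search, which `refl` makes the type checker carry
-- out; a larger amount would serve as well.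
no-forbidden R (inj₁ M) = refuted K5-e K5-e-root 200 K5-scenarios refl R M
no-forbidden R (inj₂ (inj₁ M)) = refuted K33-e K33-e-root 200 K33-scenarios refl R M
no-forbidden R (inj₂ (inj₂ (inj₁ M))) = refuted K34-2e K34-2e-root 200 K34-scenarios refl R M
no-forbidden R (inj₂ (inj₂ (inj₂ M))) = refuted K24-sub K24-sub-root 200 K24-scenarios refl R M

theorem1 : (G : Graph) (t : Node G) →
    PerfectlyResilient G t ⇔ (¬ ForbiddenRootedMinor G t)
theorem1 G t = mk⇔ no-forbidden λ nf →
  Routes.perfect G t (resilient-free _ t (ℕ.n<1+n _) (adj-sym G) (adj-irrefl G) (nf ∘ forb-rooted))
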